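{- Let $l\geq 1$ be an odd integer and $p\ge l^2+3l+5$ a prime. Let $q\ge \frac{(p+l)p}{2}$ be a prime satisfying $(l+2)q\equiv 2\pmod p$. Then $M(p;q)=\frac{p+l+2}{2}$.
   Context: For a positive integer $n$, let $\Phi_n(x)=\sum_{k}a_n(k)x^k$ be the $n$-th cyclotomic polynomial and $A(n)=\max\{|a_n(k)|:k\ge0\}$. For primes $p<q$, $M(p;q)=\max\{A(pqr): r \text{ prime}, r>q\}$. -}

module Defs where

open import Data.Nat as ℕ using (ℕ; zero; suc; _⊔_)
open import Data.Nat.Divisibility using (_∣?_)
open import Data.Integer as ℤ using (ℤ; +_; -[1+_]; ∣_∣)
open import Data.List using (List; []; _∷_; _++_; [_]; map; foldr; length; reverse; replicate)
open import Data.Product using (_×_; _,_)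
open import Relation.Nullary using (yes; no)

-- Polynomials over ℤ as coefficient lists, lowest degree first:
-- [c₀ , c₁ , … , c_d] represents c₀ + c₁ x + … + c_d x^d.
Poly : Set
Poly = List ℤ

polyAdd : Poly → Poly → Poly
polyAdd [] g = g
polyAdd f [] = f
polyAdd (a ∷ f) (b ∷ g) = (a ℤ.+ b) ∷ polyAdd f g

polyMul : Poly → Poly → Poly
polyMul [] g = []
polyMul (a ∷ f) g = polyAdd (map (a ℤ.*_) g) (+ 0 ∷ polyMul f g)

polyProd : List Poly → Poly
polyProd = foldr polyMul (+ 1 ∷ [])

xⁿ-1 : ℕ → Poly
xⁿ-1 n = -[1+ 0 ] ∷ (replicate (ℕ.pred n) (+ 0) ++ (+ 1 ∷ []))

subPrefix : List ℤ → List ℤ → List ℤ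
subPrefix xs [] = xs
subPrefix [] ys = []
subPrefix (x ∷ xs) (y ∷ ys) = (x ℤ.- y) ∷ subPrefix xs ys

-- long division, high-degree-first lists; divisor is monic 1 ∷ gs;
-- fuel = number of quotient coefficients
longDiv : ℕ → List ℤ → List ℤ → List ℤ
longDiv zero f gs = []
longDiv (suc k) [] gs = []
longDiv (suc k) (c ∷ f) gs = c ∷ longDiv k (subPrefix f (map (c ℤ.*_) gs)) gs

tail' : List ℤ → List ℤ
tail' [] = []
tail' (_ ∷ xs) = xs

divMonic : Poly → Poly → Poly
divMonic f g = reverse (longDiv (suc (length f ℕ.∸ length g)) (reverse f) (tail' (reverse g)))

-- Φ_m = (x^m - 1) / ∏_{d ∣ m, d < m} Φ_d, given the table of (d , Φ_d) for d < m
newΦ : ℕ → List (ℕ × Poly) → Poly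
newΦ m tbl = divMonic (xⁿ-1 m) (polyProd (divisorsΦ tbl))
  where
  divisorsΦ : List (ℕ × Poly) → List Poly
  divisorsΦ [] = []
  divisorsΦ ((d , φ) ∷ t) with d ∣? m
  ... | yes _ = φ ∷ divisorsΦ t
  ... | no _  = divisorsΦ t

cycTable : ℕ → List (ℕ × Poly)
cycTable zero = []
cycTable (suc n) = cycTable n ++ [ (suc n , newΦ (suc n) (cycTable n)) ]

-- n-th cyclotomic polynomial (n ≥ 1); Φ_0 := 1 is a dummy convention
cyclotomic : ℕ → Poly
cyclotomic zero = + 1 ∷ []
cyclotomic (suc n) = newΦ (suc n) (cycTable n)

A : ℕ → ℕ
A n = foldr _⊔_ 0 (map ∣_∣ (cyclotomic n))

{-# OPTIONS --safe #-}
-- Put λ = (p + l + 2)/2, the inverse of q modulo p.  Kaplan's formula writes a coefficient of Φ_pqr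
-- as the difference of two blocks of p coefficients of Φ_pq, truncated at some T.  If k = β q + γ
-- modulo p q with p ∣ γ, then the coefficient of Φ_pq at k is governed by whether β < λ and whether
-- γ ≤ (p - λ) q; γ is the same for corresponding members of the two blocks, while β is shifted by
-- the residue of 1/r modulo p.  Counting the β for which corresponding members can differ with a
-- given sign bounds the coefficients by λ.  The bound is attained at n = r (λ - 1) q + q + x with
-- 0 ≤ x < p: for a prime r with 1/r = ± (q - s p) modulo p q and suitable s, the second block is
-- spread evenly around T = (λ - 1) q, exactly its λ members with β < λ count, and the first block
-- vanishes.
--
-- The prime r comes from Dirichlet's theorem, proved over ℚ with an additive function ℓ in the role
-- of the logarithm.  Suppose the class of a modulo N contains no large primes.  Selberg's formula
-- and its analogue for products of three primes show that the classes with a substantial share of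
-- the primes make up half of the units and that no product of three of them is a.  They are then a
-- coset of a subgroup of index two, so its quadratic character χ is constant on almost all primes
-- and Σ χ(n) Λ(n)/n is unbounded, whereas L(1,χ) > 0 keeps it bounded.
module Submission where

open import Data.Nat as ℕ using (ℕ; zero; suc; z≤n; s≤s)
import Data.Nat.Properties as ℕ
import Data.Nat.DivMod as DM
open import Data.Nat.Tactic.RingSolver using () renaming (solve-∀ to ℕ-solve)
open import Data.Empty using (⊥; ⊥-elim)
open import Data.Product using (∃; ∃-syntax; _×_; _,_; proj₁; proj₂)
open import Data.Sum using (_⊎_; inj₁; inj₂)
open import Relation.Nullary using (Dec; yes; no; ¬_)
open import Relation.Binary.PropositionalEquality hiding ([_])

-- Dirichlet's theorem becomes a finite search by fixing a bound X: `ℓ`, `Λ` and `μ` depend on X and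
-- are right up to X only, every estimate is a rational inequality with explicit constants, and X is
-- chosen after the constants that a class without primes would contradict. Of the logarithm little
-- more is used than additivity and 1/(6n) ≤ ℓ(n+1) - ℓ(n) ≤ 1/n. Main terms are never computed for
-- a single class: two unit classes are compared, and the difference of their indicators has bounded
-- partial sums. In the cyclotomic half put m = l + 2 and g = (p - m)/2, so that λ = m + g and p - λ
-- = g. The construction works when the residue t of 1/r modulo p satisfies m ≤ t ≤ g; here t is ρ
-- or p - ρ for the residue ρ of q, whence the two signs. The bound on p is m (m - 1) + 3, enough to
-- read the relevant congruences as equalities of integers and so to force ρ or p - ρ into that
-- range. The bound on q is (λ - 1) p, which pays for rounding s down to an integer.

module Base where

 -- Rational inequalities, reciprocals, indicators and finite sums.

 open import Data.Rational using (ℚ; 0ℚ; 1ℚ; _+_; _*_; _-_; -_; _≤_; _<_; ∣_∣; 1/_; nonNegative; positive)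
 open import Data.Rational.Properties
 open import Relation.Nullary.Decidable using (dec⇒maybe)
 open import Tactic.RingSolver using (solve-∀)
 open import Tactic.RingSolver.Core.AlmostCommutativeRing using (AlmostCommutativeRing; fromCommutativeRing)

 ℚ-ring : AlmostCommutativeRing _ _
 ℚ-ring = fromCommutativeRing +-*-commutativeRing λ x → dec⇒maybe (0ℚ ≟ x)

 -- Inequalities are proved from certificates: a nonnegative expression
 -- assembled from the hypotheses that equals the difference of the two sides.
 diff : ∀ {a b} → a ≤ b → 0ℚ ≤ b - a
 diff {a} {b} h = subst (_≤ b - a) (+-inverseʳ a) (+-monoˡ-≤ (- a) h)

 close : ∀ {e a b} → 0ℚ ≤ e → e ≡ b - a → a ≤ b
 close {e} {a} {b} p refl = subst₂ _≤_ (+-identityˡ a) (lem a b) (+-monoˡ-≤ a p)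
  where
  lem : ∀ a b → b - a + a ≡ b
  lem = solve-∀ ℚ-ring

 infixl 6 _⊕_
 infixl 7 _⊗_

 _⊕_ : ∀ {a b} → 0ℚ ≤ a → 0ℚ ≤ b → 0ℚ ≤ a + b
 _⊕_ {a} {b} p q = subst (_≤ a + b) (+-identityˡ 0ℚ) (+-mono-≤ p q)

 _⊗_ : ∀ {a b} → 0ℚ ≤ a → 0ℚ ≤ b → 0ℚ ≤ a * b
 _⊗_ {a} {b} p q = subst (_≤ a * b) (*-zeroʳ a) (*-monoˡ-≤-nonNeg a {{nonNegative p}} q)

 0≤1 : 0ℚ ≤ 1ℚ
 0≤1 = nonNegative⁻¹ 1ℚ

 0≤sq : ∀ a → 0ℚ ≤ a * a
 0≤sq a with ≤-total 0ℚ a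
 ... | inj₁ p = p ⊗ p
 ... | inj₂ p = subst (0ℚ ≤_) (lem a) (diff p ⊗ diff p)
  where
  lem : ∀ a → (0ℚ - a) * (0ℚ - a) ≡ a * a
  lem = solve-∀ ℚ-ring

 *-monoˡ : ∀ {a b} c → 0ℚ ≤ c → a ≤ b → c * a ≤ c * b
 *-monoˡ c p = *-monoˡ-≤-nonNeg c {{nonNegative p}}

 *-monoʳ : ∀ {a b} c → 0ℚ ≤ c → a ≤ b → a * c ≤ b * c
 *-monoʳ c p = *-monoʳ-≤-nonNeg c {{nonNegative p}}

 *-mono : ∀ {a b c d} → 0ℚ ≤ a → 0ℚ ≤ d → a ≤ b → c ≤ d → a * c ≤ b * d
 *-mono {a} {b} {c} {d} pa pd h k = ≤-trans (*-monoˡ a pa k) (*-monoʳ d pd h)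

 *-cancelˡ : ∀ {a b} c → 0ℚ < c → c * a ≤ c * b → a ≤ b
 *-cancelˡ c p = *-cancelˡ-≤-pos c {{positive p}}

 ∣∣≤ : ∀ {x b} → - b ≤ x → x ≤ b → ∣ x ∣ ≤ b
 ∣∣≤ {x} {b} l u with ∣p∣≡p∨∣p∣≡-p x
 ... | inj₁ e = subst (_≤ b) (sym e) u
 ... | inj₂ e = subst (_≤ b) (sym e) (close (diff l) (lem b x))
  where
  lem : ∀ b x → x - - b ≡ b - - x
  lem = solve-∀ ℚ-ring

 x≤∣x∣ : ∀ x → x ≤ ∣ x ∣
 x≤∣x∣ x with ∣p∣≡p∨∣p∣≡-p x | ≤-total 0ℚ x
 ... | inj₁ e | _ = ≤-reflexive (sym e)
 ... | inj₂ e | inj₁ p = ≤-reflexive (sym (0≤p⇒∣p∣≡p p))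
 ... | inj₂ e | inj₂ p = ≤-trans p (0≤∣p∣ x)

 -∣x∣≤x : ∀ x → - ∣ x ∣ ≤ x
 -∣x∣≤x x = close (diff (subst (- x ≤_) (∣-p∣≡∣p∣ x) (x≤∣x∣ (- x)))) (lem x ∣ x ∣)
  where
  lem : ∀ x y → y - - x ≡ x - - y
  lem = solve-∀ ℚ-ring

 ∣∣⇒≤ : ∀ {x b} → ∣ x ∣ ≤ b → x ≤ b
 ∣∣⇒≤ {x} = ≤-trans (x≤∣x∣ x)

 ∣∣⇒≥ : ∀ {x b} → ∣ x ∣ ≤ b → - b ≤ x
 ∣∣⇒≥ {x} h = ≤-trans (neg-antimono-≤ h) (-∣x∣≤x x)

 ∣∣-mul : ∀ {x a y b} → ∣ x ∣ ≤ a → ∣ y ∣ ≤ b → ∣ x * y ∣ ≤ a * b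
 ∣∣-mul {x} {a} {y} {b} h k = subst (_≤ a * b) (sym (∣p*q∣≡∣p∣*∣q∣ x y)) (*-mono (0≤∣p∣ x) (≤-trans (0≤∣p∣ y) k) h k)

 ∣∣-add : ∀ {x a y b} → ∣ x ∣ ≤ a → ∣ y ∣ ≤ b → ∣ x + y ∣ ≤ a + b
 ∣∣-add {x} {a} {y} {b} h k = ≤-trans (∣p+q∣≤∣p∣+∣q∣ x y) (+-mono-≤ h k)

 0≤⇒∣∣ : ∀ {x b} → 0ℚ ≤ x → x ≤ b → ∣ x ∣ ≤ b
 0≤⇒∣∣ {x} {b} p h = subst (_≤ b) (sym (0≤p⇒∣p∣≡p p)) h

 ι : ℕ → ℚ
 ι zero = 0ℚ
 ι (suc n) = ι n + 1ℚ

 ι-+ : ∀ m n → ι (m ℕ.+ n) ≡ ι m + ι n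
 ι-+ zero n = sym (+-identityˡ (ι n))
 ι-+ (suc m) n = trans (cong (_+ 1ℚ) (ι-+ m n)) (lem (ι m) (ι n))
  where
  lem : ∀ a b → a + b + 1ℚ ≡ a + 1ℚ + b
  lem = solve-∀ ℚ-ring

 ι-* : ∀ m n → ι (m ℕ.* n) ≡ ι m * ι n
 ι-* zero n = sym (*-zeroˡ (ι n))
 ι-* (suc m) n = trans (ι-+ n (m ℕ.* n)) (trans (cong (ι n +_) (ι-* m n)) (lem (ι m) (ι n)))
  where
  lem : ∀ a b → b + a * b ≡ (a + 1ℚ) * b
  lem = solve-∀ ℚ-ring

 0≤ι : ∀ n → 0ℚ ≤ ι n
 0≤ι zero = ≤-refl
 0≤ι (suc n) = 0≤ι n ⊕ 0≤1

 ι-mono : ∀ {m n} → m ℕ.≤ n → ι m ≤ ι n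
 ι-mono {n = n} z≤n = 0≤ι n
 ι-mono (s≤s h) = +-monoˡ-≤ 1ℚ (ι-mono h)

 0<ι : ∀ n → 0ℚ < ι (suc n)
 0<ι n = <-≤-trans (positive⁻¹ 1ℚ) (subst (_≤ ι n + 1ℚ) (+-identityˡ 1ℚ) (+-monoˡ-≤ 1ℚ (0≤ι n)))

 1≤ι : ∀ n → 1ℚ ≤ ι (suc n)
 1≤ι n = subst (_≤ ι n + 1ℚ) (+-identityˡ 1ℚ) (+-monoˡ-≤ 1ℚ (0≤ι n))

 ι-cancel : ∀ {m n} → ι m ≤ ι n → m ℕ.≤ n
 ι-cancel {m} {n} h with m ℕ.≤? n
 ... | yes p = p
 ... | no ¬p = ⊥-elim (<-irrefl refl (≤-<-trans (≤-trans (ι-mono (ℕ.≰⇒> ¬p)) h)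
         (subst (_< ι n + 1ℚ) (+-identityʳ (ι n)) (+-monoʳ-< (ι n) (positive⁻¹ 1ℚ)))))

 -- The reciprocal of 0 is 0.
 opaque
  inv : ℕ → ℚ
  inv zero = 0ℚ
  inv (suc n) = (1/ ι (suc n)) {{pos⇒nonZero (ι (suc n)) {{positive (0<ι n)}}}}

  inv-0 : inv 0 ≡ 0ℚ
  inv-0 = refl

  ι*inv : ∀ n → ι (suc n) * inv (suc n) ≡ 1ℚ
  ι*inv n = *-inverseʳ (ι (suc n)) {{pos⇒nonZero (ι (suc n)) {{positive (0<ι n)}}}}

  0≤inv : ∀ n → 0ℚ ≤ inv n
  0≤inv zero = ≤-refl
  0≤inv (suc n) = <⇒≤ (positive⁻¹ (inv (suc n)) {{1/pos⇒pos (ι (suc n)) {{positive (0<ι n)}}}})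

 ι*inv′ : ∀ n → 1 ℕ.≤ n → ι n * inv n ≡ 1ℚ
 ι*inv′ (suc n) _ = ι*inv n

 inv-1 : inv 1 ≡ 1ℚ
 inv-1 = trans (sym (*-identityˡ (inv 1))) (ι*inv 0)

 inv-unique : ∀ n {x} → ι (suc n) * x ≡ 1ℚ → x ≡ inv (suc n)
 inv-unique n {x} h = begin
  x ≡⟨ *-identityˡ x ⟨
  1ℚ * x ≡⟨ cong (_* x) (ι*inv n) ⟨
  ι (suc n) * inv (suc n) * x ≡⟨ lem (ι (suc n)) (inv (suc n)) x ⟩
  inv (suc n) * (ι (suc n) * x) ≡⟨ cong (inv (suc n) *_) h ⟩
  inv (suc n) * 1ℚ ≡⟨ *-identityʳ _ ⟩
  inv (suc n) ∎
  where
  open ≡-Reasoning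
  lem : ∀ a b c → a * b * c ≡ b * (a * c)
  lem = solve-∀ ℚ-ring

 inv-* : ∀ m n → inv (m ℕ.* n) ≡ inv m * inv n
 inv-* zero n = trans inv-0 (trans (sym (*-zeroˡ (inv n))) (cong (_* inv n) (sym inv-0)))
 inv-* (suc m) zero = trans (cong inv (ℕ.*-zeroʳ m)) (trans inv-0 (trans (sym (*-zeroʳ (inv (suc m)))) (cong (inv (suc m) *_) (sym inv-0))))
 inv-* (suc m) (suc n) = sym (inv-unique (n ℕ.+ m ℕ.* suc n) (begin
  ι (suc m ℕ.* suc n) * (inv (suc m) * inv (suc n)) ≡⟨ cong (_* (inv (suc m) * inv (suc n))) (ι-* (suc m) (suc n)) ⟩
  ι (suc m) * ι (suc n) * (inv (suc m) * inv (suc n)) ≡⟨ lem (ι (suc m)) (ι (suc n)) (inv (suc m)) (inv (suc n)) ⟩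
  (ι (suc m) * inv (suc m)) * (ι (suc n) * inv (suc n)) ≡⟨ cong₂ _*_ (ι*inv m) (ι*inv n) ⟩
  1ℚ * 1ℚ ≡⟨ *-identityʳ 1ℚ ⟩
  1ℚ ∎))
  where
  open ≡-Reasoning
  lem : ∀ a b c d → a * b * (c * d) ≡ (a * c) * (b * d)
  lem = solve-∀ ℚ-ring

 ≤inv* : ∀ n {x y} → ι (suc n) * x ≤ y → x ≤ inv (suc n) * y
 ≤inv* n {x} {y} h = subst (_≤ inv (suc n) * y)
  (trans (sym (*-assoc (inv (suc n)) (ι (suc n)) x)) (trans (cong (_* x) (trans (*-comm (inv (suc n)) (ι (suc n))) (ι*inv n))) (*-identityˡ x)))
  (*-monoˡ (inv (suc n)) (0≤inv (suc n)) h)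

 inv*≤ : ∀ n {x y} → x ≤ ι (suc n) * y → inv (suc n) * x ≤ y
 inv*≤ n {x} {y} h = subst (inv (suc n) * x ≤_)
  (trans (sym (*-assoc (inv (suc n)) (ι (suc n)) y)) (trans (cong (_* y) (trans (*-comm (inv (suc n)) (ι (suc n))) (ι*inv n))) (*-identityˡ y)))
  (*-monoˡ (inv (suc n)) (0≤inv (suc n)) h)

 inv-anti : ∀ m n → suc m ℕ.≤ n → inv n ≤ inv (suc m)
 inv-anti m (suc n) h = subst (_≤ inv (suc m)) (*-identityʳ (inv (suc n)))
  (inv*≤ n (subst (_≤ ι (suc n) * inv (suc m)) (ι*inv m) (*-monoʳ (inv (suc m)) (0≤inv (suc m)) (ι-mono h))))

 inv≤1 : ∀ n → inv n ≤ 1ℚ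
 inv≤1 zero = subst (_≤ 1ℚ) (sym inv-0) 0≤1
 inv≤1 (suc n) = subst (inv (suc n) ≤_) inv-1 (inv-anti 0 (suc n) (s≤s z≤n))

 𝟙 : ∀ {P : Set} → Dec P → ℚ
 𝟙 (yes _) = 1ℚ
 𝟙 (no _) = 0ℚ

 𝟙-yes : ∀ {P : Set} (d : Dec P) → P → 𝟙 d ≡ 1ℚ
 𝟙-yes (yes _) _ = refl
 𝟙-yes (no ¬p) p = ⊥-elim (¬p p)

 𝟙-no : ∀ {P : Set} (d : Dec P) → ¬ P → 𝟙 d ≡ 0ℚ
 𝟙-no (yes p) ¬p = ⊥-elim (¬p p)
 𝟙-no (no _) _ = refl

 𝟙-cong : ∀ {P Q : Set} (d : Dec P) (e : Dec Q) → (P → Q) → (Q → P) → 𝟙 d ≡ 𝟙 e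
 𝟙-cong (yes p) e f g = sym (𝟙-yes e (f p))
 𝟙-cong (no ¬p) e f g = sym (𝟙-no e (λ q → ¬p (g q)))

 0≤𝟙 : ∀ {P : Set} (d : Dec P) → 0ℚ ≤ 𝟙 d
 0≤𝟙 (yes _) = 0≤1
 0≤𝟙 (no _) = ≤-refl

 𝟙≤1 : ∀ {P : Set} (d : Dec P) → 𝟙 d ≤ 1ℚ
 𝟙≤1 (yes _) = ≤-refl
 𝟙≤1 (no _) = 0≤1

 𝟙-guard : ∀ {P : Set} (d : Dec P) {a b} → (P → a ≡ b) → 𝟙 d * a ≡ 𝟙 d * b
 𝟙-guard (yes p) h = cong (1ℚ *_) (h p)
 𝟙-guard (no _) {a} {b} h = trans (*-zeroˡ a) (sym (*-zeroˡ b))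

 𝟙-guard-≤ : ∀ {P : Set} (d : Dec P) {a b} → (P → a ≤ b) → 𝟙 d * a ≤ 𝟙 d * b
 𝟙-guard-≤ (yes p) h = *-monoˡ 1ℚ 0≤1 (h p)
 𝟙-guard-≤ (no _) {a} {b} h = ≤-reflexive (trans (*-zeroˡ a) (sym (*-zeroˡ b)))

 -- Summation starts at 1, as divisor sums require. The value at 0 never enters, so hypotheses on
 -- summands are mostly stated at `suc i`.
 ∑ : ℕ → (ℕ → ℚ) → ℚ
 ∑ zero f = 0ℚ
 ∑ (suc n) f = ∑ n f + f (suc n)

 ∑-cong : ∀ n {f g} → (∀ i → suc i ℕ.≤ n → f (suc i) ≡ g (suc i)) → ∑ n f ≡ ∑ n g
 ∑-cong zero h = refl
 ∑-cong (suc n) h = cong₂ _+_ (∑-cong n (λ i b → h i (ℕ.m≤n⇒m≤1+n b))) (h n ℕ.≤-refl)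

 ∑-ext : ∀ n {f g} → (∀ i → f i ≡ g i) → ∑ n f ≡ ∑ n g
 ∑-ext n h = ∑-cong n (λ i _ → h (suc i))

 ∑-mono : ∀ n {f g} → (∀ i → suc i ℕ.≤ n → f (suc i) ≤ g (suc i)) → ∑ n f ≤ ∑ n g
 ∑-mono zero h = ≤-refl
 ∑-mono (suc n) h = +-mono-≤ (∑-mono n (λ i b → h i (ℕ.m≤n⇒m≤1+n b))) (h n ℕ.≤-refl)

 ∑-0 : ∀ n → ∑ n (λ _ → 0ℚ) ≡ 0ℚ
 ∑-0 zero = refl
 ∑-0 (suc n) = trans (+-identityʳ _) (∑-0 n)

 ∑-zero : ∀ n {f} → (∀ i → suc i ℕ.≤ n → f (suc i) ≡ 0ℚ) → ∑ n f ≡ 0ℚ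
 ∑-zero n h = trans (∑-cong n h) (∑-0 n)

 ∑-nonneg : ∀ n {f} → (∀ i → suc i ℕ.≤ n → 0ℚ ≤ f (suc i)) → 0ℚ ≤ ∑ n f
 ∑-nonneg n {f} h = subst (_≤ ∑ n f) (∑-0 n) (∑-mono n h)

 ∑-+ : ∀ n f g → ∑ n (λ i → f i + g i) ≡ ∑ n f + ∑ n g
 ∑-+ zero f g = refl
 ∑-+ (suc n) f g = trans (cong (_+ (f (suc n) + g (suc n))) (∑-+ n f g)) (lem (∑ n f) (∑ n g) (f (suc n)) (g (suc n)))
  where
  lem : ∀ a b c d → a + b + (c + d) ≡ a + c + (b + d)
  lem = solve-∀ ℚ-ring

 ∑-- : ∀ n f g → ∑ n (λ i → f i - g i) ≡ ∑ n f - ∑ n g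
 ∑-- zero f g = refl
 ∑-- (suc n) f g = trans (cong (_+ (f (suc n) - g (suc n))) (∑-- n f g)) (lem (∑ n f) (∑ n g) (f (suc n)) (g (suc n)))
  where
  lem : ∀ a b c d → a - b + (c - d) ≡ a + c - (b + d)
  lem = solve-∀ ℚ-ring

 ∑-*ˡ : ∀ n c f → ∑ n (λ i → c * f i) ≡ c * ∑ n f
 ∑-*ˡ zero c f = sym (*-zeroʳ c)
 ∑-*ˡ (suc n) c f = trans (cong (_+ c * f (suc n)) (∑-*ˡ n c f)) (sym (*-distribˡ-+ c (∑ n f) (f (suc n))))

 ∑-*ʳ : ∀ n c f → ∑ n (λ i → f i * c) ≡ ∑ n f * c
 ∑-*ʳ n c f = trans (∑-ext n (λ i → *-comm (f i) c)) (trans (∑-*ˡ n c f) (*-comm c (∑ n f)))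

 ∑-const : ∀ n c → ∑ n (λ _ → c) ≡ ι n * c
 ∑-const zero c = sym (*-zeroˡ c)
 ∑-const (suc n) c = trans (cong (_+ c) (∑-const n c)) (lem (ι n) c)
  where
  lem : ∀ a c → a * c + c ≡ (a + 1ℚ) * c
  lem = solve-∀ ℚ-ring

 ∑-swap : ∀ m n (f : ℕ → ℕ → ℚ) → ∑ m (λ i → ∑ n (f i)) ≡ ∑ n (λ j → ∑ m (λ i → f i j))
 ∑-swap zero n f = sym (∑-0 n)
 ∑-swap (suc m) n f = trans (cong (_+ ∑ n (f (suc m))) (∑-swap m n f)) (sym (∑-+ n (λ j → ∑ m (λ i → f i j)) (f (suc m))))

 ∑-abs : ∀ n f → ∣ ∑ n f ∣ ≤ ∑ n (λ i → ∣ f i ∣)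
 ∑-abs zero f = ≤-refl
 ∑-abs (suc n) f = ≤-trans (∣p+q∣≤∣p∣+∣q∣ (∑ n f) (f (suc n))) (+-monoˡ-≤ _ (∑-abs n f))

 ∑-abs-≤ : ∀ n {f g} → (∀ i → suc i ℕ.≤ n → ∣ f (suc i) ∣ ≤ g (suc i)) → ∣ ∑ n f ∣ ≤ ∑ n g
 ∑-abs-≤ n {f} h = ≤-trans (∑-abs n f) (∑-mono n h)

 ∑-split : ∀ m n f → ∑ (m ℕ.+ n) f ≡ ∑ m f + ∑ n (λ i → f (m ℕ.+ i))
 ∑-split m zero f = trans (cong (λ k → ∑ k f) (ℕ.+-identityʳ m)) (sym (+-identityʳ _))
 ∑-split m (suc n) f = trans (cong (λ k → ∑ k f) (ℕ.+-suc m n))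
  (trans (cong₂ _+_ (∑-split m n f) (cong f (sym (ℕ.+-suc m n)))) (+-assoc (∑ m f) _ _))

 ∑-extend : ∀ {m n} f → m ℕ.≤ n → (∀ i → m ℕ.< i → f i ≡ 0ℚ) → ∑ n f ≡ ∑ m f
 ∑-extend {m} {n} f h z = begin
  ∑ n f ≡⟨ cong (λ k → ∑ k f) (ℕ.m+[n∸m]≡n h) ⟨
  ∑ (m ℕ.+ (n ℕ.∸ m)) f ≡⟨ ∑-split m (n ℕ.∸ m) f ⟩
  ∑ m f + ∑ (n ℕ.∸ m) (λ i → f (m ℕ.+ i)) ≡⟨ cong (∑ m f +_) (∑-zero (n ℕ.∸ m) (λ i _ → z _ (ℕ.m<m+n m (s≤s z≤n)))) ⟩
  ∑ m f + 0ℚ ≡⟨ +-identityʳ _ ⟩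
  ∑ m f ∎
  where open ≡-Reasoning

 ∑-mono-range : ∀ {m n} f → m ℕ.≤ n → (∀ i → suc i ℕ.≤ n → 0ℚ ≤ f (suc i)) → ∑ m f ≤ ∑ n f
 ∑-mono-range {m} {zero} f z≤n p = ≤-refl
 ∑-mono-range {m} {suc n} f h p with m ℕ.≟ suc n
 ... | yes refl = ≤-refl
 ... | no ¬e = ≤-trans (∑-mono-range f (ℕ.≤-pred (ℕ.≤∧≢⇒< h ¬e)) (λ i b → p i (ℕ.m≤n⇒m≤1+n b)))
         (subst (_≤ ∑ n f + f (suc n)) (+-identityʳ _) (+-monoʳ-≤ (∑ n f) (p n ℕ.≤-refl)))

 ∑-single-0 : ∀ n c (f : ℕ → ℚ) → n ℕ.< c → ∑ n (λ i → 𝟙 (i ℕ.≟ c) * f i) ≡ 0ℚ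
 ∑-single-0 n c f h = ∑-zero n (λ i b → trans (cong (_* f (suc i)) (𝟙-no (suc i ℕ.≟ c) (λ e → ℕ.<-irrefl e (ℕ.≤-<-trans b h)))) (*-zeroˡ (f (suc i))))

 ∑-single : ∀ n c (f : ℕ → ℚ) → suc c ℕ.≤ n → ∑ n (λ i → 𝟙 (i ℕ.≟ suc c) * f i) ≡ f (suc c)
 ∑-single (suc n) c f h with suc c ℕ.≟ suc n
 ... | yes refl = trans (cong₂ _+_ (∑-single-0 n (suc n) f ℕ.≤-refl) (cong (_* f (suc n)) (𝟙-yes (suc n ℕ.≟ suc n) refl)))
          (trans (+-identityˡ _) (*-identityˡ _))
 ... | no ¬e = trans (cong₂ _+_ (∑-single n c f (ℕ.≤-pred (ℕ.≤∧≢⇒< h ¬e))) (trans (cong (_* f (suc n)) (𝟙-no (suc n ℕ.≟ suc c) (λ e → ¬e (sym e)))) (*-zeroˡ (f (suc n)))))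
         (+-identityʳ _)

 term≤∑ : ∀ n c (f : ℕ → ℚ) → suc c ℕ.≤ n → (∀ i → suc i ℕ.≤ n → 0ℚ ≤ f (suc i)) → f (suc c) ≤ ∑ n f
 term≤∑ n c f h p = subst (_≤ ∑ n f) (∑-single n c f h)
  (∑-mono n (λ i b → subst (𝟙 (suc i ℕ.≟ suc c) * f (suc i) ≤_) (*-identityˡ _) (*-monoʳ (f (suc i)) (p i b) (𝟙≤1 (suc i ℕ.≟ suc c)))))

-- Dirichlet convolution on a bounded range.

module Conv where

 open Base
 open import Data.Rational using (ℚ; 0ℚ; _+_; _*_; _≤_; _<_)
 open import Data.Rational.Properties
 open import Tactic.RingSolver using (solve-∀)

 -- Division with x ÷ 0 = 0.
 _÷_ : ℕ → ℕ → ℕ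
 x ÷ zero = 0
 x ÷ suc d = x ℕ./ suc d

 ÷-upper : ∀ x d m → suc d ℕ.* m ℕ.≤ x → m ℕ.≤ x ÷ suc d
 ÷-upper x d m h = subst (ℕ._≤ x ℕ./ suc d) (trans (cong (ℕ._/ suc d) (ℕ.*-comm (suc d) m)) (DM.m*n/n≡m m (suc d))) (DM./-monoˡ-≤ (suc d) h)

 ÷-lower : ∀ x d → suc d ℕ.* (x ÷ suc d) ℕ.≤ x
 ÷-lower x d = subst (ℕ._≤ x) (ℕ.*-comm (x ℕ./ suc d) (suc d)) (DM.m/n*n≤m x (suc d))

 ÷-lower′ : ∀ x d m → m ℕ.≤ x ÷ suc d → suc d ℕ.* m ℕ.≤ x
 ÷-lower′ x d m h = ℕ.≤-trans (ℕ.*-monoʳ-≤ (suc d) h) (÷-lower x d)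

 ÷-≤ : ∀ x d → x ÷ d ℕ.≤ x
 ÷-≤ x zero = z≤n
 ÷-≤ x (suc d) = DM.m/n≤m x (suc d)

 ÷-< : ∀ x d → x ℕ.< suc d ℕ.* suc (x ÷ suc d)
 ÷-< x d = ℕ.≰⇒> (λ h → ℕ.<-irrefl refl (÷-upper x d (suc (x ÷ suc d)) h))

 ∑-trunc : ∀ {X x} d φ → x ℕ.≤ X → ∑ X (λ m → 𝟙 (suc d ℕ.* m ℕ.≤? x) * φ m) ≡ ∑ (x ÷ suc d) φ
 ∑-trunc {X} {x} d φ h = trans
  (∑-extend (λ m → 𝟙 (suc d ℕ.* m ℕ.≤? x) * φ m) (ℕ.≤-trans (÷-≤ x (suc d)) h)
   (λ i lt → trans (cong (_* φ i) (𝟙-no (suc d ℕ.* i ℕ.≤? x) (λ b → ℕ.<⇒≱ lt (÷-upper x d i b)))) (*-zeroˡ (φ i))))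
  (∑-cong (x ÷ suc d) (λ i b → trans (cong (_* φ (suc i)) (𝟙-yes (suc d ℕ.* suc i ℕ.≤? x) (÷-lower′ x d (suc i) b))) (*-identityˡ (φ (suc i)))))

 ∑-eq-trunc : ∀ x c (φ : ℕ → ℚ) → ∑ x (λ n → 𝟙 (suc c ℕ.≟ n) * φ n) ≡ 𝟙 (suc c ℕ.≤? x) * φ (suc c)
 ∑-eq-trunc x c φ with suc c ℕ.≤? x
 ... | yes p = trans (∑-ext x (λ i → cong (_* φ i) (𝟙-cong (suc c ℕ.≟ i) (i ℕ.≟ suc c) sym sym))) (trans (∑-single x c φ p) (sym (*-identityˡ (φ (suc c)))))
 ... | no ¬p = trans (∑-ext x (λ i → cong (_* φ i) (𝟙-cong (suc c ℕ.≟ i) (i ℕ.≟ suc c) sym sym))) (trans (∑-single-0 x (suc c) φ (ℕ.≰⇒> ¬p)) (sym (*-zeroˡ (φ (suc c)))))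

 -- Dirichlet convolution, correct at the arguments up to the bound X.
 module Convolution (X : ℕ) where

  infixl 7 _⋆_

  _⋆_ : (ℕ → ℚ) → (ℕ → ℚ) → ℕ → ℚ
  (f ⋆ g) n = ∑ X (λ d → ∑ X (λ m → 𝟙 (d ℕ.* m ℕ.≟ n) * (f d * g m)))

  ⋆-cong : ∀ {f f′ g g′} → (∀ i → suc i ℕ.≤ X → f (suc i) ≡ f′ (suc i)) → (∀ i → suc i ℕ.≤ X → g (suc i) ≡ g′ (suc i)) →
      ∀ n → (f ⋆ g) n ≡ (f′ ⋆ g′) n
  ⋆-cong hf hg n = ∑-cong X (λ d bd → ∑-cong X (λ m bm → cong (𝟙 (suc d ℕ.* suc m ℕ.≟ n) *_) (cong₂ _*_ (hf d bd) (hg m bm))))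

  ⋆-comm : ∀ f g n → (f ⋆ g) n ≡ (g ⋆ f) n
  ⋆-comm f g n = trans (∑-swap X X (λ d m → 𝟙 (d ℕ.* m ℕ.≟ n) * (f d * g m)))
   (∑-ext X (λ m → ∑-ext X (λ d → cong₂ _*_
    (𝟙-cong (d ℕ.* m ℕ.≟ n) (m ℕ.* d ℕ.≟ n) (trans (ℕ.*-comm m d)) (trans (ℕ.*-comm d m))) (*-comm (f d) (g m)))))

  ⋆-distribˡ : ∀ f g h n → (f ⋆ (λ i → g i + h i)) n ≡ (f ⋆ g) n + (f ⋆ h) n
  ⋆-distribˡ f g h n = trans (∑-ext X (λ d → trans
    (∑-ext X (λ m → lem (𝟙 (d ℕ.* m ℕ.≟ n)) (f d) (g m) (h m)))
    (∑-+ X (λ m → 𝟙 (d ℕ.* m ℕ.≟ n) * (f d * g m)) (λ m → 𝟙 (d ℕ.* m ℕ.≟ n) * (f d * h m)))))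
   (∑-+ X (λ d → ∑ X (λ m → 𝟙 (d ℕ.* m ℕ.≟ n) * (f d * g m))) (λ d → ∑ X (λ m → 𝟙 (d ℕ.* m ℕ.≟ n) * (f d * h m))))
   where
   lem : ∀ a b c d → a * (b * (c + d)) ≡ a * (b * c) + a * (b * d)
   lem = solve-∀ ℚ-ring

  ⋆-distribʳ : ∀ f g h n → ((λ i → g i + h i) ⋆ f) n ≡ (g ⋆ f) n + (h ⋆ f) n
  ⋆-distribʳ f g h n = trans (⋆-comm (λ i → g i + h i) f n) (trans (⋆-distribˡ f g h n) (cong₂ _+_ (⋆-comm f g n) (⋆-comm f h n)))

  private
   triple : (f g h : ℕ → ℚ) → ℕ → ℚ
   triple f g h n = ∑ X (λ d → ∑ X (λ e → ∑ X (λ m → 𝟙 (d ℕ.* e ℕ.* m ℕ.≟ n) * (f d * g e * h m))))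

   -- A factorisation d e m = n has d e ≤ n ≤ X, so the inner convolution, although truncated at X,
   -- misses none of them. This is where n ≤ X is used.
   ⋆-triple : ∀ f g h n → n ℕ.≤ X → (f ⋆ g ⋆ h) n ≡ triple f g h n
   ⋆-triple f g h n n≤X = begin
    ∑ X (λ k → ∑ X (λ m → 𝟙 (k ℕ.* m ℕ.≟ n) * ((f ⋆ g) k * h m)))
     ≡⟨ ∑-ext X (λ k → ∑-ext X (λ m → push k m)) ⟩
    ∑ X (λ k → ∑ X (λ m → ∑ X (λ d → ∑ X (λ e → A d e m k))))
     ≡⟨ ∑-ext X (λ k → trans (∑-swap X X _) (∑-ext X (λ d → ∑-swap X X _))) ⟩
    ∑ X (λ k → ∑ X (λ d → ∑ X (λ e → ∑ X (λ m → A d e m k))))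
     ≡⟨ trans (∑-swap X X _) (∑-ext X (λ d → trans (∑-swap X X _) (∑-ext X (λ e → ∑-swap X X _)))) ⟩
    ∑ X (λ d → ∑ X (λ e → ∑ X (λ m → ∑ X (A d e m))))
     ≡⟨ ∑-cong X (λ d _ → ∑-cong X (λ e _ → ∑-cong X (λ m _ → pick d e m))) ⟩
    triple f g h n ∎
    where
    open ≡-Reasoning
    A : ℕ → ℕ → ℕ → ℕ → ℚ
    A d e m k = 𝟙 (d ℕ.* e ℕ.≟ k) * (𝟙 (k ℕ.* m ℕ.≟ n) * (f d * g e * h m))
    lem : ∀ a b c d e → a * (b * (c * d)) * e ≡ b * (a * (c * d * e))
    lem = solve-∀ ℚ-ring
    lem′ : ∀ a b c → a * (b * c) ≡ a * b * c
    lem′ = solve-∀ ℚ-ring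
    push : ∀ k m → 𝟙 (k ℕ.* m ℕ.≟ n) * ((f ⋆ g) k * h m) ≡ ∑ X (λ d → ∑ X (λ e → A d e m k))
    push k m = trans (lem′ (𝟙 (k ℕ.* m ℕ.≟ n)) ((f ⋆ g) k) (h m))
     (trans (cong (_* h m) (sym (trans (∑-ext X (λ d → ∑-*ˡ X (𝟙 (k ℕ.* m ℕ.≟ n)) (λ e → 𝟙 (d ℕ.* e ℕ.≟ k) * (f d * g e)))) (∑-*ˡ X (𝟙 (k ℕ.* m ℕ.≟ n)) (λ d → ∑ X (λ e → 𝟙 (d ℕ.* e ℕ.≟ k) * (f d * g e)))))))
     (sym (trans (∑-ext X (λ d → trans (∑-ext X (λ e → sym (lem (𝟙 (k ℕ.* m ℕ.≟ n)) (𝟙 (d ℕ.* e ℕ.≟ k)) (f d) (g e) (h m))))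
      (∑-*ʳ X (h m) (λ e → 𝟙 (k ℕ.* m ℕ.≟ n) * (𝟙 (d ℕ.* e ℕ.≟ k) * (f d * g e))))))
      (∑-*ʳ X (h m) (λ d → ∑ X (λ e → 𝟙 (k ℕ.* m ℕ.≟ n) * (𝟙 (d ℕ.* e ℕ.≟ k) * (f d * g e))))))))
    pick : ∀ d e m → ∑ X (A (suc d) (suc e) (suc m)) ≡ 𝟙 (suc d ℕ.* suc e ℕ.* suc m ℕ.≟ n) * (f (suc d) * g (suc e) * h (suc m))
    pick d e m = trans (∑-eq-trunc X (e ℕ.+ d ℕ.* suc e) (λ k → 𝟙 (k ℕ.* suc m ℕ.≟ n) * (f (suc d) * g (suc e) * h (suc m)))) (go (suc d ℕ.* suc e ℕ.≤? X))
     where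
     P : ℚ
     P = 𝟙 (suc d ℕ.* suc e ℕ.* suc m ℕ.≟ n) * (f (suc d) * g (suc e) * h (suc m))
     go : (dec : Dec (suc d ℕ.* suc e ℕ.≤ X)) → 𝟙 dec * P ≡ P
     go (yes _) = *-identityˡ P
     go (no ¬p) = trans (*-zeroˡ P) (sym (trans (cong (_* (f (suc d) * g (suc e) * h (suc m)))
      (𝟙-no (suc d ℕ.* suc e ℕ.* suc m ℕ.≟ n) (λ eq → ¬p (ℕ.≤-trans (ℕ.m≤m*n (suc d ℕ.* suc e) (suc m)) (ℕ.≤-trans (ℕ.≤-reflexive eq) n≤X)))))
      (*-zeroˡ (f (suc d) * g (suc e) * h (suc m)))))

  -- The triple sum is invariant under cyclic rotation of its three factors, which reduces
  -- associativity to commutativity.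
  ⋆-assoc : ∀ f g h n → n ℕ.≤ X → (f ⋆ g ⋆ h) n ≡ (f ⋆ (g ⋆ h)) n
  ⋆-assoc f g h n n≤X = begin
   (f ⋆ g ⋆ h) n ≡⟨ ⋆-triple f g h n n≤X ⟩
   triple f g h n ≡⟨ trans (∑-swap X X _) (∑-ext X (λ e → ∑-swap X X _)) ⟩
   ∑ X (λ e → ∑ X (λ m → ∑ X (λ d → 𝟙 (d ℕ.* e ℕ.* m ℕ.≟ n) * (f d * g e * h m))))
    ≡⟨ ∑-ext X (λ e → ∑-ext X (λ m → ∑-ext X (λ d → cong₂ _*_
      (𝟙-cong (d ℕ.* e ℕ.* m ℕ.≟ n) (e ℕ.* m ℕ.* d ℕ.≟ n) (trans (sym (rot d e m))) (trans (rot d e m))) (lem (f d) (g e) (h m))))) ⟩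
   triple g h f n ≡⟨ ⋆-triple g h f n n≤X ⟨
   (g ⋆ h ⋆ f) n ≡⟨ ⋆-comm (g ⋆ h) f n ⟩
   (f ⋆ (g ⋆ h)) n ∎
   where
   open ≡-Reasoning
   rot : ∀ d e m → d ℕ.* e ℕ.* m ≡ e ℕ.* m ℕ.* d
   rot d e m = trans (ℕ.*-assoc d e m) (ℕ.*-comm d (e ℕ.* m))
   lem : ∀ a b c → a * b * c ≡ b * c * a
   lem = solve-∀ ℚ-ring

  ε : ℕ → ℚ
  ε n = 𝟙 (n ℕ.≟ 1)

  ⋆-identityˡ : ∀ f n → suc n ℕ.≤ X → (ε ⋆ f) (suc n) ≡ f (suc n)
  ⋆-identityˡ f n n≤X = begin
   ∑ X (λ d → ∑ X (λ m → 𝟙 (d ℕ.* m ℕ.≟ suc n) * (ε d * f m)))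
    ≡⟨ ∑-ext X (λ d → trans (∑-ext X (λ m → lem (𝟙 (d ℕ.* m ℕ.≟ suc n)) (ε d) (f m))) (∑-*ˡ X (ε d) (λ m → 𝟙 (d ℕ.* m ℕ.≟ suc n) * f m))) ⟩
   ∑ X (λ d → ε d * ∑ X (λ m → 𝟙 (d ℕ.* m ℕ.≟ suc n) * f m))
    ≡⟨ ∑-single X 0 (λ d → ∑ X (λ m → 𝟙 (d ℕ.* m ℕ.≟ suc n) * f m)) (ℕ.≤-trans (s≤s z≤n) n≤X) ⟩
   ∑ X (λ m → 𝟙 (1 ℕ.* m ℕ.≟ suc n) * f m)
    ≡⟨ ∑-ext X (λ m → cong (_* f m) (𝟙-cong (1 ℕ.* m ℕ.≟ suc n) (m ℕ.≟ suc n) (trans (sym (ℕ.*-identityˡ m))) (trans (ℕ.*-identityˡ m)))) ⟩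
   ∑ X (λ m → 𝟙 (m ℕ.≟ suc n) * f m)
    ≡⟨ ∑-single X n f n≤X ⟩
   f (suc n) ∎
   where
   open ≡-Reasoning
   lem : ∀ a b c → a * (b * c) ≡ b * (a * c)
   lem = solve-∀ ℚ-ring

  ⋆-*ʳ : ∀ f g c n → (f ⋆ g) n * c ≡ ∑ X (λ d → ∑ X (λ m → 𝟙 (d ℕ.* m ℕ.≟ n) * (f d * g m * c)))
  ⋆-*ʳ f g c n = sym (trans (∑-ext X (λ d → trans (∑-ext X (λ m → sym (lem (𝟙 (d ℕ.* m ℕ.≟ n)) (f d) (g m) c)))
          (∑-*ʳ X c (λ m → 𝟙 (d ℕ.* m ℕ.≟ n) * (f d * g m)))))
          (∑-*ʳ X c (λ d → ∑ X (λ m → 𝟙 (d ℕ.* m ℕ.≟ n) * (f d * g m)))))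
   where
   lem : ∀ a b c d → a * (b * c) * d ≡ a * (b * c * d)
   lem = solve-∀ ℚ-ring

  -- Multiplication by an additive function is a derivation of the convolution product. It plays the
  -- part of differentiating a Dirichlet series.
  ⋆-derivation : ∀ (λ′ : ℕ → ℚ) f g n → (∀ d m → suc d ℕ.* suc m ≡ n → λ′ n ≡ λ′ (suc d) + λ′ (suc m)) →
   (f ⋆ g) n * λ′ n ≡ ((λ i → f i * λ′ i) ⋆ g) n + (f ⋆ (λ i → g i * λ′ i)) n
  ⋆-derivation λ′ f g n add = begin
   (f ⋆ g) n * λ′ n
    ≡⟨ ⋆-*ʳ f g (λ′ n) n ⟩
   ∑ X (λ d → ∑ X (λ m → 𝟙 (d ℕ.* m ℕ.≟ n) * (f d * g m * λ′ n)))
    ≡⟨ ∑-cong X (λ d _ → ∑-cong X (λ m _ → trans (𝟙-guard (suc d ℕ.* suc m ℕ.≟ n) (λ eq → cong (f (suc d) * g (suc m) *_) (add d m eq)))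
      (lem (𝟙 (suc d ℕ.* suc m ℕ.≟ n)) (f (suc d)) (g (suc m)) (λ′ (suc d)) (λ′ (suc m))))) ⟩
   ∑ X (λ d → ∑ X (λ m → P d m + Q d m))
    ≡⟨ ∑-ext X (λ d → ∑-+ X (P d) (Q d)) ⟩
   ∑ X (λ d → ∑ X (P d) + ∑ X (Q d))
    ≡⟨ ∑-+ X (λ d → ∑ X (P d)) (λ d → ∑ X (Q d)) ⟩
   ((λ i → f i * λ′ i) ⋆ g) n + (f ⋆ (λ i → g i * λ′ i)) n ∎
   where
   open ≡-Reasoning
   P Q : ℕ → ℕ → ℚ
   P d m = 𝟙 (d ℕ.* m ℕ.≟ n) * (f d * λ′ d * g m)
   Q d m = 𝟙 (d ℕ.* m ℕ.≟ n) * (f d * (g m * λ′ m))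
   lem : ∀ a b c d e → a * (b * c * (d + e)) ≡ a * (b * d * c) + a * (b * (c * e))
   lem = solve-∀ ℚ-ring

  ⋆-twist : ∀ (χ : ℕ → ℚ) f g n → (∀ d m → χ (d ℕ.* m) ≡ χ d * χ m) →
   (f ⋆ g) n * χ n ≡ ((λ i → f i * χ i) ⋆ (λ i → g i * χ i)) n
  ⋆-twist χ f g n mult = trans (⋆-*ʳ f g (χ n) n)
   (∑-ext X (λ d → ∑-ext X (λ m → 𝟙-guard (d ℕ.* m ℕ.≟ n) (λ eq →
    trans (cong (f d * g m *_) (trans (cong χ (sym eq)) (mult d m))) (lem (f d) (g m) (χ d) (χ m))))))
   where
   lem : ∀ a b c d → a * b * (c * d) ≡ a * c * (b * d)
   lem = solve-∀ ℚ-ring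

  ⋆-nonneg : ∀ f g n → (∀ i → 0ℚ ≤ f i) → (∀ i → 0ℚ ≤ g i) → 0ℚ ≤ (f ⋆ g) n
  ⋆-nonneg f g n pf pg = ∑-nonneg X (λ d _ → ∑-nonneg X (λ m _ → 0≤𝟙 (suc d ℕ.* suc m ℕ.≟ n) ⊗ (pf (suc d) ⊗ pg (suc m))))

  -- Sorting the products n = d m by d turns a weighted sum of a convolution into sums of `g` up to
  -- x ÷ d. Nearly all estimates for convolutions below start from this rearrangement.
  ∑-⋆ : ∀ f g (w : ℕ → ℚ) x → x ℕ.≤ X →
   ∑ x (λ n → (f ⋆ g) n * w n) ≡ ∑ x (λ d → f d * ∑ (x ÷ d) (λ m → g m * w (d ℕ.* m)))
  ∑-⋆ f g w x x≤X = begin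
   ∑ x (λ n → (f ⋆ g) n * w n)
    ≡⟨ ∑-ext x (λ n → trans (⋆-*ʳ f g (w n) n) (∑-ext X (λ d → ∑-ext X (λ m → refl)))) ⟩
   ∑ x (λ n → ∑ X (λ d → ∑ X (λ m → A d m n)))
    ≡⟨ trans (∑-swap x X _) (∑-ext X (λ d → ∑-swap x X _)) ⟩
   ∑ X (λ d → ∑ X (λ m → ∑ x (A d m)))
    ≡⟨ ∑-cong X (λ d _ → trans (∑-cong X (λ m _ → pick d m)) (∑-*ˡ X (f (suc d)) (λ m → 𝟙 (suc d ℕ.* m ℕ.≤? x) * (g m * w (suc d ℕ.* m))))) ⟩
   ∑ X (λ d → f d * ∑ X (λ m → 𝟙 (d ℕ.* m ℕ.≤? x) * (g m * w (d ℕ.* m))))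
    ≡⟨ ∑-cong X (λ d _ → cong (f (suc d) *_) (∑-trunc d (λ m → g m * w (suc d ℕ.* m)) x≤X)) ⟩
   ∑ X (λ d → f d * ∑ (x ÷ d) (λ m → g m * w (d ℕ.* m)))
    ≡⟨ ∑-extend _ x≤X (λ { (suc i) lt → trans (cong (λ k → f (suc i) * ∑ k (λ m → g m * w (suc i ℕ.* m))) (DM.m<n⇒m/n≡0 lt)) (*-zeroʳ (f (suc i))) }) ⟩
   ∑ x (λ d → f d * ∑ (x ÷ d) (λ m → g m * w (d ℕ.* m))) ∎
   where
   open ≡-Reasoning
   A : ℕ → ℕ → ℕ → ℚ
   A d m n = 𝟙 (d ℕ.* m ℕ.≟ n) * (f d * g m * w n)
   lem : ∀ a b c d → a * (b * c * d) ≡ b * (a * (c * d))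
   lem = solve-∀ ℚ-ring
   pick : ∀ d m → ∑ x (A (suc d) (suc m)) ≡ f (suc d) * (𝟙 (suc d ℕ.* suc m ℕ.≤? x) * (g (suc m) * w (suc d ℕ.* suc m)))
   pick d m = trans (∑-eq-trunc x (m ℕ.+ d ℕ.* suc m) (λ n → f (suc d) * g (suc m) * w n))
    (lem (𝟙 (suc d ℕ.* suc m ℕ.≤? x)) (f (suc d)) (g (suc m)) (w (suc d ℕ.* suc m)))

-- A completely additive integer-valued logarithm with controlled increments.

module NatLog where

 open import Data.Nat
 open import Data.Nat.Properties
 open import Data.Nat.DivMod using (m≡m%n+[m/n]*n; m%n<n; m/n*n≤m)
 open import Data.Nat.Primality using (Prime; prime⇒nonZero; prime⇒nonTrivial)
 open import Data.Nat.Primality.Factorisation using (PrimeFactorisation; factorise; factors; factorisationUnique; primeFactorisation[p])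
 open import Data.Nat.ListAction using (sum; product)
 open import Data.Nat.ListAction.Properties using (sum-++; sum-↭; product-++)
 open import Data.List using (List; []; _∷_; _++_; map)
 open import Data.List.Properties using (map-++)
 open import Data.List.Relation.Unary.All using (All; []; _∷_)
 open import Data.List.Relation.Unary.All.Properties using (++⁺)
 open import Data.List.Relation.Binary.Permutation.Propositional.Properties using (map⁺)
 open import Data.Nat.Tactic.RingSolver using (solve-∀)

 prime≥2 : ∀ {p} → Prime p → 2 ≤ p
 prime≥2 pp = nonTrivial⇒n>1 _ {{prime⇒nonTrivial pp}}

 prime-induction : (P : ℕ → Set) → P 1 → (∀ p n → Prime p → 1 ≤ n → P n → P (p * n)) → ∀ n → 1 ≤ n → P n
 prime-induction P p1 ps (suc n) _ = subst P (sym (PrimeFactorisation.isFactorisation f)) (proj₁ (go (factors f) (PrimeFactorisation.factorsPrime f)))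
  where
  f : PrimeFactorisation (suc n)
  f = factorise (suc n)
  go : ∀ as → All Prime as → P (product as) × 1 ≤ product as
  go [] [] = p1 , ≤-refl
  go (a ∷ as) (pa ∷ pas) with go as pas
  ... | h , pos = ps a (product as) pa pos h , *-mono-≤ (≤-trans (s≤s z≤n) (prime≥2 pa)) pos

 lg : ∀ n → 1 ≤ n → ∃ λ e → 2 ^ e ≤ n × n < 2 ^ suc e
 lg 1 _ = 0 , s≤s z≤n , s≤s (s≤s z≤n)
 lg (suc (suc n)) _ with lg (suc n) (s≤s z≤n)
 ... | e , l , u with m≤n⇒m<n∨m≡n u
 ... | inj₁ h = e , m≤n⇒m≤1+n l , h
 ... | inj₂ h = suc e , ≤-reflexive (sym h) , subst (_< 2 ^ suc (suc e)) (sym h) (^-monoʳ-< 2 (s≤s (s≤s z≤n)) (n<1+n (suc e)))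

 bitLog : ℕ → ℕ
 bitLog zero = 0
 bitLog (suc n) = proj₁ (lg (suc n) (s≤s z≤n))

 bitLog-lower : ∀ n → 1 ≤ n → 2 ^ bitLog n ≤ n
 bitLog-lower (suc n) _ = proj₁ (proj₂ (lg (suc n) (s≤s z≤n)))

 bitLog-upper : ∀ n → 1 ≤ n → n < 2 ^ suc (bitLog n)
 bitLog-upper (suc n) _ = proj₂ (proj₂ (lg (suc n) (s≤s z≤n)))

 -- A completely additive function that approximates K log₂: exact additivity
 -- is bought by rounding only at the primes.
 module Additive (K : ℕ) where

  L : ℕ → ℕ
  L zero = 0
  L (suc n) = sum (map (λ p → bitLog (p ^ K)) (factors (factorise (suc n))))

  private
   L-unique : ∀ n (f : PrimeFactorisation (suc n)) → L (suc n) ≡ sum (map (λ p → bitLog (p ^ K)) (factors f))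
   L-unique n f = sum-↭ (map⁺ (λ p → bitLog (p ^ K)) (factorisationUnique (factorise (suc n)) f))

  L-prime : ∀ {p} → Prime p → L p ≡ bitLog (p ^ K)
  L-prime {zero} pp = ⊥-elim (n≮0 (prime≥2 pp))
  L-prime {suc p} pp = trans (L-unique p (primeFactorisation[p] pp)) (+-identityʳ _)

  L-* : ∀ m n → 1 ≤ m → 1 ≤ n → L (m * n) ≡ L m + L n
  L-* (suc m) (suc n) _ _ = trans (L-unique (n + m * suc n) fac)
   (trans (cong sum (map-++ (λ p → bitLog (p ^ K)) (factors f) (factors g))) (sum-++ (map _ (factors f)) (map _ (factors g))))
   where
   f = factorise (suc m)
   g = factorise (suc n)
   fac : PrimeFactorisation (suc m * suc n)
   fac = record
    { factors = factors f ++ factors g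
    ; isFactorisation = trans (cong₂ _*_ (PrimeFactorisation.isFactorisation f) (PrimeFactorisation.isFactorisation g)) (sym (product-++ (factors f) (factors g)))
    ; factorsPrime = ++⁺ (PrimeFactorisation.factorsPrime f) (PrimeFactorisation.factorsPrime g)
    }

  ^-distribʳ-* : ∀ m n o → (m * n) ^ o ≡ m ^ o * n ^ o
  ^-distribʳ-* m n zero = refl
  ^-distribʳ-* m n (suc o) = trans (cong (m * n *_) (^-distribʳ-* m n o)) (lem m n (m ^ o) (n ^ o))
   where
   lem : ∀ a b c d → a * b * (c * d) ≡ a * c * (b * d)
   lem = solve-∀

  -- Each prime factor loses less than one bit to rounding. The allowance n suffices because passing
  -- from n to p n raises it by at least 1.
  L-bounds : ∀ n → 1 ≤ n → 2 ^ L n ≤ n ^ K × n ^ K ≤ 2 ^ (L n + n)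
  L-bounds = prime-induction _ (≤-reflexive (sym (^-zeroˡ K)) , ≤-trans (≤-reflexive (^-zeroˡ K)) (s≤s z≤n)) step
   where
   step : ∀ p n → Prime p → 1 ≤ n → (2 ^ L n ≤ n ^ K × n ^ K ≤ 2 ^ (L n + n)) → 2 ^ L (p * n) ≤ (p * n) ^ K × (p * n) ^ K ≤ 2 ^ (L (p * n) + p * n)
   step p n pp 1≤n (lo , hi) = lower , upper
    where
    p≥1 = ≤-trans (s≤s z≤n) (prime≥2 pp)
    1≤p^K : 1 ≤ p ^ K
    1≤p^K = m^n>0 p {{prime⇒nonZero pp}} K
    e : L (p * n) ≡ bitLog (p ^ K) + L n
    e = trans (L-* p n p≥1 1≤n) (cong (_+ L n) (L-prime pp))
    open ≤-Reasoning
    lower : 2 ^ L (p * n) ≤ (p * n) ^ K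
    lower = begin
     2 ^ L (p * n) ≡⟨ cong (2 ^_) e ⟩
     2 ^ (bitLog (p ^ K) + L n) ≡⟨ ^-distribˡ-+-* 2 (bitLog (p ^ K)) (L n) ⟩
     2 ^ bitLog (p ^ K) * 2 ^ L n ≤⟨ *-mono-≤ (bitLog-lower (p ^ K) 1≤p^K) lo ⟩
     p ^ K * n ^ K ≡⟨ ^-distribʳ-* p n K ⟨
     (p * n) ^ K ∎
    upper : (p * n) ^ K ≤ 2 ^ (L (p * n) + p * n)
    upper = begin
     (p * n) ^ K ≡⟨ ^-distribʳ-* p n K ⟩
     p ^ K * n ^ K ≤⟨ *-mono-≤ (<⇒≤ (bitLog-upper (p ^ K) 1≤p^K)) hi ⟩
     2 ^ suc (bitLog (p ^ K)) * 2 ^ (L n + n) ≡⟨ ^-distribˡ-+-* 2 (suc (bitLog (p ^ K))) (L n + n) ⟨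
     2 ^ (suc (bitLog (p ^ K)) + (L n + n)) ≤⟨ ^-monoʳ-≤ 2 (≤-trans (≤-reflexive (lem (bitLog (p ^ K)) (L n) n)) (+-mono-≤ (≤-reflexive (sym e)) n+1≤pn)) ⟩
     2 ^ (L (p * n) + p * n) ∎
     where
     lem : ∀ a b c → suc a + (b + c) ≡ a + b + suc c
     lem = solve-∀
     n+1≤pn : suc n ≤ p * n
     n+1≤pn = begin
      suc n ≤⟨ +-monoˡ-≤ n 1≤n ⟩
      n + n ≡⟨ cong (n +_) (+-identityʳ n) ⟨
      2 * n ≤⟨ *-monoˡ-≤ n (prime≥2 pp) ⟩
      p * n ∎

 private
  -- Bernoulli's inequality for (1 + 1/n)^j without denominators; j = n gives (1 + 1/n)^n ≥ 2.
  bernoulli : ∀ n j → (n + j) * n ^ j ≤ n * suc n ^ j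
  bernoulli n zero = ≤-reflexive (cong (_* 1) (+-identityʳ n))
  bernoulli n (suc j) = begin
   (n + suc j) * (n * n ^ j) ≤⟨ m≤m+n _ _ ⟩
   (n + suc j) * (n * n ^ j) + j * n ^ j ≡⟨ lem n j (n ^ j) ⟩
   suc n * ((n + j) * n ^ j) ≤⟨ *-monoʳ-≤ (suc n) (bernoulli n j) ⟩
   suc n * (n * suc n ^ j) ≡⟨ lem′ n (suc n ^ j) ⟩
   n * (suc n * suc n ^ j) ∎
   where
   open ≤-Reasoning
   lem : ∀ n j x → (n + suc j) * (n * x) + j * x ≡ suc n * ((n + j) * x)
   lem = solve-∀
   lem′ : ∀ n x → suc n * (n * x) ≡ n * (suc n * x)
   lem′ = solve-∀

  double : ∀ n → 1 ≤ n → 2 * n ^ n ≤ suc n ^ n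
  double n@(suc n′) 1≤n = *-cancelˡ-≤ n (begin
   n * (2 * n ^ n) ≡⟨ lem n (n ^ n) ⟩
   (n + n) * n ^ n ≤⟨ bernoulli n n ⟩
   n * suc n ^ n ∎)
   where
   open ≤-Reasoning
   lem : ∀ n x → n * (2 * x) ≡ (n + n) * x
   lem = solve-∀

  -- Bernoulli's inequality for (1 - 1/(n+1))^j without denominators; for 2 j ≤ n + 1 it gives (1 +
  -- 1/n)^j ≤ 2.
  bernoulli′ : ∀ n j → suc n * suc n ^ j ≤ suc n * n ^ j + j * suc n ^ j
  bernoulli′ n zero = m≤m+n _ _
  bernoulli′ n (suc j) = begin
   suc n * (suc n * suc n ^ j) ≤⟨ *-monoʳ-≤ (suc n) (bernoulli′ n j) ⟩
   suc n * (suc n * n ^ j + j * suc n ^ j) ≡⟨ lem n j (n ^ j) (suc n ^ j) ⟩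
   suc n * (n * n ^ j) + suc n * n ^ j + j * (suc n * suc n ^ j) ≤⟨ +-monoˡ-≤ _ (+-monoʳ-≤ (suc n * (n * n ^ j)) (*-monoʳ-≤ (suc n) (^-monoˡ-≤ j (n≤1+n n)))) ⟩
   suc n * (n * n ^ j) + suc n * suc n ^ j + j * (suc n * suc n ^ j) ≡⟨ +-assoc (suc n * (n * n ^ j)) _ _ ⟩
   suc n * (n * n ^ j) + suc j * (suc n * suc n ^ j) ∎
   where
   open ≤-Reasoning
   lem : ∀ n j x y → suc n * (suc n * x + j * y) ≡ suc n * (n * x) + suc n * x + j * (suc n * y)
   lem = solve-∀

  halve : ∀ n j → j + j ≤ suc n → suc n ^ j ≤ 2 * n ^ j
  halve n j h = *-cancelˡ-≤ (suc n) (+-cancelʳ-≤ (suc n * suc n ^ j) _ _ (begin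
   suc n * suc n ^ j + suc n * suc n ^ j ≤⟨ +-mono-≤ (bernoulli′ n j) (bernoulli′ n j) ⟩
   (suc n * n ^ j + j * suc n ^ j) + (suc n * n ^ j + j * suc n ^ j) ≡⟨ lem n j (n ^ j) (suc n ^ j) ⟩
   suc n * (2 * n ^ j) + (j + j) * suc n ^ j ≤⟨ +-monoʳ-≤ (suc n * (2 * n ^ j)) (*-monoˡ-≤ (suc n ^ j) h) ⟩
   suc n * (2 * n ^ j) + suc n * suc n ^ j ∎))
   where
   open ≤-Reasoning
   lem : ∀ n j x y → (suc n * x + j * y) + (suc n * x + j * y) ≡ suc n * (2 * x) + (j + j) * y
   lem = solve-∀

  half : ∀ n → ∃ λ j → n ≤ j + j × j + j ≤ suc n
  half zero = 0 , z≤n , z≤n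
  half (suc n) with half n
  ... | j , l , u with m≤n⇒m<n∨m≡n l
  ... | inj₁ h = j , h , ≤-trans u (n≤1+n (suc n))
  ... | inj₂ h = suc j , s≤s (≤-trans (≤-reflexive h) (+-monoʳ-≤ j (n≤1+n j))) , s≤s (≤-trans (≤-reflexive (+-suc j j)) (s≤s (≤-reflexive (sym h))))

 -- The K factors 1 + 1/n are grouped into K / n batches of n, each worth at least 2; the K % n
 -- leftover factors are at least 1.
 ratio-lower : ∀ n K .{{_ : NonZero n}} → 2 ^ (K / n) * n ^ K ≤ suc n ^ K
 ratio-lower n@(suc _) K = begin
  2 ^ t * n ^ K ≡⟨ cong (λ k → 2 ^ t * n ^ k) eK ⟩
  2 ^ t * n ^ (n * t + ρ) ≡⟨ cong (2 ^ t *_) (trans (^-distribˡ-+-* n (n * t) ρ) (cong (_* n ^ ρ) (sym (^-*-assoc n n t)))) ⟩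
  2 ^ t * ((n ^ n) ^ t * n ^ ρ) ≡⟨ trans (sym (*-assoc (2 ^ t) ((n ^ n) ^ t) (n ^ ρ))) (cong (_* n ^ ρ) (sym (Additive.^-distribʳ-* 0 2 (n ^ n) t))) ⟩
  (2 * n ^ n) ^ t * n ^ ρ ≤⟨ *-mono-≤ (^-monoˡ-≤ t (double n (s≤s z≤n))) (^-monoˡ-≤ ρ (n≤1+n n)) ⟩
  (suc n ^ n) ^ t * suc n ^ ρ ≡⟨ trans (cong (_* suc n ^ ρ) (^-*-assoc (suc n) n t)) (sym (^-distribˡ-+-* (suc n) (n * t) ρ)) ⟩
  suc n ^ (n * t + ρ) ≡⟨ cong (suc n ^_) eK ⟨
  suc n ^ K ∎
  where
  open ≤-Reasoning
  t = K / n
  ρ = K % n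
  eK : K ≡ n * t + ρ
  eK = trans (m≡m%n+[m/n]*n K n) (trans (+-comm ρ (t * n)) (cong (_+ ρ) (*-comm t n)))

 -- Batches of j factors, j about n/2, are worth at most 2 each, and 2 (K / n + 1) batches hold all
 -- K factors. The surplus `e` is multiplied to both sides so that the batches come out even.
 ratio-upper : ∀ n K .{{_ : NonZero n}} → suc n ^ K ≤ 2 ^ (2 * suc (K / n)) * n ^ K
 ratio-upper n@(suc _) K = *-cancelʳ-≤ (suc n ^ K) (2 ^ (2 * suc t) * n ^ K) (suc n ^ e) {{m^n≢0 (suc n) e}} (begin
  suc n ^ K * suc n ^ e ≡⟨ ^-distribˡ-+-* (suc n) K e ⟨
  suc n ^ (K + e) ≡⟨ cong (suc n ^_) Ke ⟩
  suc n ^ (j * (2 * suc t)) ≡⟨ ^-*-assoc (suc n) j (2 * suc t) ⟨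
  (suc n ^ j) ^ (2 * suc t) ≤⟨ ^-monoˡ-≤ (2 * suc t) (halve n j (proj₂ (proj₂ hf))) ⟩
  (2 * n ^ j) ^ (2 * suc t) ≡⟨ Additive.^-distribʳ-* 0 2 (n ^ j) (2 * suc t) ⟩
  2 ^ (2 * suc t) * (n ^ j) ^ (2 * suc t) ≡⟨ cong (2 ^ (2 * suc t) *_) (trans (^-*-assoc n j (2 * suc t)) (trans (cong (n ^_) (sym Ke)) (^-distribˡ-+-* n K e))) ⟩
  2 ^ (2 * suc t) * (n ^ K * n ^ e) ≡⟨ *-assoc (2 ^ (2 * suc t)) (n ^ K) (n ^ e) ⟨
  2 ^ (2 * suc t) * n ^ K * n ^ e ≤⟨ *-monoʳ-≤ (2 ^ (2 * suc t) * n ^ K) (^-monoˡ-≤ e (n≤1+n n)) ⟩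
  2 ^ (2 * suc t) * n ^ K * suc n ^ e ∎)
  where
  open ≤-Reasoning
  t = K / n
  hf = half n
  j = proj₁ hf
  e = j * (2 * suc t) ∸ K
  K≤ : K ≤ j * (2 * suc t)
  K≤ = begin
   K ≡⟨ m≡m%n+[m/n]*n K n ⟩
   K % n + t * n ≤⟨ +-monoˡ-≤ (t * n) (<⇒≤ (m%n<n K n)) ⟩
   n + t * n ≡⟨ *-comm (suc t) n ⟩
   n * suc t ≤⟨ *-monoˡ-≤ (suc t) (proj₁ (proj₂ hf)) ⟩
   (j + j) * suc t ≡⟨ lem j t ⟩
   j * (2 * suc t) ∎
   where
   lem : ∀ j t → (j + j) * suc t ≡ j * (2 * suc t)
   lem = solve-∀
  Ke : K + e ≡ j * (2 * suc t)
  Ke = m+[n∸m]≡n K≤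

 ^-cancelʳ-≤ : ∀ a b → 2 ^ a ≤ 2 ^ b → a ≤ b
 ^-cancelʳ-≤ a b h with a ≤? b
 ... | yes p = p
 ... | no ¬p = ⊥-elim (<⇒≱ (^-monoʳ-< 2 (s≤s (s≤s z≤n)) (≰⇒> ¬p)) h)

 module Steps (X : ℕ) where

  -- n times a step of `L` at n is about K, with a rounding error of order n². Taking K of order X²
  -- keeps this error below the main term for all n < X.
  K : ℕ
  K = 4 * (X * X)

  open Additive K public

  L-step-lower : ∀ n .{{_ : NonZero n}} → suc n ≤ X → n * L n + 2 * (X * X) ≤ n * L (suc n)
  L-step-lower n@(suc _) n<X = +-cancelʳ-≤ (n * suc n + n) _ _ (begin
   n * L n + 2 * (X * X) + (n * suc n + n) ≡⟨ lem₁ n (L n) (X * X) ⟩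
   n * L n + (2 * (X * X) + (n * n + 2 * n)) ≤⟨ +-monoʳ-≤ (n * L n) (+-monoʳ-≤ (2 * (X * X)) n²≤) ⟩
   n * L n + (2 * (X * X) + 2 * (X * X)) ≡⟨ cong (n * L n +_) (lem₂ (X * X)) ⟩
   n * L n + K ≤⟨ +-monoʳ-≤ (n * L n) K≤ ⟩
   n * L n + (n + n * t) ≡⟨ lem₃ n (L n) t ⟩
   n * (t + L n) + n ≤⟨ +-monoˡ-≤ n (*-monoʳ-≤ n main) ⟩
   n * (L (suc n) + suc n) + n ≡⟨ lem₄ n (L (suc n)) ⟩
   n * L (suc n) + (n * suc n + n) ∎)
   where
   open ≤-Reasoning
   t = K / n
   lem₁ : ∀ n l x → n * l + 2 * x + (n * suc n + n) ≡ n * l + (2 * x + (n * n + 2 * n))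
   lem₁ = solve-∀
   lem₂ : ∀ x → 2 * x + 2 * x ≡ 4 * x
   lem₂ = solve-∀
   lem₃ : ∀ n l t → n * l + (n + n * t) ≡ n * (t + l) + n
   lem₃ = solve-∀
   lem₄ : ∀ n l → n * (l + suc n) + n ≡ n * l + (n * suc n + n)
   lem₄ = solve-∀
   lem₅ : ∀ n → suc n * suc n ≡ suc (n * n + 2 * n)
   lem₅ = solve-∀
   n²≤ : n * n + 2 * n ≤ 2 * (X * X)
   n²≤ = ≤-trans (≤-trans (n≤1+n _) (≤-trans (≤-reflexive (sym (lem₅ n))) (*-mono-≤ n<X n<X))) (m≤m+n (X * X) _)
   K≤ : K ≤ n + n * t
   K≤ = ≤-trans (≤-reflexive (m≡m%n+[m/n]*n K n)) (+-mono-≤ (<⇒≤ (m%n<n K n)) (≤-reflexive (*-comm t n)))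
   main : t + L n ≤ L (suc n) + suc n
   main = ^-cancelʳ-≤ _ _ (begin
    2 ^ (t + L n) ≡⟨ ^-distribˡ-+-* 2 t (L n) ⟩
    2 ^ t * 2 ^ L n ≤⟨ *-monoʳ-≤ (2 ^ t) (proj₁ (L-bounds n (s≤s z≤n))) ⟩
    2 ^ t * n ^ K ≤⟨ ratio-lower n K ⟩
    suc n ^ K ≤⟨ proj₂ (L-bounds (suc n) (s≤s z≤n)) ⟩
    2 ^ (L (suc n) + suc n) ∎)

  L-step-upper : ∀ n .{{_ : NonZero n}} → suc n ≤ X → n * L (suc n) ≤ n * L n + 12 * (X * X)
  L-step-upper n@(suc _) n<X = begin
   n * L (suc n) ≤⟨ *-monoʳ-≤ n main ⟩
   n * (2 * suc t + (L n + n)) ≡⟨ lem₁ n t (L n) ⟩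
   n * L n + (2 * (n * t) + (n * n + 2 * n)) ≤⟨ +-monoʳ-≤ (n * L n) (+-mono-≤ (*-monoʳ-≤ 2 nt≤K) n²≤) ⟩
   n * L n + (2 * K + 4 * (X * X)) ≡⟨ cong (n * L n +_) (lem₂ (X * X)) ⟩
   n * L n + 12 * (X * X) ∎
   where
   open ≤-Reasoning
   t = K / n
   lem₁ : ∀ n t l → n * (2 * suc t + (l + n)) ≡ n * l + (2 * (n * t) + (n * n + 2 * n))
   lem₁ = solve-∀
   lem₂ : ∀ x → 2 * (4 * x) + 4 * x ≡ 12 * x
   lem₂ = solve-∀
   lem₅ : ∀ n → suc n * suc n ≡ suc (n * n + 2 * n)
   lem₅ = solve-∀
   n²≤ : n * n + 2 * n ≤ 4 * (X * X)
   n²≤ = ≤-trans (≤-trans (n≤1+n _) (≤-trans (≤-reflexive (sym (lem₅ n))) (*-mono-≤ n<X n<X))) (m≤m+n (X * X) _)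
   nt≤K : n * t ≤ K
   nt≤K = ≤-trans (≤-reflexive (*-comm n t)) (m/n*n≤m K n)
   main : L (suc n) ≤ 2 * suc t + (L n + n)
   main = ^-cancelʳ-≤ _ _ (begin
    2 ^ L (suc n) ≤⟨ proj₁ (L-bounds (suc n) (s≤s z≤n)) ⟩
    suc n ^ K ≤⟨ ratio-upper n K ⟩
    2 ^ (2 * suc t) * n ^ K ≤⟨ *-monoʳ-≤ (2 ^ (2 * suc t)) (proj₂ (L-bounds n (s≤s z≤n))) ⟩
    2 ^ (2 * suc t) * 2 ^ (L n + n) ≡⟨ ^-distribˡ-+-* 2 (2 * suc t) (L n + n) ⟨
    2 ^ (2 * suc t + (L n + n)) ∎)

-- The von Mangoldt function belonging to the additive logarithm.

module Mangoldt where

 open Base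
 open Conv
 open NatLog using (module Steps; prime≥2; prime-induction)
 open import Data.Nat using (_^_)
 open import Data.Nat.Divisibility using (_∣_; _∣?_; divides; ∣-trans; ∣⇒≤; *-monoʳ-∣; *-cancelˡ-∣; ∣n⇒∣m*n; m∣m*n; ∣1⇒≡1)
 open import Data.Nat.Coprimality using (Coprime; coprime-divisor)
 open import Data.Nat.Primality using (Prime; prime?; prime⇒nonZero; prime⇒irreducible; euclidsLemma)
 open import Data.Rational using (ℚ; 0ℚ; 1ℚ; _+_; _*_; _-_; -_; _≤_; _<_; ∣_∣)
 open import Data.Rational.Properties
 open import Relation.Binary.Definitions using (tri<; tri≈; tri>)
 open import Tactic.RingSolver using (solve-∀)

 prime≢1 : ∀ {p} → Prime p → p ≢ 1
 prime≢1 pp refl = ℕ.<-irrefl refl (prime≥2 pp)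

 n<p^n : ∀ {p} → Prime p → ∀ n → n ℕ.< p ^ n
 n<p^n pp zero = s≤s z≤n
 n<p^n {p} pp (suc n) = ℕ.≤-trans (ℕ.≤-trans (s≤s (s≤s ℕ.≤-refl)) (ℕ.≤-trans (s≤s (n<p^n pp n)) (lem (p ^ n) (ℕ.≤-trans (s≤s z≤n) (n<p^n pp n)))))
            (ℕ.*-monoˡ-≤ (p ^ n) (prime≥2 pp))
  where
  lem : ∀ a → 1 ℕ.≤ a → suc a ℕ.≤ 2 ℕ.* a
  lem a h = subst (suc a ℕ.≤_) (cong (a ℕ.+_) (sym (ℕ.+-identityʳ a))) (ℕ.+-monoˡ-≤ a h)

 prime∣^ : ∀ {p} → Prime p → ∀ q k → p ∣ q ^ k → p ∣ q
 prime∣^ pp q zero h = ⊥-elim (prime≢1 pp (∣1⇒≡1 h))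
 prime∣^ pp q (suc k) h with euclidsLemma q (q ^ k) pp h
 ... | inj₁ d = d
 ... | inj₂ d = prime∣^ pp q k d

 prime∣prime : ∀ {p q} → Prime p → Prime q → p ∣ q → p ≡ q
 prime∣prime pp qp d with prime⇒irreducible qp d
 ... | inj₁ e = ⊥-elim (prime≢1 pp e)
 ... | inj₂ e = e

 ^∣prime* : ∀ {p q} → Prime p → Prime q → p ≢ q → ∀ k n → p ^ k ∣ q ℕ.* n → p ^ k ∣ n
 ^∣prime* {p} {q} pp qp p≢q k n = coprime-divisor coprime
  where
  coprime : Coprime (p ^ k) q
  coprime (d∣ , d∣q) with prime⇒irreducible qp d∣q
  ... | inj₁ e = e
  ... | inj₂ refl = ⊥-elim (p≢q (sym (prime∣prime qp pp (prime∣^ qp p k d∣))))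

 one : ℕ → ℚ
 one _ = 1ℚ

 module Functions (X′ : ℕ) where

  X : ℕ
  X = suc X′

  open Steps X using (L; L-*; L-step-lower; L-step-upper)
  open Convolution X public

  -- The scale turns the upper step estimate into ℓ (n + 1) - ℓ n ≤ 1 / n.
  s : ℚ
  s = inv (12 ℕ.* (X ℕ.* X))

  opaque
   ℓ : ℕ → ℚ
   ℓ n = ι (L n) * s

   ℓ-1 : ℓ 1 ≡ 0ℚ
   ℓ-1 = *-zeroˡ s

   0≤ℓ : ∀ n → 0ℚ ≤ ℓ n
   0≤ℓ n = 0≤ι (L n) ⊗ 0≤inv (12 ℕ.* (X ℕ.* X))

   ℓ-* : ∀ m n → ℓ (suc m ℕ.* suc n) ≡ ℓ (suc m) + ℓ (suc n)
   ℓ-* m n = trans (cong (λ k → ι k * s) (L-* (suc m) (suc n) (s≤s z≤n) (s≤s z≤n)))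
    (trans (cong (_* s) (ι-+ (L (suc m)) (L (suc n)))) (*-distribʳ-+ s (ι (L (suc m))) (ι (L (suc n)))))

   private
    scaled : ∀ {a b} → a ℕ.≤ b → ι a * s ≤ ι b * s
    scaled h = *-monoʳ s (0≤inv (12 ℕ.* (X ℕ.* X))) (ι-mono h)

    scale-1 : ι (12 ℕ.* (X ℕ.* X)) * s ≡ 1ℚ
    scale-1 = ι*inv′ (12 ℕ.* (X ℕ.* X)) (s≤s z≤n)

   ℓ-step-upper : ∀ n → suc (suc n) ℕ.≤ X → ℓ (suc (suc n)) - ℓ (suc n) ≤ inv (suc n)
   ℓ-step-upper n h = subst (ℓ (suc (suc n)) - ℓ (suc n) ≤_) (*-identityʳ (inv (suc n)))
    (≤inv* n (close (diff (scaled (L-step-upper (suc n) h))) (trans (cong₂ _-_ rhs lhs) (lem (ι (suc n)) (ℓ (suc n)) (ℓ (suc (suc n)))))))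
    where
    lem : ∀ a b c → (a * b + 1ℚ) - a * c ≡ 1ℚ - a * (c - b)
    lem = solve-∀ ℚ-ring
    assoc : ∀ m → ι (suc n ℕ.* L m) * s ≡ ι (suc n) * ℓ m
    assoc m = trans (cong (_* s) (ι-* (suc n) (L m))) (*-assoc (ι (suc n)) (ι (L m)) s)
    lhs : ι (suc n ℕ.* L (suc (suc n))) * s ≡ ι (suc n) * ℓ (suc (suc n))
    lhs = assoc (suc (suc n))
    rhs : ι (suc n ℕ.* L (suc n) ℕ.+ 12 ℕ.* (X ℕ.* X)) * s ≡ ι (suc n) * ℓ (suc n) + 1ℚ
    rhs = trans (cong (_* s) (ι-+ (suc n ℕ.* L (suc n)) (12 ℕ.* (X ℕ.* X))))
     (trans (*-distribʳ-+ s (ι (suc n ℕ.* L (suc n))) (ι (12 ℕ.* (X ℕ.* X)))) (cong₂ _+_ (assoc (suc n)) scale-1))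

   ℓ-step-lower : ∀ n → suc (suc n) ℕ.≤ X → inv (suc n) ≤ ι 6 * (ℓ (suc (suc n)) - ℓ (suc n))
   ℓ-step-lower n h = subst (_≤ ι 6 * (ℓ (suc (suc n)) - ℓ (suc n))) (*-identityʳ (inv (suc n)))
    (inv*≤ n (close (diff (*-monoˡ (ι 6) (0≤ι 6) (scaled (L-step-lower (suc n) h))))
     (trans (cong₂ (λ x y → ι 6 * x - ι 6 * y) (assoc (suc (suc n))) rhs)
      (trans (lem (ι 6) (ι (suc n)) (ℓ (suc n)) (ℓ (suc (suc n))) (ι (2 ℕ.* (X ℕ.* X)) * s)) (cong (λ y → ι (suc n) * (ι 6 * (ℓ (suc (suc n)) - ℓ (suc n))) - y) six)))))
    where
    lem : ∀ z a b c d → z * (a * c) - z * (a * b + d) ≡ a * (z * (c - b)) - z * d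
    lem = solve-∀ ℚ-ring
    assoc : ∀ m → ι (suc n ℕ.* L m) * s ≡ ι (suc n) * ℓ m
    assoc m = trans (cong (_* s) (ι-* (suc n) (L m))) (*-assoc (ι (suc n)) (ι (L m)) s)
    rhs : ι (suc n ℕ.* L (suc n) ℕ.+ 2 ℕ.* (X ℕ.* X)) * s ≡ ι (suc n) * ℓ (suc n) + ι (2 ℕ.* (X ℕ.* X)) * s
    rhs = trans (cong (_* s) (ι-+ (suc n ℕ.* L (suc n)) (2 ℕ.* (X ℕ.* X))))
     (trans (*-distribʳ-+ s (ι (suc n ℕ.* L (suc n))) (ι (2 ℕ.* (X ℕ.* X)))) (cong (_+ ι (2 ℕ.* (X ℕ.* X)) * s) (assoc (suc n))))
    six : ι 6 * (ι (2 ℕ.* (X ℕ.* X)) * s) ≡ 1ℚ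
    six = trans (sym (*-assoc (ι 6) (ι (2 ℕ.* (X ℕ.* X))) s))
     (trans (cong (_* s) (trans (sym (ι-* 6 (2 ℕ.* (X ℕ.* X)))) (cong ι (sym (ℕ.*-assoc 6 2 (X ℕ.* X)))))) scale-1)

  ℓ-step-mono : ∀ n → suc (suc n) ℕ.≤ X → ℓ (suc n) ≤ ℓ (suc (suc n))
  ℓ-step-mono n h = close {e = inv 6 * (inv (suc n) + (ι 6 * (ℓ (suc (suc n)) - ℓ (suc n)) - inv (suc n)))}
   (0≤inv 6 ⊗ (0≤inv (suc n) ⊕ diff (ℓ-step-lower n h)))
   (trans (lem (inv 6) (ι 6) (ℓ (suc (suc n))) (ℓ (suc n)) (inv (suc n))) (trans (cong (_* (ℓ (suc (suc n)) - ℓ (suc n))) (ι*inv 5)) (*-identityˡ (ℓ (suc (suc n)) - ℓ (suc n)))))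
   where
   lem : ∀ a b c d e → a * (e + (b * (c - d) - e)) ≡ b * a * (c - d)
   lem = solve-∀ ℚ-ring

  ℓ-mono : ∀ m n → suc m ℕ.≤ suc n → suc n ℕ.≤ X → ℓ (suc m) ≤ ℓ (suc n)
  ℓ-mono m zero (s≤s z≤n) h = ≤-refl
  ℓ-mono m (suc n) b h with m ℕ.≟ suc n
  ... | yes refl = ≤-refl
  ... | no ¬e = ≤-trans (ℓ-mono m n (s≤s (ℕ.≤-pred (ℕ.≤∧≢⇒< (ℕ.≤-pred b) ¬e))) (ℕ.≤-trans (ℕ.n≤1+n _) h)) (ℓ-step-mono n h)

  ℓ≤ι : ∀ n → suc n ℕ.≤ X → ℓ (suc n) ≤ ι n
  ℓ≤ι zero h = ≤-reflexive ℓ-1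
  ℓ≤ι (suc n) h = close (diff (ℓ≤ι n (ℕ.≤-trans (ℕ.n≤1+n _) h)) ⊕ diff (ℓ-step-upper n h) ⊕ diff (inv≤1 (suc n)))
   (lem (ι n) (ℓ (suc n)) (ℓ (suc (suc n))) (inv (suc n)))
   where
   lem : ∀ a b c d → a - b + (d - (c - b)) + (1ℚ - d) ≡ a + 1ℚ - c
   lem = solve-∀ ℚ-ring

  -- At a prime power n = p^k with k ≥ 1 exactly one term of the double sum survives, at other n
  -- none. Written this way, exchanging sums needs no case distinction on n.
  Λ : ℕ → ℚ
  Λ n = ∑ X (λ p → ∑ X (λ k → 𝟙 (prime? p) * (𝟙 (p ^ k ℕ.≟ n) * ℓ p)))

  0≤Λ : ∀ n → 0ℚ ≤ Λ n
  0≤Λ n = ∑-nonneg X (λ p _ → ∑-nonneg X (λ k _ → 0≤𝟙 (prime? (suc p)) ⊗ (0≤𝟙 (suc p ^ suc k ℕ.≟ n) ⊗ 0≤ℓ (suc p))))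

  Λ-weighted : ∀ x (w : ℕ → ℚ) → x ℕ.≤ X →
   ∑ x (λ n → Λ n * w n) ≡ ∑ X (λ p → ∑ X (λ k → 𝟙 (prime? p) * (𝟙 (p ^ k ℕ.≤? x) * (ℓ p * w (p ^ k)))))
  Λ-weighted x w x≤X = begin
   ∑ x (λ n → Λ n * w n)
    ≡⟨ ∑-ext x (λ n → sym (trans (∑-ext X (λ p → ∑-*ʳ X (w n) (λ k → 𝟙 (prime? p) * (𝟙 (p ^ k ℕ.≟ n) * ℓ p)))) (∑-*ʳ X (w n) (λ p → ∑ X (λ k → 𝟙 (prime? p) * (𝟙 (p ^ k ℕ.≟ n) * ℓ p)))))) ⟩
   ∑ x (λ n → ∑ X (λ p → ∑ X (λ k → 𝟙 (prime? p) * (𝟙 (p ^ k ℕ.≟ n) * ℓ p) * w n)))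
    ≡⟨ trans (∑-swap x X _) (∑-ext X (λ p → ∑-swap x X _)) ⟩
   ∑ X (λ p → ∑ X (λ k → ∑ x (λ n → 𝟙 (prime? p) * (𝟙 (p ^ k ℕ.≟ n) * ℓ p) * w n)))
    ≡⟨ ∑-cong X (λ p _ → ∑-cong X (λ k _ → trans (∑-ext x (λ n → lem (𝟙 (prime? (suc p))) (𝟙 (suc p ^ suc k ℕ.≟ n)) (ℓ (suc p)) (w n)))
      (trans (∑-*ˡ x (𝟙 (prime? (suc p))) (λ n → 𝟙 (suc p ^ suc k ℕ.≟ n) * (ℓ (suc p) * w n))) (cong (𝟙 (prime? (suc p)) *_) (pick p (suc k)))))) ⟩
   ∑ X (λ p → ∑ X (λ k → 𝟙 (prime? p) * (𝟙 (p ^ k ℕ.≤? x) * (ℓ p * w (p ^ k))))) ∎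
   where
   open ≡-Reasoning
   lem : ∀ a b c d → a * (b * c) * d ≡ a * (b * (c * d))
   lem = solve-∀ ℚ-ring
   pick : ∀ p k → ∑ x (λ n → 𝟙 (suc p ^ k ℕ.≟ n) * (ℓ (suc p) * w n)) ≡ 𝟙 (suc p ^ k ℕ.≤? x) * (ℓ (suc p) * w (suc p ^ k))
   pick p k with suc p ^ k | ℕ.m^n>0 (suc p) k
   ... | suc c | _ = ∑-eq-trunc x c (λ n → ℓ (suc p) * w n)

  private
   multiples : ∀ n c → suc n ℕ.≤ X → ∑ X (λ m → 𝟙 (suc c ℕ.* m ℕ.≟ suc n) * 1ℚ) ≡ 𝟙 (suc c ∣? suc n)
   multiples n c n≤X with suc c ∣? suc n
   ... | no ¬d = ∑-zero X (λ m _ → trans (*-identityʳ (𝟙 (suc c ℕ.* suc m ℕ.≟ suc n))) (𝟙-no (suc c ℕ.* suc m ℕ.≟ suc n) (λ e → ¬d (divides (suc m) (trans (sym e) (ℕ.*-comm (suc c) (suc m)))))))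
   ... | yes (divides (suc q) e) = trans
    (∑-ext X (λ m → cong (_* 1ℚ) (𝟙-cong (suc c ℕ.* m ℕ.≟ suc n) (m ℕ.≟ suc q)
     (λ h → ℕ.*-cancelˡ-≡ m (suc q) (suc c) (trans h (trans e (ℕ.*-comm (suc q) (suc c)))))
     (λ { refl → trans (ℕ.*-comm (suc c) (suc q)) (sym e) }))))
    (∑-single X q (λ _ → 1ℚ) (ℕ.≤-trans (ℕ.≤-trans (ℕ.m≤m*n (suc q) (suc c)) (ℕ.≤-reflexive (sym e))) n≤X))

   -- The p-adic valuation of n, as the number of exponents k ≥ 1 with p^k dividing n.
   powers : ℕ → ℕ → ℚ
   powers p n = ∑ X (λ k → 𝟙 (p ^ k ∣? n))

   D : ℕ → ℚ
   D n = ∑ X (λ p → 𝟙 (prime? p) * (powers p n * ℓ p))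

   Λ⋆one-D : ∀ n → suc n ℕ.≤ X → (Λ ⋆ one) (suc n) ≡ D (suc n)
   Λ⋆one-D n n≤X = begin
    ∑ X (λ d → ∑ X (λ m → 𝟙 (d ℕ.* m ℕ.≟ suc n) * (Λ d * 1ℚ)))
     ≡⟨ ∑-ext X (λ d → trans (∑-ext X (λ m → lem (𝟙 (d ℕ.* m ℕ.≟ suc n)) (Λ d))) (∑-*ˡ X (Λ d) (λ m → 𝟙 (d ℕ.* m ℕ.≟ suc n) * 1ℚ))) ⟩
    ∑ X (λ d → Λ d * τ d)
     ≡⟨ Λ-weighted X τ ℕ.≤-refl ⟩
    ∑ X (λ p → ∑ X (λ k → 𝟙 (prime? p) * (𝟙 (p ^ k ℕ.≤? X) * (ℓ p * τ (p ^ k)))))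
     ≡⟨ ∑-cong X (λ p _ → trans (∑-cong X (λ k _ → inner p k)) (trans (∑-*ˡ X (𝟙 (prime? (suc p))) (λ k → 𝟙 (suc p ^ k ∣? suc n) * ℓ (suc p))) (cong (𝟙 (prime? (suc p)) *_) (∑-*ʳ X (ℓ (suc p)) (λ k → 𝟙 (suc p ^ k ∣? suc n)))))) ⟩
    D (suc n) ∎
    where
    open ≡-Reasoning
    τ : ℕ → ℚ
    τ d = ∑ X (λ m → 𝟙 (d ℕ.* m ℕ.≟ suc n) * 1ℚ)
    lem : ∀ a b → a * (b * 1ℚ) ≡ b * (a * 1ℚ)
    lem = solve-∀ ℚ-ring
    drop : ∀ c x → 𝟙 (suc c ℕ.≤? X) * (x * τ (suc c)) ≡ 𝟙 (suc c ∣? suc n) * x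
    drop c x with suc c ℕ.≤? X
    ... | yes _ = trans (*-identityˡ (x * τ (suc c))) (trans (cong (x *_) (multiples n c n≤X)) (*-comm x (𝟙 (suc c ∣? suc n))))
    ... | no ¬p = trans (*-zeroˡ (x * τ (suc c))) (sym (trans (cong (_* x) (𝟙-no (suc c ∣? suc n) (λ d → ¬p (ℕ.≤-trans (∣⇒≤ d) n≤X)))) (*-zeroˡ x)))
    inner : ∀ p k → 𝟙 (prime? (suc p)) * (𝟙 (suc p ^ suc k ℕ.≤? X) * (ℓ (suc p) * τ (suc p ^ suc k))) ≡ 𝟙 (prime? (suc p)) * (𝟙 (suc p ^ suc k ∣? suc n) * ℓ (suc p))
    inner p k with suc p ^ suc k | ℕ.m^n>0 (suc p) (suc k)
    ... | suc c | _ = cong (𝟙 (prime? (suc p)) *_) (drop c (ℓ (suc p)))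

   powers-other : ∀ {p q} n → Prime p → Prime q → p ≢ q → powers p (q ℕ.* n) ≡ powers p n
   powers-other {p} {q} n pp qp p≢q = ∑-ext X (λ k → 𝟙-cong (p ^ k ∣? (q ℕ.* n)) (p ^ k ∣? n) (^∣prime* pp qp p≢q k n) (∣n⇒∣m*n q))

   powers-self : ∀ {p} n → Prime p → suc n ℕ.≤ X → powers p (p ℕ.* suc n) ≡ powers p (suc n) + 1ℚ
   powers-self {p} n pp n≤X = begin
    ∑ X (λ k → 𝟙 (p ^ k ∣? (p ℕ.* suc n)))
     ≡⟨ ∑-cong X (λ k _ → 𝟙-cong (p ^ suc k ∣? (p ℕ.* suc n)) (p ^ k ∣? suc n) (*-cancelˡ-∣ p {{prime⇒nonZero pp}}) (*-monoʳ-∣ p)) ⟩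
    ∑ X (λ k → 𝟙 (p ^ (k ℕ.∸ 1) ∣? suc n))
     ≡⟨ ∑-split 1 X′ (λ k → 𝟙 (p ^ (k ℕ.∸ 1) ∣? suc n)) ⟩
    0ℚ + 𝟙 (1 ∣? suc n) + ∑ X′ (λ k → 𝟙 (p ^ k ∣? suc n))
     ≡⟨ cong₂ _+_ (trans (+-identityˡ (𝟙 (1 ∣? suc n))) (𝟙-yes (1 ∣? suc n) (divides (suc n) (sym (ℕ.*-identityʳ (suc n)))))) last ⟩
    1ℚ + powers p (suc n)
     ≡⟨ +-comm 1ℚ (powers p (suc n)) ⟩
    powers p (suc n) + 1ℚ ∎
    where
    open ≡-Reasoning
    last : ∑ X′ (λ k → 𝟙 (p ^ k ∣? suc n)) ≡ powers p (suc n)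
    last = sym (trans (cong (∑ X′ (λ k → 𝟙 (p ^ k ∣? suc n)) +_) (𝟙-no (p ^ X ∣? suc n) (λ d → ℕ.<⇒≱ (n<p^n pp X) (ℕ.≤-trans (∣⇒≤ d) n≤X)))) (+-identityʳ _))

   D-* : ∀ p n → Prime p → 1 ℕ.≤ n → p ℕ.* n ℕ.≤ X → D (p ℕ.* n) ≡ ℓ p + D n
   D-* p@(suc p′) n@(suc n′) pp _ pn≤X = begin
    ∑ X (λ q → 𝟙 (prime? q) * (powers q (p ℕ.* n) * ℓ q))
     ≡⟨ ∑-ext X (λ q → trans (𝟙-guard (prime? q) (λ qp → trans (cong (_* ℓ q) (step q qp)) (lem (𝟙 (q ℕ.≟ p)) (powers q n) (ℓ q)))) (lem′ (𝟙 (prime? q)) (𝟙 (q ℕ.≟ p)) (powers q n) (ℓ q))) ⟩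
    ∑ X (λ q → 𝟙 (q ℕ.≟ p) * (𝟙 (prime? q) * ℓ q) + 𝟙 (prime? q) * (powers q n * ℓ q))
     ≡⟨ ∑-+ X (λ q → 𝟙 (q ℕ.≟ p) * (𝟙 (prime? q) * ℓ q)) (λ q → 𝟙 (prime? q) * (powers q n * ℓ q)) ⟩
    ∑ X (λ q → 𝟙 (q ℕ.≟ p) * (𝟙 (prime? q) * ℓ q)) + D n
     ≡⟨ cong (_+ D n) (trans (∑-single X p′ (λ q → 𝟙 (prime? q) * ℓ q) (ℕ.≤-trans (ℕ.m≤m*n p n) pn≤X)) (trans (cong (_* ℓ p) (𝟙-yes (prime? p) pp)) (*-identityˡ (ℓ p)))) ⟩
    ℓ p + D n ∎
    where
    open ≡-Reasoning
    lem : ∀ a b c → (a + b) * c ≡ a * c + b * c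
    lem = solve-∀ ℚ-ring
    lem′ : ∀ a b c d → a * (b * d + c * d) ≡ b * (a * d) + a * (c * d)
    lem′ = solve-∀ ℚ-ring
    step : ∀ q → Prime q → powers q (p ℕ.* n) ≡ 𝟙 (q ℕ.≟ p) + powers q n
    step q qp with q ℕ.≟ p
    ... | yes refl = trans (powers-self n′ pp (ℕ.≤-trans (ℕ.m≤n*m n p) pn≤X)) (+-comm (powers p n) 1ℚ)
    ... | no q≢p = trans (powers-other n qp pp q≢p) (sym (+-identityˡ (powers q n)))

   D-1 : D 1 ≡ 0ℚ
   D-1 = ∑-zero X (λ q _ → trans (𝟙-guard (prime? (suc q)) (λ qp → trans (cong (_* ℓ (suc q)) (none (suc q) qp)) (*-zeroˡ (ℓ (suc q))))) (*-zeroʳ (𝟙 (prime? (suc q)))))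
    where
    none : ∀ q → Prime q → powers q 1 ≡ 0ℚ
    none q qp = ∑-zero X (λ k _ → 𝟙-no (q ^ suc k ∣? 1) (λ d → prime≢1 qp (∣1⇒≡1 (∣-trans (m∣m*n (q ^ k)) d))))

  -- The left-hand side is the sum of v_p(n) ℓ(p) over the primes p. Multiplying n by a prime adds
  -- the `ℓ` of that prime to it, so induction over prime factors identifies it with `ℓ`.
  Λ⋆one : ∀ n → suc n ℕ.≤ X → (Λ ⋆ one) (suc n) ≡ ℓ (suc n)
  Λ⋆one n n≤X = trans (Λ⋆one-D n n≤X) (prime-induction (λ m → m ℕ.≤ X → D m ≡ ℓ m) (λ _ → trans D-1 (sym ℓ-1)) step (suc n) (s≤s z≤n) n≤X)
   where
   step : ∀ p m → Prime p → 1 ℕ.≤ m → (m ℕ.≤ X → D m ≡ ℓ m) → p ℕ.* m ℕ.≤ X → D (p ℕ.* m) ≡ ℓ (p ℕ.* m)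
   step p@(suc p′) m@(suc m′) pp 1≤m ih h = trans (D-* p m pp 1≤m h) (trans (cong (ℓ p +_) (ih (ℕ.≤-trans (ℕ.m≤n*m m p) h))) (sym (ℓ-* p′ m′)))
   step zero m pp = ⊥-elim (ℕ.n≮0 (prime≥2 pp))

  -- The square of p^k is p^(2k), which carries the same weight ℓ p. This serves the lower bound for
  -- 1 ⋆ χ at squares, where a quadratic character takes the value 1.
  Λ-square : ∀ n → suc n ℕ.* suc n ℕ.≤ X → Λ (suc n) ≤ Λ (suc n ℕ.* suc n)
  Λ-square n h = ∑-mono X (λ p _ → go (suc p))
   where
   go : ∀ p → ∑ X (λ k → 𝟙 (prime? p) * (𝟙 (p ^ k ℕ.≟ suc n) * ℓ p)) ≤ ∑ X (λ k → 𝟙 (prime? p) * (𝟙 (p ^ k ℕ.≟ suc n ℕ.* suc n) * ℓ p))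
   go p = subst₂ _≤_ (sym (∑-*ˡ X (𝟙 (prime? p)) (λ k → 𝟙 (p ^ k ℕ.≟ suc n) * ℓ p))) (sym (∑-*ˡ X (𝟙 (prime? p)) (λ k → 𝟙 (p ^ k ℕ.≟ suc n ℕ.* suc n) * ℓ p)))
    (𝟙-guard-≤ (prime? p) (λ pp → subst₂ _≤_ (sym (∑-*ʳ X (ℓ p) (λ k → 𝟙 (p ^ k ℕ.≟ suc n)))) (sym (∑-*ʳ X (ℓ p) (λ k → 𝟙 (p ^ k ℕ.≟ suc n ℕ.* suc n))))
     (*-monoʳ (ℓ p) (0≤ℓ p) (count pp))))
    where
    module _ (pp : Prime p) where
     sq : ∀ k → p ^ k ≡ suc n → p ^ (k ℕ.+ k) ≡ suc n ℕ.* suc n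
     sq k e = trans (ℕ.^-distribˡ-+-* p k k) (cong₂ ℕ._*_ e e)
     inj : ∀ i j → p ^ i ≡ p ^ j → i ≡ j
     inj i j e with ℕ.<-cmp i j
     ... | tri< lt _ _ = ⊥-elim (ℕ.<-irrefl e (ℕ.^-monoʳ-< p (prime≥2 pp) lt))
     ... | tri≈ _ e′ _ = e′
     ... | tri> _ _ gt = ⊥-elim (ℕ.<-irrefl (sym e) (ℕ.^-monoʳ-< p (prime≥2 pp) gt))
     F : ℕ → ℚ
     F k = 𝟙 (p ^ k ℕ.≟ suc n ℕ.* suc n)
     0≤∑F : 0ℚ ≤ ∑ X F
     0≤∑F = ∑-nonneg X (λ k _ → 0≤𝟙 (p ^ suc k ℕ.≟ suc n ℕ.* suc n))
     count : ∑ X (λ k → 𝟙 (p ^ k ℕ.≟ suc n)) ≤ ∑ X F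
     count with ℕ.anyUpTo? (λ k → p ^ k ℕ.≟ suc n) (suc X)
     ... | no ¬∃ = subst (_≤ ∑ X F) (sym (∑-zero X (λ k b → 𝟙-no (p ^ suc k ℕ.≟ suc n) (λ e → ¬∃ (suc k , s≤s b , e))))) 0≤∑F
     ... | yes (zero , _ , e) = subst (_≤ ∑ X F) (sym (∑-zero X (λ k b → 𝟙-no (p ^ suc k ℕ.≟ suc n) (λ e′ → ⊥-elim (ℕ.0≢1+n (inj 0 (suc k) (trans e (sym e′)))))))) 0≤∑F
     ... | yes (suc c , s≤s b , e) = subst (_≤ ∑ X F) (sym one-term)
        (subst (_≤ ∑ X F) (𝟙-yes (p ^ (suc c ℕ.+ suc c) ℕ.≟ suc n ℕ.* suc n) (sq (suc c) e))
         (term≤∑ X (c ℕ.+ suc c) F (ℕ.≤-trans (ℕ.<⇒≤ (n<p^n pp (suc c ℕ.+ suc c))) (subst (ℕ._≤ X) (sym (sq (suc c) e)) h)) (λ k _ → 0≤𝟙 (p ^ suc k ℕ.≟ suc n ℕ.* suc n))))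
      where
      one-term : ∑ X (λ k → 𝟙 (p ^ k ℕ.≟ suc n)) ≡ 1ℚ
      one-term = trans (∑-ext X (λ k → trans (𝟙-cong (p ^ k ℕ.≟ suc n) (k ℕ.≟ suc c) (λ e′ → inj k (suc c) (trans e′ (sym e))) (λ { refl → e })) (sym (*-identityʳ (𝟙 (k ℕ.≟ suc c))))))
       (∑-single X c (λ _ → 1ℚ) b)

-- The Möbius function as a product of local factors.

module Mobius where

 open Base
 open Conv
 open NatLog using (prime≥2; prime-induction)
 open Mangoldt using (prime≢1; prime∣prime; ^∣prime*; one)
 open import Data.Nat using (_^_)
 open import Data.Nat.Divisibility using (_∣_; _∣?_; divides; ∣-trans; ∣⇒≤; *-monoʳ-∣; *-cancelˡ-∣; ∣n⇒∣m*n; m∣m*n; n∣m*n; ∣-refl)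
 open import Data.Nat.Coprimality using (Coprime; coprime-divisor)
 open import Data.Nat.Primality using (Prime; prime?; prime⇒irreducible; euclidsLemma)
 open import Data.Rational using (ℚ; 0ℚ; 1ℚ; _+_; _*_; _-_; -_; _≤_; ∣_∣)
 open import Data.Rational.Properties
 open import Tactic.RingSolver using (solve-∀)

 ∏ : ℕ → (ℕ → ℚ) → ℚ
 ∏ zero f = 1ℚ
 ∏ (suc n) f = ∏ n f * f (suc n)

 ∏-cong : ∀ n {f g : ℕ → ℚ} → (∀ i → i ℕ.≤ n → f i ≡ g i) → ∏ n f ≡ ∏ n g
 ∏-cong zero h = refl
 ∏-cong (suc n) h = cong₂ _*_ (∏-cong n (λ i b → h i (ℕ.m≤n⇒m≤1+n b))) (h (suc n) ℕ.≤-refl)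

 ∏-update : ∀ n c {f g : ℕ → ℚ} → suc c ℕ.≤ n → f (suc c) ≡ 1ℚ → (∀ i → i ≢ suc c → g i ≡ f i) → ∏ n g ≡ g (suc c) * ∏ n f
 ∏-update (suc n) c {f} {g} h f1 same with c ℕ.≟ n
 ... | yes refl = trans (cong (_* g (suc n)) (∏-cong n (λ i b → same i (λ { refl → ℕ.<-irrefl refl b }))))
          (trans (*-comm (∏ n f) (g (suc n))) (cong (g (suc n) *_) (sym (trans (cong (∏ n f *_) f1) (*-identityʳ (∏ n f))))))
 ... | no c≢n = trans (cong₂ _*_ (∏-update n c (ℕ.≤∧≢⇒< (ℕ.≤-pred h) c≢n) f1 same) (same (suc n) (λ e → c≢n (sym (ℕ.suc-injective e)))))
         (*-assoc (g (suc c)) (∏ n f) (f (suc n)))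

 ∏-zero : ∀ n c {g : ℕ → ℚ} → suc c ℕ.≤ n → g (suc c) ≡ 0ℚ → ∏ n g ≡ 0ℚ
 ∏-zero (suc n) c {g} h z with c ℕ.≟ n
 ... | yes refl = trans (cong (∏ n g *_) z) (*-zeroʳ (∏ n g))
 ... | no c≢n = trans (cong (_* g (suc n)) (∏-zero n c (ℕ.≤∧≢⇒< (ℕ.≤-pred h) c≢n) z)) (*-zeroˡ (g (suc n)))

 ∏-∣∣≤1 : ∀ n {f : ℕ → ℚ} → (∀ i → ∣ f i ∣ ≤ 1ℚ) → ∣ ∏ n f ∣ ≤ 1ℚ
 ∏-∣∣≤1 zero h = ≤-refl
 ∏-∣∣≤1 (suc n) h = ∣∣-mul (∏-∣∣≤1 n h) (h (suc n))

 prime-factor : ∀ n → 2 ℕ.≤ n → ∃ λ p → Prime p × p ∣ n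
 prime-factor n h = prime-induction (λ m → 2 ℕ.≤ m → ∃ λ p → Prime p × p ∣ m) (λ { (s≤s ()) }) (λ p m pp _ _ _ → p , pp , m∣m*n m) n (ℕ.≤-trans (s≤s z≤n) h) h

 ∑-multiples : ∀ X n c → suc n ℕ.≤ X → ∑ X (λ m → 𝟙 (suc c ℕ.* m ℕ.≟ suc n)) ≡ 𝟙 (suc c ∣? suc n)
 ∑-multiples X n c n≤X with suc c ∣? suc n
 ... | no ¬d = ∑-zero X (λ m _ → 𝟙-no (suc c ℕ.* suc m ℕ.≟ suc n) (λ e → ¬d (divides (suc m) (trans (sym e) (ℕ.*-comm (suc c) (suc m))))))
 ... | yes (divides (suc q) e) = trans
  (∑-ext X (λ m → trans (𝟙-cong (suc c ℕ.* m ℕ.≟ suc n) (m ℕ.≟ suc q)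
   (λ h → ℕ.*-cancelˡ-≡ m (suc q) (suc c) (trans h (trans e (ℕ.*-comm (suc q) (suc c)))))
   (λ { refl → trans (ℕ.*-comm (suc c) (suc q)) (sym e) })) (sym (*-identityʳ (𝟙 (m ℕ.≟ suc q))))))
  (∑-single X q (λ _ → 1ℚ) (ℕ.≤-trans (ℕ.≤-trans (ℕ.m≤m*n (suc q) (suc c)) (ℕ.≤-reflexive (sym e))) n≤X))

 ∑-over-multiples : ∀ X p (φ : ℕ → ℚ) → ∑ X (λ d → 𝟙 (suc p ∣? d) * φ d) ≡ ∑ X (λ e → 𝟙 (suc p ℕ.* e ℕ.≤? X) * φ (suc p ℕ.* e))
 ∑-over-multiples X p φ = begin
  ∑ X (λ d → 𝟙 (suc p ∣? d) * φ d)
   ≡⟨ ∑-cong X (λ d b → trans (cong (_* φ (suc d)) (sym (∑-multiples X d p b))) (sym (∑-*ʳ X (φ (suc d)) (λ e → 𝟙 (suc p ℕ.* e ℕ.≟ suc d))))) ⟩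
  ∑ X (λ d → ∑ X (λ e → 𝟙 (suc p ℕ.* e ℕ.≟ d) * φ d))
   ≡⟨ ∑-swap X X _ ⟩
  ∑ X (λ e → ∑ X (λ d → 𝟙 (suc p ℕ.* e ℕ.≟ d) * φ d))
   ≡⟨ ∑-cong X (λ e _ → ∑-eq-trunc X (e ℕ.+ p ℕ.* suc e) φ) ⟩
  ∑ X (λ e → 𝟙 (suc p ℕ.* e ℕ.≤? X) * φ (suc p ℕ.* e)) ∎
  where open ≡-Reasoning

 module Möbius (X : ℕ) where

  open Convolution X

  -- For prime p this is 1 if p does not divide n, -1 if p divides n exactly once and 0 if p²
  -- divides n; at other p it is 1.
  fac : ℕ → ℕ → ℚ
  fac n p = 1ℚ - 𝟙 (prime? p) * (𝟙 (p ∣? n) * (1ℚ + 1ℚ - 𝟙 (p ^ 2 ∣? n)))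

  μ : ℕ → ℚ
  μ n = ∏ X (fac n)

  ∣μ∣≤1 : ∀ n → ∣ μ n ∣ ≤ 1ℚ
  ∣μ∣≤1 n = ∏-∣∣≤1 X go
   where
   go : ∀ p → ∣ fac n p ∣ ≤ 1ℚ
   go p with prime? p | p ∣? n | p ^ 2 ∣? n
   ... | yes _ | yes _ | yes _ = 0≤1
   ... | yes _ | yes _ | no _ = ≤-refl
   ... | yes _ | no _ | yes _ = ≤-refl
   ... | yes _ | no _ | no _ = ≤-refl
   ... | no _ | yes _ | yes _ = ≤-refl
   ... | no _ | yes _ | no _ = ≤-refl
   ... | no _ | no _ | yes _ = ≤-refl
   ... | no _ | no _ | no _ = ≤-refl

  private
   fac-other : ∀ p e q → Prime p → q ≢ p → fac (p ℕ.* e) q ≡ fac e q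
   fac-other p e q pp q≢p = cong (λ x → 1ℚ - x) (𝟙-guard (prime? q) (λ qp → cong₂ (λ x y → x * (1ℚ + 1ℚ - y))
    (𝟙-cong (q ∣? (p ℕ.* e)) (q ∣? e) (to qp) (∣n⇒∣m*n p))
    (𝟙-cong (q ^ 2 ∣? (p ℕ.* e)) (q ^ 2 ∣? e) (^∣prime* qp pp q≢p 2 e) (∣n⇒∣m*n p))))
    where
    to : Prime q → q ∣ p ℕ.* e → q ∣ e
    to qp d with euclidsLemma p e qp d
    ... | inj₁ h = ⊥-elim (q≢p (prime∣prime qp pp h))
    ... | inj₂ h = h

   μ-* : ∀ p e → Prime p → p ℕ.≤ X → μ (p ℕ.* e) ≡ (𝟙 (p ∣? e) - 1ℚ) * μ e
   μ-* zero e pp _ = ⊥-elim (ℕ.n≮0 (prime≥2 pp))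
   μ-* p@(suc p′) e pp p≤X with p ∣? e in eq
   ... | yes d = trans (∏-zero X p′ p≤X zero-factor) (sym (trans (cong (_* μ e) (+-inverseʳ 1ℚ)) (*-zeroˡ (μ e))))
    where
    zero-factor : fac (p ℕ.* e) p ≡ 0ℚ
    zero-factor rewrite 𝟙-yes (prime? p) pp | 𝟙-yes (p ∣? (p ℕ.* e)) (m∣m*n e)
     | 𝟙-yes (p ^ 2 ∣? (p ℕ.* e)) (subst (_∣ p ℕ.* e) (cong (p ℕ.*_) (sym (ℕ.*-identityʳ p))) (*-monoʳ-∣ p d)) = refl
   ... | no ¬d = trans (∏-update X p′ p≤X one-factor (λ i i≢ → fac-other p e i pp i≢)) (cong (_* μ e) neg-factor)
    where
    one-factor : fac e p ≡ 1ℚ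
    one-factor = trans (cong (λ x → 1ℚ - 𝟙 (prime? p) * (x * (1ℚ + 1ℚ - 𝟙 (p ^ 2 ∣? e)))) (𝟙-no (p ∣? e) ¬d)) (lem (𝟙 (prime? p)) (1ℚ + 1ℚ - 𝟙 (p ^ 2 ∣? e)))
     where
     lem : ∀ a b → 1ℚ - a * (0ℚ * b) ≡ 1ℚ
     lem = solve-∀ ℚ-ring
    neg-factor : fac (p ℕ.* e) p ≡ 0ℚ - 1ℚ
    neg-factor rewrite 𝟙-yes (prime? p) pp | 𝟙-yes (p ∣? (p ℕ.* e)) (m∣m*n e)
     | 𝟙-no (p ^ 2 ∣? (p ℕ.* e)) (λ h → ¬d (*-cancelˡ-∣ p (subst (_∣ p ℕ.* e) (cong (p ℕ.*_) (ℕ.*-identityʳ p)) h))) = refl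

   coprime-prime : ∀ {p e} → Prime p → ¬ p ∣ e → Coprime e p
   coprime-prime pp ¬d (a , b) with prime⇒irreducible pp b
   ... | inj₁ r = r
   ... | inj₂ refl = ⊥-elim (¬d a)

   divisor-sum : ∀ n → suc n ℕ.≤ X → (μ ⋆ one) (suc n) ≡ ∑ X (λ d → 𝟙 (d ∣? suc n) * μ d)
   divisor-sum n n≤X = ∑-cong X (λ d _ → trans (∑-ext X (λ m → lem (𝟙 (suc d ℕ.* m ℕ.≟ suc n)) (μ (suc d))))
    (trans (∑-*ʳ X (μ (suc d)) (λ m → 𝟙 (suc d ℕ.* m ℕ.≟ suc n))) (cong (_* μ (suc d)) (∑-multiples X n d n≤X))))
    where
    lem : ∀ a b → a * (b * 1ℚ) ≡ a * b
    lem = solve-∀ ℚ-ring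

   -- Divisors d prime to p are paired with p d, where μ (p d) = - μ d. The remaining divisors are p
   -- d with p dividing d, where μ vanishes.
   cancel : ∀ n p → Prime p → p ∣ suc n → suc n ℕ.≤ X → ∑ X (λ d → 𝟙 (d ∣? suc n) * μ d) ≡ 0ℚ
   cancel n zero pp _ _ = ⊥-elim (ℕ.n≮0 (prime≥2 pp))
   cancel n p@(suc p′) pp p∣n n≤X = begin
    ∑ X (λ d → 𝟙 (d ∣? suc n) * μ d)
     ≡⟨ ∑-ext X (λ d → lem (𝟙 (p ∣? d)) (𝟙 (d ∣? suc n)) (μ d)) ⟩
    ∑ X (λ d → (1ℚ - 𝟙 (p ∣? d)) * (𝟙 (d ∣? suc n) * μ d) + 𝟙 (p ∣? d) * (𝟙 (d ∣? suc n) * μ d))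
     ≡⟨ ∑-+ X _ _ ⟩
    ∑ X F + ∑ X (λ d → 𝟙 (p ∣? d) * (𝟙 (d ∣? suc n) * μ d))
     ≡⟨ cong (∑ X F +_) (trans (∑-over-multiples X p′ (λ d → 𝟙 (d ∣? suc n) * μ d)) (∑-cong X (λ e _ → step (suc e)))) ⟩
    ∑ X F + ∑ X (λ d → (0ℚ - 1ℚ) * F d)
     ≡⟨ cong (∑ X F +_) (∑-*ˡ X (0ℚ - 1ℚ) F) ⟩
    ∑ X F + (0ℚ - 1ℚ) * ∑ X F
     ≡⟨ lem′ (∑ X F) ⟩
    0ℚ ∎
    where
    open ≡-Reasoning
    F : ℕ → ℚ
    F d = (1ℚ - 𝟙 (p ∣? d)) * (𝟙 (d ∣? suc n) * μ d)
    lem : ∀ a b c → b * c ≡ (1ℚ - a) * (b * c) + a * (b * c)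
    lem = solve-∀ ℚ-ring
    lem′ : ∀ a → a + (0ℚ - 1ℚ) * a ≡ 0ℚ
    lem′ = solve-∀ ℚ-ring
    step : ∀ e → 𝟙 (p ℕ.* e ℕ.≤? X) * (𝟙 (p ℕ.* e ∣? suc n) * μ (p ℕ.* e)) ≡ (0ℚ - 1ℚ) * F e
    step e = begin
     𝟙 (p ℕ.* e ℕ.≤? X) * (𝟙 (p ℕ.* e ∣? suc n) * μ (p ℕ.* e))
      ≡⟨ cong (λ x → 𝟙 (p ℕ.* e ℕ.≤? X) * (𝟙 (p ℕ.* e ∣? suc n) * x)) (μ-* p e pp (ℕ.≤-trans (∣⇒≤ p∣n) n≤X)) ⟩
     𝟙 (p ℕ.* e ℕ.≤? X) * (𝟙 (p ℕ.* e ∣? suc n) * ((𝟙 (p ∣? e) - 1ℚ) * μ e))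
      ≡⟨ inner ⟩
     (0ℚ - 1ℚ) * F e ∎
     where
     lem₃ : ∀ a b c → a * (b * (0ℚ * c)) ≡ 0ℚ
     lem₃ = solve-∀ ℚ-ring
     lem₄ : ∀ b c → (0ℚ - 1ℚ) * (0ℚ * (b * c)) ≡ 0ℚ
     lem₄ = solve-∀ ℚ-ring
     lem₅ : ∀ b c → b * ((0ℚ - 1ℚ) * c) ≡ (0ℚ - 1ℚ) * ((1ℚ - 0ℚ) * (b * c))
     lem₅ = solve-∀ ℚ-ring
     inner : 𝟙 (p ℕ.* e ℕ.≤? X) * (𝟙 (p ℕ.* e ∣? suc n) * ((𝟙 (p ∣? e) - 1ℚ) * μ e)) ≡ (0ℚ - 1ℚ) * F e
     inner with p ∣? e
     ... | yes _ = trans (lem₃ (𝟙 (p ℕ.* e ℕ.≤? X)) (𝟙 (p ℕ.* e ∣? suc n)) (μ e)) (sym (lem₄ (𝟙 (e ∣? suc n)) (μ e)))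
     ... | no ¬d = trans absorb (trans (cong (_* ((0ℚ - 1ℚ) * μ e)) (𝟙-cong (p ℕ.* e ∣? suc n) (e ∣? suc n) (∣-trans (n∣m*n p)) (both p∣n))) (lem₅ (𝟙 (e ∣? suc n)) (μ e)))
      where
      both : p ∣ suc n → e ∣ suc n → p ℕ.* e ∣ suc n
      both (divides k eq) e∣n = subst (p ℕ.* e ∣_) (trans (ℕ.*-comm p k) (sym eq)) (*-monoʳ-∣ p (coprime-divisor (coprime-prime pp ¬d) (subst (e ∣_) (trans eq (ℕ.*-comm k p)) e∣n)))
      absorb : 𝟙 (p ℕ.* e ℕ.≤? X) * (𝟙 (p ℕ.* e ∣? suc n) * ((0ℚ - 1ℚ) * μ e)) ≡ 𝟙 (p ℕ.* e ∣? suc n) * ((0ℚ - 1ℚ) * μ e)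
      absorb = trans (lem₆ (𝟙 (p ℕ.* e ℕ.≤? X)) (𝟙 (p ℕ.* e ∣? suc n)) ((0ℚ - 1ℚ) * μ e))
       (trans (𝟙-guard (p ℕ.* e ∣? suc n) (λ d → trans (cong (_* ((0ℚ - 1ℚ) * μ e)) (𝟙-yes (p ℕ.* e ℕ.≤? X) (ℕ.≤-trans (∣⇒≤ d) n≤X))) (*-identityˡ ((0ℚ - 1ℚ) * μ e)))) refl)
       where
       lem₆ : ∀ a b c → a * (b * c) ≡ b * (a * c)
       lem₆ = solve-∀ ℚ-ring

  μ⋆one : ∀ n → suc n ℕ.≤ X → (μ ⋆ one) (suc n) ≡ ε (suc n)
  μ⋆one zero 1≤X = trans (divisor-sum 0 1≤X) (trans
   (∑-ext X (λ d → cong (_* μ d) (𝟙-cong (d ∣? 1) (d ℕ.≟ 1) ∣1⇒≡1 (λ { refl → ∣-refl }))))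
   (trans (∑-single X 0 μ 1≤X) (trans (∏-one X) (sym (𝟙-yes (1 ℕ.≟ 1) refl)))))
   where
   open import Data.Nat.Divisibility using (∣1⇒≡1)
   lem : ∀ b → 1ℚ - (0ℚ * b) ≡ 1ℚ
   lem = solve-∀ ℚ-ring
   fac-1 : ∀ p → fac 1 p ≡ 1ℚ
   fac-1 p = trans (cong (λ x → 1ℚ - x) (trans (𝟙-guard (prime? p) (λ pp → trans (cong (_* (1ℚ + 1ℚ - 𝟙 (p ^ 2 ∣? 1))) (𝟙-no (p ∣? 1) (λ d → prime≢1 pp (∣1⇒≡1 d)))) (*-zeroˡ (1ℚ + 1ℚ - 𝟙 (p ^ 2 ∣? 1))))) (*-zeroʳ (𝟙 (prime? p))))) (lem 1ℚ)
   ∏-one : ∀ n → ∏ n (fac 1) ≡ 1ℚ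
   ∏-one zero = refl
   ∏-one (suc n) = trans (cong₂ _*_ (∏-one n) (fac-1 (suc n))) (*-identityˡ 1ℚ)
  μ⋆one (suc n) n≤X with prime-factor (suc (suc n)) (s≤s (s≤s z≤n))
  ... | p , pp , d = trans (divisor-sum (suc n) n≤X) (trans (cancel (suc n) p pp d n≤X) (sym (𝟙-no (suc (suc n) ℕ.≟ 1) (λ ()))))

-- Abel summation and arithmetic modulo N.

module Periodic where

 open Base
 open import Data.Nat using (_%_)
 open import Data.Nat.Divisibility using (_∣_; ∣-trans; m∣m*n; n∣m*n; ∣m∣n⇒∣m+n; ∣n⇒∣m*n; %-presˡ-∣)
 open import Data.Nat.Coprimality using (Coprime; coprime?; coprime-Bézout; coprime-divisor)
 open import Data.Nat.GCD using (module Bézout)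
 open import Data.Rational using (ℚ; 0ℚ; 1ℚ; _+_; _*_; _-_; -_; _≤_; _<_; ∣_∣)
 open import Data.Rational.Properties
 open import Relation.Nullary.Decidable using (map′)
 open import Tactic.RingSolver using (solve-∀)

 -- Abel summation against a potential F that dominates the variation of h.
 abel : ∀ (g h F : ℕ → ℚ) K y → (∀ k → k ℕ.≤ suc y → ∣ ∑ k g ∣ ≤ K) →
  (∀ n → suc (suc n) ℕ.≤ suc y → ∣ h (suc (suc n)) - h (suc n) ∣ ≤ F (suc n) - F (suc (suc n))) →
  ∣ h (suc y) ∣ ≤ F (suc y) → ∣ ∑ (suc y) (λ n → g n * h n) ∣ ≤ K * F 1
 abel g h F K y partial var end = begin
  ∣ ∑ (suc y) (λ n → g n * h n) ∣ ≡⟨ cong ∣_∣ (parts y) ⟩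
  ∣ ∑ (suc y) g * h (suc y) - ∑ y (λ n → ∑ n g * (h (suc n) - h n)) ∣ ≤⟨ ∣p-q∣≤∣p∣+∣q∣ (∑ (suc y) g * h (suc y)) (∑ y (λ n → ∑ n g * (h (suc n) - h n))) ⟩
  ∣ ∑ (suc y) g * h (suc y) ∣ + ∣ ∑ y (λ n → ∑ n g * (h (suc n) - h n)) ∣ ≤⟨ +-mono-≤ (∣∣-mul (partial (suc y) ℕ.≤-refl) end)
                                            (∑-abs-≤ y (λ n b → ∣∣-mul (partial (suc n) (ℕ.m≤n⇒m≤1+n b)) (var n (s≤s b)))) ⟩
  K * F (suc y) + ∑ y (λ n → K * (F n - F (suc n))) ≡⟨ cong (K * F (suc y) +_) (∑-*ˡ y K (λ n → F n - F (suc n))) ⟩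
  K * F (suc y) + K * ∑ y (λ n → F n - F (suc n)) ≡⟨ cong (λ t → K * F (suc y) + K * t) (telescope y) ⟩
  K * F (suc y) + K * (F 1 - F (suc y)) ≡⟨ lem K (F 1) (F (suc y)) ⟩
  K * F 1 ∎
  where
  open ≤-Reasoning
  lem : ∀ k a b → k * b + k * (a - b) ≡ k * a
  lem = solve-∀ ℚ-ring
  lem₂ : ∀ a b c → a - b + (b - c) ≡ a - c
  lem₂ = solve-∀ ℚ-ring
  telescope : ∀ y → ∑ y (λ n → F n - F (suc n)) ≡ F 1 - F (suc y)
  telescope zero = sym (+-inverseʳ (F 1))
  telescope (suc y) = trans (cong (_+ (F (suc y) - F (suc (suc y)))) (telescope y)) (lem₂ (F 1) (F (suc y)) (F (suc (suc y))))
  lem₃ : ∀ a b → 0ℚ + a * b ≡ (0ℚ + a) * b - 0ℚ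
  lem₃ = solve-∀ ℚ-ring
  lem₄ : ∀ a b s g h → (a * b - s) + g * h ≡ (a + g) * h - (s + a * (h - b))
  lem₄ = solve-∀ ℚ-ring
  parts : ∀ y → ∑ (suc y) (λ n → g n * h n) ≡ ∑ (suc y) g * h (suc y) - ∑ y (λ n → ∑ n g * (h (suc n) - h n))
  parts zero = lem₃ (g 1) (h 1)
  parts (suc y) = trans (cong (_+ g (suc (suc y)) * h (suc (suc y))) (parts y))
   (lem₄ (∑ (suc y) g) (h (suc y)) (∑ y (λ n → ∑ n g * (h (suc n) - h n))) (g (suc (suc y))) (h (suc (suc y))))

 -- With H the last value of `h`, the potential 2 H - h falls exactly as fast as `h` rises and still
 -- exceeds `h` at the end.
 abel-increasing : ∀ (g h : ℕ → ℚ) K y → (∀ k → k ℕ.≤ suc y → ∣ ∑ k g ∣ ≤ K) → (∀ n → 0ℚ ≤ h n) →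
  (∀ n → suc (suc n) ℕ.≤ suc y → h (suc n) ≤ h (suc (suc n))) →
  ∣ ∑ (suc y) (λ n → g n * h n) ∣ ≤ K * (h (suc y) + h (suc y))
 abel-increasing g h K y partial pos mono = ≤-trans
  (abel g h (λ n → H + H - h n) K y partial
   (λ n b → 0≤⇒∣∣ (diff (mono n b)) (≤-reflexive (lem H (h (suc n)) (h (suc (suc n))))))
   (0≤⇒∣∣ (pos (suc y)) (≤-reflexive (lem′ H))))
  (*-monoˡ K (partial 0 z≤n) (close (pos 1) (lem″ H (h 1))))
  where
  H = h (suc y)
  lem : ∀ H a b → b - a ≡ H + H - a - (H + H - b)
  lem = solve-∀ ℚ-ring
  lem′ : ∀ H → H ≡ H + H - H
  lem′ = solve-∀ ℚ-ring
  lem″ : ∀ H a → a ≡ H + H - (H + H - a)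
  lem″ = solve-∀ ℚ-ring

 abel-decreasing : ∀ (g h : ℕ → ℚ) K y → (∀ k → k ℕ.≤ suc y → ∣ ∑ k g ∣ ≤ K) → (∀ n → 0ℚ ≤ h n) →
  (∀ n → suc (suc n) ℕ.≤ suc y → h (suc (suc n)) ≤ h (suc n)) →
  ∣ ∑ (suc y) (λ n → g n * h n) ∣ ≤ K * h 1
 abel-decreasing g h K y partial pos mono = abel g h h K y partial
  (λ n b → ∣∣≤ (≤-reflexive (lem (h (suc (suc n))) (h (suc n)))) (≤-trans (close (diff (mono n b) ⊕ diff (mono n b)) (lem′ (h (suc (suc n))) (h (suc n)))) ≤-refl))
  (0≤⇒∣∣ (pos (suc y)) ≤-refl)
  where
  lem : ∀ a b → - (b - a) ≡ a - b
  lem = solve-∀ ℚ-ring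
  lem′ : ∀ a b → (b - a) + (b - a) ≡ b - a - (a - b)
  lem′ = solve-∀ ℚ-ring

 module Residues (N′ : ℕ) where

  N : ℕ
  N = suc N′

  infix 4 _≈_ _≈?_

  -- A record rather than the bare equation of remainders, so that a and b can be inferred from the
  -- type; unification cannot invert `_%_`.
  record _≈_ (a b : ℕ) : Set where
   constructor ≈-by
   field remainder : a % N ≡ b % N
  open _≈_ public

  _≈?_ : ∀ a b → Dec (a ≈ b)
  a ≈? b = map′ ≈-by remainder (a % N ℕ.≟ b % N)

  ≈-refl : ∀ {a} → a ≈ a
  ≈-refl = ≈-by refl

  ≈-reflexive : ∀ {a b} → a ≡ b → a ≈ b
  ≈-reflexive refl = ≈-refl

  ≈-sym : ∀ {a b} → a ≈ b → b ≈ a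
  ≈-sym (≈-by h) = ≈-by (sym h)

  ≈-trans : ∀ {a b c} → a ≈ b → b ≈ c → a ≈ c
  ≈-trans (≈-by h) (≈-by k) = ≈-by (trans h k)

  ≈-* : ∀ {a b c d} → a ≈ b → c ≈ d → a ℕ.* c ≈ b ℕ.* d
  ≈-* {a} {b} {c} {d} (≈-by h) (≈-by k) = ≈-by (trans (DM.%-distribˡ-* a c N) (trans (cong₂ (λ x y → (x ℕ.* y) % N) h k) (sym (DM.%-distribˡ-* b d N))))

  ≈-*ˡ : ∀ a {c d} → c ≈ d → a ℕ.* c ≈ a ℕ.* d
  ≈-*ˡ a = ≈-* (≈-refl {a})

  ≈-*ʳ : ∀ a {c d} → c ≈ d → c ℕ.* a ≈ d ℕ.* a
  ≈-*ʳ a h = ≈-* h (≈-refl {a})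

  ≈-kN : ∀ a k → a ℕ.+ k ℕ.* N ≈ a
  ≈-kN a k = ≈-by (DM.[m+kn]%n≡m%n a k N)

  ≈-+N : ∀ a → a ℕ.+ N ≈ a
  ≈-+N a = ≈-by (DM.[m+n]%n≡m%n a N)

  Unit : ℕ → Set
  Unit n = Coprime n N

  unit? : ∀ n → Dec (Unit n)
  unit? n = coprime? n N

  Unit-≈ : ∀ {a b} → a ≈ b → Unit a → Unit b
  Unit-≈ {a} {b} (≈-by h) u {i} (i∣b , i∣N) = u (subst (i ∣_) (sym (DM.m≡m%n+[m/n]*n a N)) (∣m∣n⇒∣m+n i∣r (∣n⇒∣m*n (a ℕ./ N) i∣N)) , i∣N)
   where
   i∣r : i ∣ a % N
   i∣r = subst (i ∣_) (sym h) (%-presˡ-∣ i∣b i∣N)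

  inverse : ∀ d → Unit d → ∃ λ d′ → d ℕ.* d′ ≈ 1
  inverse d u with coprime-Bézout u
  ... | Bézout.+- x y eq = x , ≈-trans (≈-reflexive (trans (ℕ.*-comm d x) (sym eq))) (≈-kN 1 y)
  -- Here x d ≡ -1, so x itself is no inverse, but d (x x d) = (x d)² ≡ 1.
  ... | Bézout.-+ x y eq = x ℕ.* x ℕ.* d , ≈-trans (≈-sym (≈-kN (d ℕ.* (x ℕ.* x ℕ.* d)) y))
   (≈-trans (≈-reflexive (begin
    d ℕ.* (x ℕ.* x ℕ.* d) ℕ.+ y ℕ.* N ≡⟨ cong (d ℕ.* (x ℕ.* x ℕ.* d) ℕ.+_) (sym eq) ⟩
    d ℕ.* (x ℕ.* x ℕ.* d) ℕ.+ suc (x ℕ.* d) ≡⟨ lem d x ⟩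
    1 ℕ.+ x ℕ.* d ℕ.* suc (x ℕ.* d) ≡⟨ cong (λ t → 1 ℕ.+ x ℕ.* d ℕ.* t) eq ⟩
    1 ℕ.+ x ℕ.* d ℕ.* (y ℕ.* N) ≡⟨ cong (1 ℕ.+_) (sym (ℕ.*-assoc (x ℕ.* d) y N)) ⟩
    1 ℕ.+ x ℕ.* d ℕ.* y ℕ.* N ∎))
   (≈-kN 1 (x ℕ.* d ℕ.* y)))
   where
   open ≡-Reasoning
   lem : ∀ d x → d ℕ.* (x ℕ.* x ℕ.* d) ℕ.+ suc (x ℕ.* d) ≡ 1 ℕ.+ x ℕ.* d ℕ.* suc (x ℕ.* d)
   lem = ℕ-solve

  Unit-1 : Unit 1
  Unit-1 (i∣1 , _) = ∣1⇒≡1 i∣1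
   where open import Data.Nat.Divisibility using (∣1⇒≡1)

  Unit-* : ∀ {a b} → Unit a → Unit b → Unit (a ℕ.* b)
  Unit-* {a} {b} ua ub {i} (i∣ab , i∣N) = ub (coprime-divisor {i} {a} {b} (λ { (j∣i , j∣a) → ua (j∣a , ∣-trans j∣i i∣N) }) i∣ab , i∣N)

  Unit-*ˡ : ∀ {a b} → Unit (a ℕ.* b) → Unit a
  Unit-*ˡ {a} {b} u (i∣a , i∣N) = u (∣-trans i∣a (m∣m*n b) , i∣N)

  Unit-*ʳ : ∀ {a b} → Unit (a ℕ.* b) → Unit b
  Unit-*ʳ {a} {b} u (i∣b , i∣N) = u (∣-trans i∣b (n∣m*n a) , i∣N)

  Unit-inv : ∀ {a b} → a ℕ.* b ≈ 1 → Unit a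
  Unit-inv {a} {b} h = Unit-*ˡ {a} {b} (Unit-≈ (≈-sym h) Unit-1)

  divide : ∀ {d d′} → d ℕ.* d′ ≈ 1 → ∀ k c → d ℕ.* k ≈ c → k ≈ d′ ℕ.* c
  divide {d} {d′} h k c e = ≈-trans (≈-reflexive (sym (ℕ.*-identityˡ k))) (≈-trans (≈-*ʳ k (≈-sym h))
   (≈-trans (≈-reflexive (lem d d′ k)) (≈-*ˡ d′ e)))
   where
   lem : ∀ a b c → a ℕ.* b ℕ.* c ≡ b ℕ.* (a ℕ.* c)
   lem = ℕ-solve

  multiply : ∀ {d d′} → d ℕ.* d′ ≈ 1 → ∀ k c → k ≈ d′ ℕ.* c → d ℕ.* k ≈ c
  multiply {d} {d′} h k c e = ≈-trans (≈-*ˡ d e) (≈-trans (≈-reflexive (sym (ℕ.*-assoc d d′ c))) (≈-trans (≈-*ʳ c h) (≈-reflexive (ℕ.*-identityˡ c))))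

  cancelˡ : ∀ {d} → Unit d → ∀ {a b} → d ℕ.* a ≈ d ℕ.* b → a ≈ b
  cancelˡ {d} u {a} {b} h with inverse d u
  ... | d′ , e = ≈-trans (divide {d} e a (d ℕ.* b) h) (≈-sym (divide {d} e b (d ℕ.* b) ≈-refl))

  e : ℕ → ℚ
  e n = 𝟙 (unit? n)

  0≤e : ∀ n → 0ℚ ≤ e n
  0≤e n = 0≤𝟙 (unit? n)

  e≤1 : ∀ n → e n ≤ 1ℚ
  e≤1 n = 𝟙≤1 (unit? n)

  e-1 : e 1 ≡ 1ℚ
  e-1 = 𝟙-yes (unit? 1) Unit-1

  e-≈ : ∀ {a b} → a ≈ b → e a ≡ e b
  e-≈ {a} {b} h = 𝟙-cong (unit? a) (unit? b) (Unit-≈ h) (Unit-≈ (≈-sym h))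

  e-* : ∀ a b → e (a ℕ.* b) ≡ e a * e b
  e-* a b = go (unit? a) (unit? b)
   where
   go : (da : Dec (Unit a)) (db : Dec (Unit b)) → e (a ℕ.* b) ≡ 𝟙 da * 𝟙 db
   go (yes ua) (yes ub) = 𝟙-yes (unit? (a ℕ.* b)) (Unit-* {a} {b} ua ub)
   go (no ¬ua) db = trans (𝟙-no (unit? (a ℕ.* b)) (λ u → ¬ua (Unit-*ˡ {a} {b} u))) (sym (*-zeroˡ (𝟙 db)))
   go (yes ua) (no ¬ub) = 𝟙-no (unit? (a ℕ.* b)) (λ u → ¬ub (Unit-*ʳ {a} {b} u))

  Periodic : (ℕ → ℚ) → Set
  Periodic g = ∀ {a b} → a ≈ b → g a ≡ g b

  -- The range 1 to N meets each class once. The class of 0 is represented by N instead of its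
  -- remainder, hence the two cases.
  ∑-≈ : ∀ c → ∑ N (λ k → 𝟙 (k ≈? c)) ≡ 1ℚ
  ∑-≈ c = go (c % N) refl
   where
   go : ∀ r → c % N ≡ r → ∑ N (λ k → 𝟙 (k ≈? c)) ≡ 1ℚ
   go zero eq = trans (∑-cong N (λ k b → trans (𝟙-cong (suc k ≈? c) (suc k ℕ.≟ N) (λ h → to k b (trans (remainder h) eq)) (λ { refl → ≈-by (trans (DM.n%n≡0 N) (sym eq)) })) (sym (*-identityʳ (𝟙 (suc k ℕ.≟ N)))))) (∑-single N N′ (λ _ → 1ℚ) ℕ.≤-refl)
    where
    to : ∀ k → suc k ℕ.≤ N → suc k % N ≡ 0 → suc k ≡ N
    to k b h with suc k ℕ.≟ N
    ... | yes e = e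
    ... | no ¬e = ⊥-elim (ℕ.0≢1+n (trans (sym h) (DM.m<n⇒m%n≡m (ℕ.≤∧≢⇒< b ¬e))))
   go (suc r) eq = trans (∑-cong N (λ k b → trans (𝟙-cong (suc k ≈? c) (suc k ℕ.≟ suc r) (λ h → to k b (trans (remainder h) eq)) (λ { refl → ≈-by (trans (DM.m<n⇒m%n≡m r<N) (sym eq)) })) (sym (*-identityʳ (𝟙 (suc k ℕ.≟ suc r)))))) (∑-single N r (λ _ → 1ℚ) (ℕ.<⇒≤ r<N))
    where
    r<N : suc r ℕ.< N
    r<N = subst (ℕ._< N) eq (DM.m%n<n c N)
    to : ∀ k → suc k ℕ.≤ N → suc k % N ≡ suc r → suc k ≡ suc r
    to k b h with suc k ℕ.≟ N
    ... | yes refl = ⊥-elim (ℕ.0≢1+n (trans (sym (DM.n%n≡0 N)) h))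
    ... | no ¬e = trans (sym (DM.m<n⇒m%n≡m (ℕ.≤∧≢⇒< b ¬e))) h

  ∑-*≈ : ∀ d → Unit d → ∀ c → ∑ N (λ k → 𝟙 (d ℕ.* k ≈? c)) ≡ 1ℚ
  ∑-*≈ d u c with inverse d u
  ... | d′ , h = trans (∑-ext N (λ k → 𝟙-cong (d ℕ.* k ≈? c) (k ≈? d′ ℕ.* c) (divide {d} h k c) (multiply {d} h k c))) (∑-≈ (d′ ℕ.* c))

  ∑-≈-pick : ∀ (F : ℕ → ℚ) → Periodic F → ∀ c → ∑ N (λ k → 𝟙 (k ≈? c) * F k) ≡ F c
  ∑-≈-pick F per c = trans (∑-ext N (λ k → 𝟙-guard (k ≈? c) per)) (trans (∑-*ʳ N (F c) (λ k → 𝟙 (k ≈? c))) (trans (cong (_* F c) (∑-≈ c)) (*-identityˡ (F c))))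

  -- Expanding F (d k) over the classes and exchanging the sums spares the construction of the
  -- permutation k ↦ d k and its inverse.
  ∑-permute : ∀ d → Unit d → ∀ (F : ℕ → ℚ) → Periodic F → ∑ N (λ k → F (d ℕ.* k)) ≡ ∑ N F
  ∑-permute d u F per = begin
   ∑ N (λ k → F (d ℕ.* k)) ≡⟨ ∑-ext N (λ k → sym (∑-≈-pick F per (d ℕ.* k))) ⟩
   ∑ N (λ k → ∑ N (λ j → 𝟙 (j ≈? d ℕ.* k) * F j)) ≡⟨ ∑-swap N N _ ⟩
   ∑ N (λ j → ∑ N (λ k → 𝟙 (j ≈? d ℕ.* k) * F j)) ≡⟨ ∑-ext N (λ j → trans (∑-*ʳ N (F j) (λ k → 𝟙 (j ≈? d ℕ.* k)))
                                   (trans (cong (_* F j) (trans (∑-ext N (λ k → 𝟙-cong (j ≈? d ℕ.* k) (d ℕ.* k ≈? j) ≈-sym ≈-sym)) (∑-*≈ d u j))) (*-identityˡ (F j)))) ⟩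
   ∑ N F ∎
   where open ≡-Reasoning

  private
   ∑-shift : ∀ (g : ℕ → ℚ) → Periodic g → ∑ N g ≡ 0ℚ → ∀ y → ∑ (N ℕ.+ y) g ≡ ∑ y g
   ∑-shift g per z y = trans (∑-split N y g) (trans (cong₂ _+_ z (∑-ext y (λ i → per (≈-trans (≈-reflexive (ℕ.+-comm N i)) (≈-+N i))))) (+-identityˡ (∑ y g)))

   ∑-block : ∀ (g : ℕ → ℚ) → Periodic g → ∑ N g ≡ 0ℚ → ∀ j r → ∑ (j ℕ.* N ℕ.+ r) g ≡ ∑ r g
   ∑-block g per z zero r = refl
   ∑-block g per z (suc j) r = trans (cong (λ k → ∑ k g) (ℕ.+-assoc N (j ℕ.* N) r)) (trans (∑-shift g per z (j ℕ.* N ℕ.+ r)) (∑-block g per z j r))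

  -- Complete periods cancel, which leaves fewer than N terms.
  ∑-periodic-bound : ∀ (g : ℕ → ℚ) b → Periodic g → ∑ N g ≡ 0ℚ → (∀ n → ∣ g n ∣ ≤ b) → ∀ y → ∣ ∑ y g ∣ ≤ ι N * b
  ∑-periodic-bound g b per z bd y = begin
   ∣ ∑ y g ∣ ≡⟨ cong (λ k → ∣ ∑ k g ∣) (trans (DM.m≡m%n+[m/n]*n y N) (ℕ.+-comm (y % N) _)) ⟩
   ∣ ∑ (y ℕ./ N ℕ.* N ℕ.+ r) g ∣ ≡⟨ cong ∣_∣ (∑-block g per z (y ℕ./ N) r) ⟩
   ∣ ∑ r g ∣ ≤⟨ ∑-abs-≤ r {g = λ _ → b} (λ i _ → bd (suc i)) ⟩
   ∑ r (λ _ → b) ≡⟨ ∑-const r b ⟩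
   ι r * b ≤⟨ *-monoʳ b (≤-trans (0≤∣p∣ (g 0)) (bd 0)) (ι-mono (ℕ.<⇒≤ (DM.m%n<n y N))) ⟩
   ι N * b ∎
   where
   open ≤-Reasoning
   r = y % N

-- Chebyshev's upper bound for ψ, and Stirling's lower bound.

module Mertens where

 open Base
 open Conv
 open Mangoldt using (module Functions; one)
 open Periodic
 open import Data.Rational using (ℚ; 0ℚ; 1ℚ; _+_; _*_; _-_; -_; _≤_)
 open import Data.Rational.Properties
 open import Tactic.RingSolver using (solve-∀)

 ι-÷-upper : ∀ x d → ι (x ÷ suc d) ≤ ι x * inv (suc d)
 ι-÷-upper x d = subst (ι (x ÷ suc d) ≤_) (*-comm (inv (suc d)) (ι x)) (≤inv* d (subst (_≤ ι x) (ι-* (suc d) (x ÷ suc d)) (ι-mono (÷-lower x d))))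

 ι-÷-lower : ∀ x d → ι x * inv (suc d) ≤ ι (x ÷ suc d) + 1ℚ
 ι-÷-lower x d = subst (_≤ ι (suc (x ÷ suc d))) (*-comm (inv (suc d)) (ι x)) (inv*≤ d (subst (ι x ≤_) (ι-* (suc d) (suc (x ÷ suc d))) (ι-mono (ℕ.<⇒≤ (÷-< x d)))))

 parity : ∀ x → ∃ λ n → x ≡ n ℕ.+ n ⊎ x ≡ suc (n ℕ.+ n)
 parity zero = 0 , inj₁ refl
 parity (suc x) with parity x
 ... | n , inj₁ refl = n , inj₂ refl
 ... | n , inj₂ refl = suc n , inj₁ (cong suc (sym (ℕ.+-suc n n)))

 module Chebyshev (X′ : ℕ) where

  open Functions X′ public

  ψ : ℕ → ℚ
  ψ x = ∑ x Λ

  Λ≤ℓ : ∀ n → suc n ℕ.≤ X → Λ (suc n) ≤ ℓ (suc n)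
  Λ≤ℓ n h = subst₂ _≤_ (trans (cong (_* (Λ (suc n) * 1ℚ)) (𝟙-yes (suc n ℕ.* 1 ℕ.≟ suc n) (ℕ.*-identityʳ (suc n)))) (lem (Λ (suc n)))) (Λ⋆one n h)
   (≤-trans (term≤∑ X 0 (λ m → 𝟙 (suc n ℕ.* m ℕ.≟ suc n) * (Λ (suc n) * 1ℚ)) (s≤s z≤n) (λ m _ → pos n m))
    (term≤∑ X n (λ d → ∑ X (λ m → 𝟙 (d ℕ.* m ℕ.≟ suc n) * (Λ d * 1ℚ))) h (λ d _ → ∑-nonneg X (λ m _ → pos d m))))
   where
   lem : ∀ a → 1ℚ * (a * 1ℚ) ≡ a
   lem = solve-∀ ℚ-ring
   pos : ∀ d m → 0ℚ ≤ 𝟙 (suc d ℕ.* suc m ℕ.≟ suc n) * (Λ (suc d) * 1ℚ)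
   pos d m = 0≤𝟙 (suc d ℕ.* suc m ℕ.≟ suc n) ⊗ (0≤Λ (suc d) ⊗ 0≤1)

  ∑ℓ : ∀ x → x ℕ.≤ X → ∑ x ℓ ≡ ∑ x (λ d → Λ d * ι (x ÷ d))
  ∑ℓ x h = begin
   ∑ x ℓ ≡⟨ ∑-cong x (λ i b → trans (sym (Λ⋆one i (ℕ.≤-trans b h))) (sym (*-identityʳ ((Λ ⋆ one) (suc i))))) ⟩
   ∑ x (λ n → (Λ ⋆ one) n * 1ℚ) ≡⟨ ∑-⋆ Λ one one x h ⟩
   ∑ x (λ d → Λ d * ∑ (x ÷ d) (λ m → 1ℚ * 1ℚ)) ≡⟨ ∑-ext x (λ d → cong (Λ d *_) (trans (∑-const (x ÷ d) (1ℚ * 1ℚ)) (*-identityʳ (ι (x ÷ d))))) ⟩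
   ∑ x (λ d → Λ d * ι (x ÷ d)) ∎
   where open ≡-Reasoning

  private
   -- The logarithm of the central binomial coefficient is at most 2 n: by induction, the two new
   -- factors 2 n + 1 and 2 n + 2 each cost at most ℓ 2 ≤ 1 more than n + 1.
   double-log : ∀ n → n ℕ.+ n ℕ.≤ X → ∑ (n ℕ.+ n) ℓ ≤ ∑ n ℓ + ∑ n ℓ + (ι n + ι n)
   double-log zero h = ≤-refl
   double-log (suc n) h = subst (_≤ ∑ (suc n) ℓ + ∑ (suc n) ℓ + (ι (suc n) + ι (suc n))) (cong (λ k → ∑ (suc k) ℓ) (sym (ℕ.+-suc n n)))
    (close (diff (double-log n (ℕ.≤-trans (ℕ.+-mono-≤ (ℕ.n≤1+n n) (ℕ.n≤1+n n)) h)) ⊕ diff even ⊕ diff odd ⊕ diff ℓ2≤1 ⊕ diff ℓ2≤1)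
     (lem (∑ (n ℕ.+ n) ℓ) (∑ n ℓ) (ι n) (ℓ (suc n)) (ℓ 2) (ℓ (suc (n ℕ.+ n))) (ℓ (suc (suc (n ℕ.+ n))))))
    where
    lem : ∀ a b c d e f g → b + b + (c + c) - a + (e + d - g) + (e + d - f) + (1ℚ - e) + (1ℚ - e) ≡ (b + d) + (b + d) + (c + 1ℚ + (c + 1ℚ)) - (a + f + g)
    lem = solve-∀ ℚ-ring
    h′ : suc (suc (n ℕ.+ n)) ℕ.≤ X
    h′ = subst (ℕ._≤ X) (cong suc (ℕ.+-suc n n)) h
    even : ℓ (suc (suc (n ℕ.+ n))) ≤ ℓ 2 + ℓ (suc n)
    even = ≤-reflexive (trans (cong ℓ (trans (cong suc (sym (ℕ.+-suc n n))) (cong (λ k → suc n ℕ.+ k) (sym (ℕ.+-identityʳ (suc n)))))) (ℓ-* 1 n))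
    odd : ℓ (suc (n ℕ.+ n)) ≤ ℓ 2 + ℓ (suc n)
    odd = ≤-trans (ℓ-step-mono (n ℕ.+ n) h′) even
    ℓ2≤1 : ℓ 2 ≤ 1ℚ
    ℓ2≤1 = ℓ≤ι 1 (ℕ.≤-trans (s≤s (s≤s z≤n)) h′)

   -- The difference of floors is the exponent count of the central binomial coefficient. It is
   -- never negative, and it is at least 1 for n < d ≤ 2 n.
   floors : ∀ n d → suc d ℕ.≤ n ℕ.+ n → 1ℚ ≤ 𝟙 (suc d ℕ.≤? n) + (ι ((n ℕ.+ n) ÷ suc d) - (ι (n ÷ suc d) + ι (n ÷ suc d)))
   floors n d b with suc d ℕ.≤? n
   ... | yes p = close (diff (ι-mono (÷-upper (n ℕ.+ n) d (n ÷ suc d ℕ.+ n ÷ suc d) (ℕ.≤-trans (ℕ.≤-reflexive (ℕ.*-distribˡ-+ (suc d) (n ÷ suc d) (n ÷ suc d))) (ℕ.+-mono-≤ (÷-lower n d) (÷-lower n d))))))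
           (trans (cong (λ t → ι ((n ℕ.+ n) ÷ suc d) - t) (ι-+ (n ÷ suc d) (n ÷ suc d))) (lem (ι ((n ℕ.+ n) ÷ suc d)) (ι (n ÷ suc d) + ι (n ÷ suc d))))
    where
    lem : ∀ a b → a - b ≡ 1ℚ + (a - b) - 1ℚ
    lem = solve-∀ ℚ-ring
   ... | no ¬p = subst (λ t → 1ℚ ≤ 0ℚ + (ι ((n ℕ.+ n) ÷ suc d) - (ι t + ι t))) (sym (DM.m<n⇒m/n≡0 (ℕ.≰⇒> ¬p)))
           (close (diff (ι-mono (÷-upper (n ℕ.+ n) d 1 (subst (ℕ._≤ n ℕ.+ n) (sym (ℕ.*-identityʳ (suc d))) b)))) (lem (ι ((n ℕ.+ n) ÷ suc d))))
    where
    lem : ∀ a → a - (0ℚ + 1ℚ) ≡ 0ℚ + (a - (0ℚ + 0ℚ)) - 1ℚ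
    lem = solve-∀ ℚ-ring

   ψ-double : ∀ n → n ℕ.+ n ℕ.≤ X → ψ (n ℕ.+ n) ≤ ψ n + (ι n + ι n)
   ψ-double n h = begin
    ψ (n ℕ.+ n)
     ≤⟨ ∑-mono (n ℕ.+ n) (λ d b → subst (_≤ Λ (suc d) * _) (*-identityʳ (Λ (suc d))) (*-monoˡ (Λ (suc d)) (0≤Λ (suc d)) (floors n d b))) ⟩
    ∑ (n ℕ.+ n) (λ d → Λ d * (𝟙 (d ℕ.≤? n) + (ι ((n ℕ.+ n) ÷ d) - (ι (n ÷ d) + ι (n ÷ d)))))
     ≡⟨ trans (∑-ext (n ℕ.+ n) (λ d → lem (Λ d) (𝟙 (d ℕ.≤? n)) (ι ((n ℕ.+ n) ÷ d)) (ι (n ÷ d))))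
       (trans (∑-+ (n ℕ.+ n) _ _) (cong (∑ (n ℕ.+ n) (λ d → 𝟙 (d ℕ.≤? n) * Λ d) +_) (trans (∑-- (n ℕ.+ n) _ _) (cong (λ t → ∑ (n ℕ.+ n) (λ d → Λ d * ι ((n ℕ.+ n) ÷ d)) - t) (∑-+ (n ℕ.+ n) _ _))))) ⟩
    ∑ (n ℕ.+ n) (λ d → 𝟙 (d ℕ.≤? n) * Λ d) + (∑ (n ℕ.+ n) (λ d → Λ d * ι ((n ℕ.+ n) ÷ d)) - (∑ (n ℕ.+ n) A + ∑ (n ℕ.+ n) A))
     ≡⟨ cong₂ (λ a b → a + (b - (∑ (n ℕ.+ n) A + ∑ (n ℕ.+ n) A))) initial (sym (∑ℓ (n ℕ.+ n) h)) ⟩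
    ψ n + (∑ (n ℕ.+ n) ℓ - (∑ (n ℕ.+ n) A + ∑ (n ℕ.+ n) A))
     ≡⟨ cong (λ a → ψ n + (∑ (n ℕ.+ n) ℓ - (a + a))) (trans shorten (sym (∑ℓ n (ℕ.≤-trans (ℕ.m≤m+n n n) h)))) ⟩
    ψ n + (∑ (n ℕ.+ n) ℓ - (∑ n ℓ + ∑ n ℓ))
     ≤⟨ close (diff (double-log n h)) (lem′ (ψ n) (∑ (n ℕ.+ n) ℓ) (∑ n ℓ) (ι n)) ⟩
    ψ n + (ι n + ι n) ∎
    where
    open ≤-Reasoning
    A : ℕ → ℚ
    A d = Λ d * ι (n ÷ d)
    lem : ∀ a b c d → a * (b + (c - (d + d))) ≡ b * a + (a * c - (a * d + a * d))
    lem = solve-∀ ℚ-ring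
    lem′ : ∀ a b c d → c + c + (d + d) - b ≡ a + (d + d) - (a + (b - (c + c)))
    lem′ = solve-∀ ℚ-ring
    shorten : ∑ (n ℕ.+ n) A ≡ ∑ n A
    shorten = ∑-extend A (ℕ.m≤m+n n n) (λ { (suc i) lt → trans (cong (λ t → Λ (suc i) * ι t) (DM.m<n⇒m/n≡0 lt)) (*-zeroʳ (Λ (suc i))) })
    initial : ∑ (n ℕ.+ n) (λ d → 𝟙 (d ℕ.≤? n) * Λ d) ≡ ψ n
    initial = trans (∑-extend (λ d → 𝟙 (d ℕ.≤? n) * Λ d) (ℕ.m≤m+n n n) (λ i lt → trans (cong (_* Λ i) (𝟙-no (i ℕ.≤? n) (ℕ.<⇒≱ lt))) (*-zeroˡ (Λ i))))
     (∑-cong n (λ i b → trans (cong (_* Λ (suc i)) (𝟙-yes (suc i ℕ.≤? n) b)) (*-identityˡ (Λ (suc i)))))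

   ψ-bound′ : ∀ b x → x ℕ.≤ b → x ℕ.≤ X → ψ x ≤ ι 4 * ι x
   ψ-bound′ b x x≤b x≤X with parity x
   ψ-bound′ b x x≤b x≤X | zero , inj₁ refl = ≤-refl
   ψ-bound′ (suc b) x x≤b x≤X | n@(suc n′) , inj₁ refl = close
    (diff (ψ-double n x≤X) ⊕ diff (ψ-bound′ b n (ℕ.≤-pred (ℕ.≤-trans (s≤s (ℕ.≤-trans (ℕ.m≤n+m n n′) ℕ.≤-refl)) x≤b)) (ℕ.≤-trans (ℕ.m≤m+n n n) x≤X)) ⊕ (0≤ι n ⊕ 0≤ι n))
    (trans (lem (ψ (n ℕ.+ n)) (ψ n) (ι n)) (cong (λ t → ι 4 * t - ψ (n ℕ.+ n)) (sym (ι-+ n n))))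
    where
    lem : ∀ a b c → b + (c + c) - a + (ι 4 * c - b) + (c + c) ≡ ι 4 * (c + c) - a
    lem = solve-∀ ℚ-ring
   ψ-bound′ (suc b) x x≤b x≤X | n , inj₂ refl = close
    (diff (ψ-double n (ℕ.≤-trans (ℕ.n≤1+n _) x≤X)) ⊕ diff (ψ-bound′ b n (ℕ.≤-pred (ℕ.≤-trans (s≤s (ℕ.m≤m+n n n)) x≤b)) (ℕ.≤-trans (ℕ.≤-trans (ℕ.m≤m+n n n) (ℕ.n≤1+n _)) x≤X))
     ⊕ diff (subst (Λ (suc (n ℕ.+ n)) ≤_) (ι-+ n n) (≤-trans (Λ≤ℓ (n ℕ.+ n) x≤X) (ℓ≤ι (n ℕ.+ n) x≤X))) ⊕ (0≤ι 4))
    (trans (lem (ψ (n ℕ.+ n)) (ψ n) (ι n) (Λ (suc (n ℕ.+ n)))) (cong (λ t → ι 4 * (t + 1ℚ) - (ψ (n ℕ.+ n) + Λ (suc (n ℕ.+ n)))) (sym (ι-+ n n))))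
    where
    lem : ∀ a b c d → b + (c + c) - a + (ι 4 * c - b) + (c + c - d) + ι 4 ≡ ι 4 * (c + c + 1ℚ) - (a + d)
    lem = solve-∀ ℚ-ring

  ψ-bound : ∀ x → x ℕ.≤ X → ψ x ≤ ι 4 * ι x
  ψ-bound x = ψ-bound′ x x ℕ.≤-refl

  -- Going from x to x + 1 increases x log x - log x! by x (ℓ(x+1) - ℓ x), which is at most 1.
  log-deficit : ∀ x → suc x ℕ.≤ X → ι (suc x) * ℓ (suc x) - ∑ (suc x) ℓ ≤ ι x
  log-deficit zero h = ≤-reflexive (lem (ℓ 1))
   where
   lem : ∀ a → (0ℚ + 1ℚ) * a - (0ℚ + a) ≡ 0ℚ
   lem = solve-∀ ℚ-ring
  log-deficit (suc x) h = close
   (diff (log-deficit x (ℕ.≤-trans (ℕ.n≤1+n _) h)) ⊕ 0≤ι (suc x) ⊗ diff (ℓ-step-upper x h))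
   (trans (cong (λ t → (ι x - (ι (suc x) * ℓ (suc x) - ∑ (suc x) ℓ)) + t) (expand (ι (suc x)) (inv (suc x)) (ℓ (suc (suc x)) - ℓ (suc x)) (ι*inv x)))
    (lem (ι x) (ℓ (suc x)) (ℓ (suc (suc x))) (∑ x ℓ)))
   where
   expand : ∀ a b c → a * b ≡ 1ℚ → a * (b - c) ≡ 1ℚ - a * c
   expand a b c h = trans (lem₀ a b c) (cong (λ t → t - a * c) h)
    where
    lem₀ : ∀ a b c → a * (b - c) ≡ a * b - a * c
    lem₀ = solve-∀ ℚ-ring
   lem : ∀ a b c s → (a - ((a + 1ℚ) * b - (s + b))) + (1ℚ - (a + 1ℚ) * (c - b)) ≡ a + 1ℚ - ((a + 1ℚ + 1ℚ) * c - (s + b + c))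
   lem = solve-∀ ℚ-ring

-- Mertens' estimate over the integers prime to N.

module Units where

 open Base
 open Conv
 open Mangoldt using (one)
 open Mertens using (module Chebyshev; ι-÷-upper; ι-÷-lower)
 open Periodic
 open import Data.Rational using (ℚ; 0ℚ; 1ℚ; _+_; _*_; _-_; -_; _≤_; ∣_∣)
 open import Data.Rational.Properties
 open import Tactic.RingSolver using (solve-∀)

 module Coprime (X′ N′ : ℕ) where

  open Chebyshev X′ public
  open Residues N′ public

  Φ NN C : ℚ
  Φ = ∑ N e
  NN = ι N * ι N
  C = ι 10 * NN

  -- `M` is Mertens' sum of Λ(n)/n, restricted to n prime to N so that the sums over the unit
  -- classes add up to it. `κ` counts the units up to y.
  κ α M : ℕ → ℚ
  κ y = ∑ y e
  α n = Λ n * e n * inv n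
  M x = ∑ x α

  1≤N : 1ℚ ≤ ι N
  1≤N = 1≤ι N′

  N≤NN : ι N ≤ NN
  N≤NN = subst (_≤ NN) (*-identityˡ (ι N)) (*-monoʳ (ι N) (0≤ι N) 1≤N)

  0≤NN : 0ℚ ≤ NN
  0≤NN = 0≤ι N ⊗ 0≤ι N

  0≤C : 0ℚ ≤ C
  0≤C = 0≤ι 10 ⊗ 0≤NN

  0≤Φ : 0ℚ ≤ Φ
  0≤Φ = ∑-nonneg N (λ i _ → 0≤e (suc i))

  Φ≤N : Φ ≤ ι N
  Φ≤N = subst (Φ ≤_) (trans (∑-const N 1ℚ) (*-identityʳ (ι N))) (∑-mono N (λ i _ → e≤1 (suc i)))

  1≤Φ : 1ℚ ≤ Φ
  1≤Φ = subst (_≤ Φ) e-1 (term≤∑ N 0 e (s≤s z≤n) (λ i _ → 0≤e (suc i)))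

  0≤α : ∀ n → 0ℚ ≤ α n
  0≤α n = (0≤Λ n ⊗ 0≤e n) ⊗ 0≤inv n

  -- The function N e - Φ is periodic with mean zero, so its partial sums are bounded; the factor N
  -- keeps the density Φ/N free of division.
  κ-density : ∀ y → ∣ ι N * κ y - Φ * ι y ∣ ≤ NN
  κ-density y = subst (λ t → ∣ t ∣ ≤ NN) (trans (∑-- y (λ n → ι N * e n) (λ _ → Φ)) (cong₂ _-_ (∑-*ˡ y (ι N) e) (trans (∑-const y Φ) (*-comm (ι y) Φ))))
   (∑-periodic-bound (λ n → ι N * e n - Φ) (ι N) (λ h → cong (λ t → ι N * t - Φ) (e-≈ h))
    (trans (∑-- N (λ n → ι N * e n) (λ _ → Φ)) (trans (cong₂ _-_ (∑-*ˡ N (ι N) e) (∑-const N Φ)) (+-inverseʳ (ι N * Φ))))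
    (λ n → ∣∣≤ (close (diff Φ≤N ⊕ 0≤ι N ⊗ 0≤e n) (lem (ι N) (e n) Φ)) (close (0≤ι N ⊗ diff (e≤1 n) ⊕ 0≤Φ) (lem′ (ι N) (e n) Φ))) y)
   where
   lem : ∀ a b c → a - c + a * b ≡ a * b - c - - a
   lem = solve-∀ ℚ-ring
   lem′ : ∀ a b c → a * (1ℚ - b) + c ≡ a - (a * b - c)
   lem′ = solve-∀ ℚ-ring

  -- The sum S of `ℓ` over the units up to x is evaluated twice. By Λ ⋆ 1 = ℓ it is Σ Λ(d) e(d)
  -- κ(x/d), which is close to (Φ/N) x M(x); by `log-deficit` it is close to κ(x) ℓ(x), hence to
  -- (Φ/N) x ℓ(x). Chebyshev's bound controls the first error.
  mertens : ∀ x → suc x ℕ.≤ X → ∣ M (suc x) - ℓ (suc x) ∣ ≤ C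
  mertens x′ x≤X = *-cancelˡ (ι x) (0<ι x′) (begin
   ι x * ∣ M x - ℓ x ∣ ≤⟨ close (diff 1≤Φ ⊗ (0≤ι x ⊗ 0≤∣p∣ (M x - ℓ x))) (lem₁ Φ (ι x) ∣ M x - ℓ x ∣) ⟩
   Φ * ι x * ∣ M x - ℓ x ∣ ≡⟨ trans (cong (_* ∣ M x - ℓ x ∣) (sym (0≤p⇒∣p∣≡p (0≤Φ ⊗ 0≤ι x)))) (sym (∣p*q∣≡∣p∣*∣q∣ (Φ * ι x) (M x - ℓ x))) ⟩
   ∣ Φ * ι x * (M x - ℓ x) ∣ ≡⟨ cong ∣_∣ (lem₂ Φ (ι x) (M x) (ℓ x) (ι N) S (κ x)) ⟩
   ∣ (Φ * (ι x * M x) - ι N * S) + ι N * (S - κ x * ℓ x) + (ι N * κ x - Φ * ι x) * ℓ x ∣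
    ≤⟨ ∣∣-add (∣∣-add part₁ (∣∣-mul (0≤⇒∣∣ (0≤ι N) ≤-refl) part₂)) (∣∣-mul (κ-density x) (0≤⇒∣∣ (0≤ℓ x) u≤x)) ⟩
   (NN + NN) * (ι 4 * ι x) + ι N * ι x + NN * ι x
    ≤⟨ close (diff N≤NN ⊗ 0≤ι x) (lem₃ NN (ι N) (ι x)) ⟩
   ι x * C ∎)
   where
   open ≤-Reasoning
   x = suc x′
   S : ℚ
   S = ∑ x (λ n → ℓ n * e n)
   lem₁ : ∀ a b c → (a - 1ℚ) * (b * c) ≡ a * b * c - b * c
   lem₁ = solve-∀ ℚ-ring
   lem₂ : ∀ f x m u n s k → f * x * (m - u) ≡ (f * (x * m) - n * s) + n * (s - k * u) + (n * k - f * x) * u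
   lem₂ = solve-∀ ℚ-ring
   lem₃ : ∀ a b x → (a - b) * x ≡ x * (ι 10 * a) - ((a + a) * (ι 4 * x) + b * x + a * x)
   lem₃ = solve-∀ ℚ-ring
   u≤x : ℓ x ≤ ι x
   u≤x = ≤-trans (ℓ≤ι x′ x≤X) (ι-mono (ℕ.n≤1+n x′))
   S-eq : S ≡ ∑ x (λ d → Λ d * (e d * κ (x ÷ d)))
   S-eq = trans (∑-cong x (λ i b → cong (_* e (suc i)) (sym (Λ⋆one i (ℕ.≤-trans b x≤X)))))
    (trans (∑-⋆ Λ one e x x≤X) (∑-ext x (λ d → cong (Λ d *_) (trans (∑-ext (x ÷ d) (λ m → trans (*-identityˡ (e (d ℕ.* m))) (e-* d m))) (∑-*ˡ (x ÷ d) (e d) e)))))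
   term : ∀ d → ∣ Λ (suc d) * (e (suc d) * (Φ * (ι x * inv (suc d)) - ι N * κ (x ÷ suc d))) ∣ ≤ Λ (suc d) * (NN + NN)
   term d = ∣∣-mul (0≤⇒∣∣ (0≤Λ (suc d)) ≤-refl) (subst (∣ e (suc d) * (Φ * (ι x * inv (suc d)) - ι N * κ (x ÷ suc d)) ∣ ≤_) (*-identityˡ (NN + NN)) (∣∣-mul (0≤⇒∣∣ (0≤e (suc d)) (e≤1 (suc d)))
    (subst (λ t → ∣ t ∣ ≤ NN + NN) (lem (ι N * κ (x ÷ suc d)) Φ (ι (x ÷ suc d)) (ι x * inv (suc d)))
     (∣∣-add (subst (_≤ NN) (∣-p∣≡p′ (ι N * κ (x ÷ suc d) - Φ * ι (x ÷ suc d))) (κ-density (x ÷ suc d)))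
      (subst (∣ Φ * (ι x * inv (suc d) - ι (x ÷ suc d)) ∣ ≤_) (*-identityʳ NN) (∣∣-mul (0≤⇒∣∣ 0≤Φ (≤-trans Φ≤N N≤NN))
       (0≤⇒∣∣ (diff (ι-÷-upper x d)) (close (diff (ι-÷-lower x d)) (lem′ (ι x * inv (suc d)) (ι (x ÷ suc d)))))))))))
    where
    ∣-p∣≡p′ : ∀ p → ∣ p ∣ ≡ ∣ - p ∣
    ∣-p∣≡p′ p = sym (∣-p∣≡∣p∣ p)
    lem : ∀ a b c d → - (a - b * c) + b * (d - c) ≡ b * d - a
    lem = solve-∀ ℚ-ring
    lem′ : ∀ a b → b + 1ℚ - a ≡ 1ℚ - (a - b)
    lem′ = solve-∀ ℚ-ring
   part₁ : ∣ Φ * (ι x * M x) - ι N * S ∣ ≤ (NN + NN) * (ι 4 * ι x)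
   part₁ = begin
    ∣ Φ * (ι x * M x) - ι N * S ∣
     ≡⟨ cong ∣_∣ (trans (cong₂ _-_ (trans (sym (*-assoc Φ (ι x) (M x))) (sym (∑-*ˡ x (Φ * ι x) α))) (trans (cong (ι N *_) S-eq) (sym (∑-*ˡ x (ι N) (λ d → Λ d * (e d * κ (x ÷ d))))))) (sym (∑-- x _ _))) ⟩
    ∣ ∑ x (λ d → Φ * ι x * α d - ι N * (Λ d * (e d * κ (x ÷ d)))) ∣
     ≤⟨ ∑-abs-≤ x (λ d _ → subst (λ t → ∣ t ∣ ≤ Λ (suc d) * (NN + NN)) (lem Φ (ι x) (Λ (suc d)) (e (suc d)) (inv (suc d)) (ι N) (κ (x ÷ suc d))) (term d)) ⟩
    ∑ x (λ d → Λ d * (NN + NN))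
     ≡⟨ trans (∑-*ʳ x (NN + NN) Λ) (*-comm (ψ x) (NN + NN)) ⟩
    (NN + NN) * ψ x
     ≤⟨ *-monoˡ (NN + NN) (0≤NN ⊕ 0≤NN) (ψ-bound x x≤X) ⟩
    (NN + NN) * (ι 4 * ι x) ∎
    where
    lem : ∀ f x l e i n k → l * (e * (f * (x * i) - n * k)) ≡ f * x * (l * e * i) - n * (l * (e * k))
    lem = solve-∀ ℚ-ring
   part₂ : ∣ S - κ x * ℓ x ∣ ≤ ι x
   part₂ = begin
    ∣ S - κ x * ℓ x ∣
     ≡⟨ trans (cong ∣_∣ (trans (lem S (κ x * ℓ x)) (cong -_ (trans (cong (_- S) (sym (∑-*ʳ x (ℓ x) e))) (sym (∑-- x _ _)))))) (∣-p∣≡∣p∣ (∑ x (λ n → e n * ℓ x - ℓ n * e n))) ⟩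
    ∣ ∑ x (λ n → e n * ℓ x - ℓ n * e n) ∣
     ≤⟨ ∑-abs-≤ x (λ n b → subst (λ t → ∣ t ∣ ≤ ℓ x - ℓ (suc n)) (lem′ (e (suc n)) (ℓ x) (ℓ (suc n))) (0≤⇒∣∣ (0≤e (suc n) ⊗ diff (ℓ-mono n x′ b x≤X))
        (close (diff (e≤1 (suc n)) ⊗ diff (ℓ-mono n x′ b x≤X)) (lem″ (e (suc n)) (ℓ x - ℓ (suc n)))))) ⟩
    ∑ x (λ n → ℓ x - ℓ n)
     ≡⟨ trans (∑-- x (λ _ → ℓ x) ℓ) (cong (_- ∑ x ℓ) (∑-const x (ℓ x))) ⟩
    ι x * ℓ x - ∑ x ℓ
     ≤⟨ log-deficit x′ x≤X ⟩
    ι x′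
     ≤⟨ ι-mono (ℕ.n≤1+n x′) ⟩
    ι x ∎
    where
    lem : ∀ a b → a - b ≡ - (b - a)
    lem = solve-∀ ℚ-ring
    lem′ : ∀ a b c → a * (b - c) ≡ a * b - c * a
    lem′ = solve-∀ ℚ-ring
    lem″ : ∀ a b → (1ℚ - a) * b ≡ b - a * b
    lem″ = solve-∀ ℚ-ring

  M-upper : ∀ x → suc x ℕ.≤ X → M (suc x) ≤ ℓ (suc x) + C
  M-upper x h = close (diff (∣∣⇒≤ (mertens x h))) (lem (M (suc x)) (ℓ (suc x)) C)
   where
   lem : ∀ a b c → c - (a - b) ≡ b + c - a
   lem = solve-∀ ℚ-ring

  M-lower : ∀ x → suc x ℕ.≤ X → ℓ (suc x) - C ≤ M (suc x)
  M-lower x h = close (diff (∣∣⇒≥ (mertens x h))) (lem (M (suc x)) (ℓ (suc x)) C)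
   where
   lem : ∀ a b c → a - b - - c ≡ a - (b - c)
   lem = solve-∀ ℚ-ring

  -- Uses ℓ (x ÷ m) ≤ ℓ x - ℓ m.
  ℓ-÷ : ∀ x m → suc m ℕ.≤ suc x → suc x ℕ.≤ X → ℓ (suc x ÷ suc m) ≤ ℓ (suc x) - ℓ (suc m)
  ℓ-÷ x m m≤x x≤X with suc x ÷ suc m | ÷-upper (suc x) m 1 (subst (ℕ._≤ suc x) (sym (ℕ.*-identityʳ (suc m))) m≤x) | ÷-lower (suc x) m
  ... | suc y | _ | h = close (diff (subst (_≤ ℓ (suc x)) (ℓ-* m y) (ℓ-mono (y ℕ.+ m ℕ.* suc y) x h x≤X))) (lem (ℓ (suc x)) (ℓ (suc m)) (ℓ (suc y)))
   where
   lem : ∀ a b c → a - (b + c) ≡ a - b - c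
   lem = solve-∀ ℚ-ring

  M-÷ : ∀ x m → suc m ℕ.≤ suc x → suc x ℕ.≤ X → M (suc x ÷ suc m) ≤ ℓ (suc x) - ℓ (suc m) + C
  M-÷ x m m≤x x≤X with suc x ÷ suc m | ÷-upper (suc x) m 1 (subst (ℕ._≤ suc x) (sym (ℕ.*-identityʳ (suc m))) m≤x) | ÷-≤ (suc x) (suc m) | ℓ-÷ x m m≤x x≤X
  ... | suc y | _ | y≤x | h = ≤-trans (M-upper y (ℕ.≤-trans y≤x x≤X)) (+-monoˡ-≤ C h)

  -- Partial summation from M.
  σ-lower′ : ∀ x → suc x ℕ.≤ X →
   (ι 2 * M (suc x) - ℓ (suc x) - ι 2 * C) * ℓ (suc x) ≤ ι 2 * ∑ (suc x) (λ n → α n * ℓ n)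
  σ-lower′ zero h = ≤-reflexive (trans (cong ((ι 2 * M 1 - ℓ 1 - ι 2 * C) *_) ℓ-1) (trans (lem (ι 2 * M 1 - ℓ 1 - ι 2 * C) (ι 2) (α 1)) (cong (λ t → ι 2 * (0ℚ + α 1 * t)) (sym ℓ-1))))
   where
   lem : ∀ a b c → a * 0ℚ ≡ b * (0ℚ + c * 0ℚ)
   lem = solve-∀ ℚ-ring
  σ-lower′ (suc x) h = close
   (diff (σ-lower′ x h′) ⊕ (0≤ι 2 ⊗ diff (ℓ-step-mono x h)) ⊗ diff (M-upper x h′) ⊕ diff (ℓ-step-mono x h) ⊗ diff (ℓ-step-mono x h))
   (lem (M (suc x)) (α (suc (suc x))) (ℓ (suc x)) (ℓ (suc (suc x))) C (∑ (suc x) (λ n → α n * ℓ n)))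
   where
   h′ = ℕ.≤-trans (ℕ.n≤1+n _) h
   lem : ∀ m a l l′ c s → (ι 2 * s - (ι 2 * m - l - ι 2 * c) * l) + ι 2 * (l′ - l) * (l + c - m) + (l′ - l) * (l′ - l) ≡ ι 2 * (s + a * l′) - (ι 2 * (m + a) - l′ - ι 2 * c) * l′
   lem = solve-∀ ℚ-ring

  σ-lower : ∀ x → suc x ℕ.≤ X → (ℓ (suc x) - ι 4 * C) * ℓ (suc x) ≤ ι 2 * ∑ (suc x) (λ n → α n * ℓ n)
  σ-lower x h = ≤-trans (*-monoʳ {ℓ (suc x) - ι 4 * C} {ι 2 * M (suc x) - ℓ (suc x) - ι 2 * C} (ℓ (suc x)) (0≤ℓ (suc x)) (close (0≤ι 2 ⊗ diff (M-lower x h)) (lem (ℓ (suc x)) C (M (suc x))))) (σ-lower′ x h)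
   where
   lem : ∀ a c m → ι 2 * (m - (a - c)) ≡ ι 2 * m - a - ι 2 * c - (a - ι 4 * c)
   lem = solve-∀ ℚ-ring

-- Selberg's formula, compared between residue classes.

module Selberg where

 open Base
 open Conv
 open Mangoldt using (one)
 open Mobius using (module Möbius)
 open Units
 open Periodic
 open import Data.Rational using (ℚ; 0ℚ; 1ℚ; _+_; _*_; _-_; -_; _≤_; ∣_∣)
 open import Data.Rational.Properties
 open import Tactic.RingSolver using (solve-∀)

 inv-step : ∀ n → inv (suc n) - inv (suc (suc n)) ≡ inv (suc n) * inv (suc (suc n))
 inv-step n = begin
  i - j ≡⟨ cong₂ _-_ (sym (*-identityʳ i)) (sym (*-identityʳ j)) ⟩
  i * 1ℚ - j * 1ℚ ≡⟨ cong₂ (λ s t → i * s - j * t) (sym (ι*inv (suc n))) (sym (ι*inv n)) ⟩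
  i * ((ι (suc n) + 1ℚ) * j) - j * (ι (suc n) * i) ≡⟨ lem i j (ι (suc n)) ⟩
  i * j ∎
  where
  open ≡-Reasoning
  i = inv (suc n)
  j = inv (suc (suc n))
  lem : ∀ i j m → i * ((m + 1ℚ) * j) - j * (m * i) ≡ i * j
  lem = solve-∀ ℚ-ring

 module SelbergFormula (X′ N′ : ℕ) where

  open Coprime X′ N′ public
  open Möbius X

  Λℓ Λ₂ Λ₃ : ℕ → ℚ
  Λℓ n = Λ n * ℓ n
  Λ₂ n = Λℓ n + (Λ ⋆ Λ) n
  Λ₃ = Λ ⋆ (Λ ⋆ Λ)

  0≤Λ⋆Λ : ∀ n → 0ℚ ≤ (Λ ⋆ Λ) n
  0≤Λ⋆Λ n = ⋆-nonneg Λ Λ n 0≤Λ 0≤Λ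

  private
   additive : ∀ n d m → suc d ℕ.* suc m ≡ n → ℓ n ≡ ℓ (suc d) + ℓ (suc m)
   additive n d m refl = ℓ-* d m

   one⋆Λ : ∀ n → suc n ℕ.≤ X → (one ⋆ Λ) (suc n) ≡ ℓ (suc n)
   one⋆Λ n h = trans (⋆-comm one Λ (suc n)) (Λ⋆one n h)

   one⋆Λ₂ : ∀ n → suc n ℕ.≤ X → (one ⋆ Λ₂) (suc n) ≡ ℓ (suc n) * ℓ (suc n)
   one⋆Λ₂ n h = begin
    (one ⋆ Λ₂) (suc n) ≡⟨ ⋆-distribˡ one Λℓ (Λ ⋆ Λ) (suc n) ⟩
    (one ⋆ Λℓ) (suc n) + (one ⋆ (Λ ⋆ Λ)) (suc n) ≡⟨ cong ((one ⋆ Λℓ) (suc n) +_) (trans (sym (⋆-assoc one Λ Λ (suc n) h))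
                                        (⋆-cong {one ⋆ Λ} {λ i → one i * ℓ i} {Λ} {Λ} (λ i b → trans (one⋆Λ i b) (sym (*-identityˡ (ℓ (suc i))))) (λ _ _ → refl) (suc n))) ⟩
    (one ⋆ Λℓ) (suc n) + ((λ i → one i * ℓ i) ⋆ Λ) (suc n) ≡⟨ +-comm ((one ⋆ Λℓ) (suc n)) _ ⟩
    ((λ i → one i * ℓ i) ⋆ Λ) (suc n) + (one ⋆ Λℓ) (suc n) ≡⟨ ⋆-derivation ℓ one Λ (suc n) (additive (suc n)) ⟨
    (one ⋆ Λ) (suc n) * ℓ (suc n) ≡⟨ cong (_* ℓ (suc n)) (one⋆Λ n h) ⟩
    ℓ (suc n) * ℓ (suc n) ∎
    where open ≡-Reasoning

   -- Möbius inversion of 1 ⋆ Λ₂ = ℓ², an identity that arises from 1 ⋆ Λ = ℓ by one more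
   -- application of the derivation `ℓ`.
   μ⋆ℓ² : ∀ n → suc n ℕ.≤ X → (μ ⋆ (λ i → ℓ i * ℓ i)) (suc n) ≡ Λ₂ (suc n)
   μ⋆ℓ² n h = begin
    (μ ⋆ (λ i → ℓ i * ℓ i)) (suc n) ≡⟨ ⋆-cong {μ} {μ} {λ i → ℓ i * ℓ i} {one ⋆ Λ₂} (λ _ _ → refl) (λ i b → sym (one⋆Λ₂ i b)) (suc n) ⟩
    (μ ⋆ (one ⋆ Λ₂)) (suc n) ≡⟨ ⋆-assoc μ one Λ₂ (suc n) h ⟨
    (μ ⋆ one ⋆ Λ₂) (suc n) ≡⟨ ⋆-cong {μ ⋆ one} {ε} {Λ₂} {Λ₂} μ⋆one (λ _ _ → refl) (suc n) ⟩
    (ε ⋆ Λ₂) (suc n) ≡⟨ ⋆-identityˡ Λ₂ n h ⟩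
    Λ₂ (suc n) ∎
    where open ≡-Reasoning

  -- The extra factor k is there because substituting n = d m turns n ≡ a into d m ≡ a, and divisors
  -- d are carried along by the convolutions.
  δ : ℕ → ℕ → ℕ → ℕ → ℚ
  δ a b k n = 𝟙 (k ℕ.* n ≈? a) - 𝟙 (k ℕ.* n ≈? b)

  H : ℕ → ℚ
  H x = ∑ x inv

  0≤H : ∀ x → 0ℚ ≤ H x
  0≤H x = ∑-nonneg x (λ i _ → 0≤inv (suc i))

  H-bound : ∀ x → suc x ℕ.≤ X → H (suc x) ≤ 1ℚ + ι 6 * ℓ (suc x)
  H-bound zero h = close (0≤ι 6 ⊗ 0≤ℓ 1 ⊕ diff (inv≤1 1)) (lem (ι 6 * ℓ 1) (inv 1))
   where
   lem : ∀ a b → a + (1ℚ - b) ≡ 1ℚ + a - (0ℚ + b)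
   lem = solve-∀ ℚ-ring
  H-bound (suc x) h = close (diff (H-bound x (ℕ.≤-trans (ℕ.n≤1+n _) h)) ⊕ diff (ℓ-step-lower x h) ⊕ diff (inv-anti x (suc (suc x)) (ℕ.n≤1+n _)))
   (lem (H (suc x)) (ℓ (suc x)) (ℓ (suc (suc x))) (inv (suc x)) (inv (suc (suc x))))
   where
   lem : ∀ h l l′ i j → 1ℚ + ι 6 * l - h + (ι 6 * (l′ - l) - i) + (i - j) ≡ 1ℚ + ι 6 * l′ - (h + j)
   lem = solve-∀ ℚ-ring

  H-mono : ∀ {x y} → x ℕ.≤ y → H x ≤ H y
  H-mono h = ∑-mono-range inv h (λ i _ → 0≤inv (suc i))

  module _ {a b : ℕ} (ua : Unit a) (ub : Unit b) where

   δ-nonunit : ∀ k n → ¬ Unit k → δ a b k n ≡ 0ℚ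
   δ-nonunit k n ¬u = cong₂ _-_ (𝟙-no (k ℕ.* n ≈? a) (λ h → ¬u (Unit-*ˡ {k} {n} (Unit-≈ (≈-sym h) ua)))) (𝟙-no (k ℕ.* n ≈? b) (λ h → ¬u (Unit-*ˡ {k} {n} (Unit-≈ (≈-sym h) ub))))

   -- For a unit k the products k n run through all classes and the two indicators cancel over a
   -- period. For other k neither indicator can hold, since a and b are units.
   δ-∑ : ∀ k y → ∣ ∑ y (δ a b k) ∣ ≤ ι N
   δ-∑ k y = subst (∣ ∑ y (δ a b k) ∣ ≤_) (*-identityʳ (ι N)) (∑-periodic-bound (δ a b k) 1ℚ
    (λ {m} {n} h → cong₂ _-_ (𝟙-cong (k ℕ.* m ≈? a) (k ℕ.* n ≈? a) (≈-trans (≈-*ˡ k (≈-sym h))) (≈-trans (≈-*ˡ k h)))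
                (𝟙-cong (k ℕ.* m ≈? b) (k ℕ.* n ≈? b) (≈-trans (≈-*ˡ k (≈-sym h))) (≈-trans (≈-*ˡ k h))))
    (zero-sum (unit? k)) bound y)
    where
    zero-sum : Dec (Unit k) → ∑ N (δ a b k) ≡ 0ℚ
    zero-sum (yes u) = trans (∑-- N (λ n → 𝟙 (k ℕ.* n ≈? a)) (λ n → 𝟙 (k ℕ.* n ≈? b))) (trans (cong₂ _-_ (∑-*≈ k u a) (∑-*≈ k u b)) (+-inverseʳ 1ℚ))
    zero-sum (no ¬u) = ∑-zero N (λ n _ → δ-nonunit k (suc n) ¬u)
    bound : ∀ n → ∣ δ a b k n ∣ ≤ 1ℚ
    bound n = ∣∣≤ (close (0≤𝟙 (k ℕ.* n ≈? a) ⊕ diff (𝟙≤1 (k ℕ.* n ≈? b))) (lem (𝟙 (k ℕ.* n ≈? a)) (𝟙 (k ℕ.* n ≈? b))))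
           (close (0≤𝟙 (k ℕ.* n ≈? b) ⊕ diff (𝟙≤1 (k ℕ.* n ≈? a))) (lem′ (𝟙 (k ℕ.* n ≈? a)) (𝟙 (k ℕ.* n ≈? b))))
     where
     lem : ∀ x y → x + (1ℚ - y) ≡ x - y - - 1ℚ
     lem = solve-∀ ℚ-ring
     lem′ : ∀ x y → y + (1ℚ - x) ≡ 1ℚ - (x - y)
     lem′ = solve-∀ ℚ-ring

   private
    -- ℓ²/n is not monotone, so Abel summation runs against a potential of the same shape. The
    -- lower-order coefficients 4 and 6 are large enough for its decrease to dominate both signs of
    -- the variation, given only 0 ≤ ℓ(n+1) - ℓ(n) ≤ 1/n. Its first value 6 is the constant in the
    -- bounds that follow.
    h F : ℕ → ℚ
    h m = ℓ m * ℓ m * inv m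
    F m = (ℓ m * ℓ m + ι 4 * ℓ m + ι 6) * inv m

    F-1 : F 1 ≡ ι 6
    F-1 = trans (cong₂ (λ s t → (s * s + ι 4 * s + ι 6) * t) ℓ-1 inv-1) refl

    variation : ∀ n → suc (suc n) ℕ.≤ X → ∣ h (suc (suc n)) - h (suc n) ∣ ≤ F (suc n) - F (suc (suc n))
    variation n b = ∣∣≤
     (close (0≤j ⊗ (0≤ι 4 ⊗ (0≤l ⊗ 0≤i) ⊕ 0≤ι 2 ⊗ 0≤i ⊕ 0≤ι 4 ⊗ i-δ)) (trans (lem i j l l′) (trans (cong (λ t → t * (ι 4 * l + ι 6) + j * (ι 4 * l - ι 4 * l′)) (sym (inv-step n))) (lem₂ i j l l′))))
     (close (0≤j ⊗ (0≤ι 2 ⊗ (0≤l ⊗ 0≤l ⊗ 0≤i) ⊕ 0≤ι 4 ⊗ (0≤l ⊗ i-δ) ⊕ 0≤ι 6 ⊗ i-δ ⊕ 0≤ι 2 ⊗ (0≤δ ⊗ (diff (inv≤1 (suc n)) ⊕ i-δ))))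
      (trans (lem₃ i j l l′) (trans (cong (λ t → t * (ι 2 * (l * l) + ι 4 * l + ι 6) + j * (ι 2 * (l * l) - ι 2 * (l′ * l′) + ι 4 * l - ι 4 * l′)) (sym (inv-step n))) (lem₄ i j l l′))))
     where
     i = inv (suc n)
     j = inv (suc (suc n))
     l = ℓ (suc n)
     l′ = ℓ (suc (suc n))
     0≤i = 0≤inv (suc n)
     0≤j = 0≤inv (suc (suc n))
     0≤l = 0≤ℓ (suc n)
     0≤δ = diff (ℓ-step-mono n b)
     i-δ = diff (ℓ-step-upper n b)
     lem : ∀ i j l l′ → j * (ι 4 * (l * i) + ι 2 * i + ι 4 * (i - (l′ - l))) ≡ i * j * (ι 4 * l + ι 6) + j * (ι 4 * l - ι 4 * l′)
     lem = solve-∀ ℚ-ring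
     lem₂ : ∀ i j l l′ → (i - j) * (ι 4 * l + ι 6) + j * (ι 4 * l - ι 4 * l′) ≡ l′ * l′ * j - l * l * i - - ((l * l + ι 4 * l + ι 6) * i - (l′ * l′ + ι 4 * l′ + ι 6) * j)
     lem₂ = solve-∀ ℚ-ring
     lem₃ : ∀ i j l l′ → j * (ι 2 * (l * l * i) + ι 4 * (l * (i - (l′ - l))) + ι 6 * (i - (l′ - l)) + ι 2 * ((l′ - l) * (1ℚ - i + (i - (l′ - l)))))
      ≡ i * j * (ι 2 * (l * l) + ι 4 * l + ι 6) + j * (ι 2 * (l * l) - ι 2 * (l′ * l′) + ι 4 * l - ι 4 * l′)
     lem₃ = solve-∀ ℚ-ring
     lem₄ : ∀ i j l l′ → (i - j) * (ι 2 * (l * l) + ι 4 * l + ι 6) + j * (ι 2 * (l * l) - ι 2 * (l′ * l′) + ι 4 * l - ι 4 * l′)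
      ≡ (l * l + ι 4 * l + ι 6) * i - (l′ * l′ + ι 4 * l′ + ι 6) * j - (l′ * l′ * j - l * l * i)
     lem₄ = solve-∀ ℚ-ring

    inner : ∀ k y → y ℕ.≤ X → ∣ ∑ y (λ m → δ a b k m * h m) ∣ ≤ ι N * ι 6
    inner k zero _ = 0≤ι N ⊗ 0≤ι 6
    inner k (suc y) y≤X = subst (λ t → ∣ ∑ (suc y) (λ m → δ a b k m * h m) ∣ ≤ ι N * t) F-1
     (abel (δ a b k) h F (ι N) y (λ k′ _ → δ-∑ k k′) (λ n b → variation n (ℕ.≤-trans b y≤X))
      (0≤⇒∣∣ (0≤ℓ (suc y) ⊗ 0≤ℓ (suc y) ⊗ 0≤inv (suc y)) (close ((0≤ι 4 ⊗ 0≤ℓ (suc y) ⊕ 0≤ι 6) ⊗ 0≤inv (suc y)) (lem (ℓ (suc y)) (inv (suc y))))))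
     where
     lem : ∀ l i → (ι 4 * l + ι 6) * i ≡ (l * l + ι 4 * l + ι 6) * i - l * l * i
     lem = solve-∀ ℚ-ring

   -- In Λ₂ = μ ⋆ ℓ² the inner sums of ℓ²/m against the difference of two classes are bounded
   -- outright, and |μ| ≤ 1 then costs only the harmonic sum. The error is of order log y, whereas
   -- the sums compared are of order log² y.
   Λ₂-equidistributed : ∀ k y → y ℕ.≤ X → ∣ ∑ y (λ n → δ a b k n * (Λ₂ n * inv n)) ∣ ≤ ι N * ι 6 * H y
   Λ₂-equidistributed k y y≤X = begin
    ∣ ∑ y (λ n → δ a b k n * (Λ₂ n * inv n)) ∣
     ≡⟨ cong ∣_∣ (trans (∑-cong y (λ n b′ → trans (lem (δ a b k (suc n)) (Λ₂ (suc n)) (inv (suc n))) (cong (_* (δ a b k (suc n) * inv (suc n))) (sym (μ⋆ℓ² n (ℕ.≤-trans b′ y≤X))))))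
       (trans (∑-⋆ μ (λ i → ℓ i * ℓ i) (λ n → δ a b k n * inv n) y y≤X) (∑-ext y term))) ⟩
    ∣ ∑ y (λ d → μ d * inv d * ∑ (y ÷ d) (λ m → δ a b (k ℕ.* d) m * h m)) ∣
     ≤⟨ ∑-abs-≤ y (λ d _ → ∣∣-mul (∣∣-mul (∣μ∣≤1 (suc d)) (0≤⇒∣∣ (0≤inv (suc d)) ≤-refl)) (inner (k ℕ.* suc d) (y ÷ suc d) (ℕ.≤-trans (÷-≤ y (suc d)) y≤X))) ⟩
    ∑ y (λ d → 1ℚ * inv d * (ι N * ι 6))
     ≡⟨ trans (∑-ext y (λ d → lem′ (inv d) (ι N * ι 6))) (∑-*ˡ y (ι N * ι 6) inv) ⟩
    ι N * ι 6 * H y ∎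
    where
    open ≤-Reasoning
    lem : ∀ a b c → a * (b * c) ≡ b * (a * c)
    lem = solve-∀ ℚ-ring
    lem′ : ∀ a b → 1ℚ * a * b ≡ b * a
    lem′ = solve-∀ ℚ-ring
    lem″ : ∀ a l i j → l * l * (a * (i * j)) ≡ i * (a * (l * l * j))
    lem″ = solve-∀ ℚ-ring
    term : ∀ d → μ d * ∑ (y ÷ d) (λ m → ℓ m * ℓ m * (δ a b k (d ℕ.* m) * inv (d ℕ.* m))) ≡ μ d * inv d * ∑ (y ÷ d) (λ m → δ a b (k ℕ.* d) m * h m)
    term d = trans (cong (μ d *_) (trans (∑-ext (y ÷ d) (λ m → trans (cong₂ (λ s t → ℓ m * ℓ m * (s * t))
      (cong (λ t → 𝟙 (t ≈? a) - 𝟙 (t ≈? b)) (sym (ℕ.*-assoc k d m))) (inv-* d m)) (lem″ (δ a b (k ℕ.* d) m) (ℓ m) (inv d) (inv m))))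
      (∑-*ˡ (y ÷ d) (inv d) (λ m → δ a b (k ℕ.* d) m * h m)))) (sym (*-assoc (μ d) (inv d) _))

  class-sum : ∀ x (φ : ℕ → ℚ) → ∑ N (λ b → e b * ∑ x (λ n → 𝟙 (n ≈? b) * φ n)) ≡ ∑ x (λ n → e n * φ n)
  class-sum x φ = begin
   ∑ N (λ b → e b * ∑ x (λ n → 𝟙 (n ≈? b) * φ n)) ≡⟨ ∑-ext N (λ b → trans (sym (∑-*ˡ x (e b) (λ n → 𝟙 (n ≈? b) * φ n))) (∑-ext x (λ n → trans (lem (e b) (𝟙 (n ≈? b)) (φ n)) (cong (λ t → t * e b * φ n) (𝟙-cong (n ≈? b) (b ≈? n) ≈-sym ≈-sym))))) ⟩
   ∑ N (λ b → ∑ x (λ n → 𝟙 (b ≈? n) * e b * φ n)) ≡⟨ ∑-swap N x _ ⟩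
   ∑ x (λ n → ∑ N (λ b → 𝟙 (b ≈? n) * e b * φ n)) ≡⟨ ∑-ext x (λ n → trans (∑-*ʳ N (φ n) (λ b → 𝟙 (b ≈? n) * e b)) (cong (_* φ n) (∑-≈-pick e e-≈ n))) ⟩
   ∑ x (λ n → e n * φ n) ∎
   where
   open ≡-Reasoning
   lem : ∀ a b c → a * (b * c) ≡ b * a * c
   lem = solve-∀ ℚ-ring

  ∑-δ : ∀ a b x (φ : ℕ → ℚ) → ∑ x (λ n → δ a b 1 n * φ n) ≡ ∑ x (λ n → 𝟙 (n ≈? a) * φ n) - ∑ x (λ n → 𝟙 (n ≈? b) * φ n)
  ∑-δ a b x φ = trans (∑-ext x (λ n → trans (cong (λ t → (𝟙 (t ≈? a) - 𝟙 (t ≈? b)) * φ n) (ℕ.*-identityˡ n)) (lem (𝟙 (n ≈? a)) (𝟙 (n ≈? b)) (φ n)))) (∑-- x _ _)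
   where
   lem : ∀ a b c → (a - b) * c ≡ a * c - b * c
   lem = solve-∀ ℚ-ring

  average-≤ : ∀ x (φ : ℕ → ℚ) E a → (∀ b → Unit b → ∑ x (λ n → 𝟙 (n ≈? a) * φ n) ≤ ∑ x (λ n → 𝟙 (n ≈? b) * φ n) + E) →
   Φ * ∑ x (λ n → 𝟙 (n ≈? a) * φ n) ≤ ∑ x (λ n → e n * φ n) + Φ * E
  average-≤ x φ E a h = begin
   Φ * T a ≡⟨ ∑-*ʳ N (T a) e ⟨
   ∑ N (λ b → e b * T a) ≤⟨ ∑-mono N (λ b _ → 𝟙-guard-≤ (unit? (suc b)) (h (suc b))) ⟩
   ∑ N (λ b → e b * (T b + E)) ≡⟨ trans (∑-ext N (λ b → *-distribˡ-+ (e b) (T b) E)) (∑-+ N (λ b → e b * T b) (λ b → e b * E)) ⟩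
   ∑ N (λ b → e b * T b) + ∑ N (λ b → e b * E) ≡⟨ cong₂ _+_ (class-sum x φ) (∑-*ʳ N E e) ⟩
   ∑ x (λ n → e n * φ n) + Φ * E ∎
   where
   open ≤-Reasoning
   T : ℕ → ℚ
   T b = ∑ x (λ n → 𝟙 (n ≈? b) * φ n)

  average-≥ : ∀ x (φ : ℕ → ℚ) E a → (∀ b → Unit b → ∑ x (λ n → 𝟙 (n ≈? b) * φ n) ≤ ∑ x (λ n → 𝟙 (n ≈? a) * φ n) + E) →
   ∑ x (λ n → e n * φ n) ≤ Φ * (∑ x (λ n → 𝟙 (n ≈? a) * φ n) + E)
  average-≥ x φ E a h = begin
   ∑ x (λ n → e n * φ n) ≡⟨ class-sum x φ ⟨
   ∑ N (λ b → e b * T b) ≤⟨ ∑-mono N (λ b _ → 𝟙-guard-≤ (unit? (suc b)) (h (suc b))) ⟩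
   ∑ N (λ b → e b * (T a + E)) ≡⟨ ∑-*ʳ N (T a + E) e ⟩
   Φ * (T a + E) ∎
   where
   open ≤-Reasoning
   T : ℕ → ℚ
   T b = ∑ x (λ n → 𝟙 (n ≈? b) * φ n)

  ∑-e-⋆ : ∀ g x → x ℕ.≤ X → ∑ x (λ n → e n * ((Λ ⋆ g) n * inv n)) ≡ ∑ x (λ d → α d * ∑ (x ÷ d) (λ m → e m * (g m * inv m)))
  ∑-e-⋆ g x h = trans (∑-ext x (λ n → lem (e n) ((Λ ⋆ g) n) (inv n))) (trans (∑-⋆ Λ g (λ n → e n * inv n) x h)
   (∑-ext x (λ d → trans (cong (Λ d *_) (trans (∑-ext (x ÷ d) (λ m → trans (cong₂ (λ s t → g m * (s * t)) (e-* d m) (inv-* d m)) (lem′ (g m) (e d) (e m) (inv d) (inv m)))) (∑-*ˡ (x ÷ d) (e d * inv d) (λ m → e m * (g m * inv m)))))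
    (lem″ (Λ d) (e d) (inv d) (∑ (x ÷ d) (λ m → e m * (g m * inv m)))))))
   where
   lem : ∀ a b c → a * (b * c) ≡ b * (a * c)
   lem = solve-∀ ℚ-ring
   lem′ : ∀ g a b i j → g * (a * b * (i * j)) ≡ a * i * (b * (g * j))
   lem′ = solve-∀ ℚ-ring
   lem″ : ∀ a b c d → a * (b * c * d) ≡ a * b * c * d
   lem″ = solve-∀ ℚ-ring

  ∑-eΛ : ∀ x → ∑ x (λ m → e m * (Λ m * inv m)) ≡ M x
  ∑-eΛ x = ∑-ext x (λ m → lem (e m) (Λ m) (inv m))
   where
   lem : ∀ a b c → a * (b * c) ≡ b * a * c
   lem = solve-∀ ℚ-ring

  module _ (x′ : ℕ) (x≤X : suc x′ ℕ.≤ X) where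

   private
    x = suc x′
    u = ℓ x

   -- The total is Σ α(d) (ℓ d + M(x/d)); inserting M(x/d) ≤ u - ℓ d + C cancels ℓ d and leaves M(x)
   -- (u + C).
   Λ₂-total : ∑ x (λ n → e n * (Λ₂ n * inv n)) ≤ (u + C) * (u + C)
   Λ₂-total = begin
    ∑ x (λ n → e n * (Λ₂ n * inv n))
     ≡⟨ trans (∑-ext x (λ n → lem (e n) (Λ n) (ℓ n) ((Λ ⋆ Λ) n) (inv n))) (∑-+ x (λ n → α n * ℓ n) (λ n → e n * ((Λ ⋆ Λ) n * inv n))) ⟩
    ∑ x (λ n → α n * ℓ n) + ∑ x (λ n → e n * ((Λ ⋆ Λ) n * inv n))
     ≡⟨ cong (∑ x (λ n → α n * ℓ n) +_) (trans (∑-e-⋆ Λ x x≤X) (∑-ext x (λ d → cong (α d *_) (∑-eΛ (x ÷ d))))) ⟩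
    ∑ x (λ n → α n * ℓ n) + ∑ x (λ d → α d * M (x ÷ d))
     ≤⟨ +-monoʳ-≤ (∑ x (λ n → α n * ℓ n)) (∑-mono x (λ d b → *-monoˡ (α (suc d)) (0≤α (suc d)) (M-÷ x′ d b x≤X))) ⟩
    ∑ x (λ n → α n * ℓ n) + ∑ x (λ d → α d * (u - ℓ d + C))
     ≡⟨ trans (sym (∑-+ x (λ n → α n * ℓ n) (λ d → α d * (u - ℓ d + C)))) (trans (∑-ext x (λ n → lem′ (α n) (ℓ n) u C)) (∑-*ʳ x (u + C) α)) ⟩
    M x * (u + C)
     ≤⟨ *-monoʳ (u + C) (0≤ℓ x ⊕ 0≤C) (M-upper x′ x≤X) ⟩
    (u + C) * (u + C) ∎
    where
    open ≤-Reasoning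
    lem : ∀ a b c d i → a * ((b * c + d) * i) ≡ b * a * i * c + a * (d * i)
    lem = solve-∀ ℚ-ring
    lem′ : ∀ a l u c → a * l + a * (u - l + c) ≡ a * (u + c)
    lem′ = solve-∀ ℚ-ring

   -- Λ ℓ is at most Λ₂, whose total u² spreads evenly. So a class holds at most about u²/Φ, which
   -- is twice the fair share u²/(2Φ) of Λ ℓ; primes cannot crowd into fewer than half of the
   -- classes.
   σ-upper : ∀ a → Unit a → Φ * ∑ x (λ n → 𝟙 (n ≈? a) * (Λℓ n * inv n)) ≤ (u + C) * (u + C) + Φ * (ι N * ι 6 * H x)
   σ-upper a ua = begin
    Φ * ∑ x (λ n → 𝟙 (n ≈? a) * (Λℓ n * inv n))
     ≤⟨ *-monoˡ Φ 0≤Φ (∑-mono x (λ n _ → *-monoˡ (𝟙 (suc n ≈? a)) (0≤𝟙 (suc n ≈? a)) (*-monoʳ {Λℓ (suc n)} {Λ₂ (suc n)} (inv (suc n)) (0≤inv (suc n)) (close (0≤Λ⋆Λ (suc n)) (lem (Λℓ (suc n)) ((Λ ⋆ Λ) (suc n))))))) ⟩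
    Φ * ∑ x (λ n → 𝟙 (n ≈? a) * (Λ₂ n * inv n))
     ≤⟨ average-≤ x (λ n → Λ₂ n * inv n) (ι N * ι 6 * H x) a (λ b ub → close (diff (∣∣⇒≤ (subst (λ t → ∣ t ∣ ≤ ι N * ι 6 * H x) (∑-δ a b x (λ n → Λ₂ n * inv n)) (Λ₂-equidistributed ua ub 1 x x≤X))))
       (lem′ (∑ x (λ n → 𝟙 (n ≈? a) * (Λ₂ n * inv n))) (∑ x (λ n → 𝟙 (n ≈? b) * (Λ₂ n * inv n))) (ι N * ι 6 * H x))) ⟩
    ∑ x (λ n → e n * (Λ₂ n * inv n)) + Φ * (ι N * ι 6 * H x)
     ≤⟨ +-monoˡ-≤ (Φ * (ι N * ι 6 * H x)) Λ₂-total ⟩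
    (u + C) * (u + C) + Φ * (ι N * ι 6 * H x) ∎
    where
    open ≤-Reasoning
    lem : ∀ a b → b ≡ a + b - a
    lem = solve-∀ ℚ-ring
    lem′ : ∀ a b c → c - (a - b) ≡ b + c - a
    lem′ = solve-∀ ℚ-ring

-- Products of three primes in residue classes.

module Triple where

 open Base
 open Conv
 open Selberg
 open Periodic
 open import Data.Rational using (ℚ; 0ℚ; 1ℚ; _+_; _*_; _-_; -_; _≤_; ∣_∣)
 open import Data.Rational.Properties
 open import Tactic.RingSolver using (solve-∀)

 module TripleProducts (X′ N′ : ℕ) where

  open SelbergFormula X′ N′ public

  -- Λ ℓ² - 2 Λ⋆Λ⋆Λ; its class sums are equidistributed because it equals
  -- Λ₂ ℓ - 2 Λ⋆Λ₂, and its total is O(u²).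
  W : ℕ → ℚ
  W n = Λℓ n * ℓ n - ι 2 * Λ₃ n

  -- The derivation `ℓ` turns (Λ ⋆ Λ) ℓ into 2 (Λ ⋆ Λℓ), and these mixed terms cancel against those
  -- of 2 (Λ ⋆ Λ₂).
  W-Λ₂ : ∀ n → W (suc n) ≡ Λ₂ (suc n) * ℓ (suc n) - ι 2 * (Λ ⋆ Λ₂) (suc n)
  W-Λ₂ n = sym (begin
   Λ₂ (suc n) * l - ι 2 * (Λ ⋆ Λ₂) (suc n)
    ≡⟨ cong (λ t → Λ₂ (suc n) * l - ι 2 * t) (⋆-distribˡ Λ Λℓ (Λ ⋆ Λ) (suc n)) ⟩
   Λ₂ (suc n) * l - ι 2 * (D + Λ₃ (suc n))
    ≡⟨ cong (λ t → t - ι 2 * (D + Λ₃ (suc n))) (trans (*-distribʳ-+ l (Λℓ (suc n)) ((Λ ⋆ Λ) (suc n))) (cong (Λℓ (suc n) * l +_)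
      (trans (⋆-derivation ℓ Λ Λ (suc n) (λ { d m refl → ℓ-* d m })) (cong (_+ D) (⋆-comm Λℓ Λ (suc n)))))) ⟩
   Λℓ (suc n) * l + (D + D) - ι 2 * (D + Λ₃ (suc n))
    ≡⟨ lem (Λℓ (suc n) * l) D (Λ₃ (suc n)) ⟩
   Λℓ (suc n) * l - ι 2 * Λ₃ (suc n) ∎)
   where
   open ≡-Reasoning
   l = ℓ (suc n)
   D = (Λ ⋆ Λℓ) (suc n)
   lem : ∀ a d t → a + (d + d) - ι 2 * (d + t) ≡ a - ι 2 * t
   lem = solve-∀ ℚ-ring

  module _ (x′ : ℕ) (x≤X : suc x′ ℕ.≤ X) where

   private
    x = suc x′
    u = ℓ x
    K = ι N * ι 6 * H x
    0≤K : 0ℚ ≤ K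
    0≤K = 0≤ι N ⊗ 0≤ι 6 ⊗ 0≤H x
    0≤u = 0≤ℓ x

   E Q : ℚ
   E = K * (u + u) + ι 2 * (K * (u + C))
   Q = ι 13 * C * u * u + ι 10 * C * C * u + ι 2 * C * C * C

   private
    module _ {a b : ℕ} (ua : Unit a) (ub : Unit b) where

     partA : ∣ ∑ x (λ n → δ a b 1 n * (Λ₂ n * inv n) * ℓ n) ∣ ≤ K * (u + u)
     partA = abel-increasing (λ n → δ a b 1 n * (Λ₂ n * inv n)) ℓ K x′
      (λ k k≤x → ≤-trans (Λ₂-equidistributed ua ub 1 k (ℕ.≤-trans k≤x x≤X)) (*-monoˡ (ι N * ι 6) (0≤ι N ⊗ 0≤ι 6) (H-mono k≤x)))
      0≤ℓ (λ n h → ℓ-step-mono n (ℕ.≤-trans h x≤X))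

     S : ℕ → ℚ
     S d = ∑ (x ÷ d) (λ m → δ a b d m * (Λ₂ m * inv m))

     S-bound : ∀ d → ∣ S d ∣ ≤ e d * K
     S-bound d = go (unit? d)
      where
      go : (dec : Dec (Unit d)) → ∣ S d ∣ ≤ 𝟙 dec * K
      go (yes _) = subst (∣ S d ∣ ≤_) (sym (*-identityˡ K)) (≤-trans (Λ₂-equidistributed ua ub d (x ÷ d) (ℕ.≤-trans (÷-≤ x d) x≤X)) (*-monoˡ (ι N * ι 6) (0≤ι N ⊗ 0≤ι 6) (H-mono (÷-≤ x d))))
      go (no ¬u) = ≤-reflexive (trans (cong ∣_∣ (∑-zero (x ÷ d) (λ m _ → trans (cong (_* (Λ₂ (suc m) * inv (suc m))) (δ-nonunit ua ub d (suc m) ¬u)) (*-zeroˡ (Λ₂ (suc m) * inv (suc m)))))) (sym (*-zeroˡ K)))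

     partB : ∣ ∑ x (λ n → δ a b 1 n * ((Λ ⋆ Λ₂) n * inv n)) ∣ ≤ K * (u + C)
     partB = begin
      ∣ ∑ x (λ n → δ a b 1 n * ((Λ ⋆ Λ₂) n * inv n)) ∣
       ≡⟨ cong ∣_∣ (trans (∑-ext x (λ n → lem (δ a b 1 n) ((Λ ⋆ Λ₂) n) (inv n))) (trans (∑-⋆ Λ Λ₂ (λ n → δ a b 1 n * inv n) x x≤X) (∑-ext x term))) ⟩
      ∣ ∑ x (λ d → Λ d * inv d * S d) ∣
       ≤⟨ ∑-abs-≤ x {g = λ d → Λ d * inv d * (e d * K)} (λ d _ → ∣∣-mul (0≤⇒∣∣ (0≤Λ (suc d) ⊗ 0≤inv (suc d)) ≤-refl) (S-bound (suc d))) ⟩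
      ∑ x (λ d → Λ d * inv d * (e d * K))
       ≡⟨ trans (∑-ext x (λ d → lem′ (Λ d) (inv d) (e d) K)) (∑-*ˡ x K α) ⟩
      K * M x
       ≤⟨ *-monoˡ K 0≤K (M-upper x′ x≤X) ⟩
      K * (u + C) ∎
      where
      open ≤-Reasoning
      lem : ∀ a b c → a * (b * c) ≡ b * (a * c)
      lem = solve-∀ ℚ-ring
      lem′ : ∀ a b c d → a * b * (c * d) ≡ d * (a * c * b)
      lem′ = solve-∀ ℚ-ring
      lem″ : ∀ l a i j → l * (a * (i * j)) ≡ i * (a * (l * j))
      lem″ = solve-∀ ℚ-ring
      term : ∀ d → Λ d * ∑ (x ÷ d) (λ m → Λ₂ m * (δ a b 1 (d ℕ.* m) * inv (d ℕ.* m))) ≡ Λ d * inv d * S d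
      term d = trans (cong (Λ d *_) (trans (∑-ext (x ÷ d) (λ m → trans (cong₂ (λ s t → Λ₂ m * (s * t)) (cong (λ t → 𝟙 (t ≈? a) - 𝟙 (t ≈? b)) (ℕ.*-identityˡ (d ℕ.* m))) (inv-* d m))
        (lem″ (Λ₂ m) (δ a b d m) (inv d) (inv m)))) (∑-*ˡ (x ÷ d) (inv d) (λ m → δ a b d m * (Λ₂ m * inv m))))) (sym (*-assoc (Λ d) (inv d) (S d)))

     W-difference : ∣ ∑ x (λ n → 𝟙 (n ≈? a) * (W n * inv n)) - ∑ x (λ n → 𝟙 (n ≈? b) * (W n * inv n)) ∣ ≤ E
     W-difference = subst (λ t → ∣ t ∣ ≤ E) (sym (trans (sym (∑-δ a b x (λ n → W n * inv n))) split))
      (≤-trans (∣p-q∣≤∣p∣+∣q∣ A (ι 2 * B)) (+-mono-≤ partA (∣∣-mul (0≤⇒∣∣ (0≤ι 2) ≤-refl) partB)))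
      where
      A = ∑ x (λ n → δ a b 1 n * (Λ₂ n * inv n) * ℓ n)
      B = ∑ x (λ n → δ a b 1 n * ((Λ ⋆ Λ₂) n * inv n))
      lem : ∀ g l i λ₂ t → g * ((λ₂ * l - ι 2 * t) * i) ≡ g * (λ₂ * i) * l - ι 2 * (g * (t * i))
      lem = solve-∀ ℚ-ring
      split : ∑ x (λ n → δ a b 1 n * (W n * inv n)) ≡ A - ι 2 * B
      split = trans (∑-cong x (λ n _ → trans (cong (λ t → δ a b 1 (suc n) * (t * inv (suc n))) (W-Λ₂ n)) (lem (δ a b 1 (suc n)) (ℓ (suc n)) (inv (suc n)) (Λ₂ (suc n)) ((Λ ⋆ Λ₂) (suc n)))))
       (trans (∑-- x _ _) (cong (λ t → A - t) (∑-*ˡ x (ι 2) _)))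

    R : ℕ → ℚ
    R y = ∑ y (λ m → e m * ((Λ ⋆ Λ) m * inv m))

    -- From M(y/d) ≤ w - ℓ d + C and `σ-lower`: the total of Λ ⋆ Λ is at most w²/2 up to terms
    -- linear in w.
    R-bound : ∀ y → suc y ℕ.≤ X → ι 2 * R (suc y) ≤ ℓ (suc y) * ℓ (suc y) + ι 8 * C * ℓ (suc y) + ι 2 * C * C
    R-bound y y≤X = begin
     ι 2 * R (suc y)
      ≡⟨ cong (ι 2 *_) (trans (∑-e-⋆ Λ (suc y) y≤X) (∑-ext (suc y) (λ d → cong (α d *_) (∑-eΛ (suc y ÷ d))))) ⟩
     ι 2 * ∑ (suc y) (λ d → α d * M (suc y ÷ d))
      ≤⟨ *-monoˡ (ι 2) (0≤ι 2) (∑-mono (suc y) (λ d b → *-monoˡ (α (suc d)) (0≤α (suc d)) (M-÷ y d b y≤X))) ⟩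
     ι 2 * ∑ (suc y) (λ d → α d * (w - ℓ d + C))
      ≡⟨ cong (ι 2 *_) (trans (∑-ext (suc y) (λ d → lem (α d) (ℓ d) w C)) (trans (∑-- (suc y) _ _) (cong (_- σ) (∑-*ʳ (suc y) (w + C) α)))) ⟩
     ι 2 * (M (suc y) * (w + C) - σ)
      ≤⟨ close (0≤ι 2 ⊗ (diff (M-upper y y≤X) ⊗ (0≤ℓ (suc y) ⊕ 0≤C)) ⊕ diff (σ-lower y y≤X)) (lem′ (M (suc y)) w C σ) ⟩
     w * w + ι 8 * C * w + ι 2 * C * C ∎
     where
     open ≤-Reasoning
     w = ℓ (suc y)
     σ = ∑ (suc y) (λ d → α d * ℓ d)
     lem : ∀ a l w c → a * (w - l + c) ≡ a * (w + c) - a * l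
     lem = solve-∀ ℚ-ring
     lem′ : ∀ m w c s → ι 2 * ((w + c - m) * (w + c)) + (ι 2 * s - (w - ι 4 * c) * w) ≡ w * w + ι 8 * c * w + ι 2 * c * c - ι 2 * (m * (w + c) - s)
     lem′ = solve-∀ ℚ-ring

    B : ℕ → ℚ
    B d = (u - ℓ d) * (u - ℓ d) + (ι 8 * C * u + ι 2 * C * C)

    R-÷ : ∀ d → suc d ℕ.≤ x → ι 2 * R (x ÷ suc d) ≤ B (suc d)
    R-÷ d d≤x with x ÷ suc d | ÷-upper x d 1 (subst (ℕ._≤ x) (sym (ℕ.*-identityʳ (suc d))) d≤x) | ÷-≤ x (suc d) | ℓ-÷ x′ d d≤x x≤X
    ... | suc y | _ | y≤x | h = ≤-trans (R-bound y (ℕ.≤-trans y≤x x≤X))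
     (close (diff h ⊗ (0≤ℓ (suc y) ⊕ 0≤ℓ (suc y) ⊕ diff h) ⊕ 0≤ι 8 ⊗ 0≤C ⊗ (diff h ⊕ 0≤ℓ (suc d))) (lem (ℓ (suc y)) u (ℓ (suc d)) C))
     where
     lem : ∀ w u l c → (u - l - w) * (w + w + (u - l - w)) + ι 8 * c * (u - l - w + l) ≡ (u - l) * (u - l) + (ι 8 * c * u + ι 2 * c * c) - (w * w + ι 8 * c * w + ι 2 * c * c)
     lem = solve-∀ ℚ-ring

    -- Since ℓ² - (u - ℓ)² = 2 u ℓ - u², the main part is 2 u Σ α ℓ - u² Σ α. With Σ α ℓ at least
    -- u²/2 and Σ α at most u, up to errors of order C, the cubic terms cancel.
    W-total : - Q ≤ ∑ x (λ n → e n * (W n * inv n))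
    W-total = begin
     - Q
      ≤⟨ close (0≤u ⊗ diff (σ-lower x′ x≤X) ⊕ (0≤u ⊗ 0≤u ⊕ 0≤ι 8 ⊗ 0≤C ⊗ 0≤u ⊕ 0≤ι 2 ⊗ 0≤C ⊗ 0≤C) ⊗ diff (M-upper x′ x≤X)) (lem (M x) u C (∑ x (λ n → α n * ℓ n))) ⟩
     ι 2 * u * ∑ x (λ n → α n * ℓ n) - (u * u + ι 8 * C * u + ι 2 * C * C) * M x
      ≡⟨ sym (trans (∑-ext x (λ n → lem₁ (α n) (ℓ n) u C)) (trans (∑-- x _ _) (cong₂ _-_ (∑-*ˡ x (ι 2 * u) _) (∑-*ˡ x (u * u + ι 8 * C * u + ι 2 * C * C) α)))) ⟩
     ∑ x (λ n → α n * (ℓ n * ℓ n) - α n * B n)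
      ≤⟨ ∑-mono x (λ n b → close (0≤α (suc n) ⊗ diff (R-÷ n b)) (lem₂ (α (suc n)) (ℓ (suc n)) (B (suc n)) (ι 2 * R (x ÷ suc n)))) ⟩
     ∑ x (λ n → α n * (ℓ n * ℓ n) - α n * (ι 2 * R (x ÷ n)))
      ≡⟨ trans (∑-- x _ _) (cong₂ _-_ (∑-ext x (λ n → lem₃ (Λ n) (e n) (inv n) (ℓ n))) (trans (∑-ext x (λ n → lem₄ (α n) (R (x ÷ n)))) (∑-*ˡ x (ι 2) (λ n → α n * R (x ÷ n))))) ⟩
     ∑ x (λ n → e n * (Λℓ n * ℓ n * inv n)) - ι 2 * ∑ x (λ n → α n * R (x ÷ n))
      ≡⟨ cong (λ t → ∑ x (λ n → e n * (Λℓ n * ℓ n * inv n)) - ι 2 * t) (sym (∑-e-⋆ (Λ ⋆ Λ) x x≤X)) ⟩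
     ∑ x (λ n → e n * (Λℓ n * ℓ n * inv n)) - ι 2 * ∑ x (λ n → e n * (Λ₃ n * inv n))
      ≡⟨ sym (trans (∑-ext x (λ n → lem₅ (e n) (Λℓ n * ℓ n) (Λ₃ n) (inv n))) (trans (∑-- x _ _) (cong (λ t → ∑ x (λ n → e n * (Λℓ n * ℓ n * inv n)) - t) (∑-*ˡ x (ι 2) _)))) ⟩
     ∑ x (λ n → e n * (W n * inv n)) ∎
     where
     open ≤-Reasoning
     lem : ∀ m u c s → u * (ι 2 * s - (u - ι 4 * c) * u) + (u * u + ι 8 * c * u + ι 2 * c * c) * (u + c - m)
      ≡ ι 2 * u * s - (u * u + ι 8 * c * u + ι 2 * c * c) * m - - (ι 13 * c * u * u + ι 10 * c * c * u + ι 2 * c * c * c)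
     lem = solve-∀ ℚ-ring
     lem₁ : ∀ a l u c → a * (l * l) - a * ((u - l) * (u - l) + (ι 8 * c * u + ι 2 * c * c)) ≡ ι 2 * u * (a * l) - (u * u + ι 8 * c * u + ι 2 * c * c) * a
     lem₁ = solve-∀ ℚ-ring
     lem₂ : ∀ a l b r → a * (b - r) ≡ a * (l * l) - a * r - (a * (l * l) - a * b)
     lem₂ = solve-∀ ℚ-ring
     lem₃ : ∀ a e i l → a * e * i * (l * l) ≡ e * (a * l * l * i)
     lem₃ = solve-∀ ℚ-ring
     lem₄ : ∀ a r → a * (ι 2 * r) ≡ ι 2 * (a * r)
     lem₄ = solve-∀ ℚ-ring
     lem₅ : ∀ e a t i → e * ((a - ι 2 * t) * i) ≡ e * (a * i) - ι 2 * (e * (t * i))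
     lem₅ = solve-∀ ℚ-ring

    0≤Q : 0ℚ ≤ Q
    0≤Q = 0≤ι 13 ⊗ 0≤C ⊗ 0≤u ⊗ 0≤u ⊕ 0≤ι 10 ⊗ 0≤C ⊗ 0≤C ⊗ 0≤u ⊕ 0≤ι 2 ⊗ 0≤C ⊗ 0≤C ⊗ 0≤C

   -- If the class of a contains no large primes, the right-hand side is only quadratic in u,
   -- whereas three classes rich in primes with product a make the left-hand side cubic.
   triple-upper : ∀ a → Unit a → ι 2 * ∑ x (λ n → 𝟙 (n ≈? a) * (Λ₃ n * inv n)) ≤ ∑ x (λ n → 𝟙 (n ≈? a) * (Λℓ n * ℓ n * inv n)) + (Q + E)
   triple-upper a ua = close (diff W-lower) (trans (cong (λ t → t - - (Q + E)) W-split) (lem (∑ x (λ n → 𝟙 (n ≈? a) * (Λℓ n * ℓ n * inv n))) (∑ x (λ n → 𝟙 (n ≈? a) * (Λ₃ n * inv n))) (Q + E)))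
    where
    lem : ∀ a b c → (a - ι 2 * b) - - c ≡ a + c - ι 2 * b
    lem = solve-∀ ℚ-ring
    lem₅ : ∀ e a t i → e * ((a - ι 2 * t) * i) ≡ e * (a * i) - ι 2 * (e * (t * i))
    lem₅ = solve-∀ ℚ-ring
    Wa = ∑ x (λ n → 𝟙 (n ≈? a) * (W n * inv n))
    W-split : Wa ≡ ∑ x (λ n → 𝟙 (n ≈? a) * (Λℓ n * ℓ n * inv n)) - ι 2 * ∑ x (λ n → 𝟙 (n ≈? a) * (Λ₃ n * inv n))
    W-split = trans (∑-ext x (λ n → lem₅ (𝟙 (n ≈? a)) (Λℓ n * ℓ n) (Λ₃ n) (inv n))) (trans (∑-- x _ _) (cong (λ t → ∑ x (λ n → 𝟙 (n ≈? a) * (Λℓ n * ℓ n * inv n)) - t) (∑-*ˡ x (ι 2) _)))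
    averaged : - Q ≤ Φ * (Wa + E)
    averaged = ≤-trans W-total (average-≥ x (λ n → W n * inv n) E a (λ b ub → close (diff (∣∣⇒≤ (W-difference ub ua))) (lem′ (∑ x (λ n → 𝟙 (n ≈? b) * (W n * inv n))) Wa E)))
     where
     lem′ : ∀ b a e → e - (b - a) ≡ a + e - b
     lem′ = solve-∀ ℚ-ring
    W-lower : - (Q + E) ≤ Wa
    W-lower = *-cancelˡ Φ (<-≤-trans (positive⁻¹ 1ℚ) 1≤Φ) (close (diff averaged ⊕ diff 1≤Φ ⊗ 0≤Q) (lem′ Φ Q E Wa))
     where
     lem′ : ∀ f q e w → f * (w + e) - - q + (f - 1ℚ) * q ≡ f * w - f * - (q + e)
     lem′ = solve-∀ ℚ-ring

  -- Every pair d ≡ b up to y and m ≡ c up to z yields a product d m ≡ a up to y z ≤ x. The terms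
  -- are non-negative, so these pairs form a part of the sum on the right.
  class-product : ∀ f g {a b c} y z x → x ℕ.≤ X → y ℕ.* z ℕ.≤ x → b ℕ.* c ≈ a → (∀ n → 0ℚ ≤ f n) → (∀ n → 0ℚ ≤ g n) →
   ∑ y (λ n → 𝟙 (n ≈? b) * (f n * inv n)) * ∑ z (λ n → 𝟙 (n ≈? c) * (g n * inv n)) ≤ ∑ x (λ n → 𝟙 (n ≈? a) * ((f ⋆ g) n * inv n))
  class-product f g {a} {b} {c} y zero x x≤X yz≤x h pf pg = subst (_≤ ∑ x (λ n → 𝟙 (n ≈? a) * ((f ⋆ g) n * inv n))) (sym (*-zeroʳ (∑ y (λ n → 𝟙 (n ≈? b) * (f n * inv n)))))
   (∑-nonneg x (λ n _ → 0≤𝟙 (suc n ≈? a) ⊗ (⋆-nonneg f g (suc n) pf pg ⊗ 0≤inv (suc n))))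
  class-product f g {a} {b} {c} y z@(suc _) x x≤X yz≤x h pf pg = begin
   ∑ y (λ n → 𝟙 (n ≈? b) * (f n * inv n)) * G
    ≡⟨ ∑-*ʳ y G (λ n → 𝟙 (n ≈? b) * (f n * inv n)) ⟨
   ∑ y (λ d → 𝟙 (d ≈? b) * (f d * inv d) * G)
    ≤⟨ ∑-mono y (λ d b′ → subst₂ _≤_ (lem (𝟙 (suc d ≈? b)) (f (suc d)) (inv (suc d)) G) refl (term d b′)) ⟩
   ∑ y (λ d → f d * ∑ (x ÷ d) (λ m → g m * (𝟙 (d ℕ.* m ≈? a) * inv (d ℕ.* m))))
    ≤⟨ ∑-mono-range (λ d → f d * ∑ (x ÷ d) (λ m → g m * (𝟙 (d ℕ.* m ≈? a) * inv (d ℕ.* m)))) y≤x (λ d _ → pf (suc d) ⊗ ∑-nonneg (x ÷ suc d) (λ m _ → pos d m)) ⟩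
   ∑ x (λ d → f d * ∑ (x ÷ d) (λ m → g m * (𝟙 (d ℕ.* m ≈? a) * inv (d ℕ.* m))))
    ≡⟨ ∑-⋆ f g (λ n → 𝟙 (n ≈? a) * inv n) x x≤X ⟨
   ∑ x (λ n → (f ⋆ g) n * (𝟙 (n ≈? a) * inv n))
    ≡⟨ ∑-ext x (λ n → lem′ ((f ⋆ g) n) (𝟙 (n ≈? a)) (inv n)) ⟩
   ∑ x (λ n → 𝟙 (n ≈? a) * ((f ⋆ g) n * inv n)) ∎
   where
   open ≤-Reasoning
   G = ∑ z (λ n → 𝟙 (n ≈? c) * (g n * inv n))
   y≤x : y ℕ.≤ x
   y≤x = ℕ.≤-trans (ℕ.m≤m*n y z) yz≤x
   lem : ∀ t f i G → t * (f * (i * G)) ≡ t * (f * i) * G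
   lem = solve-∀ ℚ-ring
   lem′ : ∀ a b c → a * (b * c) ≡ b * (a * c)
   lem′ = solve-∀ ℚ-ring
   lem″ : ∀ g t i j → i * (t * (g * j)) ≡ g * (t * (i * j))
   lem″ = solve-∀ ℚ-ring
   pos : ∀ d m → 0ℚ ≤ g (suc m) * (𝟙 (suc d ℕ.* suc m ≈? a) * inv (suc d ℕ.* suc m))
   pos d m = pg (suc m) ⊗ (0≤𝟙 (suc d ℕ.* suc m ≈? a) ⊗ 0≤inv (suc d ℕ.* suc m))
   z≤ : ∀ d → suc d ℕ.≤ y → z ℕ.≤ x ÷ suc d
   z≤ d b′ = ÷-upper x d z (ℕ.≤-trans (ℕ.*-monoˡ-≤ z b′) yz≤x)
   term : ∀ d → suc d ℕ.≤ y → 𝟙 (suc d ≈? b) * (f (suc d) * (inv (suc d) * G)) ≤ f (suc d) * ∑ (x ÷ suc d) (λ m → g m * (𝟙 (suc d ℕ.* m ≈? a) * inv (suc d ℕ.* m)))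
   term d b′ with suc d ≈? b
   ... | no _ = subst (_≤ f (suc d) * ∑ (x ÷ suc d) (λ m → g m * (𝟙 (suc d ℕ.* m ≈? a) * inv (suc d ℕ.* m)))) (sym (*-zeroˡ (f (suc d) * (inv (suc d) * G)))) (pf (suc d) ⊗ ∑-nonneg (x ÷ suc d) (λ m _ → pos d m))
   ... | yes d≈b = subst (_≤ f (suc d) * ∑ (x ÷ suc d) (λ m → g m * (𝟙 (suc d ℕ.* m ≈? a) * inv (suc d ℕ.* m)))) (sym (*-identityˡ (f (suc d) * (inv (suc d) * G)))) (*-monoˡ (f (suc d)) (pf (suc d)) (begin
    inv (suc d) * G
     ≡⟨ ∑-*ˡ z (inv (suc d)) (λ n → 𝟙 (n ≈? c) * (g n * inv n)) ⟨
    ∑ z (λ n → inv (suc d) * (𝟙 (n ≈? c) * (g n * inv n)))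
     ≤⟨ ∑-mono z (λ m _ → subst₂ _≤_ refl (trans (lem″ (g (suc m)) (𝟙 (suc d ℕ.* suc m ≈? a)) (inv (suc d)) (inv (suc m))) (cong (λ t → g (suc m) * (𝟙 (suc d ℕ.* suc m ≈? a) * t)) (sym (inv-* (suc d) (suc m)))))
       (*-monoˡ (inv (suc d)) (0≤inv (suc d)) (*-monoʳ (g (suc m) * inv (suc m)) (pg (suc m) ⊗ 0≤inv (suc m)) (imp m)))) ⟩
    ∑ z (λ m → g m * (𝟙 (suc d ℕ.* m ≈? a) * inv (suc d ℕ.* m)))
     ≤⟨ ∑-mono-range _ (z≤ d b′) (λ m _ → pos d m) ⟩
    ∑ (x ÷ suc d) (λ m → g m * (𝟙 (suc d ℕ.* m ≈? a) * inv (suc d ℕ.* m))) ∎))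
    where
    imp : ∀ m → 𝟙 (suc m ≈? c) ≤ 𝟙 (suc d ℕ.* suc m ≈? a)
    imp m with suc m ≈? c
    ... | yes m≈c = ≤-reflexive (sym (𝟙-yes (suc d ℕ.* suc m ≈? a) (≈-trans (≈-* d≈b m≈c) h)))
    ... | no _ = 0≤𝟙 (suc d ℕ.* suc m ≈? a)

  Mc : ℕ → ℕ → ℚ
  Mc b x = ∑ x (λ n → 𝟙 (n ≈? b) * (Λ n * inv n))

  triple-lower : ∀ {a b₁ b₂ b₃} y x → x ℕ.≤ X → y ℕ.* (y ℕ.* y) ℕ.≤ x → b₁ ℕ.* (b₂ ℕ.* b₃) ≈ a →
   Mc b₁ y * (Mc b₂ y * Mc b₃ y) ≤ ∑ x (λ n → 𝟙 (n ≈? a) * (Λ₃ n * inv n))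
  triple-lower {a} zero x x≤X yyy≤x h = ∑-nonneg x {λ n → 𝟙 (n ≈? a) * (Λ₃ n * inv n)} (λ n _ → 0≤𝟙 (suc n ≈? a) ⊗ (⋆-nonneg Λ (Λ ⋆ Λ) (suc n) 0≤Λ 0≤Λ⋆Λ ⊗ 0≤inv (suc n)))
  triple-lower {a} {b₁} {b₂} {b₃} y@(suc _) x x≤X yyy≤x h = ≤-trans
   (*-monoˡ (Mc b₁ y) (∑-nonneg y (λ n _ → 0≤𝟙 (suc n ≈? b₁) ⊗ (0≤Λ (suc n) ⊗ 0≤inv (suc n))))
    (class-product Λ Λ {b₂ ℕ.* b₃} {b₂} {b₃} y y (y ℕ.* y) (ℕ.≤-trans (ℕ.m≤n*m (y ℕ.* y) y) (ℕ.≤-trans yyy≤x x≤X)) ℕ.≤-refl ≈-refl 0≤Λ 0≤Λ))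
   (class-product Λ (Λ ⋆ Λ) {a} {b₁} {b₂ ℕ.* b₃} y (y ℕ.* y) x x≤X yyy≤x h 0≤Λ 0≤Λ⋆Λ)

-- From half of the unit classes to a quadratic character.

module Group where

 open Base
 open Periodic
 open import Data.Nat using (_%_)
 open import Data.Rational using (ℚ; 0ℚ; 1ℚ; _+_; _*_; _-_; -_; _≤_; _<_; ∣_∣)
 open import Data.Rational.Properties
 open import Tactic.RingSolver using (solve-∀)

 record QuadraticCharacter (N′ : ℕ) : Set where
  field
   χ : ℕ → ℚ
   χ-≈ : Residues.Periodic N′ χ
   χ-* : ∀ m n → χ (m ℕ.* n) ≡ χ m * χ n
   χ-square : ∀ n → χ n * χ n ≡ Residues.e N′ n
   χ-nonunit : ∀ n → ¬ Residues.Unit N′ n → χ n ≡ 0ℚ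
   ∣χ∣≤1 : ∀ n → ∣ χ n ∣ ≤ 1ℚ
   ∑χ : ∑ (suc N′) χ ≡ 0ℚ

 -- A set B of at least half of the unit classes whose threefold products miss
 -- the class a is a coset of a subgroup of index two; χ is the corresponding
 -- quadratic character.
 module Coset (N′ : ℕ) (B : ℕ → Set) (B? : ∀ n → Dec (B n))
  (B-≈ : ∀ {m n} → Residues._≈_ N′ m n → B m → B n)
  (B⇒Unit : ∀ {n} → B n → Residues.Unit N′ n)
  (a : ℕ) (ua : Residues.Unit N′ a)
  (¬BBB : ∀ {x y z} → B x → B y → B z → ¬ (Residues._≈_ N′ (x ℕ.* (y ℕ.* z)) a))
  (half : ∑ (suc N′) (Residues.e N′) ≤ ∑ (suc N′) (λ n → 𝟙 (B? n)) + ∑ (suc N′) (λ n → 𝟙 (B? n))) where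

  open Residues N′

  private
   β : ℕ → ℚ
   β n = 𝟙 (B? n)

   Φ ∣B∣ : ℚ
   Φ = ∑ N e
   ∣B∣ = ∑ N β

   β-≈ : Periodic β
   β-≈ {m} {n} h = 𝟙-cong (B? m) (B? n) (B-≈ h) (B-≈ (≈-sym h))

   representative : ∀ d → ∃ λ k → suc k ℕ.≤ N × suc k ≈ d
   representative d with d % N in eq
   ... | zero = N′ , ℕ.≤-refl , ≈-by (trans (DM.n%n≡0 N) (sym eq))
   ... | suc r = r , ℕ.<⇒≤ r<N , ≈-by (trans (DM.m<n⇒m%n≡m r<N) (sym eq))
    where
    r<N : suc r ℕ.< N
    r<N = subst (ℕ._< N) eq (DM.m%n<n d N)

   vanish : ∀ (f : ℕ → ℚ) → Periodic f → (∀ n → 0ℚ ≤ f n) → ∑ N f ≤ 0ℚ → ∀ d → f d ≡ 0ℚ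
   vanish f per pos h d with representative d
   ... | k , b , k≈d = ≤-antisym (subst (_≤ 0ℚ) (per k≈d) (≤-trans (term≤∑ N k f b (λ i _ → pos (suc i))) h)) (pos d)

   -- For a unit d this is the indicator of a/d lying in B; as a count of solutions it also makes
   -- sense at non-units, where it vanishes.
   h : ℕ → ℚ
   h d = ∑ N (λ b → 𝟙 (d ℕ.* b ≈? a) * β b)

   h-≈ : Periodic h
   h-≈ {m} {n} eq = ∑-ext N (λ b → cong (_* β b) (𝟙-cong (m ℕ.* b ≈? a) (n ℕ.* b ≈? a) (≈-trans (≈-*ʳ b (≈-sym eq))) (≈-trans (≈-*ʳ b eq))))

   h-unit : ∀ d d′ → d ℕ.* d′ ≈ 1 → h d ≡ β (d′ ℕ.* a)
   h-unit d d′ i = trans (∑-ext N (λ b → cong (_* β b) (𝟙-cong (d ℕ.* b ≈? a) (b ≈? d′ ℕ.* a) (divide {d} i b a) (multiply {d} i b a)))) (∑-≈-pick β β-≈ (d′ ℕ.* a))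

   h-nonunit : ∀ d → ¬ Unit d → h d ≡ 0ℚ
   h-nonunit d ¬u = ∑-zero N (λ b _ → trans (cong (_* β (suc b)) (𝟙-no (d ℕ.* suc b ≈? a) (λ eq → ¬u (Unit-*ˡ {d} {suc b} (Unit-≈ (≈-sym eq) ua))))) (*-zeroˡ (β (suc b))))

   ∑h : ∑ N h ≡ ∣B∣
   ∑h = trans (∑-swap N N _) (∑-ext N (λ b → trans (∑-*ʳ N (β b) (λ d → 𝟙 (d ℕ.* b ≈? a))) (trans (*-comm (∑ N (λ d → 𝟙 (d ℕ.* b ≈? a))) (β b))
    (trans (𝟙-guard (B? b) (λ Bb → trans (∑-ext N (λ d → 𝟙-cong (d ℕ.* b ≈? a) (b ℕ.* d ≈? a) (≈-trans (≈-reflexive (ℕ.*-comm b d))) (≈-trans (≈-reflexive (ℕ.*-comm d b))))) (∑-*≈ b (B⇒Unit Bb) a))) (*-identityʳ (β b))))))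

   module _ {b b′ : ℕ} (Bb : B b) (i : b ℕ.* b′ ≈ 1) where

    private
     ub′ : Unit b′
     ub′ = Unit-inv {b′} {b} (≈-trans (≈-reflexive (ℕ.*-comm b′ b)) i)

     -- For a unit d, membership of d/b and of a/d in B exclude each other, as b (d/b) (a/d) = a
     -- would be a product of three members. So `slack` is non-negative. Its sum is Φ - 2 |B|, and
     -- together with `half` this forces it to vanish everywhere.
     slack : ℕ → ℚ
     slack d = e d - (β (b′ ℕ.* d) + h d)

     ∑slack : ∑ N slack ≡ Φ - (∣B∣ + ∣B∣)
     ∑slack = trans (∑-- N e (λ d → β (b′ ℕ.* d) + h d)) (cong (λ t → Φ - t) (trans (∑-+ N (λ d → β (b′ ℕ.* d)) h) (cong₂ _+_ (∑-permute b′ ub′ β β-≈) ∑h)))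

     0≤slack : ∀ d → 0ℚ ≤ slack d
     0≤slack d = go (unit? d)
      where
      go : Dec (Unit d) → 0ℚ ≤ slack d
      go (no ¬u) = ≤-reflexive (sym (trans (cong₂ (λ s t → s - (t + h d)) (𝟙-no (unit? d) ¬u) (𝟙-no (B? (b′ ℕ.* d)) (λ Bx → ¬u (Unit-*ʳ {b′} {d} (B⇒Unit Bx))))) (cong (λ t → 0ℚ - (0ℚ + t)) (h-nonunit d ¬u))))
      go (yes u) with inverse d u
      ... | d′ , dd′ = subst (0ℚ ≤_) (sym (cong₂ (λ s t → s - (β (b′ ℕ.* d) + t)) (𝟙-yes (unit? d) u) (h-unit d d′ dd′))) (cases (B? (b′ ℕ.* d)) (B? (d′ ℕ.* a)))
       where
       product : b ℕ.* (b′ ℕ.* d ℕ.* (d′ ℕ.* a)) ≈ a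
       product = ≈-trans (≈-reflexive (lem b b′ d d′ a)) (≈-trans (≈-*ʳ a (≈-* i dd′)) (≈-reflexive (ℕ.*-identityˡ a)))
        where
        lem : ∀ b b′ d d′ a → b ℕ.* (b′ ℕ.* d ℕ.* (d′ ℕ.* a)) ≡ b ℕ.* b′ ℕ.* (d ℕ.* d′) ℕ.* a
        lem = ℕ-solve
       cases : (p : Dec (B (b′ ℕ.* d))) (q : Dec (B (d′ ℕ.* a))) → 0ℚ ≤ 1ℚ - (𝟙 p + 𝟙 q)
       cases (yes p) (yes q) = ⊥-elim (¬BBB Bb p q product)
       cases (yes _) (no _) = ≤-refl
       cases (no _) (yes _) = ≤-refl
       cases (no _) (no _) = 0≤1

     slack-≈ : Periodic slack
     slack-≈ {m} {n} eq = cong₂ _-_ (e-≈ eq) (cong₂ _+_ (β-≈ (≈-*ˡ b′ eq)) (h-≈ eq))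

    ∣B∣+∣B∣≤Φ : ∣B∣ + ∣B∣ ≤ Φ
    ∣B∣+∣B∣≤Φ = close (subst (0ℚ ≤_) ∑slack (∑-nonneg N (λ d _ → 0≤slack (suc d)))) refl

    -- Every unit is in bB or divides a into B, by counting.
    split : ∀ d d′ → d ℕ.* d′ ≈ 1 → ¬ B (b′ ℕ.* d) → B (d′ ℕ.* a)
    split d d′ dd′ ¬p with B? (d′ ℕ.* a) | h-unit d d′ dd′
    ... | yes q | _ = q
    ... | no ¬q | hd = ⊥-elim (1≢0 (trans (sym (trans (cong₂ (λ s t → s - (β (b′ ℕ.* d) + t)) (𝟙-yes (unit? d) (Unit-inv {d} {d′} dd′)) hd) (cong (λ t → 1ℚ - (t + 0ℚ)) (𝟙-no (B? (b′ ℕ.* d)) ¬p))))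
        (vanish slack slack-≈ 0≤slack (subst (_≤ 0ℚ) (sym ∑slack) (close (diff half) (lem Φ ∣B∣))) d)))
     where
     lem : ∀ f b → b + b - f ≡ 0ℚ - (f - (b + b))
     lem = solve-∀ ℚ-ring

   -- If g b₀ were outside B, `split` at d = g b b₀ would put a/d into B, and then a would be the
   -- product of the three members g b, b₀ and a/d. So a g that keeps one member of B inside B keeps
   -- all of them there.
   translate : ∀ {b b₀} g → B b → B b₀ → B (g ℕ.* b) → B (g ℕ.* b₀)
   translate {b} {b₀} g Bb Bb₀ Bgb with inverse b (B⇒Unit Bb) | inverse (g ℕ.* b ℕ.* b₀) (Unit-* {g ℕ.* b} {b₀} (B⇒Unit Bgb) (B⇒Unit Bb₀))
   ... | b′ , bb′ | d′ , dd′ with B? (b′ ℕ.* (g ℕ.* b ℕ.* b₀))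
   ... | yes p = B-≈ (≈-trans (≈-reflexive (lem b b′ g b₀)) (≈-trans (≈-*ʳ (g ℕ.* b₀) bb′) (≈-reflexive (ℕ.*-identityˡ (g ℕ.* b₀))))) p
    where
    lem : ∀ b b′ g b₀ → b′ ℕ.* (g ℕ.* b ℕ.* b₀) ≡ b ℕ.* b′ ℕ.* (g ℕ.* b₀)
    lem = ℕ-solve
   ... | no ¬p = ⊥-elim (¬BBB Bgb Bb₀ (split Bb bb′ (g ℕ.* b ℕ.* b₀) d′ dd′ ¬p)
        (≈-trans (≈-reflexive (lem (g ℕ.* b) b₀ d′ a)) (≈-trans (≈-*ʳ a dd′) (≈-reflexive (ℕ.*-identityˡ a)))))
    where
    lem : ∀ x y z a → x ℕ.* (y ℕ.* (z ℕ.* a)) ≡ x ℕ.* y ℕ.* z ℕ.* a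
    lem = ℕ-solve

   nonempty : ∃ λ b → B b
   nonempty with ℕ.anyUpTo? B? (suc N)
   ... | yes (b , _ , Bb) = b , Bb
   ... | no ¬∃ = ⊥-elim (<-irrefl refl (<-≤-trans (positive⁻¹ 1ℚ) (≤-trans 1≤Φ (≤-trans half (≤-reflexive (cong₂ _+_ empty empty))))))
    where
    empty : ∣B∣ ≡ 0ℚ
    empty = ∑-zero N (λ k b → 𝟙-no (B? (suc k)) (λ Bk → ¬∃ (suc k , s≤s b , Bk)))
    1≤Φ : 1ℚ ≤ Φ
    1≤Φ = subst (_≤ Φ) e-1 (term≤∑ N 0 e (s≤s z≤n) (λ i _ → 0≤e (suc i)))

  b₀ : ℕ
  b₀ = proj₁ nonempty

  Bb₀ : B b₀
  Bb₀ = proj₂ nonempty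

  private
   ub₀ = B⇒Unit Bb₀

   -- By `translate` no element of B stays in B under such a g. Hence B and the set of d with g d in
   -- B are disjoint, and by counting they fill the units.
   complement : ∀ g → Unit g → ¬ B (g ℕ.* b₀) → ∀ c → Unit c → ¬ B c → B (g ℕ.* c)
   complement g ug ¬g c uc ¬c with B? (g ℕ.* c) in eq
   ... | yes p = p
   ... | no ¬p = ⊥-elim (1≢0 (trans (sym (trans (cong₂ (λ s t → s - (t + β (g ℕ.* c))) (𝟙-yes (unit? c) uc) (𝟙-no (B? c) ¬c)) (cong (λ t → 1ℚ - (0ℚ + 𝟙 t)) eq)))
        (vanish slack (λ {m} {n} q → cong₂ _-_ (e-≈ q) (cong₂ _+_ (β-≈ q) (β-≈ (≈-*ˡ g q)))) 0≤slack
         (subst (_≤ 0ℚ) (sym (trans (∑-- N e (λ d → β d + β (g ℕ.* d))) (cong (λ t → Φ - t) (trans (∑-+ N β (λ d → β (g ℕ.* d))) (cong (∣B∣ +_) (∑-permute g ug β β-≈)))))) (close (diff half) (lem Φ ∣B∣))) c)))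
    where
    lem : ∀ f b → b + b - f ≡ 0ℚ - (f - (b + b))
    lem = solve-∀ ℚ-ring
    slack : ℕ → ℚ
    slack d = e d - (β d + β (g ℕ.* d))
    0≤slack : ∀ d → 0ℚ ≤ slack d
    0≤slack d = go (B? d) (B? (g ℕ.* d)) (unit? d)
     where
     go : (p : Dec (B d)) (q : Dec (B (g ℕ.* d))) (u : Dec (Unit d)) → 0ℚ ≤ 𝟙 u - (𝟙 p + 𝟙 q)
     go (yes p) (yes q) _ = ⊥-elim (¬g (translate g p Bb₀ q))
     go (yes p) (no _) (no ¬u) = ⊥-elim (¬u (B⇒Unit p))
     go (no _) (yes q) (no ¬u) = ⊥-elim (¬u (Unit-*ʳ {g} {d} (B⇒Unit q)))
     go (yes _) (no _) (yes _) = ≤-refl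
     go (no _) (yes _) (yes _) = ≤-refl
     go (no _) (no _) (yes _) = 0≤1
     go (no _) (no _) (no _) = ≤-refl

  -- The value is 1 on the stabiliser of B, which by `translate` can be tested at the single member
  -- b₀, -1 on the other units and 0 elsewhere.
  χ : ℕ → ℚ
  χ n = e n * (ι 2 * β (n ℕ.* b₀) - 1ℚ)

  χ-≈ : Periodic χ
  χ-≈ h = cong₂ (λ s t → s * (ι 2 * t - 1ℚ)) (e-≈ h) (β-≈ (≈-*ʳ b₀ h))

  private
   sign : ∀ {P : Set} → Dec P → ℚ
   sign d = ι 2 * 𝟙 d - 1ℚ

   χ-in : ∀ n → Unit n → B (n ℕ.* b₀) → χ n ≡ 1ℚ
   χ-in n u p = trans (cong₂ (λ s t → s * (ι 2 * t - 1ℚ)) (𝟙-yes (unit? n) u) (𝟙-yes (B? (n ℕ.* b₀)) p)) refl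

   χ-out : ∀ n → Unit n → ¬ B (n ℕ.* b₀) → χ n ≡ - 1ℚ
   χ-out n u p = trans (cong₂ (λ s t → s * (ι 2 * t - 1ℚ)) (𝟙-yes (unit? n) u) (𝟙-no (B? (n ℕ.* b₀)) p)) refl

   χ-nonunit : ∀ n → ¬ Unit n → χ n ≡ 0ℚ
   χ-nonunit n ¬u = trans (cong (_* (ι 2 * β (n ℕ.* b₀) - 1ℚ)) (𝟙-no (unit? n) ¬u)) (*-zeroˡ (ι 2 * β (n ℕ.* b₀) - 1ℚ))

  χ-square : ∀ n → χ n * χ n ≡ e n
  χ-square n = go (unit? n) (B? (n ℕ.* b₀))
   where
   go : (u : Dec (Unit n)) (p : Dec (B (n ℕ.* b₀))) → 𝟙 u * sign p * (𝟙 u * sign p) ≡ 𝟙 u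
   go (yes _) (yes _) = refl
   go (yes _) (no _) = refl
   go (no _) (yes _) = refl
   go (no _) (no _) = refl

  ∣χ∣≤1 : ∀ n → ∣ χ n ∣ ≤ 1ℚ
  ∣χ∣≤1 n = go (unit? n) (B? (n ℕ.* b₀))
   where
   go : (u : Dec (Unit n)) (p : Dec (B (n ℕ.* b₀))) → ∣ 𝟙 u * sign p ∣ ≤ 1ℚ
   go (yes _) (yes _) = ≤-refl
   go (yes _) (no _) = ≤-refl
   go (no _) (yes _) = 0≤1
   go (no _) (no _) = 0≤1

  χ-* : ∀ m n → χ (m ℕ.* n) ≡ χ m * χ n
  χ-* m n = cases (unit? m) (unit? n)
   where
   cases : Dec (Unit m) → Dec (Unit n) → χ (m ℕ.* n) ≡ χ m * χ n
   cases (no ¬um) _ = trans (χ-nonunit (m ℕ.* n) (λ u → ¬um (Unit-*ˡ {m} {n} u))) (sym (trans (cong (_* χ n) (χ-nonunit m ¬um)) (*-zeroˡ (χ n))))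
   cases (yes um) (no ¬un) = trans (χ-nonunit (m ℕ.* n) (λ u → ¬un (Unit-*ʳ {m} {n} u))) (sym (trans (cong (χ m *_) (χ-nonunit n ¬un)) (*-zeroʳ (χ m))))
   cases (yes um) (yes un) = go (B? (m ℕ.* b₀)) (B? (n ℕ.* b₀))
    where
    umn = Unit-* {m} {n} um un
    re : m ℕ.* (n ℕ.* b₀) ≈ m ℕ.* n ℕ.* b₀
    re = ≈-reflexive (sym (ℕ.*-assoc m n b₀))
    go : (p : Dec (B (m ℕ.* b₀))) (q : Dec (B (n ℕ.* b₀))) → χ (m ℕ.* n) ≡ χ m * χ n
    go (yes p) (yes q) = trans (χ-in (m ℕ.* n) umn (B-≈ re (translate m Bb₀ q p))) (sym (cong₂ _*_ (χ-in m um p) (χ-in n un q)))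
    go (no ¬p) (yes q) = trans (χ-out (m ℕ.* n) umn (λ r → ¬p (translate m q Bb₀ (B-≈ (≈-sym re) r)))) (sym (cong₂ _*_ (χ-out m um ¬p) (χ-in n un q)))
    go (no ¬p) (no ¬q) = trans (χ-in (m ℕ.* n) umn (B-≈ re (complement m um ¬p (n ℕ.* b₀) (Unit-* {n} {b₀} un ub₀) ¬q))) (sym (cong₂ _*_ (χ-out m um ¬p) (χ-out n un ¬q)))
    go (yes p) (no ¬q) = trans (χ-out (m ℕ.* n) umn back) (sym (cong₂ _*_ (χ-in m um p) (χ-out n un ¬q)))
     where
     back : ¬ B (m ℕ.* n ℕ.* b₀)
     back r with inverse m um
     ... | m′ , mm′ = ¬q (B-≈ (cancel (n ℕ.* b₀)) (translate m′ p (B-≈ (≈-sym re) r) (B-≈ (≈-sym (cancel b₀)) Bb₀)))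
      where
      cancel : ∀ c → m′ ℕ.* (m ℕ.* c) ≈ c
      cancel c = ≈-trans (≈-reflexive (lem m m′ c)) (≈-trans (≈-*ʳ c mm′) (≈-reflexive (ℕ.*-identityˡ c)))
       where
       lem : ∀ m m′ c → m′ ℕ.* (m ℕ.* c) ≡ m ℕ.* m′ ℕ.* c
       lem = ℕ-solve

  ∑χ : ∑ N χ ≡ 0ℚ
  ∑χ = begin
   ∑ N χ ≡⟨ ∑-ext N (λ n → go n (unit? n) (B? (n ℕ.* b₀))) ⟩
   ∑ N (λ n → β (n ℕ.* b₀) + β (n ℕ.* b₀) - e n) ≡⟨ trans (∑-- N _ e) (cong (_- Φ) (∑-+ N _ _)) ⟩
   ∑ N (λ n → β (n ℕ.* b₀)) + ∑ N (λ n → β (n ℕ.* b₀)) - Φ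
    ≡⟨ cong (λ t → t + t - Φ) (trans (∑-ext N (λ n → β-≈ (≈-reflexive (ℕ.*-comm n b₀)))) (∑-permute b₀ ub₀ β β-≈)) ⟩
   ∣B∣ + ∣B∣ - Φ ≡⟨ cong (_- Φ) (≤-antisym (∣B∣+∣B∣≤Φ Bb₀ (proj₂ (inverse b₀ ub₀))) half) ⟩
   Φ - Φ ≡⟨ +-inverseʳ Φ ⟩
   0ℚ ∎
   where
   open ≡-Reasoning
   go : ∀ n (u : Dec (Unit n)) (p : Dec (B (n ℕ.* b₀))) → 𝟙 u * sign p ≡ 𝟙 p + 𝟙 p - 𝟙 u
   go n (yes _) (yes _) = refl
   go n (yes _) (no _) = refl
   go n (no ¬u) (yes p) = ⊥-elim (¬u (Unit-*ˡ {n} {b₀} (B⇒Unit p)))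
   go n (no _) (no _) = refl

  -- B is either the stabiliser itself or its other coset, according to whether b₀ b₀ lies in B.
  χ-constant : ∀ {b} → B b → χ b ≡ χ b₀
  χ-constant {b} Bb = cases (B? (b₀ ℕ.* b₀))
   where
   cases : Dec (B (b₀ ℕ.* b₀)) → χ b ≡ χ b₀
   cases (yes p) = trans (χ-in b (B⇒Unit Bb) (B-≈ (≈-reflexive (ℕ.*-comm b₀ b)) (translate b₀ Bb₀ Bb p))) (sym (χ-in b₀ ub₀ p))
   cases (no ¬p) = trans (χ-out b (B⇒Unit Bb) (λ q → ¬p (translate b₀ Bb Bb₀ (B-≈ (≈-reflexive (ℕ.*-comm b b₀)) q)))) (sym (χ-out b₀ ub₀ ¬p))

  coset-character : ∃ λ q → ∃ λ b₀ → B b₀ × (∀ b → B b → QuadraticCharacter.χ {N′} q b ≡ QuadraticCharacter.χ q b₀)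
  coset-character = record { χ = χ ; χ-≈ = χ-≈ ; χ-* = χ-* ; χ-square = χ-square ; χ-nonunit = χ-nonunit ; ∣χ∣≤1 = ∣χ∣≤1 ; ∑χ = ∑χ } ,
   b₀ , Bb₀ , λ b Bb → χ-constant Bb

-- A lower bound for L(1,χ) and the boundedness of Σ χ(n) Λ(n)/n.

module LFun where

 open Base
 open Conv
 open Mangoldt using (one)
 open Mobius using (∑-multiples)
 open Mertens using (ι-÷-upper; ι-÷-lower)
 open Selberg using (inv-step)
 open Units
 open Periodic
 open Group using (QuadraticCharacter)
 open import Data.Nat.Divisibility using (_∣?_; divides)
 open import Data.Rational using (ℚ; 0ℚ; 1ℚ; _+_; _*_; _-_; -_; _≤_; _<_; ∣_∣)
 open import Data.Rational.Properties
 open import Relation.Binary.Definitions using (tri<; tri≈; tri>)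
 open import Tactic.RingSolver using (solve-∀)

 *-square-injective : ∀ m n → m ℕ.* m ≡ n ℕ.* n → m ≡ n
 *-square-injective m n h with ℕ.<-cmp m n
 ... | tri< lt _ _ = ⊥-elim (ℕ.<-irrefl h (ℕ.*-mono-< lt lt))
 ... | tri≈ _ e _ = e
 ... | tri> _ _ gt = ⊥-elim (ℕ.<-irrefl (sym h) (ℕ.*-mono-< gt gt))

 ∑-squares : ∀ Y (F : ℕ → ℚ) → (∀ n → suc n ℕ.≤ Y → 0ℚ ≤ F (suc n)) → ∑ Y (λ d → 𝟙 (d ℕ.* d ℕ.≤? Y) * F (d ℕ.* d)) ≤ ∑ Y F
 ∑-squares Y F pos = begin
  ∑ Y (λ d → 𝟙 (d ℕ.* d ℕ.≤? Y) * F (d ℕ.* d)) ≡⟨ ∑-cong Y (λ d _ → sym (∑-eq-trunc Y (d ℕ.+ d ℕ.* suc d) F)) ⟩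
  ∑ Y (λ d → ∑ Y (λ n → 𝟙 (d ℕ.* d ℕ.≟ n) * F n)) ≡⟨ ∑-swap Y Y _ ⟩
  ∑ Y (λ n → ∑ Y (λ d → 𝟙 (d ℕ.* d ℕ.≟ n) * F n)) ≤⟨ ∑-mono Y (λ n b → subst₂ _≤_ (sym (∑-*ʳ Y (F (suc n)) (λ d → 𝟙 (d ℕ.* d ℕ.≟ suc n)))) (*-identityˡ (F (suc n))) (*-monoʳ (F (suc n)) (pos n b) (roots n))) ⟩
  ∑ Y F ∎
  where
  open ≤-Reasoning
  roots : ∀ n → ∑ Y (λ d → 𝟙 (d ℕ.* d ℕ.≟ suc n)) ≤ 1ℚ
  roots n with ℕ.anyUpTo? (λ d → d ℕ.* d ℕ.≟ suc n) (suc Y)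
  ... | no ¬∃ = subst (_≤ 1ℚ) (sym (∑-zero Y (λ d b → 𝟙-no (suc d ℕ.* suc d ℕ.≟ suc n) (λ e → ¬∃ (suc d , s≤s b , e))))) 0≤1
  ... | yes (zero , _ , ())
  ... | yes (suc c , s≤s b , e) = ≤-reflexive (trans (∑-ext Y (λ d → trans (𝟙-cong (d ℕ.* d ℕ.≟ suc n) (d ℕ.≟ suc c) (λ e′ → *-square-injective d (suc c) (trans e′ (sym e))) (λ { refl → e })) (sym (*-identityʳ (𝟙 (d ℕ.≟ suc c)))))) (∑-single Y c (λ _ → 1ℚ) b))

 riesz : ∀ y δ k → ι 2 * ∑ k (λ m → y - δ * ι m) ≡ ι 2 * ι k * y - δ * (ι k * (ι k + 1ℚ))
 riesz y δ zero = lem y δ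
  where
  lem : ∀ y δ → ι 2 * 0ℚ ≡ ι 2 * 0ℚ * y - δ * (0ℚ * (0ℚ + 1ℚ))
  lem = solve-∀ ℚ-ring
 riesz y δ (suc k) = trans (*-distribˡ-+ (ι 2) (∑ k (λ m → y - δ * ι m)) (y - δ * ι (suc k))) (trans (cong (_+ ι 2 * (y - δ * ι (suc k))) (riesz y δ k)) (lem y δ (ι k)))
  where
  lem : ∀ y δ k → ι 2 * k * y - δ * (k * (k + 1ℚ)) + ι 2 * (y - δ * (k + 1ℚ)) ≡ ι 2 * (k + 1ℚ) * y - δ * ((k + 1ℚ) * (k + 1ℚ + 1ℚ))
  lem = solve-∀ ℚ-ring

 module RealCharacter (X′ N′ : ℕ) (character : QuadraticCharacter N′) where

  open QuadraticCharacter character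
  open Coprime X′ N′

  private
   χ-1 : χ 1 ≡ 1ℚ
   χ-1 = trans (χ-* 1 1) (trans (χ-square 1) e-1)

   χ-partial : ∀ y → ∣ ∑ y χ ∣ ≤ ι N
   χ-partial y = subst (∣ ∑ y χ ∣ ≤_) (*-identityʳ (ι N)) (∑-periodic-bound χ 1ℚ χ-≈ ∑χ ∣χ∣≤1 y)

   χ-tail : ∀ z k → ∣ ∑ k (λ i → χ (z ℕ.+ i)) ∣ ≤ ι N + ι N
   χ-tail z k = subst (λ t → ∣ t ∣ ≤ ι N + ι N) (trans (cong (_- ∑ z χ) (∑-split z k χ)) (lem (∑ z χ) (∑ k (λ i → χ (z ℕ.+ i)))))
    (≤-trans (∣p-q∣≤∣p∣+∣q∣ (∑ (z ℕ.+ k) χ) (∑ z χ)) (+-mono-≤ (χ-partial (z ℕ.+ k)) (χ-partial z)))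
    where
    lem : ∀ a b → a + b - a ≡ b
    lem = solve-∀ ℚ-ring

   -- `r` has the Dirichlet series ζ(s) L(s,χ), and `Θ` belongs to its negative logarithmic
   -- derivative. As χ ≥ -1, `Θ` is non-negative.
   r Θ : ℕ → ℚ
   r = one ⋆ χ
   Θ n = Λ n + Λ n * χ n

   0≤Θ : ∀ n → 0ℚ ≤ Θ n
   0≤Θ n = subst (0ℚ ≤_) (lem (Λ n) (χ n)) (0≤Λ n ⊗ diff (∣∣⇒≥ (∣χ∣≤1 n)))
    where
    lem : ∀ a b → a * (b - - 1ℚ) ≡ a + a * b
    lem = solve-∀ ℚ-ring

   Λ-1 : Λ 1 ≡ 0ℚ
   Λ-1 = ≤-antisym (subst (Λ 1 ≤_) ℓ-1 (Λ≤ℓ 0 (s≤s z≤n))) (0≤Λ 1)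

   Θ-1 : Θ 1 ≡ 0ℚ
   Θ-1 = trans (cong (λ t → t + t * χ 1) Λ-1) (lem (χ 1))
    where
    lem : ∀ b → 0ℚ + 0ℚ * b ≡ 0ℚ
    lem = solve-∀ ℚ-ring

   -- The logarithmic derivative read as a recursion for `r`. It takes the place of multiplicativity
   -- and Euler factors in the two lower bounds for `r` below.
   r-ℓ : ∀ n → suc n ℕ.≤ X → r (suc n) * ℓ (suc n) ≡ (Θ ⋆ r) (suc n)
   r-ℓ n h = begin
    r (suc n) * ℓ (suc n)
     ≡⟨ ⋆-derivation ℓ one χ (suc n) (λ { d m refl → ℓ-* d m }) ⟩
    ((λ i → one i * ℓ i) ⋆ χ) (suc n) + (one ⋆ (λ i → χ i * ℓ i)) (suc n)
     ≡⟨ cong₂ _+_ first second ⟩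
    (Λ ⋆ r) (suc n) + (Λχ ⋆ r) (suc n)
     ≡⟨ ⋆-distribʳ r Λ Λχ (suc n) ⟨
    (Θ ⋆ r) (suc n) ∎
    where
    open ≡-Reasoning
    Λχ : ℕ → ℚ
    Λχ i = Λ i * χ i
    first : ((λ i → one i * ℓ i) ⋆ χ) (suc n) ≡ (Λ ⋆ r) (suc n)
    first = trans (⋆-cong {λ i → one i * ℓ i} {Λ ⋆ one} {χ} {χ} (λ i b → trans (*-identityˡ (ℓ (suc i))) (sym (Λ⋆one i b))) (λ _ _ → refl) (suc n)) (⋆-assoc Λ one χ (suc n) h)
    second : (one ⋆ (λ i → χ i * ℓ i)) (suc n) ≡ (Λχ ⋆ r) (suc n)
    second = begin
     (one ⋆ (λ i → χ i * ℓ i)) (suc n)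
      ≡⟨ ⋆-cong {one} {one} {λ i → χ i * ℓ i} {Λχ ⋆ χ} (λ _ _ → refl) (λ i b → trans (*-comm (χ (suc i)) (ℓ (suc i))) (trans (cong (_* χ (suc i)) (sym (Λ⋆one i b)))
        (trans (⋆-twist χ Λ one (suc i) χ-*) (⋆-cong {Λχ} {Λχ} {λ j → one j * χ j} {χ} (λ _ _ → refl) (λ j _ → *-identityˡ (χ (suc j))) (suc i))))) (suc n) ⟩
     (one ⋆ (Λχ ⋆ χ)) (suc n) ≡⟨ ⋆-comm one (Λχ ⋆ χ) (suc n) ⟩
     (Λχ ⋆ χ ⋆ one) (suc n) ≡⟨ ⋆-assoc Λχ χ one (suc n) h ⟩
     (Λχ ⋆ (χ ⋆ one)) (suc n) ≡⟨ ⋆-cong {Λχ} {Λχ} {χ ⋆ one} {r} (λ _ _ → refl) (λ i _ → ⋆-comm χ one (suc i)) (suc n) ⟩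
     (Λχ ⋆ r) (suc n) ∎

   r-1 : r 1 ≡ 1ℚ
   r-1 = begin
    ∑ X (λ d → ∑ X (λ m → 𝟙 (d ℕ.* m ℕ.≟ 1) * (1ℚ * χ m)))
     ≡⟨ ∑-ext X (λ d → trans (∑-ext X (λ m → split d m)) (∑-*ˡ X (𝟙 (d ℕ.≟ 1)) (λ m → 𝟙 (m ℕ.≟ 1) * χ m))) ⟩
    ∑ X (λ d → 𝟙 (d ℕ.≟ 1) * ∑ X (λ m → 𝟙 (m ℕ.≟ 1) * χ m))
     ≡⟨ ∑-single X 0 (λ _ → ∑ X (λ m → 𝟙 (m ℕ.≟ 1) * χ m)) (s≤s z≤n) ⟩
    ∑ X (λ m → 𝟙 (m ℕ.≟ 1) * χ m)
     ≡⟨ trans (∑-single X 0 χ (s≤s z≤n)) χ-1 ⟩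
    1ℚ ∎
    where
    open ≡-Reasoning
    split : ∀ d m → 𝟙 (d ℕ.* m ℕ.≟ 1) * (1ℚ * χ m) ≡ 𝟙 (d ℕ.≟ 1) * (𝟙 (m ℕ.≟ 1) * χ m)
    split d m with d ℕ.≟ 1
    ... | yes refl = trans (cong₂ _*_ (𝟙-cong (1 ℕ.* m ℕ.≟ 1) (m ℕ.≟ 1) (trans (sym (ℕ.*-identityˡ m))) (trans (ℕ.*-identityˡ m))) (*-identityˡ (χ m))) (sym (*-identityˡ (𝟙 (m ℕ.≟ 1) * χ m)))
    ... | no ¬e = trans (cong (_* (1ℚ * χ m)) (𝟙-no (d ℕ.* m ℕ.≟ 1) (λ h → ¬e (ℕ.m*n≡1⇒m≡1 d m h)))) (trans (*-zeroˡ (1ℚ * χ m)) (sym (*-zeroˡ (𝟙 (m ℕ.≟ 1) * χ m))))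

   0<ℓ : ∀ n → suc (suc n) ℕ.≤ X → 0ℚ < ℓ (suc (suc n))
   0<ℓ n h with <-cmp 0ℚ (ℓ (suc (suc n)))
   ... | tri< lt _ _ = lt
   ... | tri> _ _ gt = ⊥-elim (<-irrefl refl (<-≤-trans gt (0≤ℓ (suc (suc n)))))
   ... | tri≈ _ eq _ = ⊥-elim (<-irrefl refl (<-≤-trans (positive⁻¹ 1ℚ) (subst₂ _≤_ inv-1 (trans (cong (λ t → ι 6 * (t - ℓ 1)) ℓ2) (trans (cong (λ t → ι 6 * (0ℚ - t)) ℓ-1) refl)) (ℓ-step-lower 0 (ℕ.≤-trans (s≤s (s≤s z≤n)) h)))))
    where
    ℓ2 : ℓ 2 ≡ 0ℚ
    ℓ2 = ≤-antisym (subst (ℓ 2 ≤_) (sym eq) (ℓ-mono 1 (suc n) (s≤s (s≤s z≤n)) h)) (0≤ℓ 2)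

   -- Strong induction with fuel `b` along r ℓ = Θ ⋆ r. Because `Θ` vanishes at 1, only values of
   -- `r` at proper divisors occur on the right.
   0≤r′ : ∀ b n → suc n ℕ.≤ b → suc n ℕ.≤ X → 0ℚ ≤ r (suc n)
   0≤r′ (suc b) zero _ _ = subst (0ℚ ≤_) (sym r-1) 0≤1
   0≤r′ (suc b) (suc n) n≤b n≤X = *-cancelˡ (ℓ (suc (suc n))) (0<ℓ n n≤X) (subst₂ _≤_ (sym (*-zeroʳ (ℓ (suc (suc n))))) (trans (sym (r-ℓ (suc n) n≤X)) (*-comm (r (suc (suc n))) (ℓ (suc (suc n))))) pos)
    where
    pos : 0ℚ ≤ (Θ ⋆ r) (suc (suc n))
    pos = ∑-nonneg X (λ d _ → ∑-nonneg X (λ m _ → subst (_≤ 𝟙 (suc d ℕ.* suc m ℕ.≟ suc (suc n)) * (Θ (suc d) * r (suc m))) (*-zeroʳ (𝟙 (suc d ℕ.* suc m ℕ.≟ suc (suc n)))) (𝟙-guard-≤ (suc d ℕ.* suc m ℕ.≟ suc (suc n)) (term d m))))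
     where
     term : ∀ d m → suc d ℕ.* suc m ≡ suc (suc n) → 0ℚ ≤ Θ (suc d) * r (suc m)
     term zero m _ = ≤-reflexive (sym (trans (cong (_* r (suc m)) Θ-1) (*-zeroˡ (r (suc m)))))
     term (suc d) m e = 0≤Θ (suc (suc d)) ⊗ 0≤r′ b m (ℕ.≤-pred (ℕ.≤-trans m<n n≤b)) (ℕ.≤-trans (ℕ.<⇒≤ m<n) n≤X)
      where
      m<n : suc m ℕ.< suc (suc n)
      m<n = subst (suc m ℕ.<_) e (ℕ.m<m+n (suc m) (s≤s z≤n))

   0≤r : ∀ n → suc n ℕ.≤ X → 0ℚ ≤ r (suc n)
   0≤r n = 0≤r′ (suc n) n ℕ.≤-refl

   Λ-divisors : ∀ n → suc n ℕ.≤ X → ∑ X (λ d → 𝟙 (d ∣? suc n) * Λ d) ≡ ℓ (suc n)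
   Λ-divisors n h = trans (sym (∑-cong X (λ d _ → trans (∑-ext X (λ m → lem (𝟙 (suc d ℕ.* m ℕ.≟ suc n)) (Λ (suc d)))) (trans (∑-*ʳ X (Λ (suc d)) (λ m → 𝟙 (suc d ℕ.* m ℕ.≟ suc n))) (cong (_* Λ (suc d)) (∑-multiples X n d h)))))) (Λ⋆one n h)
    where
    lem : ∀ a b → a * (b * 1ℚ) ≡ a * b
    lem = solve-∀ ℚ-ring

   -- In (Θ ⋆ r)(K²) only the divisors d² with d dividing K are kept. There Θ(d²) = 2 Λ(d²) ≥ 2
   -- Λ(d), and r((K/d)²) ≥ 1 by induction for d > 1. The sum of 2 Λ(d) over the divisors of K is 2
   -- ℓ(K) = ℓ(K²), which is then cancelled.
   1≤r-square′ : ∀ b k → suc k ℕ.≤ b → Unit (suc k) → suc k ℕ.* suc k ℕ.≤ X → 1ℚ ≤ r (suc k ℕ.* suc k)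
   1≤r-square′ (suc b) zero _ _ _ = ≤-reflexive (sym r-1)
   1≤r-square′ (suc b) (suc k) k≤b uk kk≤X = *-cancelˡ (ℓ K + ℓ K) (<-≤-trans (0<ℓ k K≤X) (subst (_≤ ℓ K + ℓ K) (+-identityʳ (ℓ K)) (+-monoʳ-≤ (ℓ K) (0≤ℓ K)))) (begin
    (ℓ K + ℓ K) * 1ℚ
     ≡⟨ lem (ℓ K) ⟩
    ι 2 * ℓ K
     ≡⟨ trans (∑-*ˡ X (ι 2) (λ d → 𝟙 (d ∣? K) * Λ d)) (cong (ι 2 *_) (Λ-divisors (suc k) K≤X)) ⟨
    ∑ X (λ d → ι 2 * (𝟙 (d ∣? K) * Λ d))
     ≤⟨ ∑-mono X (λ d _ → step d) ⟩
    ∑ X (λ d → 𝟙 (d ℕ.* d ℕ.≤? X) * F (d ℕ.* d))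
     ≤⟨ ∑-squares X F (λ n _ → 0≤F n) ⟩
    ∑ X F
     ≡⟨ sym (∑-ext X (λ d → trans (∑-ext X (λ m → lem₃ (𝟙 (d ℕ.* m ℕ.≟ K ℕ.* K)) (Θ d) (r m))) (∑-*ˡ X (Θ d) _))) ⟩
    (Θ ⋆ r) (K ℕ.* K)
     ≡⟨ r-ℓ (suc k ℕ.+ suc k ℕ.* suc (suc k)) kk≤X ⟨
    r (K ℕ.* K) * ℓ (K ℕ.* K)
     ≡⟨ trans (*-comm (r (K ℕ.* K)) (ℓ (K ℕ.* K))) (cong (_* r (K ℕ.* K)) (ℓ-* (suc k) (suc k))) ⟩
    (ℓ K + ℓ K) * r (K ℕ.* K) ∎)
    where
    open ≤-Reasoning
    K = suc (suc k)
    K≤X : K ℕ.≤ X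
    K≤X = ℕ.≤-trans (ℕ.m≤m*n K K) kk≤X
    lem : ∀ a → (a + a) * 1ℚ ≡ ι 2 * a
    lem = solve-∀ ℚ-ring
    lem₃ : ∀ a b c → a * (b * c) ≡ b * (a * c)
    lem₃ = solve-∀ ℚ-ring
    ρ F : ℕ → ℚ
    ρ D = ∑ X (λ m → 𝟙 (D ℕ.* m ℕ.≟ K ℕ.* K) * r m)
    F D = Θ D * ρ D
    0≤ρ : ∀ D → 0ℚ ≤ ρ D
    0≤ρ D = ∑-nonneg X (λ m b′ → 0≤𝟙 (D ℕ.* suc m ℕ.≟ K ℕ.* K) ⊗ 0≤r m b′)
    0≤F : ∀ n → 0ℚ ≤ F (suc n)
    0≤F n = 0≤Θ (suc n) ⊗ 0≤ρ (suc n)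
    step : ∀ d → ι 2 * (𝟙 (suc d ∣? K) * Λ (suc d)) ≤ 𝟙 (suc d ℕ.* suc d ℕ.≤? X) * F (suc d ℕ.* suc d)
    step d with suc d ∣? K
    ... | no _ = subst (_≤ 𝟙 (suc d ℕ.* suc d ℕ.≤? X) * F (suc d ℕ.* suc d)) (lem′ (Λ (suc d))) (0≤𝟙 (suc d ℕ.* suc d ℕ.≤? X) ⊗ 0≤F (d ℕ.+ d ℕ.* suc d))
     where
     lem′ : ∀ a → 0ℚ ≡ ι 2 * (0ℚ * a)
     lem′ = solve-∀ ℚ-ring
    step zero | yes _ = subst (_≤ 𝟙 (1 ℕ.≤? X) * F 1) (trans (lem′ (ι 2)) (cong (λ t → ι 2 * (1ℚ * t)) (sym Λ-1))) (0≤𝟙 (1 ℕ.≤? X) ⊗ 0≤F 0)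
     where
     lem′ : ∀ a → 0ℚ ≡ a * (1ℚ * 0ℚ)
     lem′ = solve-∀ ℚ-ring
    step (suc d) | yes (divides (suc m) e) = subst (ι 2 * (1ℚ * Λ D) ≤_) (sym (trans (cong (_* F (D ℕ.* D)) (𝟙-yes (D ℕ.* D ℕ.≤? X) DD≤X)) (*-identityˡ (F (D ℕ.* D))))) (begin
     ι 2 * (1ℚ * Λ D) ≤⟨ *-monoˡ (ι 2) (0≤ι 2) (subst₂ _≤_ (sym (*-identityˡ (Λ D))) refl (Λ-square (suc d) DD≤X)) ⟩
     ι 2 * Λ (D ℕ.* D) ≡⟨ lem′ (Λ (D ℕ.* D)) ⟩
     Λ (D ℕ.* D) + Λ (D ℕ.* D) * 1ℚ ≡⟨ cong (λ t → Λ (D ℕ.* D) + Λ (D ℕ.* D) * t) (sym (trans (χ-* D D) (trans (χ-square D) (𝟙-yes (unit? D) (Unit-*ʳ {suc m} {D} (subst Unit e uk)))))) ⟩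
     Θ (D ℕ.* D) ≡⟨ *-identityʳ (Θ (D ℕ.* D)) ⟨
     Θ (D ℕ.* D) * 1ℚ ≤⟨ *-monoˡ (Θ (D ℕ.* D)) (0≤Θ (D ℕ.* D)) 1≤ρ ⟩
     F (D ℕ.* D) ∎)
     where
     D = suc (suc d)
     lem′ : ∀ a → ι 2 * a ≡ a + a * 1ℚ
     lem′ = solve-∀ ℚ-ring
     D≤K : D ℕ.≤ K
     D≤K = ℕ.≤-trans (ℕ.m≤n*m D (suc m)) (ℕ.≤-reflexive (sym e))
     DD≤X : D ℕ.* D ℕ.≤ X
     DD≤X = ℕ.≤-trans (ℕ.*-mono-≤ D≤K D≤K) kk≤X
     m<K : suc m ℕ.< K
     m<K = subst (suc m ℕ.<_) (trans (ℕ.*-comm D (suc m)) (sym e)) (ℕ.m<m+n (suc m) (s≤s z≤n))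
     mm≤X : suc m ℕ.* suc m ℕ.≤ X
     mm≤X = ℕ.≤-trans (ℕ.*-mono-≤ (ℕ.<⇒≤ m<K) (ℕ.<⇒≤ m<K)) kk≤X
     eq : D ℕ.* D ℕ.* (suc m ℕ.* suc m) ≡ K ℕ.* K
     eq = trans (rearr D (suc m)) (sym (cong₂ ℕ._*_ e e))
      where
      rearr : ∀ a b → a ℕ.* a ℕ.* (b ℕ.* b) ≡ b ℕ.* a ℕ.* (b ℕ.* a)
      rearr = ℕ-solve
     1≤ρ : 1ℚ ≤ ρ (D ℕ.* D)
     1≤ρ = ≤-trans (1≤r-square′ b m (ℕ.≤-pred (ℕ.≤-trans m<K k≤b)) (Unit-*ˡ {suc m} {D} (subst Unit e uk)) mm≤X)
      (subst (_≤ ρ (D ℕ.* D)) (trans (cong (_* r (suc m ℕ.* suc m)) (𝟙-yes (D ℕ.* D ℕ.* (suc m ℕ.* suc m) ℕ.≟ K ℕ.* K) eq)) (*-identityˡ (r (suc m ℕ.* suc m))))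
       (term≤∑ X (m ℕ.+ m ℕ.* suc m) (λ n → 𝟙 (D ℕ.* D ℕ.* n ℕ.≟ K ℕ.* K) * r n) mm≤X (λ n b′ → 0≤𝟙 (D ℕ.* D ℕ.* suc n ℕ.≟ K ℕ.* K) ⊗ 0≤r n b′)))

   1≤r-square : ∀ k → Unit (suc k) → suc k ℕ.* suc k ℕ.≤ X → 1ℚ ≤ r (suc k ℕ.* suc k)
   1≤r-square k = 1≤r-square′ (suc k) k ℕ.≤-refl

  L : ℕ → ℚ
  L y = ∑ y (λ n → χ n * inv n)

  L-tail : ∀ z k → ∣ L (z ℕ.+ k) - L z ∣ ≤ (ι N + ι N) * inv (suc z)
  L-tail z zero = subst (λ t → ∣ t ∣ ≤ (ι N + ι N) * inv (suc z)) (sym (trans (cong (λ t → L t - L z) (ℕ.+-identityʳ z)) (+-inverseʳ (L z)))) ((0≤ι N ⊕ 0≤ι N) ⊗ 0≤inv (suc z))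
  L-tail z (suc k) = subst₂ (λ s t → ∣ s ∣ ≤ (ι N + ι N) * inv t) (sym (trans (cong (_- L z) (∑-split z (suc k) (λ n → χ n * inv n))) (lem (L z) _))) (trans (ℕ.+-suc z 0) (cong suc (ℕ.+-identityʳ z)))
   (abel-decreasing (λ i → χ (z ℕ.+ i)) (λ i → inv (z ℕ.+ i)) (ι N + ι N) k (λ k′ _ → χ-tail z k′) (λ n → 0≤inv (z ℕ.+ n))
    (λ n _ → subst (λ t → inv (z ℕ.+ suc (suc n)) ≤ inv t) (sym (ℕ.+-suc z n)) (inv-anti (z ℕ.+ n) (z ℕ.+ suc (suc n)) (ℕ.≤-trans (ℕ.≤-reflexive (sym (ℕ.+-suc z n))) (ℕ.+-monoʳ-≤ z (ℕ.n≤1+n (suc n)))))))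
   where
   lem : ∀ a b → a + b - a ≡ b
   lem = solve-∀ ℚ-ring

  ΣχΛ : ℕ → ℚ
  ΣχΛ x = ∑ x (λ n → Λ n * χ n * inv n)

  private
   variation : ∀ n → suc (suc n) ℕ.≤ X → ∣ ℓ (suc (suc n)) * inv (suc (suc n)) - ℓ (suc n) * inv (suc n) ∣ ≤ (ℓ (suc n) + ι 2) * inv (suc n) - (ℓ (suc (suc n)) + ι 2) * inv (suc (suc n))
   variation n b = ∣∣≤
    (close (0≤ι 2 ⊗ (0≤inv (suc n) ⊗ 0≤inv (suc (suc n)))) (trans (cong (ι 2 *_) (sym (inv-step n))) (lem (inv (suc n)) (inv (suc (suc n))) (ℓ (suc n)) (ℓ (suc (suc n))))))
    (close (0≤inv (suc (suc n)) ⊗ (0≤ι 2 ⊗ (0≤ℓ (suc n) ⊗ 0≤inv (suc n)) ⊕ 0≤ι 2 ⊗ diff (ℓ-step-upper n b)))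
     (trans (lem₁ (inv (suc n)) (inv (suc (suc n))) (ℓ (suc n)) (ℓ (suc (suc n)))) (trans (cong (λ t → t * (ι 2 * ℓ (suc n) + ι 2) + inv (suc (suc n)) * (ι 2 * ℓ (suc n) - ι 2 * ℓ (suc (suc n)))) (sym (inv-step n)))
      (lem₂ (inv (suc n)) (inv (suc (suc n))) (ℓ (suc n)) (ℓ (suc (suc n)))))))
    where
    lem : ∀ i j l l′ → ι 2 * (i - j) ≡ l′ * j - l * i - - ((l + ι 2) * i - (l′ + ι 2) * j)
    lem = solve-∀ ℚ-ring
    lem₁ : ∀ i j l l′ → j * (ι 2 * (l * i) + ι 2 * (i - (l′ - l))) ≡ i * j * (ι 2 * l + ι 2) + j * (ι 2 * l - ι 2 * l′)
    lem₁ = solve-∀ ℚ-ring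
    lem₂ : ∀ i j l l′ → (i - j) * (ι 2 * l + ι 2) + j * (ι 2 * l - ι 2 * l′) ≡ (l + ι 2) * i - (l′ + ι 2) * j - (l′ * j - l * i)
    lem₂ = solve-∀ ℚ-ring

   χℓ-bound : ∀ x → suc x ℕ.≤ X → ∣ ∑ (suc x) (λ n → χ n * (ℓ n * inv n)) ∣ ≤ ι N * ι 2
   χℓ-bound x x≤X = subst (λ t → ∣ ∑ (suc x) (λ n → χ n * (ℓ n * inv n)) ∣ ≤ ι N * t) (trans (cong₂ (λ s t → (s + ι 2) * t) ℓ-1 inv-1) refl)
    (abel χ (λ n → ℓ n * inv n) (λ n → (ℓ n + ι 2) * inv n) (ι N) x (λ k _ → χ-partial k) (λ n b → variation n (ℕ.≤-trans b x≤X))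
     (0≤⇒∣∣ (0≤ℓ (suc x) ⊗ 0≤inv (suc x)) (close (0≤ι 2 ⊗ 0≤inv (suc x)) (lem (ℓ (suc x)) (inv (suc x))))))
    where
    lem : ∀ l i → ι 2 * i ≡ (l + ι 2) * i - l * i
    lem = solve-∀ ℚ-ring

   L-÷ : ∀ x d → suc d ℕ.≤ suc x → ∣ L (suc x) - L (suc x ÷ suc d) ∣ ≤ (ι N + ι N) * (ι (suc d) * inv (suc x))
   L-÷ x d d≤x = ≤-trans (subst (λ t → ∣ L t - L k ∣ ≤ (ι N + ι N) * inv (suc k)) (ℕ.m+[n∸m]≡n (÷-≤ (suc x) (suc d))) (L-tail k (suc x ℕ.∸ k)))
    (*-monoˡ (ι N + ι N) (0≤ι N ⊕ 0≤ι N) small)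
    where
    k = suc x ÷ suc d
    small : inv (suc k) ≤ ι (suc d) * inv (suc x)
    small = subst (_≤ ι (suc d) * inv (suc x)) (*-identityʳ (inv (suc k))) (inv*≤ k (begin
     1ℚ ≡⟨ trans (sym (ι*inv x)) refl ⟩
     ι (suc x) * inv (suc x) ≤⟨ *-monoʳ (inv (suc x)) (0≤inv (suc x)) (ι-mono (ℕ.<⇒≤ (÷-< (suc x) d))) ⟩
     ι (suc d ℕ.* suc k) * inv (suc x) ≡⟨ trans (cong (_* inv (suc x)) (trans (ι-* (suc d) (suc k)) (*-comm (ι (suc d)) (ι (suc k))))) (*-assoc (ι (suc k)) (ι (suc d)) (inv (suc x))) ⟩
     ι (suc k) * (ι (suc d) * inv (suc x)) ∎))
     where open ≤-Reasoning

  -- Σ χ(n) ℓ(n)/n is bounded by Abel summation and equals Σ χ(d) Λ(d)/d L(x/d). Replacing L(x/d) by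
  -- L(x) costs 2 N d/x in the term of d, that is 2 N Λ(d)/x, and Chebyshev's bound sums this to 8
  -- N.
  L-ΣχΛ : ∀ x → suc x ℕ.≤ X → ∣ ΣχΛ (suc x) * L (suc x) ∣ ≤ ι 10 * ι N
  L-ΣχΛ x′ x≤X = begin
   ∣ ΣχΛ x * L x ∣
    ≡⟨ cong ∣_∣ (trans (sym (∑-*ʳ x (L x) (λ n → Λ n * χ n * inv n))) (trans (∑-ext x (λ d → lem (Λ d * χ d * inv d) (L x) (L (x ÷ d)))) (trans (∑-+ x _ _) (cong (_+ ∑ x (λ d → Λ d * χ d * inv d * (L x - L (x ÷ d)))) (sym main))))) ⟩
   ∣ ∑ x (λ n → χ n * (ℓ n * inv n)) + ∑ x (λ d → Λ d * χ d * inv d * (L x - L (x ÷ d))) ∣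
    ≤⟨ ∣∣-add (χℓ-bound x′ x≤X) (∑-abs-≤ x {g = λ d → Λ d * ((ι N + ι N) * inv x)} term) ⟩
   ι N * ι 2 + ∑ x (λ d → Λ d * ((ι N + ι N) * inv x))
    ≡⟨ cong (ι N * ι 2 +_) (∑-*ʳ x ((ι N + ι N) * inv x) Λ) ⟩
   ι N * ι 2 + ψ x * ((ι N + ι N) * inv x)
    ≤⟨ +-monoʳ-≤ (ι N * ι 2) (*-monoʳ ((ι N + ι N) * inv x) ((0≤ι N ⊕ 0≤ι N) ⊗ 0≤inv x) (ψ-bound x x≤X)) ⟩
   ι N * ι 2 + ι 4 * ι x * ((ι N + ι N) * inv x)
    ≡⟨ trans (lem₂ (ι N) (ι x) (inv x)) (trans (cong (λ t → ι N * ι 2 + ι 4 * (ι N + ι N) * t) (ι*inv x′)) (lem₃ (ι N))) ⟩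
   ι 10 * ι N ∎
   where
   open ≤-Reasoning
   x = suc x′
   lem : ∀ a b c → a * b ≡ a * c + a * (b - c)
   lem = solve-∀ ℚ-ring
   lem₂ : ∀ n x i → n * ι 2 + ι 4 * x * ((n + n) * i) ≡ n * ι 2 + ι 4 * (n + n) * (x * i)
   lem₂ = solve-∀ ℚ-ring
   lem₃ : ∀ n → n * ι 2 + ι 4 * (n + n) * 1ℚ ≡ ι 10 * n
   lem₃ = solve-∀ ℚ-ring
   main : ∑ x (λ n → χ n * (ℓ n * inv n)) ≡ ∑ x (λ d → Λ d * χ d * inv d * L (x ÷ d))
   main = trans (∑-cong x (λ n b → trans (lem₄ (χ (suc n)) (ℓ (suc n)) (inv (suc n))) (cong (_* (χ (suc n) * inv (suc n))) (sym (Λ⋆one n (ℕ.≤-trans b x≤X))))))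
    (trans (∑-⋆ Λ one (λ n → χ n * inv n) x x≤X) (∑-ext x (λ d → trans (cong (Λ d *_) (trans (∑-ext (x ÷ d) (λ m → trans (cong₂ (λ s t → 1ℚ * (s * t)) (χ-* d m) (inv-* d m)) (lem₅ (χ d) (χ m) (inv d) (inv m)))) (∑-*ˡ (x ÷ d) (χ d * inv d) _))) (lem₆ (Λ d) (χ d) (inv d) (L (x ÷ d))))))
    where
    lem₄ : ∀ a b c → a * (b * c) ≡ b * (a * c)
    lem₄ = solve-∀ ℚ-ring
    lem₅ : ∀ a b i j → 1ℚ * (a * b * (i * j)) ≡ a * i * (b * j)
    lem₅ = solve-∀ ℚ-ring
    lem₆ : ∀ a b c d → a * (b * c * d) ≡ a * b * c * d
    lem₆ = solve-∀ ℚ-ring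
   term : ∀ d → suc d ℕ.≤ x → ∣ Λ (suc d) * χ (suc d) * inv (suc d) * (L x - L (x ÷ suc d)) ∣ ≤ Λ (suc d) * ((ι N + ι N) * inv x)
   term d d≤x = subst (∣ Λ (suc d) * χ (suc d) * inv (suc d) * (L x - L (x ÷ suc d)) ∣ ≤_)
    (trans (lem₇ (Λ (suc d)) (inv (suc d)) (ι N) (ι (suc d)) (inv x)) (trans (cong (λ t → t * (Λ (suc d) * ((ι N + ι N) * inv x))) (ι*inv d)) (*-identityˡ (Λ (suc d) * ((ι N + ι N) * inv x)))))
    (∣∣-mul (∣∣-mul (∣∣-mul (0≤⇒∣∣ (0≤Λ (suc d)) ≤-refl) (∣χ∣≤1 (suc d))) (0≤⇒∣∣ (0≤inv (suc d)) ≤-refl)) (L-÷ x′ d d≤x))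
    where
    lem₇ : ∀ a i n d x → a * 1ℚ * i * ((n + n) * (d * x)) ≡ d * i * (a * ((n + n) * x))
    lem₇ = solve-∀ ℚ-ring

  -- Lower bound for L(1,χ): compare Σ r(n) (Y - n) ≥ Σ_k (Y - k²) over squares
  -- of units with its main term (Y²/2) L, splitting the divisor sum at D.
  module LowerBound (z′ : ℕ) (z-large : 128 ℕ.* (128 ℕ.* (N ℕ.* N ℕ.* (N ℕ.* N))) ℕ.≤ suc z′)
   (Y≤X : 4 ℕ.* (suc z′ ℕ.* N ℕ.* (suc z′ ℕ.* N)) ℕ.≤ X) where

   private
    z P Y : ℕ
    z = suc z′
    P = z ℕ.* N
    Y = 4 ℕ.* (P ℕ.* P)

   -- With Y = 4 (zN)², the z numbers d ≡ 1 modulo N up to zN give at least 3 z (zN)² from their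
   -- squares, doubled 6 z³ N². Beyond D the error is at most 2 N Y²/D = z³ N²/2. Up to D it is Y N
   -- + D², of order N⁶ z², which is small because z ≥ 128² N⁴.
   D : ℕ
   D = 64 ℕ.* (N ℕ.* N ℕ.* N) ℕ.* z

   private
    n ζ y : ℚ
    n = ι N
    ζ = ι z
    y = ι Y

    1≤ζ : 1ℚ ≤ ζ
    1≤ζ = 1≤ι z′

    ζ-large : ι 128 * (ι 128 * (n * n * (n * n))) ≤ ζ
    ζ-large = subst (_≤ ζ) (trans (ι-* 128 (128 ℕ.* (N ℕ.* N ℕ.* (N ℕ.* N)))) (cong (ι 128 *_) (trans (ι-* 128 (N ℕ.* N ℕ.* (N ℕ.* N))) (cong (ι 128 *_) (trans (ι-* (N ℕ.* N) (N ℕ.* N)) (cong₂ _*_ (ι-* N N) (ι-* N N))))))) (ι-mono z-large)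

    y-eq : y ≡ ι 4 * (ζ * n * (ζ * n))
    y-eq = trans (ι-* 4 (P ℕ.* P)) (cong (ι 4 *_) (trans (ι-* P P) (cong₂ _*_ (ι-* z N) (ι-* z N))))

    D-eq : ι D ≡ ι 64 * (n * n * n) * ζ
    D-eq = trans (ι-* (64 ℕ.* (N ℕ.* N ℕ.* N)) z) (cong (_* ζ) (trans (ι-* 64 (N ℕ.* N ℕ.* N)) (cong (ι 64 *_) (trans (ι-* (N ℕ.* N) N) (cong (_* n) (ι-* N N))))))

    0≤n = 0≤ι N
    0≤ζ = 0≤ι z
    0≤y = 0≤ι Y

    P≤Y : P ℕ.≤ Y
    P≤Y = ℕ.≤-trans (ℕ.m≤m*n P P) (ℕ.m≤m+n (P ℕ.* P) _)

    ∑-periods : ∀ k (g : ℕ → ℚ) → Periodic g → ∑ (k ℕ.* N) g ≡ ι k * ∑ N g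
    ∑-periods zero g per = sym (*-zeroˡ (∑ N g))
    ∑-periods (suc k) g per = trans (∑-split N (k ℕ.* N) g) (trans (cong (∑ N g +_) (trans (∑-ext (k ℕ.* N) (λ i → per (≈-trans (≈-reflexive (ℕ.+-comm N i)) (≈-+N i)))) (∑-periods k g per))) (lem (ι k) (∑ N g)))
     where
     lem : ∀ a b → b + a * b ≡ (a + 1ℚ) * b
     lem = solve-∀ ℚ-ring

    F : ℕ → ℚ
    F m = r m * (y - ι m)

    0≤F : ∀ m → suc m ℕ.≤ Y → 0ℚ ≤ F (suc m)
    0≤F m h = 0≤r m (ℕ.≤-trans h Y≤X) ⊗ diff (ι-mono h)

    lower : ζ * (ι 3 * (ζ * n * (ζ * n))) ≤ ∑ Y F
    lower = begin
     ζ * c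
      ≡⟨ cong (_* c) (trans (sym (*-identityʳ ζ)) (trans (cong (ζ *_) (sym (∑-≈ 1))) (sym (∑-periods z (λ d → 𝟙 (d ≈? 1)) (λ {a} {b} h → 𝟙-cong (a ≈? 1) (b ≈? 1) (≈-trans (≈-sym h)) (≈-trans h)))))) ⟩
     ∑ P (λ d → 𝟙 (d ≈? 1)) * c
      ≡⟨ ∑-*ʳ P c (λ d → 𝟙 (d ≈? 1)) ⟨
     ∑ P (λ d → 𝟙 (d ≈? 1) * c)
      ≤⟨ ∑-mono P (λ d d≤P → term d d≤P) ⟩
     ∑ P (λ d → 𝟙 (d ℕ.* d ℕ.≤? Y) * F (d ℕ.* d))
      ≤⟨ ∑-mono-range (λ d → 𝟙 (d ℕ.* d ℕ.≤? Y) * F (d ℕ.* d)) P≤Y (λ d _ → subst (_≤ 𝟙 (suc d ℕ.* suc d ℕ.≤? Y) * F (suc d ℕ.* suc d)) (*-zeroʳ (𝟙 (suc d ℕ.* suc d ℕ.≤? Y))) (𝟙-guard-≤ (suc d ℕ.* suc d ℕ.≤? Y) (0≤F (d ℕ.+ d ℕ.* suc d)))) ⟩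
     ∑ Y (λ d → 𝟙 (d ℕ.* d ℕ.≤? Y) * F (d ℕ.* d))
      ≤⟨ ∑-squares Y F 0≤F ⟩
     ∑ Y F ∎
     where
     open ≤-Reasoning
     c = ι 3 * (ζ * n * (ζ * n))
     term : ∀ d → suc d ℕ.≤ P → 𝟙 (suc d ≈? 1) * c ≤ 𝟙 (suc d ℕ.* suc d ℕ.≤? Y) * F (suc d ℕ.* suc d)
     term d d≤P = subst (𝟙 (suc d ≈? 1) * c ≤_) (sym (trans (cong (_* F (suc d ℕ.* suc d)) (𝟙-yes (suc d ℕ.* suc d ℕ.≤? Y) dd≤Y)) (*-identityˡ (F (suc d ℕ.* suc d))))) (go (suc d ≈? 1))
      where
      dd≤P : suc d ℕ.* suc d ℕ.≤ P ℕ.* P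
      dd≤P = ℕ.*-mono-≤ d≤P d≤P
      dd≤Y : suc d ℕ.* suc d ℕ.≤ Y
      dd≤Y = ℕ.≤-trans dd≤P (ℕ.m≤m+n (P ℕ.* P) _)
      dd≤ : ι (suc d ℕ.* suc d) ≤ ζ * n * (ζ * n)
      dd≤ = subst (ι (suc d ℕ.* suc d) ≤_) (trans (ι-* P P) (cong₂ _*_ (ι-* z N) (ι-* z N))) (ι-mono dd≤P)
      go : (dec : Dec (suc d ≈ 1)) → 𝟙 dec * c ≤ F (suc d ℕ.* suc d)
      go (no _) = subst (_≤ F (suc d ℕ.* suc d)) (sym (*-zeroˡ c)) (0≤F (d ℕ.+ d ℕ.* suc d) dd≤Y)
      go (yes h) = *-mono 0≤1 (diff (ι-mono dd≤Y)) (1≤r-square d (Unit-≈ (≈-sym h) Unit-1) (ℕ.≤-trans dd≤Y Y≤X))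
       (close (diff dd≤) (trans (lem (ζ * n * (ζ * n)) (ι (suc d ℕ.* suc d))) (cong (λ t → t - ι (suc d ℕ.* suc d) - c) (sym y-eq))))
       where
       lem : ∀ a b → a - b ≡ ι 4 * a - b - ι 3 * a
       lem = solve-∀ ℚ-ring

    -- The benefit of the weight Y - n over a sharp cutoff: `G` decreases in d, so Abel summation
    -- handles the tail, and 2 G d differs from Y²/d - Y by at most d.
    G : ℕ → ℚ
    G d = ∑ (Y ÷ d) (λ m → y - ι d * ι m)

    ∑F : ∑ Y F ≡ ∑ Y (λ d → χ d * G d)
    ∑F = trans (∑-ext Y (λ m → cong (_* (y - ι m)) (⋆-comm one χ m))) (trans (∑-⋆ χ one (λ m → y - ι m) Y Y≤X)
     (∑-ext Y (λ d → cong (χ d *_) (∑-ext (Y ÷ d) (λ m → trans (*-identityˡ (y - ι (d ℕ.* m))) (cong (λ t → y - t) (ι-* d m)))))))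

    -- The fractional part of Y/d.
    v : ℕ → ℚ
    v d = y * inv d - ι (Y ÷ d)

    0≤v : ∀ d → 0ℚ ≤ v (suc d)
    0≤v d = diff (ι-÷-upper Y d)

    v≤1 : ∀ d → v (suc d) ≤ 1ℚ
    v≤1 d = close (diff (ι-÷-lower Y d)) (lem (ι (Y ÷ suc d)) (y * inv (suc d)))
     where
     lem : ∀ a b → a + 1ℚ - b ≡ 1ℚ - (b - a)
     lem = solve-∀ ℚ-ring

    2G : ∀ d → ι 2 * G (suc d) ≡ y * y * inv (suc d) - y + ι (suc d) * (v (suc d) - v (suc d) * v (suc d))
    2G d = trans (riesz y (ι (suc d)) (Y ÷ suc d)) (reduce (ι (suc d)) (inv (suc d)) (ι (Y ÷ suc d)) y (ι*inv d))
     where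
     lem : ∀ δ i k y → ι 2 * k * y - δ * (k * (k + 1ℚ)) ≡ y * y * i - y + δ * ((y * i - k) - (y * i - k) * (y * i - k)) + (1ℚ - δ * i) * (ι 2 * k * y + y - y * y * i)
     lem = solve-∀ ℚ-ring
     lem₁ : ∀ a b → a + (1ℚ - 1ℚ) * b ≡ a
     lem₁ = solve-∀ ℚ-ring
     reduce : ∀ δ i k y → δ * i ≡ 1ℚ → ι 2 * k * y - δ * (k * (k + 1ℚ)) ≡ y * y * i - y + δ * ((y * i - k) - (y * i - k) * (y * i - k))
     reduce δ i k y h = trans (lem δ i k y) (trans (cong (λ t → a + (1ℚ - t) * b) h) (lem₁ a b))
      where
      a b : ℚ
      a = y * y * i - y + δ * ((y * i - k) - (y * i - k) * (y * i - k))
      b = ι 2 * k * y + y - y * y * i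

    2G≤ : ∀ d → ι 2 * G (suc d) ≤ y * y * inv (suc d)
    2G≤ d = subst (_≤ y * y * inv (suc d)) (sym (2G d)) (close (0≤ι (suc d) ⊗ 0≤sq (v (suc d)) ⊕ 0≤ι (suc d) ⊗ 0≤ι (Y ÷ suc d))
     (trans (lem (ι (suc d)) (inv (suc d)) (ι (Y ÷ suc d)) y (v (suc d))) (trans (cong (λ t → ι (suc d) * (v (suc d) * v (suc d)) + ι (suc d) * ι (Y ÷ suc d) + y - y * t) (sym (ι*inv d))) (lem′ (ι (suc d)) (inv (suc d)) (ι (Y ÷ suc d)) y))))
     where
     lem : ∀ δ i k y v → δ * (v * v) + δ * k ≡ δ * (v * v) + δ * k + y - y * 1ℚ
     lem = solve-∀ ℚ-ring
     lem′ : ∀ δ i k y → δ * ((y * i - k) * (y * i - k)) + δ * k + y - y * (δ * i) ≡ y * y * i - (y * y * i - y + δ * ((y * i - k) - (y * i - k) * (y * i - k)))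
     lem′ = solve-∀ ℚ-ring

    0≤term : ∀ d m → m ℕ.≤ Y ÷ suc d → 0ℚ ≤ y - ι (suc d) * ι m
    0≤term d m h = diff (subst (_≤ y) (ι-* (suc d) m) (ι-mono (÷-lower′ Y d m h)))

    0≤G : ∀ d → 0ℚ ≤ G d
    0≤G zero = ≤-refl
    0≤G (suc d) = ∑-nonneg (Y ÷ suc d) (λ m b → 0≤term d (suc m) b)

    G-decreasing : ∀ d → G (suc (suc d)) ≤ G (suc d)
    G-decreasing d = ≤-trans (∑-mono (Y ÷ suc (suc d)) (λ m _ → close (0≤ι (suc m)) (lem y (ι (suc d)) (ι (suc m)))))
     (∑-mono-range (λ m → y - ι (suc d) * ι m) (÷-upper Y d (Y ÷ suc (suc d)) (ℕ.≤-trans (ℕ.*-monoˡ-≤ (Y ÷ suc (suc d)) (ℕ.n≤1+n (suc d))) (÷-lower Y (suc d)))) (λ m b → 0≤term d (suc m) b))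
     where
     lem : ∀ y δ m → m ≡ y - δ * m - (y - (δ + 1ℚ) * m)
     lem = solve-∀ ℚ-ring

    head : ι 2 * ∑ D (λ d → χ d * G d) ≤ y * y * L D + y * n + ι D * ι D
    head = begin
     ι 2 * ∑ D (λ d → χ d * G d)
      ≡⟨ trans (sym (∑-*ˡ D (ι 2) (λ d → χ d * G d))) (∑-cong D (λ d _ → trans (lem (χ (suc d)) (G (suc d))) (trans (cong (χ (suc d) *_) (2G d)) (lem′ (χ (suc d)) y (inv (suc d)) (ι (suc d) * (v (suc d) - v (suc d) * v (suc d))))))) ⟩
     ∑ D (λ d → y * y * (χ d * inv d) - y * χ d + χ d * (ι d * (v d - v d * v d)))
      ≡⟨ trans (∑-+ D _ _) (cong (_+ ∑ D (λ d → χ d * (ι d * (v d - v d * v d)))) (trans (∑-- D _ _) (cong₂ _-_ (∑-*ˡ D (y * y) _) (∑-*ˡ D y χ)))) ⟩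
     y * y * L D - y * ∑ D χ + ∑ D (λ d → χ d * (ι d * (v d - v d * v d)))
      ≤⟨ close (0≤y ⊗ diff (∣∣⇒≥ (χ-partial D)) ⊕ diff (∣∣⇒≤ errors)) (lem″ (y * y * L D) y (∑ D χ) n (∑ D (λ d → χ d * (ι d * (v d - v d * v d)))) (ι D * ι D)) ⟩
     y * y * L D + y * n + ι D * ι D ∎
     where
     open ≤-Reasoning
     lem : ∀ a b → ι 2 * (a * b) ≡ a * (ι 2 * b)
     lem = solve-∀ ℚ-ring
     lem′ : ∀ c y i t → c * (y * y * i - y + t) ≡ y * y * (c * i) - y * c + c * t
     lem′ = solve-∀ ℚ-ring
     lem″ : ∀ a y s n e d → y * (s - - n) + (d - e) ≡ a + y * n + d - (a - y * s + e)
     lem″ = solve-∀ ℚ-ring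
     lem₁ : ∀ v → v * (1ℚ - v) ≡ v - v * v
     lem₁ = solve-∀ ℚ-ring
     lem₂ : ∀ v → (1ℚ - v) + v * v ≡ 1ℚ - (v - v * v)
     lem₂ = solve-∀ ℚ-ring
     errors : ∣ ∑ D (λ d → χ d * (ι d * (v d - v d * v d))) ∣ ≤ ι D * ι D
     errors = subst (∣ ∑ D (λ d → χ d * (ι d * (v d - v d * v d))) ∣ ≤_) (∑-const D (ι D)) (∑-abs-≤ D {g = λ _ → ι D} (λ d b →
      subst (∣ χ (suc d) * (ι (suc d) * (v (suc d) - v (suc d) * v (suc d))) ∣ ≤_) (trans (*-identityˡ (ι D * 1ℚ)) (*-identityʳ (ι D)))
       (∣∣-mul (∣χ∣≤1 (suc d)) (∣∣-mul (0≤⇒∣∣ (0≤ι (suc d)) (ι-mono b)) (0≤⇒∣∣ (subst (0ℚ ≤_) (lem₁ (v (suc d))) (0≤v d ⊗ diff (v≤1 d))) (close (diff (v≤1 d) ⊕ 0≤sq (v (suc d))) (lem₂ (v (suc d)))))))))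

    tail : ∀ t → ∑ t (λ i → χ (D ℕ.+ i) * G (D ℕ.+ i)) ≤ (n + n) * G (suc D)
    tail zero = (0≤n ⊕ 0≤n) ⊗ 0≤G (suc D)
    tail (suc t) = ∣∣⇒≤ (subst (λ s → ∣ ∑ (suc t) (λ i → χ (D ℕ.+ i) * G (D ℕ.+ i)) ∣ ≤ (n + n) * G s) (trans (ℕ.+-suc D 0) (cong suc (ℕ.+-identityʳ D)))
     (abel-decreasing (λ i → χ (D ℕ.+ i)) (λ i → G (D ℕ.+ i)) (n + n) t (λ k _ → χ-tail D k) (λ i → 0≤G (D ℕ.+ i))
      (λ i _ → subst₂ (λ a b → G a ≤ G b) (sym (trans (ℕ.+-suc D (suc i)) (cong suc (ℕ.+-suc D i)))) (sym (ℕ.+-suc D i)) (G-decreasing (D ℕ.+ i)))))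

    ζ-16 : ι 16 * n ≤ ζ
    ζ-16 = ≤-trans (*-mono (0≤ι 16) (0≤ι 128 ⊗ (0≤NN ⊗ 0≤NN)) (ι-mono {16} {128} (ℕ.m≤m+n 16 112)) nn≤) ζ-large
     where
     nn≤ : n ≤ ι 128 * (n * n * (n * n))
     nn≤ = ≤-trans N≤NN (close (0≤NN ⊗ diff (≤-trans 1≤N N≤NN) ⊕ 0≤ι 127 ⊗ (0≤NN ⊗ 0≤NN)) (lem₃ NN))
      where
      lem₃ : ∀ a → a * (a - 1ℚ) + ι 127 * (a * a) ≡ ι 128 * (a * a) - a
      lem₃ = solve-∀ ℚ-ring

    D≤Y : D ℕ.≤ Y
    D≤Y = ι-cancel (subst₂ _≤_ (sym D-eq) (sym y-eq) (close (0≤ι 4 ⊗ (0≤n ⊗ 0≤n ⊗ 0≤ζ ⊗ diff ζ-16)) (lem n ζ)))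
     where
     lem : ∀ n ζ → ι 4 * (n * n * ζ * (ζ - ι 16 * n)) ≡ ι 4 * (ζ * n * (ζ * n)) - ι 64 * (n * n * n) * ζ
     lem = solve-∀ ℚ-ring

    j : ℚ
    j = inv (suc D)

    0≤j = 0≤inv (suc D)

    j-small : ι 64 * (n * n * n) * ζ * j ≤ 1ℚ
    j-small = subst₂ _≤_ (cong (_* j) D-eq) (ι*inv D) (*-monoʳ j 0≤j (ι-mono (ℕ.n≤1+n D)))

    1≤* : ∀ {a b} → 1ℚ ≤ a → 1ℚ ≤ b → 1ℚ ≤ a * b
    1≤* {a} {b} h k = close (diff h ⊗ ≤-trans 0≤1 k ⊕ diff k) (lem a b)
     where
     lem : ∀ a b → (a - 1ℚ) * b + (b - 1ℚ) ≡ a * b - 1ℚ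
     lem = solve-∀ ℚ-ring

    combined : ι 2 * (ζ * (ι 3 * (ζ * n * (ζ * n)))) ≤ y * y * L D + y * n + ι D * ι D + (n + n) * (y * y * j)
    combined = begin
     ι 2 * (ζ * (ι 3 * (ζ * n * (ζ * n))))
      ≤⟨ *-monoˡ (ι 2) (0≤ι 2) lower ⟩
     ι 2 * ∑ Y F
      ≡⟨ cong (ι 2 *_) (trans ∑F (trans (cong (λ k → ∑ k (λ d → χ d * G d)) (sym (ℕ.m+[n∸m]≡n D≤Y))) (∑-split D (Y ℕ.∸ D) (λ d → χ d * G d)))) ⟩
     ι 2 * (∑ D (λ d → χ d * G d) + T)
      ≡⟨ *-distribˡ-+ (ι 2) (∑ D (λ d → χ d * G d)) T ⟩
     ι 2 * ∑ D (λ d → χ d * G d) + ι 2 * T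
      ≤⟨ +-mono-≤ head (≤-trans (*-monoˡ (ι 2) (0≤ι 2) (tail (Y ℕ.∸ D))) (≤-trans (≤-reflexive (lem n (G (suc D)))) (*-monoˡ (n + n) (0≤n ⊕ 0≤n) (2G≤ D)))) ⟩
     y * y * L D + y * n + ι D * ι D + (n + n) * (y * y * j) ∎
     where
     open ≤-Reasoning
     T = ∑ (Y ℕ.∸ D) (λ i → χ (D ℕ.+ i) * G (D ℕ.+ i))
     lem : ∀ n g → ι 2 * ((n + n) * g) ≡ (n + n) * (ι 2 * g)
     lem = solve-∀ ℚ-ring

    main : ι 5 ≤ ι 16 * (n * n * ζ) * L D
    main = *-cancelˡ (ι 4 * (n * n * (ζ * ζ * ζ))) (<-≤-trans (positive⁻¹ 1ℚ) (1≤* (1≤ι 3) (1≤* (1≤* 1≤N 1≤N) (1≤* (1≤* 1≤ζ 1≤ζ) 1≤ζ)))) (close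
     (0≤ι 4 ⊗ diff combined′ ⊕ 0≤n ⊗ 0≤n ⊗ (0≤ζ ⊗ 0≤ζ) ⊗ diff ζ-16 ⊕ 0≤n ⊗ 0≤n ⊗ (0≤ζ ⊗ 0≤ζ) ⊗ diff ζ-large ⊕ 0≤ι 2 ⊗ (0≤n ⊗ 0≤n ⊗ (0≤ζ ⊗ 0≤ζ ⊗ 0≤ζ)) ⊗ diff j-small) (lem n ζ (L D) j))
     where
     y₀ D₀ : ℚ
     y₀ = ι 4 * (ζ * n * (ζ * n))
     D₀ = ι 64 * (n * n * n) * ζ
     combined′ : ι 2 * (ζ * (ι 3 * (ζ * n * (ζ * n)))) ≤ y₀ * y₀ * L D + y₀ * n + D₀ * D₀ + (n + n) * (y₀ * y₀ * j)
     combined′ = subst₂ (λ a b → ι 2 * (ζ * (ι 3 * (ζ * n * (ζ * n)))) ≤ a * a * L D + a * n + b * b + (n + n) * (a * a * j)) y-eq D-eq combined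
     lem : ∀ n ζ l j → ι 4 * ((ι 4 * (ζ * n * (ζ * n))) * (ι 4 * (ζ * n * (ζ * n))) * l + (ι 4 * (ζ * n * (ζ * n))) * n + (ι 64 * (n * n * n) * ζ) * (ι 64 * (n * n * n) * ζ) + (n + n) * ((ι 4 * (ζ * n * (ζ * n))) * (ι 4 * (ζ * n * (ζ * n))) * j) - ι 2 * (ζ * (ι 3 * (ζ * n * (ζ * n)))))
      + n * n * (ζ * ζ) * (ζ - ι 16 * n) + n * n * (ζ * ζ) * (ζ - ι 128 * (ι 128 * (n * n * (n * n)))) + ι 2 * (n * n * (ζ * ζ * ζ)) * (1ℚ - ι 64 * (n * n * n) * ζ * j)
      ≡ ι 4 * (n * n * (ζ * ζ * ζ)) * (ι 16 * (n * n * ζ) * l) - ι 4 * (n * n * (ζ * ζ * ζ)) * ι 5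
     lem = solve-∀ ℚ-ring

   L-lower : ∀ x → D ℕ.≤ x → 1ℚ ≤ ι 32 * (n * n * ζ) * L x
   L-lower x D≤x = close (0≤ι 2 ⊗ diff main ⊕ 0≤ι 32 ⊗ (0≤n ⊗ 0≤n ⊗ 0≤ζ) ⊗ diff (∣∣⇒≥ (subst (λ t → ∣ L t - L D ∣ ≤ (n + n) * j) (ℕ.m+[n∸m]≡n D≤x) (L-tail D (x ℕ.∸ D)))) ⊕ diff j-small ⊕ 0≤ι 8)
    (lem n ζ (L D) (L x) j)
    where
    lem : ∀ n ζ l l′ j → ι 2 * (ι 16 * (n * n * ζ) * l - ι 5) + ι 32 * (n * n * ζ) * (l′ - l - - ((n + n) * j)) + (1ℚ - ι 64 * (n * n * n) * ζ * j) + ι 8 ≡ ι 32 * (n * n * ζ) * l′ - 1ℚ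
    lem = solve-∀ ℚ-ring

   ΣχΛ-bound : ∀ x → D ℕ.≤ suc x → suc x ℕ.≤ X → ∣ ΣχΛ (suc x) ∣ ≤ ι 32 * (ι 10 * (n * n * n * ζ))
   ΣχΛ-bound x D≤x x≤X = begin
    ∣ ΣχΛ (suc x) ∣
     ≡⟨ *-identityʳ ∣ ΣχΛ (suc x) ∣ ⟨
    ∣ ΣχΛ (suc x) ∣ * 1ℚ
     ≤⟨ *-monoˡ ∣ ΣχΛ (suc x) ∣ (0≤∣p∣ (ΣχΛ (suc x))) (≤-trans (L-lower (suc x) D≤x) (*-monoˡ (ι 32 * (n * n * ζ)) 0≤V (x≤∣x∣ (L (suc x))))) ⟩
    ∣ ΣχΛ (suc x) ∣ * (ι 32 * (n * n * ζ) * ∣ L (suc x) ∣)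
     ≡⟨ trans (lem (∣ ΣχΛ (suc x) ∣) (ι 32 * (n * n * ζ)) (∣ L (suc x) ∣)) (cong (ι 32 * (n * n * ζ) *_) (sym (∣p*q∣≡∣p∣*∣q∣ (ΣχΛ (suc x)) (L (suc x))))) ⟩
    ι 32 * (n * n * ζ) * ∣ ΣχΛ (suc x) * L (suc x) ∣
     ≤⟨ *-monoˡ (ι 32 * (n * n * ζ)) 0≤V (L-ΣχΛ x x≤X) ⟩
    ι 32 * (n * n * ζ) * (ι 10 * n)
     ≡⟨ lem′ n ζ ⟩
    ι 32 * (ι 10 * (n * n * n * ζ)) ∎
    where
    open ≤-Reasoning
    0≤V : 0ℚ ≤ ι 32 * (n * n * ζ)
    0≤V = 0≤ι 32 ⊗ (0≤n ⊗ 0≤n ⊗ 0≤ζ)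
    lem : ∀ a b c → a * (b * c) ≡ b * (a * c)
    lem = solve-∀ ℚ-ring
    lem′ : ∀ n ζ → ι 32 * (n * n * ζ) * (ι 10 * n) ≡ ι 32 * (ι 10 * (n * n * n * ζ))
    lem′ = solve-∀ ℚ-ring

-- The class sum of Λ(n)/n in a class without large primes.

module PrimePowers where

 open Base
 open Conv
 open NatLog using (prime≥2)
 open Selberg using (inv-step)
 open Triple
 open Periodic
 open import Data.Nat using (_^_)
 open import Data.Nat.Primality using (Prime; prime?)
 open import Data.Rational using (ℚ; 0ℚ; 1ℚ; _+_; _*_; _-_; -_; _≤_; _<_)
 open import Data.Rational.Properties
 open import Tactic.RingSolver using (solve-∀)

 ∑-𝟙≤ : ∀ X R → ∑ X (λ p → 𝟙 (p ℕ.≤? R)) ≤ ι R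
 ∑-𝟙≤ X R with ℕ.≤-total R X
 ... | inj₁ R≤X = subst (_≤ ι R) (sym (∑-extend (λ p → 𝟙 (p ℕ.≤? R)) R≤X (λ i lt → 𝟙-no (i ℕ.≤? R) (ℕ.<⇒≱ lt)))) (bounded R)
  where

  bounded : ∀ Y → ∑ Y (λ p → 𝟙 (p ℕ.≤? R)) ≤ ι Y
  bounded Y = subst (∑ Y (λ p → 𝟙 (p ℕ.≤? R)) ≤_) (trans (∑-const Y 1ℚ) (*-identityʳ (ι Y))) (∑-mono Y (λ p _ → 𝟙≤1 (suc p ℕ.≤? R)))
 ... | inj₂ X≤R = ≤-trans (subst (∑ X (λ p → 𝟙 (p ℕ.≤? R)) ≤_) (trans (∑-const X 1ℚ) (*-identityʳ (ι X))) (∑-mono X (λ p _ → 𝟙≤1 (suc p ℕ.≤? R)))) (ι-mono X≤R)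

 geometric : ∀ p → 2 ℕ.≤ p → ∀ m → ∑ m (λ k → inv (p ^ suc k)) ≤ ι 2 * (inv p * inv p)
 geometric p@(suc p′) 2≤p m = ≤-trans (partial m) (≤-reflexive (cong (ι 2 *_) (trans (cong inv (cong (p ℕ.*_) (ℕ.*-identityʳ p))) (inv-* p p))))
  where
  halving : ∀ k → ι 2 * inv (p ^ suc k) ≤ inv (p ^ k)
  halving k = subst₂ _≤_ (trans (*-assoc (ι 2) (inv p) (inv (p ^ k))) (cong (ι 2 *_) (sym (inv-* p (p ^ k))))) (*-identityˡ (inv (p ^ k)))
   (*-monoʳ (inv (p ^ k)) (0≤inv (p ^ k)) (subst (ι 2 * inv p ≤_) (ι*inv p′) (*-monoʳ (inv p) (0≤inv p) (ι-mono 2≤p))))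
  strong : ∀ m → ∑ (suc m) (λ k → inv (p ^ suc k)) ≤ ι 2 * inv (p ^ 2) - inv (p ^ suc (suc m))
  strong zero = ≤-reflexive (lem (inv (p ^ 2)))
   where
   lem : ∀ a → 0ℚ + a ≡ ι 2 * a - a
   lem = solve-∀ ℚ-ring
  strong (suc m) = close (diff (strong m) ⊕ diff (halving (suc (suc m)))) (lem (∑ (suc m) (λ k → inv (p ^ suc k))) (inv (p ^ 2)) (inv (p ^ suc (suc m))) (inv (p ^ suc (suc (suc m)))))
   where
   lem : ∀ s a b c → ι 2 * a - b - s + (b - ι 2 * c) ≡ ι 2 * a - c - (s + c)
   lem = solve-∀ ℚ-ring
  partial : ∀ m → ∑ m (λ k → inv (p ^ suc k)) ≤ ι 2 * inv (p ^ 2)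
  partial zero = 0≤ι 2 ⊗ 0≤inv (p ^ 2)
  partial (suc m) = ≤-trans (strong m) (close (0≤inv (p ^ suc (suc m))) (lem (ι 2 * inv (p ^ 2)) (inv (p ^ suc (suc m)))))
   where
   lem : ∀ a b → b ≡ a - (a - b)
   lem = solve-∀ ℚ-ring

 module Sparse (X′ N′ : ℕ) where

  open TripleProducts X′ N′

  -- Telescoping: -(ℓ n + 2)/n acts as a discrete antiderivative, its increments dominating the
  -- terms.
  ∑ℓ/n² : ∀ m → suc m ℕ.≤ X → ∑ (suc m) (λ n → ℓ n * (inv n * inv n)) ≤ ι 2 - (ℓ (suc m) + ι 2) * inv (suc m)
  ∑ℓ/n² zero h = ≤-reflexive (trans (cong₂ (λ s t → 0ℚ + s * (t * t)) ℓ-1 inv-1) (trans refl (sym (cong₂ (λ s t → ι 2 - (s + ι 2) * t) ℓ-1 inv-1))))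
  ∑ℓ/n² (suc m) h = close
   (0≤inv (suc (suc m)) ⊗ (0≤ℓ (suc m) ⊗ diff (inv-anti m (suc (suc m)) (ℕ.n≤1+n _)) ⊕ 0≤ι 2 ⊗ diff (ℓ-step-upper m h) ⊕ diff (ℓ-step-mono m h) ⊗ diff (inv≤1 (suc (suc m)))) ⊕ diff (∑ℓ/n² m (ℕ.≤-trans (ℕ.n≤1+n _) h)))
   (trans (lem i j l l′ S) (trans (cong (λ t → t * (l + ι 2) - l * (j * j) - (l′ - l) * j - (l′ - l) * (j * j) + (ι 2 - (l + ι 2) * i - S)) (sym (inv-step m))) (lem₂ i j l l′ S)))
   where
   i = inv (suc m)
   j = inv (suc (suc m))
   l = ℓ (suc m)
   l′ = ℓ (suc (suc m))
   S = ∑ (suc m) (λ n → ℓ n * (inv n * inv n))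
   lem : ∀ i j l l′ s → j * (l * (i - j) + ι 2 * (i - (l′ - l)) + (l′ - l) * (1ℚ - j)) + (ι 2 - (l + ι 2) * i - s)
    ≡ i * j * (l + ι 2) - l * (j * j) - (l′ - l) * j - (l′ - l) * (j * j) + (ι 2 - (l + ι 2) * i - s)
   lem = solve-∀ ℚ-ring
   lem₂ : ∀ i j l l′ s → (i - j) * (l + ι 2) - l * (j * j) - (l′ - l) * j - (l′ - l) * (j * j) + (ι 2 - (l + ι 2) * i - s)
    ≡ ι 2 - (l′ + ι 2) * j - (s + l′ * (j * j))
   lem₂ = solve-∀ ℚ-ring

  -- A prime p ≤ R contributes at most ℓ p / p ≤ 1. The higher powers of p contribute at most 2 ℓ p
  -- / p², and the sum of ℓ p / p² is at most 2.
  class-sum-bound : ∀ a R v → v ℕ.≤ X → (∀ p → Prime p → p ≈ a → R ℕ.< p → p ℕ.≤ X → ⊥) →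
   ∑ v (λ n → 𝟙 (n ≈? a) * (Λ n * inv n)) ≤ ι R + ι 4
  class-sum-bound a R v v≤X none = begin
   ∑ v (λ n → 𝟙 (n ≈? a) * (Λ n * inv n))
    ≡⟨ trans (∑-ext v (λ n → lem (𝟙 (n ≈? a)) (Λ n) (inv n))) (Λ-weighted v w v≤X) ⟩
   ∑ X (λ p → ∑ X (λ k → 𝟙 (prime? p) * (𝟙 (p ^ k ℕ.≤? v) * (ℓ p * w (p ^ k)))))
    ≤⟨ ∑-mono X (λ p b → per-prime (suc p) b (prime? (suc p))) ⟩
   ∑ X (λ p → 𝟙 (p ℕ.≤? R) + ι 2 * (ℓ p * (inv p * inv p)))
    ≡⟨ trans (∑-+ X _ _) (cong (∑ X (λ p → 𝟙 (p ℕ.≤? R)) +_) (∑-*ˡ X (ι 2) _)) ⟩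
   ∑ X (λ p → 𝟙 (p ℕ.≤? R)) + ι 2 * ∑ X (λ p → ℓ p * (inv p * inv p))
    ≤⟨ close (diff (∑-𝟙≤ X R) ⊕ 0≤ι 2 ⊗ (diff (∑ℓ/n² X′ ℕ.≤-refl) ⊕ (0≤ℓ X ⊕ 0≤ι 2) ⊗ 0≤inv X)) (lem′ (∑ X (λ p → 𝟙 (p ℕ.≤? R))) (ι R) (∑ X (λ p → ℓ p * (inv p * inv p))) ((ℓ X + ι 2) * inv X)) ⟩
   ι R + ι 4 ∎
   where
   open ≤-Reasoning
   w : ℕ → ℚ
   w n = 𝟙 (n ≈? a) * inv n
   lem : ∀ a b c → a * (b * c) ≡ b * (a * c)
   lem = solve-∀ ℚ-ring
   lem′ : ∀ a r s t → r - a + ι 2 * (ι 2 - t - s + t) ≡ r + ι 4 - (a + ι 2 * s)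
   lem′ = solve-∀ ℚ-ring
   0≤w : ∀ n → 0ℚ ≤ w n
   0≤w n = 0≤𝟙 (n ≈? a) ⊗ 0≤inv n
   w≤inv : ∀ n → w n ≤ inv n
   w≤inv n = subst (w n ≤_) (*-identityˡ (inv n)) (*-monoʳ (inv n) (0≤inv n) (𝟙≤1 (n ≈? a)))
   drop : ∀ p k → 𝟙 (p ^ k ℕ.≤? v) * (ℓ p * w (p ^ k)) ≤ ℓ p * w (p ^ k)
   drop p k = subst (𝟙 (p ^ k ℕ.≤? v) * (ℓ p * w (p ^ k)) ≤_) (*-identityˡ (ℓ p * w (p ^ k))) (*-monoʳ (ℓ p * w (p ^ k)) (0≤ℓ p ⊗ 0≤w (p ^ k)) (𝟙≤1 (p ^ k ℕ.≤? v)))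
   per-prime : ∀ p → p ℕ.≤ X → (dec : Dec (Prime p)) →
    ∑ X (λ k → 𝟙 dec * (𝟙 (p ^ k ℕ.≤? v) * (ℓ p * w (p ^ k)))) ≤ 𝟙 (p ℕ.≤? R) + ι 2 * (ℓ p * (inv p * inv p))
   per-prime p p≤X (no _) = ≤-trans (≤-reflexive (∑-zero X (λ k _ → *-zeroˡ (𝟙 (p ^ suc k ℕ.≤? v) * (ℓ p * w (p ^ suc k)))))) (0≤𝟙 (p ℕ.≤? R) ⊕ 0≤ι 2 ⊗ (0≤ℓ p ⊗ (0≤inv p ⊗ 0≤inv p)))
   per-prime zero p≤X (yes pp) = ⊥-elim (ℕ.n≮0 (prime≥2 pp))
   per-prime p@(suc p′) p≤X (yes pp) = begin
    ∑ X (λ k → 1ℚ * (𝟙 (p ^ k ℕ.≤? v) * (ℓ p * w (p ^ k))))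
     ≤⟨ ∑-mono X (λ k _ → subst (_≤ ℓ p * w (p ^ suc k)) (sym (*-identityˡ (𝟙 (p ^ suc k ℕ.≤? v) * (ℓ p * w (p ^ suc k))))) (drop p (suc k))) ⟩
    ∑ X (λ k → ℓ p * w (p ^ k))
     ≡⟨ trans (∑-split 1 X′ (λ k → ℓ p * w (p ^ k))) (cong₂ _+_ (trans (+-identityˡ (ℓ p * w (p ^ 1))) (cong (λ t → ℓ p * w t) (ℕ.*-identityʳ p))) (∑-*ˡ X′ (ℓ p) (λ k → w (p ^ suc k)))) ⟩
    ℓ p * w p + ℓ p * ∑ X′ (λ k → w (p ^ suc k))
     ≤⟨ +-mono-≤ first (*-monoˡ (ℓ p) (0≤ℓ p) (≤-trans (∑-mono X′ (λ k _ → w≤inv (p ^ suc (suc k)))) (geometric p (prime≥2 pp) X′))) ⟩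
    𝟙 (p ℕ.≤? R) + ℓ p * (ι 2 * (inv p * inv p))
     ≡⟨ cong (𝟙 (p ℕ.≤? R) +_) (lem (ℓ p) (ι 2) (inv p * inv p)) ⟩
    𝟙 (p ℕ.≤? R) + ι 2 * (ℓ p * (inv p * inv p)) ∎
    where
    first : ℓ p * w p ≤ 𝟙 (p ℕ.≤? R)
    first with p ℕ.≤? R
    ... | yes _ = ≤-trans (*-mono (0≤ℓ p) (0≤inv p) (≤-trans (ℓ≤ι p′ p≤X) (ι-mono (ℕ.n≤1+n p′))) (w≤inv p)) (≤-reflexive (ι*inv p′))
    ... | no p≰R = ≤-reflexive (trans (cong (λ t → ℓ p * (t * inv p)) (𝟙-no (p ≈? a) (λ p≈a → none p pp p≈a (ℕ.≰⇒> p≰R) p≤X))) (lem₃ (ℓ p) (inv p)))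
     where
     lem₃ : ∀ a b → a * (0ℚ * b) ≡ 0ℚ
     lem₃ = solve-∀ ℚ-ring

-- Dirichlet's theorem on primes in residue classes.

module Dirichlet where

 open Base
 open Conv
 open Mangoldt using (n<p^n)
 open Triple
 open PrimePowers
 open Periodic
 open Group
 open LFun
 open import Data.Nat using (_^_)
 open import Data.Nat.Primality using (Prime; prime?; prime[2])
 open import Data.Rational using (ℚ; 0ℚ; 1ℚ; _+_; _*_; _-_; -_; _≤_; _<_; _≤?_)
 open import Data.Rational.Properties hiding (_≤?_)
 open import Relation.Nullary.Decidable using (_×-dec_)
 open import Tactic.RingSolver using (solve-∀)

 -- Serves to find a natural number above all constants; x and X are built from it.
 NatBounded : ℚ → Set
 NatBounded q = ∃ λ n → q ≤ ι n

 bounded-ι : ∀ n → NatBounded (ι n)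
 bounded-ι n = n , ≤-refl

 bounded-+ : ∀ {p q} → NatBounded p → NatBounded q → NatBounded (p + q)
 bounded-+ {p} {q} (m , h) (n , k) = m ℕ.+ n , subst (p + q ≤_) (sym (ι-+ m n)) (+-mono-≤ h k)

 bounded-* : ∀ {p q} → 0ℚ ≤ q → NatBounded p → NatBounded q → NatBounded (p * q)
 bounded-* {p} {q} 0≤q (m , h) (n , k) = m ℕ.* n , subst (p * q ≤_) (sym (ι-* m n)) (≤-trans (*-monoʳ q 0≤q h) (*-monoˡ (ι m) (0≤ι m) k))

 ∑-𝟙-count : ∀ n {P : ℕ → Set} (P? : ∀ k → Dec (P k)) → ∃ λ c → ∑ n (λ k → 𝟙 (P? k)) ≡ ι c
 ∑-𝟙-count zero P? = 0 , refl
 ∑-𝟙-count (suc n) P? with ∑-𝟙-count n P? | P? (suc n)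
 ... | c , h | yes _ = suc c , cong (_+ 1ℚ) h
 ... | c , h | no _ = c , trans (+-identityʳ (∑ n (λ k → 𝟙 (P? k)))) h

 private
  absurd : ∀ {a} → a + 1ℚ ≤ a → ⊥
  absurd {a} h = <-irrefl refl (<-≤-trans (subst (_< a + 1ℚ) (+-identityʳ a) (+-monoʳ-< a (positive⁻¹ 1ℚ))) h)

  exceeds : ∀ {u κ} → u ≤ κ → κ + 1ℚ ≤ u → ⊥
  exceeds h k = absurd (≤-trans k h)

  cancel-u : ∀ {u p q} → 1ℚ ≤ u → p * u ≤ q * u → p ≤ q
  cancel-u {u} {p} {q} 1≤u h = *-cancelˡ u (<-≤-trans (positive⁻¹ 1ℚ) 1≤u) (subst₂ _≤_ (*-comm p u) (*-comm q u) h)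

 module _ (N′ a : ℕ) (ua : Residues.Unit N′ a) (R : ℕ) (z′ : ℕ) (z-large : 128 ℕ.* (128 ℕ.* (suc N′ ℕ.* suc N′ ℕ.* (suc N′ ℕ.* suc N′))) ℕ.≤ suc z′) where

  private
   N : ℕ
   N = suc N′

   n C s : ℚ
   n = ι N
   C = ι 10 * (n * n)
   s = ι 4 * (n * n)

   0≤n = 0≤ι N
   1≤n = 1≤ι N′

   0≤C : 0ℚ ≤ C
   0≤C = 0≤ι 10 ⊗ (0≤n ⊗ 0≤n)

   0≤s : 0ℚ ≤ s
   0≤s = 0≤ι 4 ⊗ (0≤n ⊗ 0≤n)

   z Y D : ℕ
   z = suc z′
   Y = 4 ℕ.* (z ℕ.* N ℕ.* (z ℕ.* N))
   D = 64 ℕ.* (N ℕ.* N ℕ.* N) ℕ.* z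

   -- Each contradiction bounds u = ℓ x: by κ₁ if B has fewer than half of the unit classes, by κ₂
   -- if three members of B multiply to a, by κ₃ once the character exists. P₀ bounds the prime-free
   -- class sum, V bounds Σ χ Λ/n, and T collects the coefficients of u². All are stated without
   -- `ℓ`, since X is chosen after them.
   P₀ V T κ₁ κ₂ κ₃ : ℚ
   P₀ = ι R + ι 4
   V = ι 32 * (ι 10 * (n * n * n * ι z))
   T = ι 9 * P₀ + ι 117 * C + ι 30 * (C * C) + ι 2 * (C * C * C) + ι 114 * (n * (ι 12 + ι 2 * C))
   κ₁ = ι 12 * (n * C) + ι 2 * (n * (C * C)) + ι 84 * (n * (n * n))
   κ₂ = s * (s * s) * T
   κ₃ = ι 2 * V + ι 2 * C

   0≤P₀ = 0≤ι R ⊕ 0≤ι 4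
   0≤V = 0≤ι 32 ⊗ (0≤ι 10 ⊗ (0≤n ⊗ 0≤n ⊗ 0≤n ⊗ 0≤ι z))

   0≤T : 0ℚ ≤ T
   0≤T = 0≤ι 9 ⊗ 0≤P₀ ⊕ 0≤ι 117 ⊗ 0≤C ⊕ 0≤ι 30 ⊗ (0≤C ⊗ 0≤C) ⊕ 0≤ι 2 ⊗ (0≤C ⊗ 0≤C ⊗ 0≤C) ⊕ 0≤ι 114 ⊗ (0≤n ⊗ (0≤ι 12 ⊕ 0≤ι 2 ⊗ 0≤C))

   0≤κ₁ = 0≤ι 12 ⊗ (0≤n ⊗ 0≤C) ⊕ 0≤ι 2 ⊗ (0≤n ⊗ (0≤C ⊗ 0≤C)) ⊕ 0≤ι 84 ⊗ (0≤n ⊗ (0≤n ⊗ 0≤n))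
   0≤κ₂ = 0≤s ⊗ (0≤s ⊗ 0≤s) ⊗ 0≤T
   0≤κ₃ = 0≤ι 2 ⊗ 0≤V ⊕ 0≤ι 2 ⊗ 0≤C

   bound : NatBounded (κ₁ + κ₂ + κ₃ + ι D + 1ℚ)
   bound = bounded-+ (bounded-+ (bounded-+ (bounded-+ bκ₁ bκ₂) bκ₃) (bounded-ι D)) (1 , ≤-reflexive (sym (+-identityˡ 1ℚ)))
    where
    bn = bounded-ι N
    bn² = bounded-* 0≤n bn bn
    bC : NatBounded C
    bC = bounded-* (0≤n ⊗ 0≤n) (bounded-ι 10) bn²
    bC² = bounded-* 0≤C bC bC
    bs : NatBounded s
    bs = bounded-* (0≤n ⊗ 0≤n) (bounded-ι 4) bn²
    bV : NatBounded V
    bV = bounded-* (0≤ι 10 ⊗ (0≤n ⊗ 0≤n ⊗ 0≤n ⊗ 0≤ι z)) (bounded-ι 32) (bounded-* (0≤n ⊗ 0≤n ⊗ 0≤n ⊗ 0≤ι z) (bounded-ι 10) (bounded-* (0≤ι z) (bounded-* 0≤n bn² bn) (bounded-ι z)))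
    bT : NatBounded T
    bT = bounded-+ (bounded-+ (bounded-+ (bounded-+ (bounded-* 0≤P₀ (bounded-ι 9) (bounded-+ (bounded-ι R) (bounded-ι 4))) (bounded-* 0≤C (bounded-ι 117) bC))
       (bounded-* (0≤C ⊗ 0≤C) (bounded-ι 30) bC²)) (bounded-* (0≤C ⊗ 0≤C ⊗ 0≤C) (bounded-ι 2) (bounded-* 0≤C bC² bC)))
       (bounded-* (0≤n ⊗ (0≤ι 12 ⊕ 0≤ι 2 ⊗ 0≤C)) (bounded-ι 114) (bounded-* (0≤ι 12 ⊕ 0≤ι 2 ⊗ 0≤C) bn (bounded-+ (bounded-ι 12) (bounded-* 0≤C (bounded-ι 2) bC))))
    bκ₁ : NatBounded κ₁
    bκ₁ = bounded-+ (bounded-+ (bounded-* (0≤n ⊗ 0≤C) (bounded-ι 12) (bounded-* 0≤C bn bC)) (bounded-* (0≤n ⊗ (0≤C ⊗ 0≤C)) (bounded-ι 2) (bounded-* (0≤C ⊗ 0≤C) bn bC²)))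
        (bounded-* (0≤n ⊗ (0≤n ⊗ 0≤n)) (bounded-ι 84) (bounded-* (0≤n ⊗ 0≤n) bn bn²))
    bκ₂ : NatBounded κ₂
    bκ₂ = bounded-* 0≤T (bounded-* (0≤s ⊗ 0≤s) bs (bounded-* 0≤s bs bs)) bT
    bκ₃ : NatBounded κ₃
    bκ₃ = bounded-+ (bounded-* 0≤V (bounded-ι 2) bV) (bounded-* 0≤C (bounded-ι 2) bC)

   -- ℓ 2 ≥ 1/6 makes ℓ x ≥ U for x > 2^(6U). The range has to contain x³, where products of three
   -- numbers up to x lie, and Y for the bound on L(1,χ). Primed numbers are predecessors, arranged
   -- so that `x₃` is x (x x) by computation.
   U x′ x x₂′ x₃′ x₃ X′ : ℕ
   U = proj₁ bound
   x′ = 2 ^ (6 ℕ.* U)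
   x = suc x′
   x₂′ = x′ ℕ.+ x′ ℕ.* x
   x₃′ = x₂′ ℕ.+ x′ ℕ.* (x ℕ.* x)
   x₃ = suc x₃′
   X′ = x₃ ℕ.+ Y

   open TripleProducts X′ N′ hiding (N; C; s; 0≤C; Φ≤N; 1≤N)
   open TripleProducts X′ N′ using (Φ≤N)
   open Sparse X′ N′ using (class-sum-bound)

   x₃≤X : x₃ ℕ.≤ X
   x₃≤X = ℕ.≤-trans (ℕ.m≤m+n x₃ Y) (ℕ.n≤1+n X′)

   x≤x₃ : x ℕ.≤ x₃
   x≤x₃ = ℕ.m≤m*n x (x ℕ.* x)

   x≤X : x ℕ.≤ X
   x≤X = ℕ.≤-trans x≤x₃ x₃≤X

   u v w : ℚ
   u = ℓ x
   v = ℓ x₃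
   -- Small enough that all classes below this threshold together hold at most Φ w ≤ u/4, even after
   -- another factor Φ.
   w = inv (4 ℕ.* (N ℕ.* N)) * u

   v-eq : v ≡ u + (u + u)
   v-eq = trans (ℓ-* x′ x₂′) (cong (u +_) (ℓ-* x′ x′))

   sw : s * w ≡ u
   sw = trans (sym (*-assoc s (inv (4 ℕ.* (N ℕ.* N))) u)) (trans (cong (_* u) (trans (cong (_* inv (4 ℕ.* (N ℕ.* N))) (sym (trans (ι-* 4 (N ℕ.* N)) (cong (ι 4 *_) (ι-* N N))))) (ι*inv′ (4 ℕ.* (N ℕ.* N)) (s≤s z≤n)))) (*-identityˡ u))

   0≤w : 0ℚ ≤ w
   0≤w = 0≤inv (4 ℕ.* (N ℕ.* N)) ⊗ 0≤ℓ x

   ℓ-pow : ∀ k → ℓ (2 ^ k) ≡ ι k * ℓ 2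
   ℓ-pow zero = trans ℓ-1 (sym (*-zeroˡ (ℓ 2)))
   ℓ-pow (suc k) = trans (step (2 ^ k) (ℕ.m^n>0 2 k)) (trans (cong (ℓ 2 +_) (ℓ-pow k)) (lem (ℓ 2) (ι k)))
    where
    step : ∀ m → 1 ℕ.≤ m → ℓ (2 ℕ.* m) ≡ ℓ 2 + ℓ m
    step (suc m) _ = ℓ-* 1 m
    lem : ∀ a b → a + b * a ≡ (b + 1ℚ) * a
    lem = solve-∀ ℚ-ring

   2≤X : 2 ℕ.≤ X
   2≤X = ℕ.≤-trans (s≤s (ℕ.m^n>0 2 (6 ℕ.* U))) x≤X

   U≤u : ι U ≤ u
   U≤u = begin
    ι U ≡⟨ *-identityʳ (ι U) ⟨
    ι U * 1ℚ ≤⟨ *-monoˡ (ι U) (0≤ι U) (subst₂ _≤_ inv-1 (trans (cong (λ t → ι 6 * (ℓ 2 - t)) ℓ-1) (lem (ι 6) (ℓ 2))) (ℓ-step-lower 0 2≤X)) ⟩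
    ι U * (ι 6 * ℓ 2) ≡⟨ trans (lem′ (ι U) (ι 6) (ℓ 2)) (cong (_* ℓ 2) (sym (ι-* 6 U))) ⟩
    ι (6 ℕ.* U) * ℓ 2 ≡⟨ ℓ-pow (6 ℕ.* U) ⟨
    ℓ x′ ≤⟨ pow-mono x′ (ℕ.m^n>0 2 (6 ℕ.* U)) x≤X ⟩
    u ∎
    where
    open ≤-Reasoning
    lem : ∀ a b → a * (b - 0ℚ) ≡ a * b
    lem = solve-∀ ℚ-ring
    lem′ : ∀ a b c → a * (b * c) ≡ b * a * c
    lem′ = solve-∀ ℚ-ring
    pow-mono : ∀ m → 1 ℕ.≤ m → suc m ℕ.≤ X → ℓ m ≤ ℓ (suc m)
    pow-mono (suc m) _ h = ℓ-step-mono m h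

   large : κ₁ + κ₂ + κ₃ + ι D + 1ℚ ≤ u
   large = ≤-trans (proj₂ bound) U≤u

   κ₁<u : κ₁ + 1ℚ ≤ u
   κ₁<u = ≤-trans (close (0≤κ₂ ⊕ 0≤κ₃ ⊕ 0≤ι D) (lem κ₁ κ₂ κ₃ (ι D))) large
    where
    lem : ∀ a b c d → b + c + d ≡ a + b + c + d + 1ℚ - (a + 1ℚ)
    lem = solve-∀ ℚ-ring

   κ₂<u : κ₂ + 1ℚ ≤ u
   κ₂<u = ≤-trans (close (0≤κ₁ ⊕ 0≤κ₃ ⊕ 0≤ι D) (lem κ₁ κ₂ κ₃ (ι D))) large
    where
    lem : ∀ a b c d → a + c + d ≡ a + b + c + d + 1ℚ - (b + 1ℚ)
    lem = solve-∀ ℚ-ring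

   κ₃<u : κ₃ + 1ℚ ≤ u
   κ₃<u = ≤-trans (close (0≤κ₁ ⊕ 0≤κ₂ ⊕ 0≤ι D) (lem κ₁ κ₂ κ₃ (ι D))) large
    where
    lem : ∀ a b c d → a + b + d ≡ a + b + c + d + 1ℚ - (c + 1ℚ)
    lem = solve-∀ ℚ-ring

   1≤u : 1ℚ ≤ u
   1≤u = ≤-trans (subst (_≤ κ₁ + 1ℚ) (+-identityˡ 1ℚ) (+-monoˡ-≤ 1ℚ 0≤κ₁)) κ₁<u

   0≤u : 0ℚ ≤ u
   0≤u = 0≤ℓ x

   D≤x : D ℕ.≤ x
   D≤x = ℕ.≤-trans (ι-cancel (≤-trans (close (0≤κ₁ ⊕ 0≤κ₂ ⊕ 0≤κ₃ ⊕ 0≤1) (lem κ₁ κ₂ κ₃ (ι D))) (proj₂ bound)))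
    (ℕ.≤-trans (ℕ.m≤n*m U 6) (ℕ.≤-trans (ℕ.<⇒≤ (n<p^n prime[2] (6 ℕ.* U))) (ℕ.n≤1+n x′)))
    where
    lem : ∀ a b c d → a + b + c + 1ℚ ≡ a + b + c + d + 1ℚ - d
    lem = solve-∀ ℚ-ring

   0≤Mc : ∀ b y → 0ℚ ≤ Mc b y
   0≤Mc b y = ∑-nonneg y (λ k _ → 0≤𝟙 (suc k ≈? b) ⊗ (0≤Λ (suc k) ⊗ 0≤inv (suc k)))

   Mc-≈ : ∀ {b c} y → b ≈ c → Mc b y ≡ Mc c y
   Mc-≈ {b} {c} y h = ∑-ext y (λ k → cong (_* (Λ k * inv k)) (𝟙-cong (k ≈? b) (k ≈? c) (λ r → ≈-trans r h) (λ r → ≈-trans r (≈-sym h))))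

   -- The classes with a substantial share of the primes.
   B : ℕ → Set
   B b = Unit b × w ≤ Mc b x

   B? : ∀ b → Dec (B b)
   B? b = unit? b ×-dec (w ≤? Mc b x)

   B-≈ : ∀ {b c} → b ≈ c → B b → B c
   B-≈ h (ub , hb) = Unit-≈ h ub , subst (w ≤_) (Mc-≈ x h) hb

   β : ℕ → ℚ
   β b = 𝟙 (B? b)

   module NoPrimes (none : ∀ p → Prime p → p ≈ a → R ℕ.< p → p ℕ.≤ X → ⊥) where

    -- The three classes put at least w³, of order u³, into the class of a for Λ ⋆ Λ ⋆ Λ up to x³.
    -- Without large primes in that class `triple-upper` allows only T u².
    ¬BBB : ∀ {b₁ b₂ b₃} → B b₁ → B b₂ → B b₃ → ¬ (b₁ ℕ.* (b₂ ℕ.* b₃) ≈ a)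
    ¬BBB {b₁} {b₂} {b₃} (_ , h₁) (_ , h₂) (_ , h₃) eq = exceeds u≤κ₂ κ₂<u
     where
     K = ι N * ι 6 * H x₃
     K≤ : K ≤ ι 114 * (n * u)
     K≤ = ≤-trans (*-monoˡ (ι N * ι 6) (0≤n ⊗ 0≤ι 6) (H-bound x₃′ x₃≤X)) (subst (λ t → ι N * ι 6 * (1ℚ + ι 6 * t) ≤ ι 114 * (n * u)) (sym v-eq)
      (close (0≤n ⊗ 0≤ι 6 ⊗ diff 1≤u) (lem n u)))
      where
      lem : ∀ n u → n * ι 6 * (u - 1ℚ) ≡ ι 114 * (n * u) - n * ι 6 * (1ℚ + ι 6 * (u + (u + u)))
      lem = solve-∀ ℚ-ring
     squares : ∑ x₃ (λ k → 𝟙 (k ≈? a) * (Λℓ k * ℓ k * inv k)) ≤ v * v * P₀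
     squares = begin
      ∑ x₃ (λ k → 𝟙 (k ≈? a) * (Λℓ k * ℓ k * inv k))
       ≤⟨ ∑-mono x₃ (λ k b → close (0≤𝟙 (suc k ≈? a) ⊗ (0≤Λ (suc k) ⊗ 0≤inv (suc k)) ⊗ (diff (ℓ-mono k x₃′ b x₃≤X) ⊗ (0≤ℓ x₃ ⊕ 0≤ℓ (suc k)))) (lem (𝟙 (suc k ≈? a)) (Λ (suc k)) (inv (suc k)) v (ℓ (suc k)))) ⟩
      ∑ x₃ (λ k → v * v * (𝟙 (k ≈? a) * (Λ k * inv k)))
       ≡⟨ ∑-*ˡ x₃ (v * v) _ ⟩
      v * v * ∑ x₃ (λ k → 𝟙 (k ≈? a) * (Λ k * inv k))
       ≤⟨ *-monoˡ (v * v) (0≤ℓ x₃ ⊗ 0≤ℓ x₃) (class-sum-bound a R x₃ x₃≤X none) ⟩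
      v * v * P₀ ∎
      where
      open ≤-Reasoning
      lem : ∀ t l i v m → t * (l * i) * ((v - m) * (v + m)) ≡ v * v * (t * (l * i)) - t * (l * m * m * i)
      lem = solve-∀ ℚ-ring
     T₃ = ∑ x₃ (λ k → 𝟙 (k ≈? a) * (Λ₃ k * inv k))
     cubes : w * (w * w) ≤ T₃
     cubes = ≤-trans (*-mono 0≤w (0≤Mc b₂ x ⊗ 0≤Mc b₃ x) h₁ (*-mono 0≤w (0≤Mc b₃ x) h₂ h₃)) (triple-lower {a} {b₁} {b₂} {b₃} x x₃ x₃≤X ℕ.≤-refl eq)
     total : ι 2 * (w * (w * w)) ≤ T * (u * u)
     total = ≤-trans (*-monoˡ (ι 2) (0≤ι 2) cubes) (≤-trans (triple-upper x₃′ x₃≤X a ua) (≤-trans (+-monoˡ-≤ (Q x₃′ x₃≤X + E x₃′ x₃≤X) squares)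
      (subst (λ t → t * t * P₀ + ((ι 13 * C * t * t + ι 10 * C * C * t + ι 2 * C * C * C) + (K * (t + t) + ι 2 * (K * (t + C)))) ≤ T * (u * u)) (sym v-eq)
       (close (diff K≤ ⊗ (0≤ι 12 ⊗ 0≤u ⊕ 0≤ι 2 ⊗ 0≤C) ⊕ 0≤ι 228 ⊗ (0≤n ⊗ 0≤u) ⊗ (0≤C ⊗ diff 1≤u) ⊕ 0≤ι 30 ⊗ (0≤C ⊗ 0≤C) ⊗ (0≤u ⊗ diff 1≤u) ⊕ 0≤ι 2 ⊗ (0≤C ⊗ 0≤C ⊗ 0≤C) ⊗ (diff 1≤u ⊗ (0≤u ⊕ 0≤1)))
        (lem C K n u P₀)))))
      where
      lem : ∀ C K n u P → (ι 114 * (n * u) - K) * (ι 12 * u + ι 2 * C) + ι 228 * (n * u) * (C * (u - 1ℚ)) + ι 30 * (C * C) * (u * (u - 1ℚ)) + ι 2 * (C * C * C) * ((u - 1ℚ) * (u + 1ℚ))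
       ≡ (ι 9 * P + ι 117 * C + ι 30 * (C * C) + ι 2 * (C * C * C) + ι 114 * (n * (ι 12 + ι 2 * C))) * (u * u)
        - ((u + (u + u)) * (u + (u + u)) * P + ((ι 13 * C * (u + (u + u)) * (u + (u + u)) + ι 10 * C * C * (u + (u + u)) + ι 2 * C * C * C) + (K * ((u + (u + u)) + (u + (u + u))) + ι 2 * (K * ((u + (u + u)) + C)))))
      lem = solve-∀ ℚ-ring
     u≤κ₂ : u ≤ κ₂
     u≤κ₂ = cancel-u 1≤u (cancel-u 1≤u (≤-trans (close (0≤u ⊗ 0≤u ⊗ 0≤u) (trans (lem u) (cong (λ t → ι 2 * t - u * u * u) (sym scaled))))
       (≤-trans (≤-reflexive (lem₂ s w)) (≤-trans (*-monoˡ (s * (s * s)) (0≤s ⊗ (0≤s ⊗ 0≤s)) total) (≤-reflexive (lem₃ (s * (s * s)) T u))))))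
      where
      lem : ∀ u → u * u * u ≡ ι 2 * (u * u * u) - u * u * u
      lem = solve-∀ ℚ-ring
      scaled : s * w * (s * w) * (s * w) ≡ u * u * u
      scaled = cong (λ t → t * t * t) sw
      lem₂ : ∀ s w → ι 2 * (s * w * (s * w) * (s * w)) ≡ s * (s * s) * (ι 2 * (w * (w * w)))
      lem₂ = solve-∀ ℚ-ring
      lem₃ : ∀ s T u → s * (T * (u * u)) ≡ s * T * u * u
      lem₃ = solve-∀ ℚ-ring

   Φ≤n : Φ ≤ n
   Φ≤n = Φ≤N

   ∣B∣ : ℚ
   ∣B∣ = ∑ N β

   -- A member of B holds at most about u²/Φ of Σ Λ(n) ℓ(n)/n, the other classes hold little, and
   -- the total is about u²/2. This gives |B| ≥ Φ/2 up to lower-order terms.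
   half : Φ ≤ ∣B∣ + ∣B∣
   half = go (Φ ≤? ∣B∣ + ∣B∣)
    where
    go : Dec (Φ ≤ ∣B∣ + ∣B∣) → Φ ≤ ∣B∣ + ∣B∣
    go (yes h) = h
    go (no ¬h) = ⊥-elim (exceeds u≤κ₁ κ₁<u)
     where
     K = ι N * ι 6 * H x
     S = (u + C) * (u + C) + Φ * K
     0≤K : 0ℚ ≤ K
     0≤K = 0≤n ⊗ 0≤ι 6 ⊗ 0≤H x
     K≤ : K ≤ ι 42 * (n * u)
     K≤ = ≤-trans (*-monoˡ (ι N * ι 6) (0≤n ⊗ 0≤ι 6) (H-bound x′ x≤X)) (close (0≤n ⊗ 0≤ι 6 ⊗ diff 1≤u) (lem n u))
      where
      lem : ∀ n u → n * ι 6 * (u - 1ℚ) ≡ ι 42 * (n * u) - n * ι 6 * (1ℚ + ι 6 * u)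
      lem = solve-∀ ℚ-ring
     -- Both counts are integers, so failure leaves a gap of 1. The gap is worth u², more than the
     -- errors, which are linear in u.
     count : ∣B∣ + ∣B∣ + 1ℚ ≤ Φ
     count = compare (∑-𝟙-count N B?) (∑-𝟙-count N unit?)
      where
      compare : (∃ λ c → ∣B∣ ≡ ι c) → (∃ λ f → Φ ≡ ι f) → ∣B∣ + ∣B∣ + 1ℚ ≤ Φ
      compare (c , hc) (f , hf) = subst₂ (λ s t → s + s + 1ℚ ≤ t) (sym hc) (sym hf) (subst (_≤ ι f) (cong (_+ 1ℚ) (ι-+ c c)) (ι-mono {suc (c ℕ.+ c)} {f} (ℕ.≰⇒> {f} {c ℕ.+ c} (λ f≤ → ¬h (subst₂ (λ s t → t ≤ s + s) (sym hc) (sym hf) (subst (ι f ≤_) (ι-+ c c) (ι-mono {f} {c ℕ.+ c} f≤)))))))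
     σ : ℕ → ℚ
     σ b = ∑ x (λ k → 𝟙 (k ≈? b) * (Λℓ k * inv k))
     σ≤ : ∀ b → σ b ≤ u * Mc b x
     σ≤ b = subst (σ b ≤_) (∑-*ˡ x u _) (∑-mono x (λ k h → close (0≤𝟙 (suc k ≈? b) ⊗ (0≤Λ (suc k) ⊗ 0≤inv (suc k)) ⊗ diff (ℓ-mono k x′ h x≤X)) (lem (𝟙 (suc k ≈? b)) (Λ (suc k)) (inv (suc k)) u (ℓ (suc k)))))
      where
      lem : ∀ t l i u m → t * (l * i) * (u - m) ≡ u * (t * (l * i)) - t * (l * m * i)
      lem = solve-∀ ℚ-ring
     0≤S : 0ℚ ≤ S
     0≤S = (0≤u ⊕ 0≤C) ⊗ (0≤u ⊕ 0≤C) ⊕ 0≤Φ ⊗ 0≤K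
     per-class : ∀ b → Φ * (e b * σ b) ≤ β b * S + e b * (Φ * (u * w))
     per-class b = cases (unit? b) (w ≤? Mc b x)
      where
      cases : (d : Dec (Unit b)) (d′ : Dec (w ≤ Mc b x)) → Φ * (𝟙 d * σ b) ≤ 𝟙 (d ×-dec d′) * S + 𝟙 d * (Φ * (u * w))
      cases (yes ub) (yes _) = close (diff (σ-upper x′ x≤X b ub) ⊕ 0≤Φ ⊗ (0≤u ⊗ 0≤w)) (lem Φ (σ b) S (Φ * (u * w)))
       where
       lem : ∀ f t s c → s - f * t + c ≡ 1ℚ * s + 1ℚ * c - f * (1ℚ * t)
       lem = solve-∀ ℚ-ring
      cases (yes ub) (no ¬w) = close (0≤Φ ⊗ (diff (σ≤ b) ⊕ 0≤u ⊗ diff (<⇒≤ (≰⇒> ¬w)))) (lem Φ (σ b) S u w (Mc b x))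
       where
       lem : ∀ f t s u w m → f * (u * m - t + u * (w - m)) ≡ 0ℚ * s + 1ℚ * (f * (u * w)) - f * (1ℚ * t)
       lem = solve-∀ ℚ-ring
      cases (no _) d′ = ≤-reflexive (lem Φ (σ b) S (Φ * (u * w)))
       where
       lem : ∀ f t s c → f * (0ℚ * t) ≡ 0ℚ * s + 0ℚ * c
       lem = solve-∀ ℚ-ring
     summed : Φ * ∑ x (λ k → α k * ℓ k) ≤ ∣B∣ * S + Φ * (Φ * (u * w))
     summed = begin
      Φ * ∑ x (λ k → α k * ℓ k)
       ≡⟨ cong (Φ *_) (trans (∑-ext x (λ k → lem (Λ k) (e k) (inv k) (ℓ k))) (sym (class-sum x (λ k → Λℓ k * inv k)))) ⟩
      Φ * ∑ N (λ b → e b * σ b)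
       ≡⟨ ∑-*ˡ N Φ (λ b → e b * σ b) ⟨
      ∑ N (λ b → Φ * (e b * σ b))
       ≤⟨ ∑-mono N (λ b _ → per-class (suc b)) ⟩
      ∑ N (λ b → β b * S + e b * (Φ * (u * w)))
       ≡⟨ trans (∑-+ N _ _) (cong₂ _+_ (∑-*ʳ N S β) (∑-*ʳ N (Φ * (u * w)) e)) ⟩
      ∣B∣ * S + Φ * (Φ * (u * w)) ∎
      where
      open ≤-Reasoning
      lem : ∀ a e i l → a * e * i * l ≡ e * (a * l * i)
      lem = solve-∀ ℚ-ring
     ΦΦw≤ : ι 4 * (Φ * (Φ * w)) ≤ u
     ΦΦw≤ = subst (ι 4 * (Φ * (Φ * w)) ≤_) sw (close (0≤ι 4 ⊗ (0≤w ⊗ (diff Φ≤n ⊗ (0≤n ⊕ 0≤Φ)))) (lem Φ n w))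
      where
      lem : ∀ f n w → ι 4 * (w * ((n - f) * (n + f))) ≡ ι 4 * (n * n) * w - ι 4 * (f * (f * w))
      lem = solve-∀ ℚ-ring
     u²≤ : u * u ≤ ι 12 * (Φ * C) * u + ι 2 * (Φ * (C * C)) + ι 2 * (Φ * Φ) * K
     u²≤ = close (0≤ι 2 ⊗ (0≤Φ ⊗ diff (σ-lower x′ x≤X)) ⊕ 0≤ι 4 ⊗ diff summed ⊕ 0≤u ⊗ diff ΦΦw≤ ⊕ 0≤ι 2 ⊗ (diff count ⊗ 0≤S) ⊕ 0≤ι 2 ⊗ ((0≤u ⊗ 0≤C ⊕ 0≤u ⊗ 0≤C) ⊕ 0≤C ⊗ 0≤C ⊕ 0≤Φ ⊗ 0≤K))
      (lem Φ u C K w ∣B∣ (∑ x (λ k → α k * ℓ k)))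
      where
      lem : ∀ f u c k w b t → ι 2 * (f * (ι 2 * t - (u - ι 4 * c) * u)) + ι 4 * (b * ((u + c) * (u + c) + f * k) + f * (f * (u * w)) - f * t) + u * (u - ι 4 * (f * (f * w)))
        + ι 2 * ((f - (b + b + 1ℚ)) * ((u + c) * (u + c) + f * k)) + ι 2 * ((u * c + u * c) + c * c + f * k)
       ≡ ι 12 * (f * c) * u + ι 2 * (f * (c * c)) + ι 2 * (f * f) * k - u * u
      lem = solve-∀ ℚ-ring
     u≤κ₁ : u ≤ κ₁
     u≤κ₁ = cancel-u 1≤u (≤-trans u²≤ (close
      (0≤ι 12 ⊗ (diff Φ≤n ⊗ 0≤C) ⊗ 0≤u ⊕ 0≤ι 2 ⊗ (diff Φ≤n ⊗ (0≤C ⊗ 0≤C)) ⊕ 0≤ι 2 ⊗ (0≤n ⊗ (0≤C ⊗ 0≤C)) ⊗ diff 1≤u ⊕ 0≤ι 2 ⊗ (diff Φ≤n ⊗ (0≤n ⊕ 0≤Φ)) ⊗ 0≤K ⊕ 0≤ι 2 ⊗ (0≤n ⊗ 0≤n) ⊗ diff K≤)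
      (lem Φ n C u K)))
      where
      lem : ∀ f n c u k → ι 12 * ((n - f) * c) * u + ι 2 * ((n - f) * (c * c)) + ι 2 * (n * (c * c)) * (u - 1ℚ) + ι 2 * ((n - f) * (n + f)) * k + ι 2 * (n * n) * (ι 42 * (n * u) - k)
       ≡ (ι 12 * (n * c) + ι 2 * (n * (c * c)) + ι 84 * (n * (n * n))) * u - (ι 12 * (f * c) * u + ι 2 * (f * (c * c)) + ι 2 * (f * f) * k)
      lem = solve-∀ ℚ-ring

   -- On B the product of χ with its value c at b₀ is 1, and the classes outside B hold at most Φ w.
   -- Hence c Σ χ Λ/n ≥ M(x) - 2 Φ w ≥ u/2 - C, against the upper bound V.
   contradiction′ : (∀ p → Prime p → p ≈ a → R ℕ.< p → p ℕ.≤ X → ⊥) → ⊥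
   contradiction′ none = conclude (Coset.coset-character N′ B B? B-≈ proj₁ a ua (NoPrimes.¬BBB none) half)
    where
    conclude : (∃ λ q → ∃ λ b₀ → B b₀ × (∀ b → B b → QuadraticCharacter.χ {N′} q b ≡ QuadraticCharacter.χ q b₀)) → ⊥
    conclude (q , b₀ , Bb₀ , constant) = exceeds u≤κ₃ κ₃<u
     where
     open QuadraticCharacter q
     open RealCharacter X′ N′ q using (ΣχΛ)
     c : ℚ
     c = χ b₀
     cc : c * c ≡ 1ℚ
     cc = trans (χ-square b₀) (𝟙-yes (unit? b₀) (proj₁ Bb₀))
     pointwise : ∀ k → e k - ι 2 * (e k * (1ℚ - β k)) ≤ c * χ k
     pointwise k = go (unit? k) (B? k)
      where
      go : (d : Dec (Unit k)) (d′ : Dec (B k)) → 𝟙 d - ι 2 * (𝟙 d * (1ℚ - 𝟙 d′)) ≤ c * χ k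
      go (no ¬u) (yes Bk) = ⊥-elim (¬u (proj₁ Bk))
      go (yes _) (yes Bk) = ≤-reflexive (sym (trans (cong (c *_) (constant k Bk)) cc))
      go (yes _) (no _) = ∣∣⇒≥ (∣∣-mul (∣χ∣≤1 b₀) (∣χ∣≤1 k))
      go (no ¬u) (no _) = ≤-reflexive (sym (trans (cong (c *_) (χ-nonunit k ¬u)) (*-zeroʳ c)))
     outside : ∑ x (λ k → e k * ((1ℚ - β k) * (Λ k * inv k))) ≤ Φ * w
     outside = begin
      ∑ x (λ k → e k * ((1ℚ - β k) * (Λ k * inv k)))
       ≡⟨ class-sum x (λ k → (1ℚ - β k) * (Λ k * inv k)) ⟨
      ∑ N (λ b → e b * ∑ x (λ k → 𝟙 (k ≈? b) * ((1ℚ - β k) * (Λ k * inv k))))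
       ≡⟨ ∑-ext N (λ b → cong (e b *_) (trans (∑-ext x (λ k → trans (𝟙-guard (k ≈? b) (λ h → cong (λ t → (1ℚ - t) * (Λ k * inv k)) (𝟙-cong (B? k) (B? b) (B-≈ h) (B-≈ (≈-sym h))))) (lem (𝟙 (k ≈? b)) (1ℚ - β b) (Λ k * inv k)))) (∑-*ˡ x (1ℚ - β b) _))) ⟩
      ∑ N (λ b → e b * ((1ℚ - β b) * Mc b x))
       ≤⟨ ∑-mono N (λ b _ → per-class (suc b)) ⟩
      ∑ N (λ b → e b * w)
       ≡⟨ ∑-*ʳ N w e ⟩
      Φ * w ∎
      where
      open ≤-Reasoning
      lem : ∀ a b c → a * (b * c) ≡ b * (a * c)
      lem = solve-∀ ℚ-ring
      per-class : ∀ b → e b * ((1ℚ - β b) * Mc b x) ≤ e b * w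
      per-class b = cases (unit? b) (w ≤? Mc b x)
       where
       cases : (d : Dec (Unit b)) (d′ : Dec (w ≤ Mc b x)) → 𝟙 d * ((1ℚ - 𝟙 (d ×-dec d′)) * Mc b x) ≤ 𝟙 d * w
       cases (yes _) (yes _) = close 0≤w (lem′ w (Mc b x))
        where
        lem′ : ∀ w m → w ≡ 1ℚ * w - 1ℚ * ((1ℚ - 1ℚ) * m)
        lem′ = solve-∀ ℚ-ring
       cases (yes _) (no ¬w) = close (diff (<⇒≤ (≰⇒> ¬w))) (lem′ w (Mc b x))
        where
        lem′ : ∀ w m → w - m ≡ 1ℚ * w - 1ℚ * ((1ℚ - 0ℚ) * m)
        lem′ = solve-∀ ℚ-ring
       cases (no _) d′ = ≤-reflexive (lem′ w (Mc b x))
        where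
        lem′ : ∀ w m → 0ℚ * ((1ℚ - 0ℚ) * m) ≡ 0ℚ * w
        lem′ = solve-∀ ℚ-ring
     twisted : M x - ι 2 * (Φ * w) ≤ c * ΣχΛ x
     twisted = begin
      M x - ι 2 * (Φ * w)
       ≤⟨ close (0≤ι 2 ⊗ diff outside) (lem (M x) (Φ * w) O) ⟩
      M x - ι 2 * O
       ≡⟨ sym (trans (∑-ext x (λ k → lem₂ (Λ k) (inv k) (e k) (β k))) (trans (∑-- x (λ k → Λ k * e k * inv k) (λ k → ι 2 * (e k * ((1ℚ - β k) * (Λ k * inv k))))) (cong (λ t → M x - t) (∑-*ˡ x (ι 2) (λ k → e k * ((1ℚ - β k) * (Λ k * inv k))))))) ⟩
      ∑ x (λ k → (e k - ι 2 * (e k * (1ℚ - β k))) * (Λ k * inv k))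
       ≤⟨ ∑-mono x (λ k _ → *-monoʳ (Λ (suc k) * inv (suc k)) (0≤Λ (suc k) ⊗ 0≤inv (suc k)) (pointwise (suc k))) ⟩
      ∑ x (λ k → c * χ k * (Λ k * inv k))
       ≡⟨ trans (∑-ext x (λ k → lem₃ c (χ k) (Λ k) (inv k))) (∑-*ˡ x c _) ⟩
      c * ΣχΛ x ∎
      where
      open ≤-Reasoning
      O = ∑ x (λ k → e k * ((1ℚ - β k) * (Λ k * inv k)))
      lem : ∀ m f o → ι 2 * (f - o) ≡ m - ι 2 * o - (m - ι 2 * f)
      lem = solve-∀ ℚ-ring
      lem₂ : ∀ l i e b → (e - ι 2 * (e * (1ℚ - b))) * (l * i) ≡ l * e * i - ι 2 * (e * ((1ℚ - b) * (l * i)))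
      lem₂ = solve-∀ ℚ-ring
      lem₃ : ∀ c x l i → c * x * (l * i) ≡ c * (l * x * i)
      lem₃ = solve-∀ ℚ-ring
     bounded : c * ΣχΛ x ≤ V
     bounded = subst (c * ΣχΛ x ≤_) (*-identityˡ V) (∣∣⇒≤ (∣∣-mul (∣χ∣≤1 b₀) (RealCharacter.LowerBound.ΣχΛ-bound X′ N′ q z′ z-large (ℕ.≤-trans (ℕ.m≤n+m Y x₃) (ℕ.n≤1+n X′)) x′ D≤x x≤X)))
     Φw≤ : ι 4 * (Φ * w) ≤ u
     Φw≤ = subst (ι 4 * (Φ * w) ≤_) sw (close (0≤ι 4 ⊗ (0≤w ⊗ (diff Φ≤n ⊕ 0≤n ⊗ diff 1≤n))) (lem Φ n w))
      where
      lem : ∀ f n w → ι 4 * (w * (n - f + n * (n - 1ℚ))) ≡ ι 4 * (n * n) * w - ι 4 * (f * w)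
      lem = solve-∀ ℚ-ring
     u≤κ₃ : u ≤ κ₃
     u≤κ₃ = close (0≤ι 2 ⊗ diff bounded ⊕ 0≤ι 2 ⊗ diff twisted ⊕ 0≤ι 2 ⊗ diff (M-lower x′ x≤X) ⊕ diff Φw≤) (lem u C V (M x) (Φ * w) (c * ΣχΛ x))
      where
      lem : ∀ u c v m f t → ι 2 * (v - t) + ι 2 * (t - (m - ι 2 * f)) + ι 2 * (m - (u - c)) + (u - ι 4 * f) ≡ ι 2 * v + ι 2 * c - u
      lem = solve-∀ ℚ-ring

  prime-in-class : ∃ λ r → Prime r × R ℕ.< r × Residues._≈_ N′ r a
  prime-in-class = search (ℕ.anyUpTo? (λ r → prime? r ×-dec ((R ℕ.<? r) ×-dec (r ≈? a))) (suc X))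
   where
   search : Dec (∃ λ r → r ℕ.< suc X × Prime r × R ℕ.< r × r ≈ a) → ∃ λ r → Prime r × R ℕ.< r × r ≈ a
   search (yes (r , _ , found)) = r , found
   search (no ¬∃) = ⊥-elim (contradiction′ (λ p pp p≈a R<p p≤X → ¬∃ (p , s≤s p≤X , pp , R<p , p≈a)))

 -- The argument treats z as a variable with a lower bound; its size, 128² N⁴ + 1, is fixed only
 -- here.
 dirichlet : ∀ N′ a → Residues.Unit N′ a → ∀ R → ∃ λ r → Prime r × R ℕ.< r × Residues._≈_ N′ r a
 dirichlet N′ a ua R = prime-in-class N′ a ua R _ (ℕ.n≤1+n _)

-- Formal power series over the integers.

module Series where

 open import Data.Integer using (ℤ; _+_; _*_; _-_; -_; 0ℤ; 1ℤ)
 open import Data.Integer.Properties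
 open import Data.Integer.Tactic.RingSolver using (solve-∀)
 open import Algebra.Bundles using (CommutativeMonoid)
 open import Level using (0ℓ)
 open import Function using (_∘_)

 Series : Set
 Series = ℕ → ℤ

 infix 4 _≋_
 _≋_ : Series → Series → Set
 f ≋ g = ∀ n → f n ≡ g n

 ≋-refl : ∀ {f} → f ≋ f
 ≋-refl n = refl

 ≋-sym : ∀ {f g} → f ≋ g → g ≋ f
 ≋-sym h n = sym (h n)

 ≋-trans : ∀ {f g h} → f ≋ g → g ≋ h → f ≋ h
 ≋-trans h k n = trans (h n) (k n)

 infixl 7 _∗_
 -- The Cauchy product by recursion on the index, splitting off the first coefficient of the left
 -- factor; this keeps subtraction of indices out of the ring laws.
 _∗_ : Series → Series → Series
 (f ∗ g) zero = f 0 * g 0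
 (f ∗ g) (suc n) = f 0 * g (suc n) + ((f ∘ suc) ∗ g) n

 ∗-cong : ∀ {f f′ g g′} → f ≋ f′ → g ≋ g′ → f ∗ g ≋ f′ ∗ g′
 ∗-cong h k zero = cong₂ _*_ (h 0) (k 0)
 ∗-cong h k (suc n) = cong₂ _+_ (cong₂ _*_ (h 0) (k (suc n))) (∗-cong (h ∘ suc) k n)

 ∗-congˡ : ∀ {f g g′} → g ≋ g′ → f ∗ g ≋ f ∗ g′
 ∗-congˡ = ∗-cong ≋-refl

 ∗-congʳ : ∀ {f f′ g} → f ≋ f′ → f ∗ g ≋ f′ ∗ g
 ∗-congʳ {g = g} h = ∗-cong {g = g} h ≋-refl

 ∗-distribʳ : ∀ f g h n → ((λ i → f i + g i) ∗ h) n ≡ (f ∗ h) n + (g ∗ h) n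
 ∗-distribʳ f g h zero = *-distribʳ-+ (h 0) (f 0) (g 0)
 ∗-distribʳ f g h (suc n) = trans (cong₂ _+_ (*-distribʳ-+ (h (suc n)) (f 0) (g 0)) (∗-distribʳ (f ∘ suc) (g ∘ suc) h n)) (lem (f 0 * h (suc n)) (g 0 * h (suc n)) ((f ∘ suc ∗ h) n) ((g ∘ suc ∗ h) n))
  where
  lem : ∀ a b c d → a + b + (c + d) ≡ a + c + (b + d)
  lem = solve-∀

 ∗-scaleˡ : ∀ c f h n → ((λ i → c * f i) ∗ h) n ≡ c * (f ∗ h) n
 ∗-scaleˡ c f h zero = *-assoc c (f 0) (h 0)
 ∗-scaleˡ c f h (suc n) = trans (cong₂ _+_ (*-assoc c (f 0) (h (suc n))) (∗-scaleˡ c (f ∘ suc) h n)) (sym (*-distribˡ-+ c (f 0 * h (suc n)) ((f ∘ suc ∗ h) n)))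

 ∗-assoc : ∀ f g h → f ∗ g ∗ h ≋ f ∗ (g ∗ h)
 ∗-assoc f g h zero = *-assoc (f 0) (g 0) (h 0)
 ∗-assoc f g h (suc n) = begin
  f 0 * g 0 * h (suc n) + ((λ i → f 0 * g (suc i) + (f ∘ suc ∗ g) i) ∗ h) n
   ≡⟨ cong (f 0 * g 0 * h (suc n) +_) (trans (∗-distribʳ (λ i → f 0 * g (suc i)) (f ∘ suc ∗ g) h n) (cong₂ _+_ (∗-scaleˡ (f 0) (g ∘ suc) h n) (∗-assoc (f ∘ suc) g h n))) ⟩
  f 0 * g 0 * h (suc n) + (f 0 * (g ∘ suc ∗ h) n + (f ∘ suc ∗ (g ∗ h)) n)
   ≡⟨ lem (f 0) (g 0) (h (suc n)) ((g ∘ suc ∗ h) n) ((f ∘ suc ∗ (g ∗ h)) n) ⟩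
  f 0 * (g 0 * h (suc n) + (g ∘ suc ∗ h) n) + (f ∘ suc ∗ (g ∗ h)) n ∎
  where
  open ≡-Reasoning
  lem : ∀ a b c d e → a * b * c + (a * d + e) ≡ a * (b * c + d) + e
  lem = solve-∀

 private
  ∗-last : ∀ f g n → (f ∗ g) (suc n) ≡ (f ∗ (g ∘ suc)) n + f (suc n) * g 0
  ∗-last f g zero = refl
  ∗-last f g (suc n) = trans (cong (f 0 * g (suc (suc n)) +_) (∗-last (f ∘ suc) g n)) (sym (+-assoc (f 0 * g (suc (suc n))) ((f ∘ suc ∗ g ∘ suc) n) (f (suc (suc n)) * g 0)))

 ∗-comm : ∀ f g → f ∗ g ≋ g ∗ f
 ∗-comm f g zero = *-comm (f 0) (g 0)
 ∗-comm f g (suc n) = trans (cong₂ _+_ (*-comm (f 0) (g (suc n))) (∗-comm (f ∘ suc) g n)) (trans (+-comm (g (suc n) * f 0) ((g ∗ f ∘ suc) n)) (sym (∗-last g f n)))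

 shift : ℕ → Series → Series
 shift zero f = f
 shift (suc k) f zero = 0ℤ
 shift (suc k) f (suc n) = shift k f n

 δ₀ : Series
 δ₀ zero = 1ℤ
 δ₀ (suc n) = 0ℤ

 δ : ℕ → Series
 δ k = shift k δ₀

 private
  zero-∗ : ∀ f → (λ _ → 0ℤ) ∗ f ≋ (λ _ → 0ℤ)
  zero-∗ f zero = refl
  zero-∗ f (suc n) = trans (+-identityˡ _) (zero-∗ f n)

 δ-∗ : ∀ k f → δ k ∗ f ≋ shift k f
 δ-∗ zero f zero = *-identityˡ (f 0)
 δ-∗ zero f (suc n) = trans (cong₂ _+_ (*-identityˡ (f (suc n))) (zero-∗ f n)) (+-identityʳ (f (suc n)))
 δ-∗ (suc k) f zero = refl
 δ-∗ (suc k) f (suc n) = trans (+-identityˡ _) (δ-∗ k f n)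

 ∗-commutativeMonoid : CommutativeMonoid 0ℓ 0ℓ
 ∗-commutativeMonoid = record
  { Carrier = Series ; _≈_ = _≋_ ; _∙_ = _∗_ ; ε = δ₀
  ; isCommutativeMonoid = record
   { isMonoid = record
    { isSemigroup = record
     { isMagma = record { isEquivalence = record { refl = ≋-refl ; sym = ≋-sym ; trans = ≋-trans } ; ∙-cong = ∗-cong }
     ; assoc = ∗-assoc }
    ; identity = (λ f → δ-∗ 0 f) , (λ f → ≋-trans (∗-comm f δ₀) (δ-∗ 0 f)) }
   ; comm = ∗-comm } }

 shift-cong : ∀ k {f g} → f ≋ g → shift k f ≋ shift k g
 shift-cong zero h = h
 shift-cong (suc k) h zero = refl
 shift-cong (suc k) h (suc n) = shift-cong k h n

 shift-+ : ∀ j k f → shift j (shift k f) ≋ shift (j ℕ.+ k) f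
 shift-+ zero k f n = refl
 shift-+ (suc j) k f zero = refl
 shift-+ (suc j) k f (suc n) = shift-+ j k f n

 shift-< : ∀ k f n → n ℕ.< k → shift k f n ≡ 0ℤ
 shift-< (suc k) f zero h = refl
 shift-< (suc k) f (suc n) (s≤s h) = shift-< k f n h

 shift-≥ : ∀ k f n → shift k f (k ℕ.+ n) ≡ f n
 shift-≥ zero f n = refl
 shift-≥ (suc k) f n = shift-≥ k f n

 shift-∸ : ∀ k f n → k ℕ.≤ n → shift k f n ≡ f (n ℕ.∸ k)
 shift-∸ k f n h = trans (cong (shift k f) (sym (ℕ.m+[n∸m]≡n h))) (shift-≥ k f (n ℕ.∸ k))

 -- The reversal of x^k - 1.
 E : ℕ → Series
 E k n = δ₀ n - δ k n

 ∗-distribʳ-- : ∀ f g h n → ((λ i → f i - g i) ∗ h) n ≡ (f ∗ h) n - (g ∗ h) n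
 ∗-distribʳ-- f g h n = trans (∗-distribʳ f (λ i → - g i) h n) (cong ((f ∗ h) n +_) (trans (∗-cong {λ i → - g i} {λ i → - 1ℤ * g i} {h} {h} (λ i → sym (-1*i≡-i (g i))) ≋-refl n) (trans (∗-scaleˡ (- 1ℤ) g h n) (-1*i≡-i ((g ∗ h) n)))))

 E-∗ : ∀ k f n → (E k ∗ f) n ≡ f n - shift k f n
 E-∗ k f n = trans (∗-distribʳ-- δ₀ (δ k) f n) (cong₂ _-_ (δ-∗ 0 f n) (δ-∗ k f n))

 ∗-zero-below : ∀ k g f → g 0 ≡ 1ℤ → (∀ i → i ℕ.< k → (f ∗ g) i ≡ 0ℤ) → ∀ i → i ℕ.< k → f i ≡ 0ℤ
 ∗-zero-below (suc k) g f g0 h zero _ = trans (sym (*-identityʳ (f 0))) (trans (cong (f 0 *_) (sym g0)) (h 0 (s≤s z≤n)))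
 ∗-zero-below (suc k) g f g0 h (suc i) (s≤s i<k) = ∗-zero-below k g (f ∘ suc) g0 (λ j j<k → trans (sym (+-identityˡ _)) (trans (cong (λ t → t * g (suc j) + (f ∘ suc ∗ g) j) (sym (∗-zero-below (suc k) g f g0 h zero (s≤s z≤n)))) (h (suc j) (s≤s j<k)))) i i<k

 -- A factor with constant term 1 determines the other factor coefficient by coefficient. The
 -- truncated form is what polynomial division provides, since a quotient is specified on its own
 -- length.
 ∗-cancel-below : ∀ k g f f′ → g 0 ≡ 1ℤ → (∀ i → i ℕ.< k → (g ∗ f) i ≡ (g ∗ f′) i) → ∀ i → i ℕ.< k → f i ≡ f′ i
 ∗-cancel-below k g f f′ g0 h i i<k = i-j≡0⇒i≡j (f i) (f′ i) (∗-zero-below k g (λ j → f j - f′ j) g0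
  (λ j j<k → trans (∗-distribʳ-- f f′ g j) (i≡j⇒i-j≡0 (trans (∗-comm f g j) (trans (h j j<k) (∗-comm g f′ j))))) i i<k)

 ∗-cancel : ∀ g f f′ → g 0 ≡ 1ℤ → g ∗ f ≋ g ∗ f′ → f ≋ f′
 ∗-cancel g f f′ g0 h n = ∗-cancel-below (suc n) g f f′ g0 (λ i _ → h i) n ℕ.≤-refl

 -- Runs over 0 to n - 1, as coefficient indices do, whereas `∑` runs over 1 to n.
 Σ : ℕ → (ℕ → ℤ) → ℤ
 Σ zero f = 0ℤ
 Σ (suc n) f = Σ n f + f n

 Σ-cong : ∀ n {f g : ℕ → ℤ} → (∀ i → i ℕ.< n → f i ≡ g i) → Σ n f ≡ Σ n g
 Σ-cong zero h = refl
 Σ-cong (suc n) h = cong₂ _+_ (Σ-cong n (λ i b → h i (ℕ.m≤n⇒m≤1+n b))) (h n ℕ.≤-refl)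

 Σ-0 : ∀ n → Σ n (λ _ → 0ℤ) ≡ 0ℤ
 Σ-0 zero = refl
 Σ-0 (suc n) = trans (+-identityʳ _) (Σ-0 n)

 Σ-zero : ∀ n {f : ℕ → ℤ} → (∀ i → i ℕ.< n → f i ≡ 0ℤ) → Σ n f ≡ 0ℤ
 Σ-zero n h = trans (Σ-cong n h) (Σ-0 n)

 Σ-+ : ∀ n f g → Σ n (λ i → f i + g i) ≡ Σ n f + Σ n g
 Σ-+ zero f g = refl
 Σ-+ (suc n) f g = trans (cong (_+ (f n + g n)) (Σ-+ n f g)) (lem (Σ n f) (Σ n g) (f n) (g n))
  where
  lem : ∀ a b c d → a + b + (c + d) ≡ a + c + (b + d)
  lem = solve-∀

 Σ-- : ∀ n f g → Σ n (λ i → f i - g i) ≡ Σ n f - Σ n g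
 Σ-- zero f g = refl
 Σ-- (suc n) f g = trans (cong (_+ (f n - g n)) (Σ-- n f g)) (lem (Σ n f) (Σ n g) (f n) (g n))
  where
  lem : ∀ a b c d → a - b + (c - d) ≡ a + c - (b + d)
  lem = solve-∀

 Σ-*ˡ : ∀ n c f → Σ n (λ i → c * f i) ≡ c * Σ n f
 Σ-*ˡ zero c f = sym (*-zeroʳ c)
 Σ-*ˡ (suc n) c f = trans (cong (_+ c * f n) (Σ-*ˡ n c f)) (sym (*-distribˡ-+ c (Σ n f) (f n)))

 Σ-swap : ∀ m n (f : ℕ → ℕ → ℤ) → Σ m (λ i → Σ n (f i)) ≡ Σ n (λ j → Σ m (λ i → f i j))
 Σ-swap zero n f = sym (Σ-0 n)
 Σ-swap (suc m) n f = trans (cong (_+ Σ n (f m)) (Σ-swap m n f)) (sym (Σ-+ n (λ j → Σ m (λ i → f i j)) (f m)))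

 Σ-first : ∀ n f → Σ (suc n) f ≡ f 0 + Σ n (f ∘ suc)
 Σ-first zero f = +-comm 0ℤ (f 0)
 Σ-first (suc n) f = trans (cong (_+ f (suc n)) (Σ-first n f)) (+-assoc (f 0) (Σ n (f ∘ suc)) (f (suc n)))

 ∗-Σ : ∀ f g n → (f ∗ g) n ≡ Σ (suc n) (λ m → f m * g (n ℕ.∸ m))
 ∗-Σ f g zero = sym (+-identityˡ (f 0 * g 0))
 ∗-Σ f g (suc n) = trans (cong (f 0 * g (suc n) +_) (∗-Σ (f ∘ suc) g n)) (sym (Σ-first (suc n) (λ m → f m * g (suc n ℕ.∸ m))))

 [_] : ∀ {P : Set} → Dec P → ℤ
 [ yes _ ] = 1ℤ
 [ no _ ] = 0ℤ

 []-yes : ∀ {P : Set} (d : Dec P) → P → [ d ] ≡ 1ℤ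
 []-yes (yes _) _ = refl
 []-yes (no ¬p) p = ⊥-elim (¬p p)

 []-no : ∀ {P : Set} (d : Dec P) → ¬ P → [ d ] ≡ 0ℤ
 []-no (yes p) ¬p = ⊥-elim (¬p p)
 []-no (no _) _ = refl

 []-cong : ∀ {P Q : Set} (d : Dec P) (e : Dec Q) → (P → Q) → (Q → P) → [ d ] ≡ [ e ]
 []-cong (yes p) e f g = sym ([]-yes e (f p))
 []-cong (no ¬p) e f g = sym ([]-no e (λ q → ¬p (g q)))

 Σ-single-0 : ∀ n c (f : ℕ → ℤ) → n ℕ.≤ c → Σ n (λ i → [ i ℕ.≟ c ] * f i) ≡ 0ℤ
 Σ-single-0 n c f h = Σ-zero n (λ i b → trans (cong (_* f i) ([]-no (i ℕ.≟ c) (λ e → ℕ.<-irrefl e (ℕ.<-≤-trans b h)))) refl)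

 Σ-single : ∀ n c (f : ℕ → ℤ) → c ℕ.< n → Σ n (λ i → [ i ℕ.≟ c ] * f i) ≡ f c
 Σ-single (suc n) c f h with c ℕ.≟ n
 ... | yes refl = trans (cong₂ _+_ (Σ-single-0 n n f ℕ.≤-refl) (trans (cong (_* f n) ([]-yes (n ℕ.≟ n) refl)) (*-identityˡ (f n)))) (+-identityˡ (f n))
 ... | no ¬e = trans (cong₂ _+_ (Σ-single n c f (ℕ.≤∧≢⇒< (ℕ.≤-pred h) ¬e)) (cong (_* f n) ([]-no (n ℕ.≟ c) (λ e → ¬e (sym e))))) (+-identityʳ (f c))

-- Coefficient lists read as power series from the leading coefficient.

module PolyList where

 open import Defs
 open Series
 open import Data.Nat using (_⊔_)
 open import Data.Integer using (ℤ; -[1+_]; _+_; _*_; _-_; -_; 0ℤ; 1ℤ; ∣_∣)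
 open import Data.Integer.Properties
 open import Data.Integer.Tactic.RingSolver using (solve-∀)
 open import Data.List using (List; []; _∷_; _++_; map; foldr; length; reverse; replicate)
 open import Data.List.Properties using (reverse-involutive; length-reverse; unfold-reverse; length-map; length-++; length-replicate)
 open import Data.List.Relation.Unary.All using (All; []; _∷_)
 open import Data.List.Relation.Unary.All.Properties using (++⁺)
 open import Function using (_∘_)

 coef : List ℤ → Series
 coef [] i = 0ℤ
 coef (x ∷ xs) zero = x
 coef (x ∷ xs) (suc i) = coef xs i

 -- Coefficients from the leading one downwards.
 rc : Poly → Series
 rc f = coef (reverse f)

 coef-snoc : ∀ xs x i → coef (xs ++ x ∷ []) i ≡ coef xs i + x * δ (length xs) i
 coef-snoc [] x zero = sym (trans (+-identityˡ (x * 1ℤ)) (*-identityʳ x))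
 coef-snoc [] x (suc i) = sym (trans (+-identityˡ (x * 0ℤ)) (*-zeroʳ x))
 coef-snoc (y ∷ xs) x zero = sym (trans (cong (λ t → y + t) (*-zeroʳ x)) (+-identityʳ y))
 coef-snoc (y ∷ xs) x (suc i) = coef-snoc xs x i

 coef-beyond : ∀ xs i → length xs ℕ.≤ i → coef xs i ≡ 0ℤ
 coef-beyond [] i h = refl
 coef-beyond (x ∷ xs) (suc i) (s≤s h) = coef-beyond xs i h

 rc-∷ : ∀ x xs i → rc (x ∷ xs) i ≡ rc xs i + x * δ (length xs) i
 rc-∷ x xs i = trans (cong (λ t → coef t i) (unfold-reverse x xs)) (trans (coef-snoc (reverse xs) x i) (cong (λ k → rc xs i + x * δ k i) (length-reverse xs)))

 shift-linear : ∀ d f g c n → shift d (λ i → f i + c * g i) n ≡ shift d f n + c * shift d g n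
 shift-linear zero f g c n = refl
 shift-linear (suc d) f g c zero = sym (trans (+-identityˡ (c * 0ℤ)) (*-zeroʳ c))
 shift-linear (suc d) f g c (suc n) = shift-linear d f g c n

 shift-0 : ∀ d n → shift d (λ _ → 0ℤ) n ≡ 0ℤ
 shift-0 zero n = refl
 shift-0 (suc d) zero = refl
 shift-0 (suc d) (suc n) = shift-0 d n

 length-polyAdd : ∀ s t → length s ℕ.≤ length t → length (polyAdd s t) ≡ length t
 length-polyAdd [] t h = refl
 length-polyAdd (a ∷ s) (b ∷ t) (s≤s h) = cong suc (length-polyAdd s t h)

 -- Lists are aligned at the constant term, so the leading coefficients of summands of different
 -- length meet only after a shift by the difference of the lengths.
 rc-polyAdd : ∀ s t → length s ℕ.≤ length t → ∀ i → rc (polyAdd s t) i ≡ rc t i + shift (length t ℕ.∸ length s) (rc s) i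
 rc-polyAdd [] t h i = sym (trans (cong (λ x → rc t i + x) (shift-0 (length t) i)) (+-identityʳ (rc t i)))
 rc-polyAdd (a ∷ s) (b ∷ t) (s≤s h) i = begin
  rc ((a + b) ∷ polyAdd s t) i
   ≡⟨ rc-∷ (a + b) (polyAdd s t) i ⟩
  rc (polyAdd s t) i + (a + b) * δ (length (polyAdd s t)) i
   ≡⟨ cong₂ (λ x k → x + (a + b) * δ k i) (rc-polyAdd s t h i) (length-polyAdd s t h) ⟩
  rc t i + shift d (rc s) i + (a + b) * δ (length t) i
   ≡⟨ lem (rc t i) (shift d (rc s) i) a b (δ (length t) i) ⟩
  rc t i + b * δ (length t) i + (shift d (rc s) i + a * δ (length t) i)
   ≡⟨ cong₂ _+_ (sym (rc-∷ b t i)) (trans (cong (λ x → shift d (rc s) i + a * x) (sym (trans (shift-+ d (length s) δ₀ i) (cong (λ k → δ k i) (ℕ.m∸n+n≡m h))))) (sym (trans (shift-cong d (rc-∷ a s) i) (shift-linear d (rc s) (δ (length s)) a i)))) ⟩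
  rc (b ∷ t) i + shift d (rc (a ∷ s)) i ∎
  where
  open ≡-Reasoning
  d = length t ℕ.∸ length s
  lem : ∀ r s a b x → r + s + (a + b) * x ≡ r + b * x + (s + a * x)
  lem = solve-∀

 rc-map : ∀ a g i → rc (map (λ x → a * x) g) i ≡ a * rc g i
 rc-map a [] i = sym (*-zeroʳ a)
 rc-map a (b ∷ g) i = trans (rc-∷ (a * b) (map (λ x → a * x) g) i) (trans (cong₂ (λ x k → x + a * b * δ k i) (rc-map a g i) (length-map (λ x → a * x) g))
  (trans (lem a (rc g i) b (δ (length g) i)) (cong (λ t → a * t) (sym (rc-∷ b g i)))))
  where
  lem : ∀ a r b x → a * r + a * b * x ≡ a * (r + b * x)
  lem = solve-∀

 polyAdd-[] : ∀ s → polyAdd s [] ≡ s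
 polyAdd-[] [] = refl
 polyAdd-[] (x ∷ s) = refl

 rc-polyMul : ∀ a f b g → (rc (polyMul (a ∷ f) (b ∷ g)) ≋ rc (a ∷ f) ∗ rc (b ∷ g)) × length (polyMul (a ∷ f) (b ∷ g)) ≡ suc (length f ℕ.+ length g)
 rc-polyMul a [] b g = (λ i → trans (cong (λ l → rc l i) single) (trans (rc-map a (b ∷ g) i) (sym (scaled i)))) , trans (cong length single) (cong suc (length-map (λ x → a * x) g))
  where
  single : polyMul (a ∷ []) (b ∷ g) ≡ map (λ x → a * x) (b ∷ g)
  single = cong₂ _∷_ (+-identityʳ (a * b)) (polyAdd-[] (map (λ x → a * x) g))
  scaled : ∀ i → (rc (a ∷ []) ∗ rc (b ∷ g)) i ≡ a * rc (b ∷ g) i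
  scaled i = trans (∗-congʳ {g = rc (b ∷ g)} (λ { zero → sym (*-identityʳ a) ; (suc j) → sym (*-zeroʳ a) }) i) (trans (∗-scaleˡ a δ₀ (rc (b ∷ g)) i) (cong (λ t → a * t) (δ-∗ 0 (rc (b ∷ g)) i)))
 rc-polyMul a (a′ ∷ f) b g with rc-polyMul a′ f b g
 ... | ih , len = series , trans (length-polyAdd s t s≤t) (cong suc len)
  where
  s t : Poly
  s = map (λ x → a * x) (b ∷ g)
  t = 0ℤ ∷ polyMul (a′ ∷ f) (b ∷ g)
  s≤t : length s ℕ.≤ length t
  s≤t = subst₂ ℕ._≤_ (sym (length-map (λ x → a * x) (b ∷ g))) (cong suc (sym len)) (s≤s (ℕ.m≤n⇒m≤1+n (ℕ.m≤n+m (length g) (length f))))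
  gap : length t ℕ.∸ length s ≡ suc (length f)
  gap = trans (cong₂ (λ x y → suc x ℕ.∸ y) len (length-map (λ x → a * x) (b ∷ g))) (ℕ.m+n∸n≡m (suc (length f)) (length g))
  open ≡-Reasoning
  lem : ∀ x y → x + 0ℤ * y ≡ x
  lem = solve-∀
  series : rc (polyAdd s t) ≋ rc (a ∷ a′ ∷ f) ∗ rc (b ∷ g)
  series i = begin
   rc (polyAdd s t) i
    ≡⟨ rc-polyAdd s t s≤t i ⟩
   rc t i + shift (length t ℕ.∸ length s) (rc s) i
    ≡⟨ cong₂ _+_ (trans (rc-∷ 0ℤ (polyMul (a′ ∷ f) (b ∷ g)) i) (trans (lem (rc (polyMul (a′ ∷ f) (b ∷ g)) i) (δ (length (polyMul (a′ ∷ f) (b ∷ g))) i)) (ih i))) (cong (λ k → shift k (rc s) i) gap) ⟩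
   (rc (a′ ∷ f) ∗ rc (b ∷ g)) i + shift (suc (length f)) (rc s) i
    ≡⟨ cong (λ x → (rc (a′ ∷ f) ∗ rc (b ∷ g)) i + x) (trans (sym (δ-∗ (suc (length f)) (rc s) i)) (trans (∗-comm (δ (suc (length f))) (rc s) i)
      (trans (∗-congʳ {g = δ (suc (length f))} (rc-map a (b ∷ g)) i) (trans (∗-scaleˡ a (rc (b ∷ g)) (δ (suc (length f))) i) (cong (λ x → a * x) (∗-comm (rc (b ∷ g)) (δ (suc (length f))) i)))))) ⟩
   (rc (a′ ∷ f) ∗ rc (b ∷ g)) i + a * (δ (suc (length f)) ∗ rc (b ∷ g)) i
    ≡⟨ trans (cong (λ x → (rc (a′ ∷ f) ∗ rc (b ∷ g)) i + x) (sym (∗-scaleˡ a (δ (suc (length f))) (rc (b ∷ g)) i))) (sym (∗-distribʳ (rc (a′ ∷ f)) (λ j → a * δ (suc (length f)) j) (rc (b ∷ g)) i)) ⟩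
   ((λ j → rc (a′ ∷ f) j + a * δ (suc (length f)) j) ∗ rc (b ∷ g)) i
    ≡⟨ ∗-congʳ {g = rc (b ∷ g)} (λ j → sym (rc-∷ a (a′ ∷ f) j)) i ⟩
   (rc (a ∷ a′ ∷ f) ∗ rc (b ∷ g)) i ∎

 length-subPrefix : ∀ xs ys → length (subPrefix xs ys) ≡ length xs
 length-subPrefix [] [] = refl
 length-subPrefix (x ∷ xs) [] = refl
 length-subPrefix [] (y ∷ ys) = refl
 length-subPrefix (x ∷ xs) (y ∷ ys) = cong suc (length-subPrefix xs ys)

 coef-subPrefix : ∀ xs ys i → i ℕ.< length xs → coef (subPrefix xs ys) i ≡ coef xs i - coef ys i
 coef-subPrefix (x ∷ xs) [] i h = sym (+-identityʳ (coef (x ∷ xs) i))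
 coef-subPrefix (x ∷ xs) (y ∷ ys) zero h = refl
 coef-subPrefix (x ∷ xs) (y ∷ ys) (suc i) (s≤s h) = coef-subPrefix xs ys i h

 coef-map : ∀ a xs i → coef (map (λ x → a * x) xs) i ≡ a * coef xs i
 coef-map a [] i = sym (*-zeroʳ a)
 coef-map a (x ∷ xs) zero = refl
 coef-map a (x ∷ xs) (suc i) = coef-map a xs i

 -- One division step subtracts c times the divisor, which is the recursion of `_∗_` with c split
 -- off. The statement covers the k quotient positions only; a remainder would show up beyond them.
 longDiv-spec : ∀ k fs gs → k ℕ.≤ length fs → length (longDiv k fs gs) ≡ k ×
  (∀ i → i ℕ.< k → (coef (longDiv k fs gs) ∗ coef (1ℤ ∷ gs)) i ≡ coef fs i)
 longDiv-spec zero fs gs h = refl , λ i ()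
 longDiv-spec (suc k) (c ∷ f) gs (s≤s h) with longDiv-spec k (subPrefix f (map (λ x → c * x) gs)) gs (subst (k ℕ.≤_) (sym (length-subPrefix f (map (λ x → c * x) gs))) h)
 ... | len , ih = cong suc len , spec
  where
  lem : ∀ x y → x + (y - x) ≡ y
  lem = solve-∀
  spec : ∀ i → i ℕ.< suc k → (coef (longDiv (suc k) (c ∷ f) gs) ∗ coef (1ℤ ∷ gs)) i ≡ coef (c ∷ f) i
  spec zero _ = *-identityʳ c
  spec (suc i) (s≤s i<k) = trans (cong (λ t → c * coef gs i + t) (trans (ih i i<k) (trans (coef-subPrefix f (map (λ x → c * x) gs) i (ℕ.<-≤-trans i<k h)) (cong (λ t → coef f i - t) (coef-map c gs i))))) (lem (c * coef gs i) (coef f i))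

 divMonic-spec : ∀ f g x gs → reverse g ≡ x ∷ gs → x ≡ 1ℤ → 1 ℕ.≤ length f →
  length (divMonic f g) ≡ suc (length f ℕ.∸ length g) ×
  (∀ i → i ℕ.< suc (length f ℕ.∸ length g) → (rc (divMonic f g) ∗ rc g) i ≡ rc f i)
 divMonic-spec f g .1ℤ gs eq refl 1≤f = trans (length-reverse q) (proj₁ spec) , λ i h →
  trans (∗-cong {rc (divMonic f g)} {coef q} {rc g} {coef (1ℤ ∷ gs)} (λ j → cong (λ l → coef l j) (trans (reverse-involutive q) refl)) (λ j → cong (λ l → coef l j) eq) i) (subst (λ t → (coef t ∗ coef (1ℤ ∷ gs)) i ≡ rc f i) (cong (longDiv k (reverse f)) (sym tail-eq)) (proj₂ (longDiv-spec k (reverse f) gs k≤) i h))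
  where
  k = suc (length f ℕ.∸ length g)
  q = longDiv k (reverse f) (tail' (reverse g))
  tail-eq : tail' (reverse g) ≡ gs
  tail-eq = cong tail' eq
  1≤g : 1 ℕ.≤ length g
  1≤g = subst (1 ℕ.≤_) (trans (cong length (sym eq)) (length-reverse g)) (s≤s z≤n)
  k≤ : k ℕ.≤ length (reverse f)
  k≤ = subst (k ℕ.≤_) (sym (length-reverse f)) (go (length f) (length g) 1≤f 1≤g)
   where
   go : ∀ m n → 1 ℕ.≤ m → 1 ℕ.≤ n → suc (m ℕ.∸ n) ℕ.≤ m
   go (suc m) (suc n) _ _ = s≤s (ℕ.m∸n≤m m n)
  spec : length q ≡ k × (∀ i → i ℕ.< k → (coef (longDiv k (reverse f) gs) ∗ coef (1ℤ ∷ gs)) i ≡ rc f i)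
  spec = trans (cong (length ∘ longDiv k (reverse f)) tail-eq) (proj₁ (longDiv-spec k (reverse f) gs k≤)) , proj₂ (longDiv-spec k (reverse f) gs k≤)

 length-xⁿ-1 : ∀ n → length (xⁿ-1 (suc n)) ≡ suc (suc n)
 length-xⁿ-1 n = cong suc (trans (length-++ (replicate n 0ℤ)) (trans (cong (ℕ._+ 1) (length-replicate n)) (ℕ.+-comm n 1)))

 rc-xⁿ-1 : ∀ n → rc (xⁿ-1 (suc n)) ≋ E (suc n)
 rc-xⁿ-1 n i = trans (rc-∷ -[1+ 0 ] L i) (trans (cong₂ (λ x k → x + -[1+ 0 ] * δ k i) (top n i) (ℕ.suc-injective (length-xⁿ-1 n))) (lem (δ₀ i) (δ (suc n) i)))
  where
  L : Poly
  L = replicate n 0ℤ ++ 1ℤ ∷ []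
  lem : ∀ a b → a + - 1ℤ * b ≡ a - b
  lem = solve-∀
  lem′ : ∀ x y → x + 0ℤ * y ≡ x
  lem′ = solve-∀
  top : ∀ m → rc (replicate m 0ℤ ++ 1ℤ ∷ []) ≋ δ₀
  top zero zero = refl
  top zero (suc j) = refl
  top (suc m) j = trans (rc-∷ 0ℤ (replicate m 0ℤ ++ 1ℤ ∷ []) j) (trans (lem′ _ (δ (length (replicate m 0ℤ ++ 1ℤ ∷ [])) j)) (top m j))

 All-coef : ∀ {P : ℤ → Set} xs → (∀ i → i ℕ.< length xs → P (coef xs i)) → All P xs
 All-coef [] h = []
 All-coef (x ∷ xs) h = h 0 (s≤s z≤n) ∷ All-coef xs (λ i b → h (suc i) (s≤s b))

 coef-All : ∀ {P : ℤ → Set} xs → All P xs → ∀ i → i ℕ.< length xs → P (coef xs i)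
 coef-All (x ∷ xs) (p ∷ ps) zero h = p
 coef-All (x ∷ xs) (p ∷ ps) (suc i) (s≤s h) = coef-All xs ps i h

 All-reverse : ∀ {P : ℤ → Set} xs → All P xs → All P (reverse xs)
 All-reverse [] [] = []
 All-reverse {P} (x ∷ xs) (p ∷ ps) = subst (All P) (sym (unfold-reverse x xs)) (++⁺ (All-reverse xs ps) (p ∷ []))

 height : Poly → ℕ
 height f = foldr _⊔_ 0 (map ∣_∣ f)

 height-≤ : ∀ f B → (∀ i → i ℕ.< length f → ∣ rc f i ∣ ℕ.≤ B) → height f ℕ.≤ B
 height-≤ f B h = go f (subst (All (λ x → ∣ x ∣ ℕ.≤ B)) (reverse-involutive f) (All-reverse (reverse f) (All-coef (reverse f) (λ i b → h i (subst (i ℕ.<_) (length-reverse f) b)))))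
  where
  go : ∀ xs → All (λ x → ∣ x ∣ ℕ.≤ B) xs → height xs ℕ.≤ B
  go [] [] = z≤n
  go (x ∷ xs) (p ∷ ps) = ℕ.⊔-lub p (go xs ps)

 ≤-height : ∀ f i → i ℕ.< length f → ∣ rc f i ∣ ℕ.≤ height f
 ≤-height f i h = coef-All (reverse f) (All-reverse f (go f)) i (subst (i ℕ.<_) (sym (length-reverse f)) h)
  where
  weaken : ∀ {m n xs} → m ℕ.≤ n → All (λ x → ∣ x ∣ ℕ.≤ m) xs → All (λ x → ∣ x ∣ ℕ.≤ n) xs
  weaken h [] = []
  weaken h (p ∷ ps) = ℕ.≤-trans p h ∷ weaken h ps
  go : ∀ xs → All (λ x → ∣ x ∣ ℕ.≤ height xs) xs
  go [] = []
  go (x ∷ xs) = ℕ.m≤m⊔n ∣ x ∣ (height xs) ∷ weaken (ℕ.m≤n⊔m ∣ x ∣ (height xs)) (go xs)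

-- The table of cyclotomic polynomials as products over divisors.

module Cyclotomic where

 open import Defs
 open Series
 open PolyList
 open import Data.Nat using (pred)
 open import Data.Nat.Divisibility using (_∣_; _∣?_)
 open import Data.Integer using (_*_; +_; _+_; 0ℤ; 1ℤ)
 open import Data.Integer.Properties using (*-identityʳ)
 open import Algebra.Bundles using (CommutativeMonoid)
 open import Data.List using (List; []; _∷_; _++_; foldr; length; reverse)
 open import Data.List.Membership.Propositional using (_∈_)
 open import Data.List.Relation.Unary.Any using (here; there)
 open import Data.List.Relation.Unary.All as All using (All; []; _∷_)
 open import Data.List.Relation.Unary.All.Properties using (++⁺)
 open import Data.List.Relation.Unary.AllPairs using ([]; _∷_)
 open import Data.List.Relation.Unary.Unique.Propositional using (Unique)
 open import Data.Product using (∃₂)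
 open import Level using (0ℓ)

 prepend : ∀ {P : Set} → Dec P → Poly → List Poly → List Poly
 prepend (yes _) φ l = φ ∷ l
 prepend (no _) φ l = l

 divisorPolys : ℕ → List (ℕ × Poly) → List Poly
 divisorPolys m [] = []
 divisorPolys m ((d , φ) ∷ t) = prepend (d ∣? m) φ (divisorPolys m t)

 -- newΦ selects divisors with a where-bound function that has no name outside
 -- Defs. It is recovered by unification: the with-abstractions in
 -- newΦ-selected leave it applied to distinct variables.
 selected : ℕ → List (ℕ × Poly) → List (ℕ × Poly) → List Poly
 newΦ-selected : ∀ m d φ t → newΦ m ((d , φ) ∷ t) ≡ divMonic (xⁿ-1 m) (polyProd (prepend (d ∣? m) φ (selected m ((d , φ) ∷ t) t)))
 selected = _
 newΦ-selected m d φ t with d ∣? m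
 newΦ-selected m d φ t | no _ with (d , φ) ∷ t
 ... | p with foldr polyMul (+ 1 ∷ [])
 ... | w = refl
 newΦ-selected m d φ t | yes _ with (d , φ) ∷ t
 ... | p with foldr polyMul (+ 1 ∷ [])
 ... | w = refl

 selected-divisorPolys : ∀ m p t → selected m p t ≡ divisorPolys m t
 selected-divisorPolys m p [] = refl
 selected-divisorPolys m p ((d , φ) ∷ t) with d ∣? m
 ... | yes _ = cong (φ ∷_) (selected-divisorPolys m p t)
 ... | no _ = selected-divisorPolys m p t

 newΦ-divisors : ∀ m tbl → newΦ m tbl ≡ divMonic (xⁿ-1 m) (polyProd (divisorPolys m tbl))
 newΦ-divisors m tbl = cong (λ l → divMonic (xⁿ-1 m) (polyProd l)) (selected-divisorPolys m tbl tbl)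

 degree : Poly → ℕ
 degree f = pred (length f)

 Monic : Poly → Set
 Monic f = (∃₂ λ a g → f ≡ a ∷ g) × rc f 0 ≡ 1ℤ

 seriesProduct : List Poly → Series
 seriesProduct [] = δ₀
 seriesProduct (f ∷ fs) = rc f ∗ seriesProduct fs

 degreeSum : List Poly → ℕ
 degreeSum [] = 0
 degreeSum (f ∷ fs) = degree f ℕ.+ degreeSum fs

 polyProd-spec : ∀ fs → All Monic fs → Monic (polyProd fs) × (rc (polyProd fs) ≋ seriesProduct fs) × degree (polyProd fs) ≡ degreeSum fs
 polyProd-spec [] [] = ((+ 1 , [] , refl) , refl) , (λ { zero → refl ; (suc i) → refl }) , refl
 polyProd-spec (f ∷ fs) (((a , g , refl) , lead) ∷ ms) with polyProd fs | polyProd-spec fs ms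
 ... | b ∷ h | (_ , lead′) , ser , deg = (nonempty (polyMul (a ∷ g) (b ∷ h)) (proj₂ (rc-polyMul a g b h)) , trans (proj₁ (rc-polyMul a g b h) 0) (cong₂ _*_ lead lead′)) ,
  ≋-trans (proj₁ (rc-polyMul a g b h)) (∗-congˡ {rc (a ∷ g)} ser) , trans (cong pred (proj₂ (rc-polyMul a g b h))) (cong (length g ℕ.+_) deg)
  where
  nonempty : ∀ f {n} → length f ≡ suc n → ∃₂ λ a g → f ≡ a ∷ g
  nonempty (a ∷ g) _ = a , g , refl
 polyProd-spec (f ∷ fs) (_ ∷ ms) | [] | ((_ , _ , ()) , _) , _

 -- Instantiated twice: with series under `_∗_` for the product of the Φ_d, and with natural numbers
 -- under addition for the sum of their degrees.
 module TableProduct (M : CommutativeMonoid 0ℓ 0ℓ) where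

  open CommutativeMonoid M renaming (refl to ≈-refl; sym to ≈-sym; trans to ≈-trans)

  when : ∀ {P : Set} → Dec P → Carrier → Carrier
  when (yes _) x = x
  when (no _) x = ε

  ∏ : List ℕ → (ℕ → Carrier) → Carrier
  ∏ [] w = ε
  ∏ (d ∷ D) w = w d ∙ ∏ D w

  ∏-cong : ∀ D {w w′} → (∀ d → d ∈ D → w d ≈ w′ d) → ∏ D w ≈ ∏ D w′
  ∏-cong [] h = ≈-refl
  ∏-cong (d ∷ D) h = ∙-cong (h d (here refl)) (∏-cong D (λ e m → h e (there m)))

  ∏-ε : ∀ D → ∏ D (λ _ → ε) ≈ ε
  ∏-ε [] = ≈-refl
  ∏-ε (d ∷ D) = ≈-trans (identityˡ (∏ D (λ _ → ε))) (∏-ε D)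

  private
   interchange : ∀ a b c d → (a ∙ b) ∙ (c ∙ d) ≈ (a ∙ c) ∙ (b ∙ d)
   interchange a b c d = ≈-trans (assoc a b (c ∙ d)) (≈-trans (∙-congˡ (≈-trans (≈-sym (assoc b c d)) (≈-trans (∙-congʳ (comm b c)) (assoc c b d)))) (≈-sym (assoc a c (b ∙ d))))

  ∏-∙ : ∀ D w w′ → ∏ D (λ d → w d ∙ w′ d) ≈ ∏ D w ∙ ∏ D w′
  ∏-∙ [] w w′ = ≈-sym (identityˡ ε)
  ∏-∙ (d ∷ D) w w′ = ≈-trans (∙-congˡ (∏-∙ D w w′)) (interchange (w d) (w′ d) (∏ D w) (∏ D w′))

  ∏-pick-∉ : ∀ D (w : ℕ → Carrier) k → ¬ k ∈ D → ∏ D (λ d → when (k ℕ.≟ d) (w d)) ≈ ε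
  ∏-pick-∉ [] w k h = ≈-refl
  ∏-pick-∉ (d ∷ D) w k h with k ℕ.≟ d
  ... | yes refl = ⊥-elim (h (here refl))
  ... | no _ = ≈-trans (identityˡ _) (∏-pick-∉ D w k (λ m → h (there m)))

  ∏-pick-∈ : ∀ D (w : ℕ → Carrier) k → Unique D → k ∈ D → ∏ D (λ d → when (k ℕ.≟ d) (w d)) ≈ w k
  ∏-pick-∈ (d ∷ D) w k (d∉ ∷ u) m with k ℕ.≟ d
  ... | yes refl = ≈-trans (∙-congˡ (∏-pick-∉ D w d (λ m′ → All.lookup d∉ m′ refl))) (identityʳ (w d))
  ∏-pick-∈ (d ∷ D) w k (d∉ ∷ u) (here e) | no ¬e = ⊥-elim (¬e e)
  ∏-pick-∈ (d ∷ D) w k (d∉ ∷ u) (there m) | no _ = ≈-trans (identityˡ _) (∏-pick-∈ D w k u m)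

  table-product : ∀ n D (w v : ℕ → Carrier) → Unique D → (∀ d → d ∈ D → 1 ℕ.≤ d) →
   v 0 ≈ ε → (∀ k → suc k ℕ.< n → v (suc k) ≈ v k ∙ when (suc k ∣? n) (w (suc k))) →
   (∀ k → 1 ℕ.≤ k → k ℕ.< n → k ∣ n → k ∈ D) → (∀ d → d ∈ D → d ∣ n) →
   ∀ m → m ℕ.< n → v m ≈ ∏ D (λ d → when (d ℕ.≤? m) (w d))
  table-product n D w v u pos v0 vs only div zero m<n = ≈-trans v0 (≈-sym (≈-trans (∏-cong D none) (∏-ε D)))
   where
   none : ∀ d → d ∈ D → when (d ℕ.≤? 0) (w d) ≈ ε
   none d m with d ℕ.≤? 0
   ... | yes d≤0 = ⊥-elim (ℕ.<⇒≱ (pos d m) d≤0)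
   ... | no _ = ≈-refl
  table-product n D w v u pos v0 vs only div (suc m) m<n = ≈-trans (vs m m<n)
   (≈-trans (∙-cong (table-product n D w v u pos v0 vs only div m (ℕ.<-trans (ℕ.n<1+n m) m<n)) new)
    (≈-trans (≈-sym (∏-∙ D _ _)) (∏-cong D (λ d _ → merge d))))
   where
   new : when (suc m ∣? n) (w (suc m)) ≈ ∏ D (λ d → when (suc m ℕ.≟ d) (w d))
   new with suc m ∣? n
   ... | yes m∣n = ≈-sym (∏-pick-∈ D w (suc m) u (only (suc m) (s≤s z≤n) m<n m∣n))
   ... | no ¬m∣n = ≈-sym (∏-pick-∉ D w (suc m) (λ m∈D → ¬m∣n (div (suc m) m∈D)))
   merge : ∀ d → when (d ℕ.≤? m) (w d) ∙ when (suc m ℕ.≟ d) (w d) ≈ when (d ℕ.≤? suc m) (w d)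
   merge d with d ℕ.≤? m | suc m ℕ.≟ d | d ℕ.≤? suc m
   ... | yes d≤m | yes refl | _ = ⊥-elim (ℕ.<-irrefl refl d≤m)
   ... | yes _ | no _ | yes _ = identityʳ (w d)
   ... | yes d≤m | no _ | no ¬d = ⊥-elim (¬d (ℕ.m≤n⇒m≤1+n d≤m))
   ... | no _ | yes _ | yes _ = identityˡ (w d)
   ... | no _ | yes refl | no ¬d = ⊥-elim (¬d ℕ.≤-refl)
   ... | no ¬d | no ¬e | yes d≤ = ⊥-elim (¬d (ℕ.≤-pred (ℕ.≤∧≢⇒< d≤ (λ e → ¬e (sym e)))))
   ... | no _ | no _ | no _ = identityˡ ε

 divisorPolys-snoc : ∀ n t d φ → divisorPolys n (t ++ (d , φ) ∷ []) ≡ divisorPolys n t ++ prepend (d ∣? n) φ []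
 divisorPolys-snoc n [] d φ = refl
 divisorPolys-snoc n ((c , ψ) ∷ t) d φ with c ∣? n
 ... | yes _ = cong (ψ ∷_) (divisorPolys-snoc n t d φ)
 ... | no _ = divisorPolys-snoc n t d φ

 seriesProduct-snoc : ∀ fs φ → seriesProduct (fs ++ φ ∷ []) ≋ seriesProduct fs ∗ rc φ
 seriesProduct-snoc [] φ = ≋-trans (∗-comm (rc φ) δ₀) ≋-refl
 seriesProduct-snoc (f ∷ fs) φ = ≋-trans (∗-congˡ {rc f} (seriesProduct-snoc fs φ)) (≋-sym (∗-assoc (rc f) (seriesProduct fs) (rc φ)))

 degreeSum-snoc : ∀ fs φ → degreeSum (fs ++ φ ∷ []) ≡ degreeSum fs ℕ.+ degree φ
 degreeSum-snoc [] φ = ℕ.+-identityʳ (degree φ)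
 degreeSum-snoc (f ∷ fs) φ = trans (cong (degree f ℕ.+_) (degreeSum-snoc fs φ)) (sym (ℕ.+-assoc (degree f) (degreeSum fs) (degree φ)))

 divisorPolys-Monic : ∀ n t → All (λ e → Monic (proj₂ e)) t → All Monic (divisorPolys n t)
 divisorPolys-Monic n [] [] = []
 divisorPolys-Monic n ((d , φ) ∷ t) (m ∷ ms) with d ∣? n
 ... | yes _ = m ∷ divisorPolys-Monic n t ms
 ... | no _ = divisorPolys-Monic n t ms

 properDivisorPolys : ℕ → List Poly
 properDivisorPolys n = divisorPolys n (cycTable (pred n))

 private
  spec : ∀ n → All (λ e → Monic (proj₂ e)) (cycTable n) →
   length (cyclotomic (suc n)) ≡ suc (suc n ℕ.∸ degreeSum (properDivisorPolys (suc n))) ×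
   (∀ i → i ℕ.< suc (suc n ℕ.∸ degreeSum (properDivisorPolys (suc n))) → (rc (cyclotomic (suc n)) ∗ seriesProduct (properDivisorPolys (suc n))) i ≡ E (suc n) i)
  spec n ms with properDivisorPolys (suc n) | polyProd-spec (properDivisorPolys (suc n)) (divisorPolys-Monic (suc n) (cycTable n) ms) | newΦ-divisors (suc n) (cycTable n)
  ... | fs | ((a , g , eq) , lead) , ser , deg | new = subst (λ f → Goal f) (sym new) goal
   where
   Goal : Poly → Set
   Goal f = length f ≡ suc (suc n ℕ.∸ degreeSum fs) × (∀ i → i ℕ.< suc (suc n ℕ.∸ degreeSum fs) → (rc f ∗ seriesProduct fs) i ≡ E (suc n) i)
   len-eq : length (xⁿ-1 (suc n)) ℕ.∸ length (polyProd fs) ≡ suc n ℕ.∸ degreeSum fs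
   len-eq = trans (cong₂ ℕ._∸_ (length-xⁿ-1 n) (trans (cong length eq) (cong suc (trans (cong degree (sym eq)) deg)))) refl
   head : ∀ g → rc g 0 ≡ 1ℤ → ∃₂ λ x gs → reverse g ≡ x ∷ gs × x ≡ 1ℤ
   head g h with reverse g
   ... | x ∷ gs = x , gs , refl , h
   division = divMonic-spec (xⁿ-1 (suc n)) (polyProd fs) _ _ (proj₁ (proj₂ (proj₂ (head (polyProd fs) lead)))) (proj₂ (proj₂ (proj₂ (head (polyProd fs) lead)))) (subst (1 ℕ.≤_) (sym (length-xⁿ-1 n)) (s≤s z≤n))
   goal : Goal (divMonic (xⁿ-1 (suc n)) (polyProd fs))
   goal = trans (proj₁ division) (cong suc len-eq) , λ i i< → trans (∗-congˡ {rc (divMonic (xⁿ-1 (suc n)) (polyProd fs))} (≋-sym ser) i)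
    (trans (proj₂ division i (subst (i ℕ.<_) (cong suc (sym len-eq)) i<)) (rc-xⁿ-1 n i))

  seriesProduct-0 : ∀ fs → All Monic fs → seriesProduct fs 0 ≡ 1ℤ
  seriesProduct-0 [] [] = refl
  seriesProduct-0 (f ∷ fs) ((_ , h) ∷ ms) = cong₂ _*_ h (seriesProduct-0 fs ms)

  table-Monic : ∀ n → All (λ e → Monic (proj₂ e)) (cycTable n)
  table-Monic zero = []
  table-Monic (suc n) = ++⁺ (table-Monic n) (monic ∷ [])
   where
   monic : Monic (cyclotomic (suc n))
   monic with spec n (table-Monic n)
   ... | len , ser with cyclotomic (suc n) | len
   ... | a ∷ f | _ = (a , f , refl) , trans (sym (*-identityʳ (rc (a ∷ f) 0))) (trans (cong (rc (a ∷ f) 0 *_) (sym (seriesProduct-0 (properDivisorPolys (suc n)) (divisorPolys-Monic (suc n) (cycTable n) (table-Monic n))))) (ser 0 (s≤s z≤n)))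

 length-cyclotomic : ∀ n → length (cyclotomic (suc n)) ≡ suc (suc n ℕ.∸ degreeSum (properDivisorPolys (suc n)))
 length-cyclotomic n = proj₁ (spec n (table-Monic n))

 -- On the length of the quotient, P times Φ and P times F are both the reversal of x^(n+1) - 1, and
 -- P has leading coefficient 1, so it cancels.
 cyclotomic-below : ∀ n P F → seriesProduct (properDivisorPolys (suc n)) ≋ P → P ∗ F ≋ E (suc n) →
  ∀ i → i ℕ.< length (cyclotomic (suc n)) → rc (cyclotomic (suc n)) i ≡ F i
 cyclotomic-below n P F hP hF i i< = ∗-cancel-below (length (cyclotomic (suc n))) P (rc (cyclotomic (suc n))) F
  (trans (sym (hP 0)) (seriesProduct-0 (properDivisorPolys (suc n)) (divisorPolys-Monic (suc n) (cycTable n) (table-Monic n))))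
  (λ j j< → trans (∗-comm P (rc (cyclotomic (suc n))) j) (trans (∗-congˡ {rc (cyclotomic (suc n))} (≋-sym hP) j)
   (trans (proj₂ (spec n (table-Monic n)) j (subst (j ℕ.<_) (length-cyclotomic n) j<)) (sym (hF j))))) i i<

 cyclotomic-exact : ∀ n P F → seriesProduct (properDivisorPolys (suc n)) ≋ P → P ∗ F ≋ E (suc n) →
  (∀ i → length (cyclotomic (suc n)) ℕ.≤ i → F i ≡ 0ℤ) → rc (cyclotomic (suc n)) ≋ F
 cyclotomic-exact n P F hP hF z i with i ℕ.<? length (cyclotomic (suc n))
 ... | yes i< = cyclotomic-below n P F hP hF i i<
 ... | no i≮ = trans (coef-beyond (reverse (cyclotomic (suc n))) i (subst (ℕ._≤ i) (sym (length-reverse (cyclotomic (suc n)))) (ℕ.≮⇒≥ i≮))) (sym (z i (ℕ.≮⇒≥ i≮)))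
  where open import Data.List.Properties using (length-reverse)

 module _ (n : ℕ) (D : List ℕ) (unique : Unique D) (positive : ∀ d → d ∈ D → 1 ℕ.≤ d)
  (complete : ∀ k → 1 ℕ.≤ k → k ℕ.< suc n → k ∣ suc n → k ∈ D) (sound : ∀ d → d ∈ D → d ∣ suc n) (below : ∀ d → d ∈ D → d ℕ.≤ n) where

  private
   module TS = TableProduct ∗-commutativeMonoid
   module TD = TableProduct ℕ.+-0-commutativeMonoid

  divisors-series : seriesProduct (properDivisorPolys (suc n)) ≋ TS.∏ D (λ d → rc (cyclotomic d))
  divisors-series = ≋-trans (TS.table-product (suc n) D (λ d → rc (cyclotomic d)) (λ k → seriesProduct (divisorPolys (suc n) (cycTable k))) unique positive ≋-refl step complete sound n ℕ.≤-refl) (TS.∏-cong D all)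
   where
   step : ∀ k → suc k ℕ.< suc n → seriesProduct (divisorPolys (suc n) (cycTable (suc k))) ≋ seriesProduct (divisorPolys (suc n) (cycTable k)) ∗ TS.when (suc k ∣? suc n) (rc (cyclotomic (suc k)))
   step k _ rewrite divisorPolys-snoc (suc n) (cycTable k) (suc k) (newΦ (suc k) (cycTable k)) with suc k ∣? suc n
   ... | yes _ = seriesProduct-snoc (divisorPolys (suc n) (cycTable k)) (cyclotomic (suc k))
   ... | no _ = ≋-trans (λ i → cong (λ l → seriesProduct l i) (++-identityʳ (divisorPolys (suc n) (cycTable k)))) (≋-trans (≋-sym (δ-∗ 0 (seriesProduct (divisorPolys (suc n) (cycTable k))))) (∗-comm δ₀ (seriesProduct (divisorPolys (suc n) (cycTable k)))))
    where open import Data.List.Properties using (++-identityʳ)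
   all : ∀ d → d ∈ D → TS.when (d ℕ.≤? n) (rc (cyclotomic d)) ≋ rc (cyclotomic d)
   all d m with d ℕ.≤? n
   ... | yes _ = ≋-refl
   ... | no ¬d = ⊥-elim (¬d (below d m))

  divisors-degree : degreeSum (properDivisorPolys (suc n)) ≡ TD.∏ D (λ d → degree (cyclotomic d))
  divisors-degree = trans (TD.table-product (suc n) D (λ d → degree (cyclotomic d)) (λ k → degreeSum (divisorPolys (suc n) (cycTable k))) unique positive refl step complete sound n ℕ.≤-refl) (TD.∏-cong D all)
   where
   step : ∀ k → suc k ℕ.< suc n → degreeSum (divisorPolys (suc n) (cycTable (suc k))) ≡ degreeSum (divisorPolys (suc n) (cycTable k)) ℕ.+ TD.when (suc k ∣? suc n) (degree (cyclotomic (suc k)))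
   step k _ rewrite divisorPolys-snoc (suc n) (cycTable k) (suc k) (newΦ (suc k) (cycTable k)) with suc k ∣? suc n
   ... | yes _ = degreeSum-snoc (divisorPolys (suc n) (cycTable k)) (cyclotomic (suc k))
   ... | no _ = trans (cong degreeSum (++-identityʳ (divisorPolys (suc n) (cycTable k)))) (sym (ℕ.+-identityʳ _))
    where open import Data.List.Properties using (++-identityʳ)
   all : ∀ d → d ∈ D → TD.when (d ℕ.≤? n) (degree (cyclotomic d)) ≡ degree (cyclotomic d)
   all d m with d ℕ.≤? n
   ... | yes _ = refl
   ... | no ¬d = ⊥-elim (¬d (below d m))

-- The coefficients of Φ_pq.

module Binary where

 open Series
 open Periodic using (module Residues)
 open import Data.Nat using (_%_)
 open import Data.Nat.Divisibility using (_∣_; _∣?_; divides; ∣⇒≤; ∣m+n∣m⇒∣n; _∣0; ∣-refl; ∣m∣n⇒∣m+n)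
 open import Data.Integer using (_+_; _*_; _-_; -_; 0ℤ; 1ℤ)
 open import Data.Integer.Properties
 open import Data.Integer.Tactic.RingSolver using (solve-∀)
 open import Algebra.Solver.CommutativeMonoid ∗-commutativeMonoid using (solve; _⊕_; _⊜_)

 δ-≟ : ∀ k n → δ k n ≡ [ n ℕ.≟ k ]
 δ-≟ zero zero = refl
 δ-≟ zero (suc n) = refl
 δ-≟ (suc k) zero = refl
 δ-≟ (suc k) (suc n) = trans (δ-≟ k n) ([]-cong (n ℕ.≟ k) (suc n ℕ.≟ suc k) (cong suc) ℕ.suc-injective)

 box : ℕ → Series
 box m n = [ n ℕ.<? m ]

 E-box : ∀ m → E 1 ∗ box m ≋ E m
 E-box zero n = trans (E-∗ 1 (box 0) n) (trans (cong₂ _-_ ([]-no (n ℕ.<? 0) (λ ())) (small n)) (sym (+-inverseʳ (δ₀ n))))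
  where
  small : ∀ n → shift 1 (box 0) n ≡ 0ℤ
  small zero = refl
  small (suc n) = []-no (n ℕ.<? 0) (λ ())
 E-box (suc m) zero = trans (E-∗ 1 (box (suc m)) 0) refl
 E-box (suc m) (suc n) = trans (E-∗ 1 (box (suc m)) (suc n)) (trans (go (suc n ℕ.<? suc m) (n ℕ.<? suc m) (n ℕ.≟ m)) (cong (λ t → 0ℤ - t) (sym (δ-≟ m n))))
  where
  go : (a : Dec (suc n ℕ.< suc m)) (b : Dec (n ℕ.< suc m)) (c : Dec (n ≡ m)) → [ a ] - [ b ] ≡ 0ℤ - [ c ]
  go (yes a) _ (yes refl) = ⊥-elim (ℕ.<-irrefl refl a)
  go (yes a) (no ¬b) (no _) = ⊥-elim (¬b (ℕ.<-trans (ℕ.n<1+n n) a))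
  go (yes _) (yes _) (no _) = refl
  go (no _) (yes _) (yes _) = refl
  go (no _) (no ¬b) (yes refl) = ⊥-elim (¬b ℕ.≤-refl)
  go (no ¬a) (yes b) (no ¬c) = ⊥-elim (¬a (s≤s (ℕ.≤∧≢⇒< (ℕ.≤-pred b) ¬c)))
  go (no _) (no _) (no _) = refl

 Σ-∗ : ∀ m (f : ℕ → Series) h n → ((λ i → Σ m (λ b → f b i)) ∗ h) n ≡ Σ m (λ b → (f b ∗ h) n)
 Σ-∗ zero f h n = zero-∗ h n
  where
  zero-∗ : ∀ h n → ((λ _ → 0ℤ) ∗ h) n ≡ 0ℤ
  zero-∗ h zero = refl
  zero-∗ h (suc n) = trans (+-identityˡ _) (zero-∗ h n)
 Σ-∗ (suc m) f h n = trans (∗-distribʳ (λ i → Σ m (λ b → f b i)) (f m) h n) (cong (_+ (f m ∗ h) n) (Σ-∗ m f h n))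

 comb : ℕ → ℕ → Series
 comb q m n = Σ m (λ b → δ (b ℕ.* q) n)

 E-comb : ∀ q m → E q ∗ comb q m ≋ E (m ℕ.* q)
 E-comb q zero n = trans (∗-comm (E q) (comb q 0) n) (trans (Σ-∗ 0 (λ b → δ (b ℕ.* q)) (E q) n) (sym (+-inverseʳ (δ₀ n))))
 E-comb q (suc m) n = begin
  (E q ∗ comb q (suc m)) n
   ≡⟨ trans (∗-comm (E q) (comb q (suc m)) n) (trans (∗-distribʳ (comb q m) (δ (m ℕ.* q)) (E q) n) (cong₂ _+_ (∗-comm (comb q m) (E q) n) (∗-comm (δ (m ℕ.* q)) (E q) n))) ⟩
  (E q ∗ comb q m) n + (E q ∗ δ (m ℕ.* q)) n
   ≡⟨ cong₂ _+_ (E-comb q m n) (trans (E-∗ q (δ (m ℕ.* q)) n) (cong (λ t → δ (m ℕ.* q) n - t) (shift-+ q (m ℕ.* q) δ₀ n))) ⟩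
  δ₀ n - δ (m ℕ.* q) n + (δ (m ℕ.* q) n - δ (q ℕ.+ m ℕ.* q) n)
   ≡⟨ lem (δ₀ n) (δ (m ℕ.* q) n) (δ (q ℕ.+ m ℕ.* q) n) ⟩
  E (suc m ℕ.* q) n ∎
  where
  open ≡-Reasoning
  lem : ∀ a b c → a - b + (b - c) ≡ a - c
  lem = solve-∀

 -- Coefficients of Φ_pq, for λ inverse to q modulo p.
 module Coefficients (p′ q l : ℕ) (1≤q : 1 ℕ.≤ q) (l<p : l ℕ.< suc p′) (1≤l : 1 ℕ.≤ l)
  (ql≈1 : Residues._≈_ p′ (q ℕ.* l) 1) where

  open Residues p′ public using (_≈_; ≈-by; ≈-sym; ≈-trans; ≈-reflexive; ≈-*ˡ; ≈-*ʳ; ≈-kN) renaming (N to p)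

  l′ : ℕ
  l′ = p ℕ.∸ l

  l+l′ : l ℕ.+ l′ ≡ p
  l+l′ = ℕ.m+[n∸m]≡n (ℕ.<⇒≤ l<p)

  ≈⇒∣ : ∀ {a b} → a ℕ.≤ b → a ≈ b → p ∣ b ℕ.∸ a
  ≈⇒∣ {a} {b} a≤b (≈-by h) = divides (b ℕ./ p ℕ.∸ a ℕ./ p) (begin
   b ℕ.∸ a ≡⟨ cong₂ ℕ._∸_ (DM.m≡m%n+[m/n]*n b p) (trans (DM.m≡m%n+[m/n]*n a p) (cong (ℕ._+ a ℕ./ p ℕ.* p) h)) ⟩
   (b % p ℕ.+ b ℕ./ p ℕ.* p) ℕ.∸ (b % p ℕ.+ a ℕ./ p ℕ.* p) ≡⟨ ℕ.[m+n]∸[m+o]≡n∸o (b % p) _ _ ⟩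
   b ℕ./ p ℕ.* p ℕ.∸ a ℕ./ p ℕ.* p ≡⟨ ℕ.*-distribʳ-∸ p (b ℕ./ p) (a ℕ./ p) ⟨
   (b ℕ./ p ℕ.∸ a ℕ./ p) ℕ.* p ∎)
   where open ≡-Reasoning

  ∣⇒≈ : ∀ {a b} → a ℕ.≤ b → p ∣ b ℕ.∸ a → a ≈ b
  ∣⇒≈ {a} {b} a≤b (divides k eq) = ≈-trans (≈-sym (≈-kN a k)) (≈-reflexive (trans (cong (a ℕ.+_) (sym eq)) (ℕ.m+[n∸m]≡n a≤b)))

  ≈⇒≡ : ∀ {a b} → a ℕ.< p → b ℕ.< p → a ≈ b → a ≡ b
  ≈⇒≡ a< b< (≈-by h) = trans (sym (DM.m<n⇒m%n≡m a<)) (trans h (DM.m<n⇒m%n≡m b<))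

  -- The residue b with k ≡ b q modulo p.
  β : ℕ → ℕ
  β k = (k ℕ.* l) % p

  β<p : ∀ k → β k ℕ.< p
  β<p k = DM.m%n<n (k ℕ.* l) p

  β≈ : ∀ k → β k ≈ k ℕ.* l
  β≈ k = ≈-by (DM.m%n%n≡m%n (k ℕ.* l) p)

  β*q≈ : ∀ k → β k ℕ.* q ≈ k
  β*q≈ k = ≈-trans (≈-*ʳ q (β≈ k)) (≈-trans (≈-reflexive (trans (ℕ.*-assoc k l q) (cong (k ℕ.*_) (ℕ.*-comm l q)))) (≈-trans (≈-*ˡ k ql≈1) (≈-reflexive (ℕ.*-identityʳ k))))

  β-unique : ∀ k b → b ℕ.< p → b ℕ.* q ≈ k → b ≡ β k
  β-unique k b b<p h = ≈⇒≡ b<p (β<p k) (≈-trans (≈-trans (≈-reflexive (sym (ℕ.*-identityʳ b))) (≈-trans (≈-*ˡ b (≈-sym ql≈1)) (≈-trans (≈-reflexive (sym (ℕ.*-assoc b q l))) (≈-*ʳ l h)))) (≈-sym (β≈ k)))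

  multiples : Series
  multiples n = [ p ∣? n ]

  E-multiples : E p ∗ multiples ≋ δ₀
  E-multiples n = trans (E-∗ p multiples n) (go n (n ℕ.<? p))
   where
   go : ∀ n → Dec (n ℕ.< p) → multiples n - shift p multiples n ≡ δ₀ n
   go zero _ = cong (_- 0ℤ) ([]-yes (p ∣? 0) (p ∣0))
   go (suc n) (yes n<p) = cong₂ _-_ ([]-no (p ∣? suc n) (λ d → ℕ.<⇒≱ n<p (∣⇒≤ d))) (shift-< p multiples (suc n) n<p)
   go (suc n) (no n≮p) = i≡j⇒i-j≡0 (trans ([]-cong (p ∣? suc n) (p ∣? (suc n ℕ.∸ p))
     (λ d → ∣m+n∣m⇒∣n (subst (p ∣_) (sym (ℕ.m+[n∸m]≡n (ℕ.≮⇒≥ n≮p))) d) ∣-refl)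
     (λ d → subst (p ∣_) (ℕ.m+[n∸m]≡n (ℕ.≮⇒≥ n≮p)) (∣m∣n⇒∣m+n ∣-refl d))) (sym (shift-∸ p multiples (suc n) (ℕ.≮⇒≥ n≮p))))

  -- `S` is (1 - x^(pq)) / ((1 - x^p) (1 - x^q)), and `c` = (1 - x) S is the expression of Φ_pq
  -- through such binomials.
  S c : Series
  S = comb q p ∗ multiples
  c = E 1 ∗ S

  E-E-c : E p ∗ (E q ∗ c) ≋ E 1 ∗ E (p ℕ.* q)
  E-E-c = ≋-trans (solve 5 (λ a b x y z → a ⊕ (b ⊕ (x ⊕ (y ⊕ z))) ⊜ x ⊕ ((b ⊕ y) ⊕ (a ⊕ z))) ≋-refl (E p) (E q) (E 1) (comb q p) multiples)
   (∗-congˡ {E 1} (≋-trans (∗-cong (E-comb q p) E-multiples) (≋-trans (∗-comm (E (p ℕ.* q)) δ₀) (δ-∗ 0 (E (p ℕ.* q))))))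

  -- Among the b < p only β k leaves k - b q divisible by p, so at most one summand contributes. `S`
  -- is thus the indicator of the numerical semigroup generated by p and q.
  S-value : ∀ k → S k ≡ [ β k ℕ.* q ℕ.≤? k ]
  S-value k = begin
   S k ≡⟨ trans (Σ-∗ p (λ b → δ (b ℕ.* q)) multiples k) (Σ-cong p (λ b _ → δ-∗ (b ℕ.* q) multiples k)) ⟩
   Σ p (λ b → shift (b ℕ.* q) multiples k) ≡⟨ Σ-cong p (λ b b<p → term b b<p (b ℕ.* q ℕ.≤? k) (b ℕ.≟ β k)) ⟩
   Σ p (λ b → [ b ℕ.≟ β k ] * [ b ℕ.* q ℕ.≤? k ]) ≡⟨ Σ-single p (β k) (λ b → [ b ℕ.* q ℕ.≤? k ]) (β<p k) ⟩
   [ β k ℕ.* q ℕ.≤? k ] ∎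
   where
   open ≡-Reasoning
   term : ∀ b → b ℕ.< p → (x : Dec (b ℕ.* q ℕ.≤ k)) (y : Dec (b ≡ β k)) → shift (b ℕ.* q) multiples k ≡ [ y ] * [ x ]
   term b b<p (no ¬x) y = trans (shift-< (b ℕ.* q) multiples k (ℕ.≰⇒> ¬x)) (sym (*-zeroʳ [ y ]))
   term b b<p (yes x) (yes refl) = trans (shift-∸ (b ℕ.* q) multiples k x) ([]-yes (p ∣? (k ℕ.∸ b ℕ.* q)) (≈⇒∣ x (β*q≈ k)))
   term b b<p (yes x) (no ¬y) = trans (shift-∸ (b ℕ.* q) multiples k x) ([]-no (p ∣? (k ℕ.∸ b ℕ.* q)) (λ d → ¬y (β-unique k b b<p (∣⇒≈ x d))))

  c-suc : ∀ m → c (suc m) ≡ S (suc m) - S m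
  c-suc m = E-∗ 1 S (suc m)

  c-zero : c 0 ≡ S 0
  c-zero = trans (E-∗ 1 S 0) (+-identityʳ (S 0))

  private
   β-pred : ∀ m → β m ℕ.+ l ≈ β (suc m)
   β-pred m = ≈-by (trans (DM.%-distribˡ-+ (β m) l p) (trans (cong (λ t → (t ℕ.+ l % p) % p) (DM.m%n%n≡m%n (m ℕ.* l) p))
    (trans (sym (DM.%-distribˡ-+ (m ℕ.* l) l p)) (trans (cong (_% p) (ℕ.+-comm (m ℕ.* l) l)) (sym (DM.m%n%n≡m%n (suc m ℕ.* l) p))))))

   +-cancel-≈ : ∀ {a b} → a ℕ.< p → b ℕ.< p → a ℕ.+ l ≈ b ℕ.+ l → a ≡ b
   +-cancel-≈ {a} {b} a< b< h = ≈⇒≡ a< b< (≈-trans (≈-sym (≈-kN a 1)) (≈-trans (≈-reflexive (up a)) (≈-trans (shiftʳ h) (≈-trans (≈-reflexive (sym (up b))) (≈-kN b 1)))))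
    where
    up : ∀ a → a ℕ.+ 1 ℕ.* p ≡ a ℕ.+ l ℕ.+ l′
    up a = trans (cong (a ℕ.+_) (trans (ℕ.*-identityˡ p) (sym l+l′))) (sym (ℕ.+-assoc a l l′))
    shiftʳ : ∀ {x y} → x ≈ y → x ℕ.+ l′ ≈ y ℕ.+ l′
    shiftʳ {x} {y} (≈-by e) = ≈-by (trans (DM.%-distribˡ-+ x l′ p) (trans (cong (λ t → (t ℕ.+ l′ % p) % p) e) (sym (DM.%-distribˡ-+ y l′ p))))

   β-low : ∀ m → β (suc m) ℕ.< l → β m ≡ β (suc m) ℕ.+ l′
   β-low m b<l = +-cancel-≈ (β<p m) (subst (β (suc m) ℕ.+ l′ ℕ.<_) l+l′ (ℕ.+-monoˡ-< l′ b<l))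
    (≈-trans (β-pred m) (≈-trans (≈-sym (≈-kN (β (suc m)) 1)) (≈-reflexive (trans (cong (β (suc m) ℕ.+_) (trans (ℕ.*-identityˡ p) (trans (sym l+l′) (ℕ.+-comm l l′)))) (sym (ℕ.+-assoc (β (suc m)) l′ l))))))

   β-high : ∀ m → l ℕ.≤ β (suc m) → β m ≡ β (suc m) ℕ.∸ l
   β-high m l≤b = +-cancel-≈ (β<p m) (ℕ.≤-<-trans (ℕ.m∸n≤m (β (suc m)) l) (β<p (suc m)))
    (≈-trans (β-pred m) (≈-reflexive (sym (ℕ.m∸n+n≡m l≤b))))

  -- Going from k to k - 1 lowers β by l modulo p. For β k < l it wraps to β k + l′, so c k is the
  -- difference of the indicators of β q ≤ k and (β + l′) q ≤ k - 1. For larger β k there is no wrap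
  -- and the order of the two thresholds is reversed, which gives the sign in `c-high`.
  c-low : ∀ k → β k ℕ.< l → c k ≡ [ β k ℕ.* q ℕ.≤? k ] * [ k ℕ.≤? (β k ℕ.+ l′) ℕ.* q ]
  c-low zero b<l = trans c-zero (trans (S-value 0) (sym (trans (cong ([ β 0 ℕ.* q ℕ.≤? 0 ] *_) ([]-yes (0 ℕ.≤? (β 0 ℕ.+ l′) ℕ.* q) z≤n)) (*-identityʳ _))))
  c-low (suc m) b<l = trans (c-suc m) (trans (cong₂ _-_ (S-value (suc m)) (trans (S-value m) (cong (λ t → [ t ℕ.* q ℕ.≤? m ]) (β-low m b<l))))
   (go (b ℕ.* q ℕ.≤? suc m) ((b ℕ.+ l′) ℕ.* q ℕ.≤? m) (suc m ℕ.≤? (b ℕ.+ l′) ℕ.* q)))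
   where
   b = β (suc m)
   go : (x : Dec (b ℕ.* q ℕ.≤ suc m)) (y : Dec ((b ℕ.+ l′) ℕ.* q ℕ.≤ m)) (z : Dec (suc m ℕ.≤ (b ℕ.+ l′) ℕ.* q)) → [ x ] - [ y ] ≡ [ x ] * [ z ]
   go x (yes y) (yes z) = ⊥-elim (ℕ.<⇒≱ z y)
   go x (no ¬y) (no ¬z) = ⊥-elim (¬z (ℕ.≰⇒> ¬y))
   go (yes _) (yes _) (no _) = refl
   go (yes _) (no _) (yes _) = refl
   go (no _) (no _) (yes _) = refl
   go (no ¬x) (yes y) (no _) = ⊥-elim (¬x (ℕ.≤-trans (ℕ.*-monoˡ-≤ q (ℕ.m≤m+n b l′)) (ℕ.m≤n⇒m≤1+n y)))

  c-high : ∀ k → l ℕ.≤ β k → c k ≡ - ([ (β k ℕ.∸ l) ℕ.* q ℕ.<? k ] * [ k ℕ.<? β k ℕ.* q ])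
  c-high zero l≤b = ⊥-elim (ℕ.<⇒≱ 1≤l l≤b)
  c-high (suc m) l≤b = trans (c-suc m) (trans (cong₂ _-_ (S-value (suc m)) (trans (S-value m) (cong (λ t → [ t ℕ.* q ℕ.≤? m ]) (β-high m l≤b))))
   (go (b ℕ.* q ℕ.≤? suc m) ((b ℕ.∸ l) ℕ.* q ℕ.≤? m) ((b ℕ.∸ l) ℕ.* q ℕ.<? suc m) (suc m ℕ.<? b ℕ.* q)))
   where
   b = β (suc m)
   b-l<b : (b ℕ.∸ l) ℕ.* q ℕ.< b ℕ.* q
   b-l<b = ℕ.*-monoˡ-< q {{ℕ.>-nonZero 1≤q}} (ℕ.∸-monoʳ-< 1≤l l≤b)
   go : (x : Dec (b ℕ.* q ℕ.≤ suc m)) (y : Dec ((b ℕ.∸ l) ℕ.* q ℕ.≤ m)) (z : Dec ((b ℕ.∸ l) ℕ.* q ℕ.< suc m)) (w : Dec (suc m ℕ.< b ℕ.* q)) → [ x ] - [ y ] ≡ - ([ z ] * [ w ])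
   go (yes x) _ _ (yes w) = ⊥-elim (ℕ.<⇒≱ w x)
   go (no ¬x) _ _ (no ¬w) = ⊥-elim (¬w (ℕ.≰⇒> ¬x))
   go _ (yes y) (no ¬z) _ = ⊥-elim (¬z (s≤s y))
   go _ (no ¬y) (yes z) _ = ⊥-elim (¬y (ℕ.≤-pred z))
   go (yes _) (yes _) (yes _) (no _) = refl
   go (yes x) (no ¬y) (no _) (no _) = ⊥-elim (¬y (ℕ.≤-pred (ℕ.<-≤-trans b-l<b x)))
   go (no _) (yes _) (yes _) (yes _) = refl
   go (no _) (no _) (no _) (yes _) = refl

  -- Every number from (p - 1) (q - 1) on is a combination of p and q.
  S-large : ∀ k → p′ ℕ.* (q ℕ.∸ 1) ℕ.≤ k → S k ≡ 1ℤ
  S-large k h = trans (S-value k) ([]-yes (β k ℕ.* q ℕ.≤? k) (ℕ.≮⇒≥ λ k<bq → ℕ.<-irrefl refl (begin-strict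
   β k ℕ.* q ≤⟨ ℕ.*-monoˡ-≤ q (ℕ.≤-pred (β<p k)) ⟩
   p′ ℕ.* q ≡⟨ cong (p′ ℕ.*_) (sym (ℕ.m+[n∸m]≡n 1≤q)) ⟩
   p′ ℕ.* (1 ℕ.+ (q ℕ.∸ 1)) ≡⟨ ℕ.*-distribˡ-+ p′ 1 (q ℕ.∸ 1) ⟩
   p′ ℕ.* 1 ℕ.+ p′ ℕ.* (q ℕ.∸ 1) ≤⟨ ℕ.+-mono-≤ (ℕ.≤-reflexive (ℕ.*-identityʳ p′)) h ⟩
   p′ ℕ.+ k <⟨ ℕ.+-monoˡ-< k (ℕ.n<1+n p′) ⟩
   p ℕ.+ k ≤⟨ ℕ.+-monoˡ-≤ k (∣⇒≤ {{ℕ.>-nonZero (ℕ.m<n⇒0<n∸m k<bq)}} (≈⇒∣ (ℕ.<⇒≤ k<bq) (≈-sym (β*q≈ k)))) ⟩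
   (β k ℕ.* q ℕ.∸ k) ℕ.+ k ≡⟨ ℕ.m∸n+n≡m (ℕ.<⇒≤ k<bq) ⟩
   β k ℕ.* q ∎)))
   where open ℕ.≤-Reasoning

  c-beyond : ∀ k → p′ ℕ.* (q ℕ.∸ 1) ℕ.< k → c k ≡ 0ℤ
  c-beyond (suc m) h = trans (c-suc m) (cong₂ _-_ (S-large (suc m) (ℕ.<⇒≤ h)) (S-large m (ℕ.≤-pred h)))

-- Proper divisors of pqr, and Φ_pqr as Φ_pq(x^r) / Φ_pq(x).

module Ternary where

 open import Defs
 open Series
 open PolyList
 open Cyclotomic
 open Binary
 open NatLog using (prime≥2)
 open Periodic using (module Residues)
 open import Data.Nat using (_%_; _/_)
 open import Data.Nat.Divisibility using (_∣_; _∣?_; divides; m∣m*n; n∣m*n; *-cancelˡ-∣; 1∣_)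
 open import Data.Nat.Coprimality using (coprime-divisor) renaming (sym to coprime-sym)
 open import Data.Nat.Primality using (Prime; prime⇒irreducible; prime⇒nonZero)
 open import Data.Integer using (_+_; _*_; _-_; -_; 0ℤ)
 open import Data.Integer.Properties
 open import Data.Integer.Tactic.RingSolver using (solve-∀)
 open import Data.List using (List; []; _∷_; length)
 open import Data.List.Membership.Propositional using (_∈_)
 open import Data.List.Relation.Unary.Any using (here; there)
 open import Data.List.Relation.Unary.All using ([]; _∷_)
 open import Data.List.Relation.Unary.AllPairs using ([]; _∷_)
 open import Data.List.Relation.Unary.Unique.Propositional using (Unique)
 open import Algebra.Solver.CommutativeMonoid ∗-commutativeMonoid using (solve; _⊕_; _⊜_)

 rc-1 : rc (cyclotomic 1) ≋ E 1
 rc-1 = cyclotomic-exact 0 δ₀ (E 1) ≋-refl (δ-∗ 0 (E 1)) (λ { (suc (suc i)) _ → refl ; (suc zero) (s≤s ()) })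

 ∣prime : ∀ {p k} → Prime p → k ∣ p → k ≡ 1 ⊎ k ≡ p
 ∣prime pp d = prime⇒irreducible pp d

 prime-∤ : ∀ {p q} → Prime p → Prime q → p ℕ.< q → ¬ p ∣ q
 prime-∤ pp qp p<q d with ∣prime qp d
 ... | inj₁ refl = ℕ.<-irrefl refl (prime≥2 pp)
 ... | inj₂ refl = ℕ.<-irrefl refl p<q

 ∣prime* : ∀ {p} k m → Prime p → k ∣ p ℕ.* m → k ∣ m ⊎ ∃ λ k′ → k ≡ p ℕ.* k′ × k′ ∣ m
 ∣prime* {p} k m pp d with p ∣? k
 ... | yes (divides k′ e) = inj₂ (k′ , k≡ , *-cancelˡ-∣ p {{prime⇒nonZero pp}} (subst (_∣ p ℕ.* m) k≡ d))
  where
  k≡ = trans e (ℕ.*-comm k′ p)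
 ... | no ¬d = inj₁ (coprime-divisor (λ { (i∣k , i∣p) → go i∣k i∣p (∣prime pp i∣p) }) d)
  where
  go : ∀ {i} → i ∣ k → i ∣ p → i ≡ 1 ⊎ i ≡ p → i ≡ 1
  go _ _ (inj₁ e) = e
  go i∣k _ (inj₂ refl) = ⊥-elim (¬d i∣k)

 below-multiple : ∀ d e n → 1 ℕ.≤ d → 2 ℕ.≤ e → suc n ≡ d ℕ.* e → d ℕ.≤ n
 below-multiple d e n 1≤d 2≤e eq = ℕ.≤-pred (subst (d ℕ.<_) (sym eq) (ℕ.m<m*n d e {{ℕ.>-nonZero 1≤d}} 2≤e))

 module PrimeIndex (p′ : ℕ) (pp : Prime (suc p′)) where

  private
   p = suc p′
   D : List ℕ
   D = 1 ∷ []

   complete : ∀ k → 1 ℕ.≤ k → k ℕ.< p → k ∣ p → k ∈ D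
   complete k _ k<p d with ∣prime pp d
   ... | inj₁ refl = here refl
   ... | inj₂ refl = ⊥-elim (ℕ.<-irrefl refl k<p)

   positive : ∀ d → d ∈ D → 1 ℕ.≤ d
   positive d (here refl) = s≤s z≤n

   sound : ∀ d → d ∈ D → d ∣ p
   sound d (here refl) = 1∣ p

   below : ∀ d → d ∈ D → d ℕ.≤ p′
   below d (here refl) = ℕ.≤-pred (prime≥2 pp)

   ser : seriesProduct (properDivisorPolys p) ≋ E 1
   ser = ≋-trans (divisors-series p′ D ([] ∷ []) positive complete sound below) (≋-trans (∗-comm (rc (cyclotomic 1)) δ₀) (≋-trans (δ-∗ 0 (rc (cyclotomic 1))) rc-1))

  length-p : length (cyclotomic p) ≡ p
  length-p = trans (length-cyclotomic p′) (cong (λ t → suc (p ℕ.∸ t)) (divisors-degree p′ D ([] ∷ []) positive complete sound below))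

  rc-p : rc (cyclotomic p) ≋ box p
  rc-p = cyclotomic-exact p′ (E 1) (box p) ser (E-box p) (λ i h → []-no (i ℕ.<? p) (ℕ.≤⇒≯ (subst (ℕ._≤ i) length-p h)))

 module BinaryIndex (p′ q′ : ℕ) (pp : Prime (suc p′)) (qp : Prime (suc q′)) (p<q : p′ ℕ.< q′) where

  private
   p = suc p′
   q = suc q′
   open Residues p′ using (inverse; ≈-trans; ≈-*ˡ; ≈-by; Unit; remainder) renaming (_≈_ to _≈p_)

   ¬p∣q : ¬ p ∣ q
   ¬p∣q = prime-∤ pp qp (s≤s p<q)

   uq : Unit q
   uq (i∣q , i∣p) with ∣prime pp i∣p
   ... | inj₁ e = e
   ... | inj₂ refl = ⊥-elim (¬p∣q i∣q)

   l : ℕ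
   l = proj₁ (inverse q uq) % p

   ql≈1 : q ℕ.* l ≈p 1
   ql≈1 = ≈-trans (≈-*ˡ q (≈-by (DM.m%n%n≡m%n (proj₁ (inverse q uq)) p))) (proj₂ (inverse q uq))

   1≤l : 1 ℕ.≤ l
   1≤l = ℕ.n≢0⇒n>0 (λ l≡0 → ℕ.0≢1+n (trans (cong (_% p) (sym (trans (cong (q ℕ.*_) l≡0) (ℕ.*-zeroʳ q)))) (trans (remainder ql≈1) (DM.m<n⇒m%n≡m (prime≥2 pp)))))

   open Coefficients p′ q l (s≤s z≤n) (DM.m%n<n (proj₁ (inverse q uq)) p) 1≤l ql≈1 using (c; c-beyond; E-E-c)

   n′ : ℕ
   n′ = q′ ℕ.+ p′ ℕ.* q

   D : List ℕ
   D = 1 ∷ p ∷ q ∷ []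

   unique : Unique D
   unique = ((λ e → ℕ.<-irrefl e (prime≥2 pp)) ∷ (λ e → ℕ.<-irrefl e (prime≥2 qp)) ∷ []) ∷ ((λ e → ℕ.<-irrefl e (s≤s p<q)) ∷ []) ∷ [] ∷ []

   complete : ∀ k → 1 ℕ.≤ k → k ℕ.< p ℕ.* q → k ∣ p ℕ.* q → k ∈ D
   complete k _ k< d with ∣prime* k q pp d
   ... | inj₁ k∣q with ∣prime qp k∣q
   ... | inj₁ refl = here refl
   ... | inj₂ refl = there (there (here refl))
   complete k _ k< d | inj₂ (k′ , refl , k′∣q) with ∣prime qp k′∣q
   ... | inj₁ refl = there (here (ℕ.*-identityʳ p))
   ... | inj₂ refl = ⊥-elim (ℕ.<-irrefl refl k<)

   positive : ∀ d → d ∈ D → 1 ℕ.≤ d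
   positive d (here refl) = s≤s z≤n
   positive d (there (here refl)) = s≤s z≤n
   positive d (there (there (here refl))) = s≤s z≤n

   sound : ∀ d → d ∈ D → d ∣ p ℕ.* q
   sound d (here refl) = 1∣ (p ℕ.* q)
   sound d (there (here refl)) = m∣m*n q
   sound d (there (there (here refl))) = n∣m*n p

   below : ∀ d → d ∈ D → d ℕ.≤ n′
   below d (here refl) = ℕ.≤-trans (ℕ.≤-trans (s≤s z≤n) p<q) (ℕ.m≤m+n q′ _)
   below d (there (here refl)) = below-multiple p q n′ (s≤s z≤n) (prime≥2 qp) refl
   below d (there (there (here refl))) = below-multiple q p n′ (s≤s z≤n) (prime≥2 pp) (ℕ.*-comm p q)

   module P = PrimeIndex p′ pp
   module Q = PrimeIndex q′ qp

   P-ser : Series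
   P-ser = E 1 ∗ (box p ∗ box q)

   ser : seriesProduct (properDivisorPolys (p ℕ.* q)) ≋ P-ser
   ser = ≋-trans (divisors-series n′ D unique positive complete sound below) (∗-cong rc-1 (∗-cong P.rc-p (≋-trans (∗-comm (rc (cyclotomic q)) δ₀) (≋-trans (δ-∗ 0 (rc (cyclotomic q))) Q.rc-p))))

   product : P-ser ∗ c ≋ E (p ℕ.* q)
   product = ∗-cancel (E 1) (P-ser ∗ c) (E (p ℕ.* q)) refl (≋-trans
    (solve 4 (λ e a b x → e ⊕ ((e ⊕ (a ⊕ b)) ⊕ x) ⊜ (e ⊕ a) ⊕ ((e ⊕ b) ⊕ x)) ≋-refl (E 1) (box p) (box q) c)
    (≋-trans (∗-cong (E-box p) (∗-congʳ {g = c} (E-box q))) E-E-c))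

  length-pq : length (cyclotomic (p ℕ.* q)) ≡ suc (p′ ℕ.* q′)
  length-pq = trans (length-cyclotomic n′) (cong suc (trans (cong (p ℕ.* q ℕ.∸_) (trans (divisors-degree n′ D unique positive complete sound below)
   (cong₂ (λ a b → 1 ℕ.+ (a ℕ.+ (b ℕ.+ 0))) (cong ℕ.pred P.length-p) (cong ℕ.pred Q.length-p)))) (trans (cong (ℕ._∸ (1 ℕ.+ (p′ ℕ.+ (q′ ℕ.+ 0)))) (expand p′ q′)) (ℕ.m+n∸m≡n (1 ℕ.+ (p′ ℕ.+ (q′ ℕ.+ 0))) (p′ ℕ.* q′)))))
   where
   expand : ∀ a b → suc a ℕ.* suc b ≡ 1 ℕ.+ (a ℕ.+ (b ℕ.+ 0)) ℕ.+ a ℕ.* b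
   expand = ℕ-solve

  rc-pq : rc (cyclotomic (p ℕ.* q)) ≋ c
  rc-pq = cyclotomic-exact n′ P-ser c ser product (λ i h → c-beyond i (subst (ℕ._≤ i) length-pq h))

  product-pq : E 1 ∗ (box p ∗ (box q ∗ rc (cyclotomic (p ℕ.* q)))) ≋ E (p ℕ.* q)
  product-pq = ≋-trans (solve 4 (λ e a b x → e ⊕ (a ⊕ (b ⊕ x)) ⊜ (e ⊕ (a ⊕ b)) ⊕ x) ≋-refl (E 1) (box p) (box q) (rc (cyclotomic (p ℕ.* q)))) (≋-trans (∗-congˡ {P-ser} rc-pq) product)

 -- The substitution x ↦ x^r.
 module Substitution (r′ : ℕ) where

  private r = suc r′

  up : Series → Series
  up f m = [ m % r ℕ.≟ 0 ] * f (m / r)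

  up-cong : ∀ {f g} → f ≋ g → up f ≋ up g
  up-cong h m = cong ([ m % r ℕ.≟ 0 ] *_) (h (m / r))

  up-shift : ∀ k f → up (shift k f) ≋ shift (r ℕ.* k) (up f)
  up-shift k f m with m ℕ.<? r ℕ.* k
  ... | yes m< = trans (cong ([ m % r ℕ.≟ 0 ] *_) (shift-< k f (m / r) (DM.m<n*o⇒m/o<n (subst (m ℕ.<_) (ℕ.*-comm r k) m<)))) (trans (*-zeroʳ [ m % r ℕ.≟ 0 ]) (sym (shift-< (r ℕ.* k) (up f) m m<)))
  ... | no m≮ = subst (λ t → up (shift k f) t ≡ shift (r ℕ.* k) (up f) t) (ℕ.m+[n∸m]≡n (ℕ.≮⇒≥ m≮)) (go (m ℕ.∸ r ℕ.* k))
   where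
   go : ∀ j → up (shift k f) (r ℕ.* k ℕ.+ j) ≡ shift (r ℕ.* k) (up f) (r ℕ.* k ℕ.+ j)
   go j = trans (cong₂ (λ x y → [ x ℕ.≟ 0 ] * shift k f y) rem quo) (trans (cong ([ j % r ℕ.≟ 0 ] *_) (shift-≥ k f (j / r))) (sym (shift-≥ (r ℕ.* k) (up f) j)))
    where
    swap : r ℕ.* k ℕ.+ j ≡ k ℕ.* r ℕ.+ j
    swap = cong (ℕ._+ j) (ℕ.*-comm r k)
    rem : (r ℕ.* k ℕ.+ j) % r ≡ j % r
    rem = trans (cong (_% r) (trans swap (ℕ.+-comm (k ℕ.* r) j))) (DM.[m+kn]%n≡m%n j k r)
    quo : (r ℕ.* k ℕ.+ j) / r ≡ k ℕ.+ j / r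
    quo = trans (cong (_/ r) swap) (trans (DM.+-distrib-/-∣ˡ j (divides k refl)) (cong (ℕ._+ j / r) (DM.m*n/n≡m k r)))

  up-E : ∀ k f → up (E k ∗ f) ≋ E (r ℕ.* k) ∗ up f
  up-E k f m = trans (cong ([ m % r ℕ.≟ 0 ] *_) (E-∗ k f (m / r))) (trans (lem [ m % r ℕ.≟ 0 ] (f (m / r)) (shift k f (m / r)))
   (trans (cong (λ t → up f m - t) (up-shift k f m)) (sym (E-∗ (r ℕ.* k) (up f) m))))
   where
   lem : ∀ a b c → a * (b - c) ≡ a * b - a * c
   lem = solve-∀

  up-δ₀ : up δ₀ ≋ δ₀
  up-δ₀ zero = refl
  up-δ₀ (suc m) with suc m % r ℕ.≟ 0 | suc m / r in eq
  ... | no _ | _ = refl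
  ... | yes _ | suc _ = refl
  ... | yes h | zero = ⊥-elim (ℕ.1+n≢0 (trans (DM.m≡m%n+[m/n]*n (suc m) r) (cong₂ (λ a b → a ℕ.+ b ℕ.* r) h eq)))

  up-E₀ : ∀ k → up (E k) ≋ E (r ℕ.* k)
  up-E₀ k = ≋-trans (up-cong (≋-sym (≋-trans (∗-comm (E k) δ₀) (δ-∗ 0 (E k))))) (≋-trans (up-E k δ₀) (≋-trans (∗-congˡ {E (r ℕ.* k)} up-δ₀) (≋-trans (∗-comm (E (r ℕ.* k)) δ₀) (δ-∗ 0 (E (r ℕ.* k))))))

  up-Σ : ∀ f m K → m ℕ.< K → up f m ≡ Σ K (λ j → [ r ℕ.* j ℕ.≟ m ] * f j)
  up-Σ f m K m<K with m % r ℕ.≟ 0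
  ... | yes h = sym (trans (Σ-cong K (λ j _ → cong (_* f j) ([]-cong (r ℕ.* j ℕ.≟ m) (j ℕ.≟ m / r)
     (λ { refl → sym (trans (cong (_/ r) (ℕ.*-comm r j)) (DM.m*n/n≡m j r)) })
     (λ { refl → trans (ℕ.*-comm r (m / r)) (sym m≡) })))) (trans (Σ-single K (m / r) f (ℕ.≤-<-trans (DM.m/n≤m m r) m<K)) (sym (*-identityˡ (f (m / r))))))
   where
   m≡ : m ≡ m / r ℕ.* r
   m≡ = trans (DM.m≡m%n+[m/n]*n m r) (cong (ℕ._+ m / r ℕ.* r) h)
  ... | no ¬h = sym (Σ-zero K (λ j _ → trans (cong (_* f j) ([]-no (r ℕ.* j ℕ.≟ m) (λ { refl → ¬h (trans (cong (_% r) (ℕ.*-comm r j)) (DM.m*n%n≡0 j r)) }))) refl))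

 -- Φ_pq enters as any series `c` that equals it and satisfies its binomial identity, so that the
 -- caller can bring coefficients computed from its own inverse of q modulo p.
 module TernaryIndex (p′ q′ r′ : ℕ) (pp : Prime (suc p′)) (qp : Prime (suc q′)) (rp : Prime (suc r′)) (p<q : p′ ℕ.< q′) (q<r : q′ ℕ.< r′)
  (c : Series) (rc-pq : rc (cyclotomic (suc p′ ℕ.* suc q′)) ≋ c) (E-E-c : E (suc p′) ∗ (E (suc q′) ∗ c) ≋ E 1 ∗ E (suc p′ ℕ.* suc q′)) where

  p q r M n′ : ℕ
  p = suc p′
  q = suc q′
  r = suc r′
  M = p ℕ.* q
  n′ = r′ ℕ.+ (q′ ℕ.+ p′ ℕ.* q) ℕ.* r

  open Substitution r′ public

  private
   module P = PrimeIndex p′ pp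
   module Q = PrimeIndex q′ qp
   module R = PrimeIndex r′ rp
   module PQ = BinaryIndex p′ q′ pp qp p<q
   module PR = BinaryIndex p′ r′ pp rp (ℕ.<-trans p<q q<r)
   module QR = BinaryIndex q′ r′ qp rp q<r

   2≤p = prime≥2 pp
   2≤q = prime≥2 qp
   2≤r = prime≥2 rp

   D : List ℕ
   D = 1 ∷ p ∷ q ∷ r ∷ p ℕ.* q ∷ p ℕ.* r ∷ q ℕ.* r ∷ []

   1<* : ∀ {a b} → 2 ℕ.≤ a → 2 ℕ.≤ b → 1 ℕ.< a ℕ.* b
   1<* {a} {b} h k = ℕ.≤-trans (s≤s (s≤s z≤n)) (ℕ.*-mono-≤ h k)

   <*ʳ : ∀ a b → 1 ℕ.≤ a → 2 ℕ.≤ b → a ℕ.< a ℕ.* b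
   <*ʳ a b h k = ℕ.m<m*n a b {{ℕ.>-nonZero h}} k

   <*ˡ : ∀ a b → 1 ℕ.≤ b → 2 ℕ.≤ a → b ℕ.< a ℕ.* b
   <*ˡ a b h k = subst (b ℕ.<_) (ℕ.*-comm b a) (<*ʳ b a h k)

   ≢-< : ∀ {a b} → a ℕ.< b → a ≢ b
   ≢-< lt refl = ℕ.<-irrefl refl lt

   p<q′ : p ℕ.< q
   p<q′ = s≤s p<q

   q<r′ : q ℕ.< r
   q<r′ = s≤s q<r

   unique : Unique D
   unique =
    (≢-< 2≤p ∷ ≢-< 2≤q ∷ ≢-< 2≤r ∷ ≢-< (1<* 2≤p 2≤q) ∷ ≢-< (1<* 2≤p 2≤r) ∷ ≢-< (1<* 2≤q 2≤r) ∷ []) ∷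
    (≢-< p<q′ ∷ ≢-< (ℕ.<-trans p<q′ q<r′) ∷ ≢-< (<*ʳ p q (s≤s z≤n) 2≤q) ∷ ≢-< (<*ʳ p r (s≤s z≤n) 2≤r) ∷ ≢-< (ℕ.<-trans p<q′ (<*ʳ q r (s≤s z≤n) 2≤r)) ∷ []) ∷
    (≢-< q<r′ ∷ ≢-< (<*ˡ p q (s≤s z≤n) 2≤p) ∷ (λ e → prime-∤ pp qp p<q′ (subst (p ∣_) (sym e) (m∣m*n r))) ∷ ≢-< (<*ʳ q r (s≤s z≤n) 2≤r) ∷ []) ∷
    ((λ e → prime-∤ pp rp (ℕ.<-trans p<q′ q<r′) (subst (p ∣_) (sym e) (m∣m*n q))) ∷ ≢-< (<*ˡ p r (s≤s z≤n) 2≤p) ∷ ≢-< (<*ˡ q r (s≤s z≤n) 2≤q) ∷ []) ∷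
    (≢-< (ℕ.*-monoʳ-< p q<r′) ∷ (λ e → ≢-< (ℕ.*-monoˡ-< q (ℕ.<-trans p<q′ q<r′)) (trans e (ℕ.*-comm q r))) ∷ []) ∷
    (≢-< (ℕ.*-monoˡ-< r p<q′) ∷ []) ∷ [] ∷ []

   reassoc : p ℕ.* q ℕ.* r ≡ p ℕ.* (q ℕ.* r)
   reassoc = ℕ.*-assoc p q r

   complete : ∀ k → 1 ℕ.≤ k → k ℕ.< p ℕ.* q ℕ.* r → k ∣ p ℕ.* q ℕ.* r → k ∈ D
   complete k _ k< d with ∣prime* k (q ℕ.* r) pp (subst (k ∣_) reassoc d)
   ... | inj₁ d′ with ∣prime* k r qp d′
   ... | inj₁ d″ with ∣prime rp d″
   ... | inj₁ refl = here refl
   ... | inj₂ refl = there (there (there (here refl)))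
   complete k _ k< d | inj₁ d′ | inj₂ (k′ , refl , d″) with ∣prime rp d″
   ... | inj₁ refl = there (there (here (ℕ.*-identityʳ q)))
   ... | inj₂ refl = there (there (there (there (there (there (here refl))))))
   complete k _ k< d | inj₂ (k′ , refl , d′) with ∣prime* k′ r qp d′
   ... | inj₁ d″ with ∣prime rp d″
   ... | inj₁ refl = there (here (ℕ.*-identityʳ p))
   ... | inj₂ refl = there (there (there (there (there (here refl)))))
   complete k _ k< d | inj₂ (k′ , refl , d′) | inj₂ (k″ , refl , d″) with ∣prime rp d″
   ... | inj₁ refl = there (there (there (there (here (cong (p ℕ.*_) (ℕ.*-identityʳ q))))))
   ... | inj₂ refl = ⊥-elim (ℕ.<-irrefl (sym reassoc) k<)

   cofactor : ∀ d → d ∈ D → ∃ λ e → 2 ℕ.≤ e × p ℕ.* q ℕ.* r ≡ d ℕ.* e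
   cofactor d (here refl) = p ℕ.* q ℕ.* r , ℕ.≤-trans 2≤r (ℕ.m≤n*m r (p ℕ.* q)) , sym (ℕ.*-identityˡ _)
   cofactor d (there (here refl)) = q ℕ.* r , ℕ.≤-trans 2≤r (ℕ.m≤n*m r q) , reassoc
   cofactor d (there (there (here refl))) = p ℕ.* r , ℕ.≤-trans 2≤r (ℕ.m≤n*m r p) , lem p q r
    where
    lem : ∀ a b c → a ℕ.* b ℕ.* c ≡ b ℕ.* (a ℕ.* c)
    lem = ℕ-solve
   cofactor d (there (there (there (here refl)))) = p ℕ.* q , ℕ.≤-trans 2≤q (ℕ.m≤n*m q p) , ℕ.*-comm (p ℕ.* q) r
   cofactor d (there (there (there (there (here refl))))) = r , 2≤r , refl
   cofactor d (there (there (there (there (there (here refl)))))) = q , 2≤q , lem p q r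
    where
    lem : ∀ a b c → a ℕ.* b ℕ.* c ≡ a ℕ.* c ℕ.* b
    lem = ℕ-solve
   cofactor d (there (there (there (there (there (there (here refl))))))) = p , 2≤p , lem p q r
    where
    lem : ∀ a b c → a ℕ.* b ℕ.* c ≡ b ℕ.* c ℕ.* a
    lem = ℕ-solve

   positive : ∀ d → d ∈ D → 1 ℕ.≤ d
   positive zero m with cofactor 0 m
   ... | e , _ , ()
   positive (suc d) m = s≤s z≤n

   sound : ∀ d → d ∈ D → d ∣ p ℕ.* q ℕ.* r
   sound d m with cofactor d m
   ... | e , _ , eq = divides e (trans eq (ℕ.*-comm d e))

   below : ∀ d → d ∈ D → d ℕ.≤ n′
   below d m with cofactor d m
   ... | e , 2≤e , eq = below-multiple d e n′ (positive d m) 2≤e eq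

  length-pqr : length (cyclotomic (p ℕ.* q ℕ.* r)) ≡ suc (p′ ℕ.* q′ ℕ.* r′)
  length-pqr = trans (length-cyclotomic n′) (cong suc (trans (cong (p ℕ.* q ℕ.* r ℕ.∸_) degrees) (trans (cong (ℕ._∸ deg p′ q′ r′) (expand p′ q′ r′)) (ℕ.m+n∸m≡n (deg p′ q′ r′) (p′ ℕ.* q′ ℕ.* r′)))))
   where
   deg : ℕ → ℕ → ℕ → ℕ
   deg a b c = 1 ℕ.+ (a ℕ.+ (b ℕ.+ (c ℕ.+ (a ℕ.* b ℕ.+ (a ℕ.* c ℕ.+ (b ℕ.* c ℕ.+ 0))))))
   expand : ∀ a b c → suc a ℕ.* suc b ℕ.* suc c ≡ 1 ℕ.+ (a ℕ.+ (b ℕ.+ (c ℕ.+ (a ℕ.* b ℕ.+ (a ℕ.* c ℕ.+ (b ℕ.* c ℕ.+ 0)))))) ℕ.+ a ℕ.* b ℕ.* c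
   expand = ℕ-solve
   degrees : degreeSum (properDivisorPolys (p ℕ.* q ℕ.* r)) ≡ deg p′ q′ r′
   degrees = trans (divisors-degree n′ D unique positive complete sound below)
    (cong suc (cong₂ ℕ._+_ (cong ℕ.pred P.length-p) (cong₂ ℕ._+_ (cong ℕ.pred Q.length-p) (cong₂ ℕ._+_ (cong ℕ.pred R.length-p)
     (cong₂ ℕ._+_ (cong ℕ.pred PQ.length-pq) (cong₂ ℕ._+_ (cong ℕ.pred PR.length-pq) (cong₂ ℕ._+_ (cong ℕ.pred QR.length-pq) refl)))))))

  -- One period of 1/Φ_pq = (1 + ... + x^(p-1)) (1 - x^q) / (1 - x^(pq)). It fits into a period
  -- because p + q ≤ p q.
  base : Series
  base m = box p m - shift q (box p) m

  B : Series
  B n = base (n % M)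

  p+q≤M : p ℕ.+ q ℕ.≤ M
  p+q≤M = ℕ.≤-trans (ℕ.+-monoˡ-≤ q (ℕ.<⇒≤ p<q′)) (ℕ.≤-trans (ℕ.≤-reflexive (cong (q ℕ.+_) (sym (ℕ.+-identityʳ q)))) (ℕ.*-monoˡ-≤ q 2≤p))

  base-beyond : ∀ n → M ℕ.≤ n → base n ≡ 0ℤ
  base-beyond n M≤n = cong₂ _-_ ([]-no (n ℕ.<? p) (ℕ.≤⇒≯ (ℕ.≤-trans (ℕ.m≤m+n p q) p+q≤n)))
   (trans (shift-∸ q (box p) n (ℕ.≤-trans (ℕ.m≤n+m q p) p+q≤n)) ([]-no (n ℕ.∸ q ℕ.<? p) (ℕ.≤⇒≯ (subst (ℕ._≤ n ℕ.∸ q) (ℕ.m+n∸n≡m p q) (ℕ.∸-monoˡ-≤ q p+q≤n)))))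
   where
   p+q≤n = ℕ.≤-trans p+q≤M M≤n

  private
   E-B : E M ∗ B ≋ box p ∗ E q
   E-B n = trans (E-∗ M B n) (trans (go (n ℕ.<? M)) (sym (trans (∗-comm (box p) (E q) n) (E-∗ q (box p) n))))
    where
    go : Dec (n ℕ.< M) → B n - shift M B n ≡ base n
    go (yes n<M) = trans (cong₂ _-_ (cong base (DM.m<n⇒m%n≡m n<M)) (shift-< M B n n<M)) (+-identityʳ (base n))
    go (no n≮M) = trans (i≡j⇒i-j≡0 (trans (cong base (trans (cong (_% M) (sym (ℕ.m∸n+n≡m (ℕ.≮⇒≥ n≮M)))) (DM.[m+n]%n≡m%n (n ℕ.∸ M) M))) (sym (shift-∸ M B n (ℕ.≮⇒≥ n≮M))))) (sym (base-beyond n (ℕ.≮⇒≥ n≮M)))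

   C : Series
   C = up c

   E-E-C : E (p ℕ.* r) ∗ (E (q ℕ.* r) ∗ C) ≋ E r ∗ E (p ℕ.* q ℕ.* r)
   E-E-C = ≋-trans (∗-cong (E-≡ (ℕ.*-comm p r)) (∗-congʳ {g = C} (E-≡ (ℕ.*-comm q r)))) (≋-trans (≋-sym (≋-trans (up-E p (E q ∗ c)) (∗-congˡ {E (r ℕ.* p)} (up-E q c))))
    (≋-trans (up-cong E-E-c) (≋-trans (up-E 1 (E M)) (∗-cong (E-≡ (ℕ.*-identityʳ r)) (≋-trans (up-E₀ M) (E-≡ (ℕ.*-comm r M)))))))
    where
    E-≡ : ∀ {a b} → a ≡ b → E a ≋ E b
    E-≡ refl = ≋-refl

   P-ser : Series
   P-ser = E 1 ∗ (box p ∗ (box q ∗ (box r ∗ (rc (cyclotomic (p ℕ.* q)) ∗ (rc (cyclotomic (p ℕ.* r)) ∗ rc (cyclotomic (q ℕ.* r)))))))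

   ser : seriesProduct (properDivisorPolys (p ℕ.* q ℕ.* r)) ≋ P-ser
   ser = ≋-trans (divisors-series n′ D unique positive complete sound below) (∗-cong rc-1 (∗-cong P.rc-p (∗-cong Q.rc-p (∗-cong R.rc-p
    (∗-congˡ {rc (cyclotomic (p ℕ.* q))} (∗-congˡ {rc (cyclotomic (p ℕ.* r))} (≋-trans (∗-comm (rc (cyclotomic (q ℕ.* r))) δ₀) (δ-∗ 0 (rc (cyclotomic (q ℕ.* r)))))))))))

   -- After multiplication by 1 - x^r the factors regroup into the products already known for the
   -- indices pq, pr and qr, together with the binomial identities of `B` and `C`.
   product : P-ser ∗ (C ∗ B) ≋ E (p ℕ.* q ℕ.* r)
   product = ∗-cancel (E 1 ∗ box r) (P-ser ∗ (C ∗ B)) (E (p ℕ.* q ℕ.* r)) refl (≋-trans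
    (solve 9 (λ e a b d x y z u v → (e ⊕ d) ⊕ ((e ⊕ (a ⊕ (b ⊕ (d ⊕ (x ⊕ (y ⊕ z)))))) ⊕ (u ⊕ v)) ⊜ ((e ⊕ (a ⊕ (b ⊕ x))) ⊕ v) ⊕ ((d ⊕ y) ⊕ (z ⊕ ((e ⊕ d) ⊕ u)))) ≋-refl (E 1) (box p) (box q) (box r) PQr PRr QRr C B)
    (≋-trans (∗-congʳ {g = (box r ∗ PRr) ∗ (QRr ∗ ((E 1 ∗ box r) ∗ C))} (≋-trans (∗-congʳ {g = B} PQ.product-pq) (≋-trans E-B (∗-congˡ {box p} (≋-sym (E-box q))))))
    (≋-trans (solve 7 (λ e a b d y z u → (a ⊕ (e ⊕ b)) ⊕ ((d ⊕ y) ⊕ (z ⊕ ((e ⊕ d) ⊕ u))) ⊜ (e ⊕ (a ⊕ (d ⊕ y))) ⊕ ((e ⊕ (b ⊕ (d ⊕ z))) ⊕ u)) ≋-refl (E 1) (box p) (box q) (box r) PRr QRr C)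
    (≋-trans (∗-cong PR.product-pq (∗-congʳ {g = C} QR.product-pq)) (≋-trans E-E-C (∗-congʳ {g = E (p ℕ.* q ℕ.* r)} (≋-sym (E-box r))))))))
    where
    PQr PRr QRr : Series
    PQr = rc (cyclotomic (p ℕ.* q))
    PRr = rc (cyclotomic (p ℕ.* r))
    QRr = rc (cyclotomic (q ℕ.* r))

  rc-pqr : ∀ i → i ℕ.< length (cyclotomic (p ℕ.* q ℕ.* r)) → rc (cyclotomic (p ℕ.* q ℕ.* r)) i ≡ (up c ∗ B) i
  rc-pqr = cyclotomic-below n′ P-ser (C ∗ B) ser product

-- Kaplan's formula for the coefficients of Φ_pqr.

module Kaplan where

 open import Defs
 open Series
 open PolyList
 open Binary
 open Ternary
 open Periodic using (module Residues)
 open import Data.Nat using (_%_; _/_)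
 open import Data.Nat.Primality using (Prime)
 open import Data.Integer using (ℤ; _+_; _*_; _-_; -_; 0ℤ; 1ℤ)
 open import Data.Integer.Properties
 open import Data.Integer.Tactic.RingSolver using (solve-∀)

 Σ-extend : ∀ {m n} f → m ℕ.≤ n → (∀ i → m ℕ.≤ i → f i ≡ 0ℤ) → Σ n f ≡ Σ m f
 Σ-extend {m} {zero} f z≤n z = refl
 Σ-extend {m} {suc n} f h z with m ℕ.≟ suc n
 ... | yes refl = refl
 ... | no ¬e = trans (cong₂ _+_ (Σ-extend f m≤n z) (z n m≤n)) (+-identityʳ (Σ m f))
  where
  m≤n = ℕ.≤-pred (ℕ.≤∧≢⇒< h ¬e)

 Σ-*ʳ : ∀ n c f → Σ n f * c ≡ Σ n (λ i → f i * c)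
 Σ-*ʳ n c f = trans (*-comm (Σ n f) c) (trans (sym (Σ-*ˡ n c f)) (Σ-cong n (λ i _ → *-comm c (f i))))

 Σ-pick : ∀ n c (f : ℕ → ℤ) → c ℕ.< n → Σ n (λ i → f i * [ i ℕ.≟ c ]) ≡ f c
 Σ-pick n c f h = trans (Σ-cong n (λ i _ → *-comm (f i) [ i ℕ.≟ c ])) (Σ-single n c f h)

 box-Σ : ∀ p m → box p m ≡ Σ p (λ i → [ m ℕ.≟ i ])
 box-Σ p m with m ℕ.<? p
 ... | yes m<p = sym (trans (Σ-cong p (λ i _ → trans ([]-cong (m ℕ.≟ i) (i ℕ.≟ m) sym sym) (sym (*-identityʳ [ i ℕ.≟ m ])))) (Σ-single p m (λ _ → 1ℤ) m<p))
 ... | no m≮p = sym (Σ-zero p (λ i i<p → []-no (m ℕ.≟ i) (λ { refl → m≮p i<p })))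

 shift-box-Σ : ∀ q p m → shift q (box p) m ≡ Σ p (λ i → [ m ℕ.≟ q ℕ.+ i ])
 shift-box-Σ q p m with m ℕ.<? q
 ... | yes m<q = trans (shift-< q (box p) m m<q) (sym (Σ-zero p (λ i _ → []-no (m ℕ.≟ q ℕ.+ i) (λ { refl → ℕ.<⇒≱ m<q (ℕ.m≤m+n q i) }))))
 ... | no m≮q = trans (shift-∸ q (box p) m q≤m) (trans (box-Σ p (m ℕ.∸ q)) (Σ-cong p (λ i _ → []-cong (m ℕ.∸ q ℕ.≟ i) (m ℕ.≟ q ℕ.+ i)
   (λ { refl → sym (ℕ.m+[n∸m]≡n q≤m) }) (λ { refl → ℕ.m+n∸m≡n q i }))))
  where
  q≤m = ℕ.≮⇒≥ m≮q

 module Additive (N′ : ℕ) where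

  open Residues N′

  ≈-+ʳ : ∀ {a b} c → a ≈ b → a ℕ.+ c ≈ b ℕ.+ c
  ≈-+ʳ {a} {b} c (≈-by h) = ≈-by (trans (DM.%-distribˡ-+ a c N) (trans (cong (λ t → (t ℕ.+ c % N) % N) h) (sym (DM.%-distribˡ-+ b c N))))

  ≈-+ˡ : ∀ {a b} c → a ≈ b → c ℕ.+ a ≈ c ℕ.+ b
  ≈-+ˡ {a} {b} c h = ≈-trans (≈-reflexive (ℕ.+-comm c a)) (≈-trans (≈-+ʳ c h) (≈-reflexive (ℕ.+-comm b c)))

  ≈-cancel-+ʳ : ∀ {a b} c → a ℕ.+ c ≈ b ℕ.+ c → a ≈ b
  ≈-cancel-+ʳ {a} {b} c h = ≈-trans (≈-sym (≈-kN a c)) (≈-trans (≈-reflexive (lem a c N′)) (≈-trans (≈-+ʳ (c ℕ.* N′) h) (≈-trans (≈-reflexive (sym (lem b c N′))) (≈-kN b c))))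
   where
   lem : ∀ a c m → a ℕ.+ c ℕ.* suc m ≡ a ℕ.+ c ℕ.+ c ℕ.* m
   lem = ℕ-solve

  ≈-cancel-+ˡ : ∀ {a b} c → c ℕ.+ a ≈ c ℕ.+ b → a ≈ b
  ≈-cancel-+ˡ {a} {b} c h = ≈-cancel-+ʳ c (≈-trans (≈-reflexive (ℕ.+-comm a c)) (≈-trans h (≈-reflexive (ℕ.+-comm c b))))

  ≈⇒≡ : ∀ {a b} → a ℕ.< N → b ℕ.< N → a ≈ b → a ≡ b
  ≈⇒≡ a< b< (≈-by h) = trans (sym (DM.m<n⇒m%n≡m a<)) (trans h (DM.m<n⇒m%n≡m b<))

  ≈-% : ∀ a → a % N ≈ a
  ≈-% a = ≈-by (DM.m%n%n≡m%n a N)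

 -- Kaplan's formula for the coefficients of Φ_pqr in terms of those of Φ_pq.
 module KaplanSum (p′ q′ r′ : ℕ) (pp : Prime (suc p′)) (qp : Prime (suc q′)) (rp : Prime (suc r′)) (p<q : p′ ℕ.< q′) (q<r : q′ ℕ.< r′)
  (c : Series) (rc-pq : rc (cyclotomic (suc p′ ℕ.* suc q′)) ≋ c) (E-E-c : E (suc p′) ∗ (E (suc q′) ∗ c) ≋ E 1 ∗ E (suc p′ ℕ.* suc q′))
  (c-beyond : ∀ k → suc p′ ℕ.* suc q′ ℕ.≤ k → c k ≡ 0ℤ)
  (w : ℕ) (rw : Residues._≈_ (q′ ℕ.+ p′ ℕ.* suc q′) (suc r′ ℕ.* w) 1) (n : ℕ) where

  open TernaryIndex p′ q′ r′ pp qp rp p<q q<r c rc-pq E-E-c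
   using (p; q; r; M; up; up-Σ; base; B; p+q≤M)

  M′ : ℕ
  M′ = q′ ℕ.+ p′ ℕ.* suc q′

  open Residues M′
  open Additive M′

  -- The solution of r f + i ≡ n modulo p q. `M′` stands for -1, which expresses n - i without
  -- subtraction.
  f : ℕ → ℕ
  f i = (w ℕ.* (n ℕ.+ M′ ℕ.* i)) % M

  f<M : ∀ i → f i ℕ.< M
  f<M i = DM.m%n<n (w ℕ.* (n ℕ.+ M′ ℕ.* i)) M

  f-spec : ∀ i → r ℕ.* f i ℕ.+ i ≈ n
  f-spec i = ≈-trans (≈-+ʳ i (≈-trans (≈-*ˡ r (≈-% (w ℕ.* (n ℕ.+ M′ ℕ.* i)))) (≈-trans (≈-reflexive (sym (ℕ.*-assoc r w (n ℕ.+ M′ ℕ.* i))))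
   (≈-trans (≈-*ʳ (n ℕ.+ M′ ℕ.* i) rw) (≈-reflexive (ℕ.*-identityˡ (n ℕ.+ M′ ℕ.* i))))))) (≈-trans (≈-reflexive (lem n M′ i)) (≈-kN n i))
   where
   lem : ∀ n m i → n ℕ.+ m ℕ.* i ℕ.+ i ≡ n ℕ.+ i ℕ.* suc m
   lem = ℕ-solve

  f-unique : ∀ i j → j ℕ.< M → r ℕ.* j ℕ.+ i ≈ n → j ≡ f i
  f-unique i j j<M h = ≈⇒≡ j<M (f<M i) (cancelˡ {r} (Unit-inv {r} {w} rw) (≈-cancel-+ʳ i (≈-trans h (≈-sym (f-spec i)))))

  T : ℕ
  T = n / r

  g : Series
  g j = [ j ℕ.≤? T ] * c j

  private
   ≤T⇒ : ∀ j → j ℕ.≤ T → r ℕ.* j ℕ.≤ n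
   ≤T⇒ j h = ℕ.≤-trans (ℕ.≤-reflexive (ℕ.*-comm r j)) (ℕ.≤-trans (ℕ.*-monoˡ-≤ r h) (DM.m/n*n≤m n r))

   ⇒≤T : ∀ j → r ℕ.* j ℕ.≤ n → j ℕ.≤ T
   ⇒≤T j h = subst (ℕ._≤ T) (trans (cong (_/ r) (ℕ.*-comm r j)) (DM.m*n/n≡m j r)) (DM./-monoˡ-≤ r h)

   K : ℕ
   K = suc n ℕ.+ M

   gather : (up c ∗ B) n ≡ Σ K (λ j → [ j ℕ.≤? T ] * (c j * B (n ℕ.∸ r ℕ.* j)))
   gather = begin
    (up c ∗ B) n
     ≡⟨ ∗-Σ (up c) B n ⟩
    Σ (suc n) (λ m → up c m * B (n ℕ.∸ m))
     ≡⟨ Σ-cong (suc n) (λ m m≤n → trans (cong (_* B (n ℕ.∸ m)) (up-Σ c m K (ℕ.<-≤-trans m≤n (ℕ.m≤m+n (suc n) M)))) (Σ-*ʳ K (B (n ℕ.∸ m)) (λ j → [ r ℕ.* j ℕ.≟ m ] * c j))) ⟩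
    Σ (suc n) (λ m → Σ K (λ j → [ r ℕ.* j ℕ.≟ m ] * c j * B (n ℕ.∸ m)))
     ≡⟨ Σ-swap (suc n) K (λ m j → [ r ℕ.* j ℕ.≟ m ] * c j * B (n ℕ.∸ m)) ⟩
    Σ K (λ j → Σ (suc n) (λ m → [ r ℕ.* j ℕ.≟ m ] * c j * B (n ℕ.∸ m)))
     ≡⟨ Σ-cong K (λ j _ → inner j (j ℕ.≤? T)) ⟩
    Σ K (λ j → [ j ℕ.≤? T ] * (c j * B (n ℕ.∸ r ℕ.* j))) ∎
    where
    open ≡-Reasoning
    inner : ∀ j (d : Dec (j ℕ.≤ T)) → Σ (suc n) (λ m → [ r ℕ.* j ℕ.≟ m ] * c j * B (n ℕ.∸ m)) ≡ [ d ] * (c j * B (n ℕ.∸ r ℕ.* j))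
    inner j (yes h) = trans (Σ-cong (suc n) (λ m _ → trans (*-assoc [ r ℕ.* j ℕ.≟ m ] (c j) (B (n ℕ.∸ m))) (cong (_* (c j * B (n ℕ.∸ m))) ([]-cong (r ℕ.* j ℕ.≟ m) (m ℕ.≟ r ℕ.* j) sym sym))))
     (trans (Σ-single (suc n) (r ℕ.* j) (λ m → c j * B (n ℕ.∸ m)) (s≤s (≤T⇒ j h))) (sym (*-identityˡ (c j * B (n ℕ.∸ r ℕ.* j)))))
    inner j (no ¬h) = Σ-zero (suc n) (λ m m≤n → trans (cong (λ t → t * c j * B (n ℕ.∸ m)) ([]-no (r ℕ.* j ℕ.≟ m) (λ { refl → ¬h (⇒≤T j (ℕ.≤-pred m≤n)) }))) refl)

   remainder-f : ∀ j x → j ℕ.< M → x ℕ.< M → r ℕ.* j ℕ.≤ n → [ (n ℕ.∸ r ℕ.* j) % M ℕ.≟ x ] ≡ [ j ℕ.≟ f x ]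
   remainder-f j x j<M x<M rj≤n = []-cong ((n ℕ.∸ r ℕ.* j) % M ℕ.≟ x) (j ℕ.≟ f x)
    (λ e → f-unique x j j<M (≈-trans (≈-+ˡ (r ℕ.* j) (≈-trans (≈-reflexive (sym e)) (≈-% (n ℕ.∸ r ℕ.* j)))) (≈-reflexive (ℕ.m+[n∸m]≡n rj≤n))))
    (λ { refl → ≈⇒≡ (DM.m%n<n (n ℕ.∸ r ℕ.* j) M) x<M (≈-trans (≈-% (n ℕ.∸ r ℕ.* j)) (≈-cancel-+ˡ (r ℕ.* j) (≈-trans (≈-reflexive (ℕ.m+[n∸m]≡n rj≤n)) (≈-sym (f-spec x))))) })

   hits : ℕ → ℕ → ℤ
   hits j i = [ j ℕ.≟ f i ] - [ j ℕ.≟ f (q ℕ.+ i) ]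

   term : ∀ j → j ℕ.< M → (d : Dec (j ℕ.≤ T)) → [ d ] * (c j * B (n ℕ.∸ r ℕ.* j)) ≡ Σ p (λ i → [ d ] * c j * hits j i)
   term j j<M (no _) = sym (Σ-0 p)
   term j j<M (yes h) = trans (trans (*-identityˡ _) (trans (cong (_* B (n ℕ.∸ r ℕ.* j)) (sym (*-identityˡ (c j)))) (cong (1ℤ * c j *_) expand))) (sym (Σ-*ˡ p (1ℤ * c j) (hits j)))
    where
    m : ℕ
    m = (n ℕ.∸ r ℕ.* j) % M
    expand : B (n ℕ.∸ r ℕ.* j) ≡ Σ p (hits j)
    expand = trans (cong₂ _-_ (box-Σ p m) (shift-box-Σ q p m)) (trans (sym (Σ-- p _ _)) (Σ-cong p (λ i i<p → cong₂ _-_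
     (remainder-f j i j<M (ℕ.<-≤-trans i<p (ℕ.≤-trans (ℕ.m≤m+n p q) p+q≤M)) (≤T⇒ j h))
     (remainder-f j (q ℕ.+ i) j<M (ℕ.<-≤-trans (ℕ.+-monoʳ-< q i<p) (ℕ.≤-trans (ℕ.≤-reflexive (ℕ.+-comm q p)) p+q≤M)) (≤T⇒ j h)))))

  -- 1/Φ_pq has coefficient 1 at residues i < p and -1 at residues q + i, and for j < M the residue
  -- of n - r j is i exactly if j = f i. The condition r j ≤ n becomes the cutoff j ≤ T inside `g`.
  kaplan : (up c ∗ B) n ≡ Σ p (λ i → g (f i) - g (f (q ℕ.+ i)))
  kaplan = begin
   (up c ∗ B) n
    ≡⟨ gather ⟩
   Σ K (λ j → [ j ℕ.≤? T ] * (c j * B (n ℕ.∸ r ℕ.* j)))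
    ≡⟨ Σ-extend (λ j → [ j ℕ.≤? T ] * (c j * B (n ℕ.∸ r ℕ.* j))) (ℕ.m≤n+m M (suc n)) (λ j M≤j → trans (cong (λ t → [ j ℕ.≤? T ] * (t * B (n ℕ.∸ r ℕ.* j))) (c-beyond j M≤j)) (*-zeroʳ [ j ℕ.≤? T ])) ⟩
   Σ M (λ j → [ j ℕ.≤? T ] * (c j * B (n ℕ.∸ r ℕ.* j)))
    ≡⟨ Σ-cong M (λ j j<M → term j j<M (j ℕ.≤? T)) ⟩
   Σ M (λ j → Σ p (λ i → g j * hits j i))
    ≡⟨ Σ-swap M p (λ j i → g j * hits j i) ⟩
   Σ p (λ i → Σ M (λ j → g j * hits j i))
    ≡⟨ Σ-cong p (λ i _ → trans (Σ-cong M (λ j _ → distrib (g j) [ j ℕ.≟ f i ] [ j ℕ.≟ f (q ℕ.+ i) ])) (trans (Σ-- M _ _) (cong₂ _-_ (Σ-pick M (f i) g (f<M i)) (Σ-pick M (f (q ℕ.+ i)) g (f<M (q ℕ.+ i)))))) ⟩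
   Σ p (λ i → g (f i) - g (f (q ℕ.+ i))) ∎
   where
   open ≡-Reasoning
   distrib : ∀ a b c → a * (b - c) ≡ a * b - a * c
   distrib = solve-∀

-- The upper bound, and conditions under which it is attained.

module Upper where

 open import Defs
 open Series
 open PolyList
 open Binary
 open Ternary
 open Kaplan
 open Periodic using (module Residues)
 open import Data.Nat using (_%_; _⊓_)
 open import Data.Nat.Divisibility using (_∣_; divides; ∣⇒≤; m%n≡0⇒n∣m)
 open import Data.Nat.Coprimality using (Coprime; coprime-divisor; prime⇒coprime) renaming (sym to coprime-sym)
 open import Data.Nat.Primality using (Prime)
 open import Data.Integer as ℤ using (ℤ; _+_; _*_; _-_; -_; 0ℤ; 1ℤ; _≤_; ∣_∣; +≤+)
 open import Data.Integer.Properties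
 open import Data.Integer.Tactic.RingSolver using (solve-∀)
 open import Algebra.Solver.CommutativeMonoid ∗-commutativeMonoid using (solve; _⊕_; _⊜_)

 0≤[] : ∀ {P : Set} (d : Dec P) → 0ℤ ≤ [ d ]
 0≤[] (yes _) = +≤+ z≤n
 0≤[] (no _) = +≤+ z≤n

 0≤[]*[] : ∀ {P Q : Set} (d : Dec P) (e : Dec Q) → 0ℤ ≤ [ d ] * [ e ]
 0≤[]*[] (yes _) e = subst (0ℤ ≤_) (sym (*-identityˡ [ e ])) (0≤[] e)
 0≤[]*[] (no _) e = ≤-refl

 []≤1 : ∀ {P : Set} (d : Dec P) → [ d ] ≤ 1ℤ
 []≤1 (yes _) = +≤+ (s≤s z≤n)
 []≤1 (no _) = +≤+ z≤n

 []-mono : ∀ {P Q : Set} (d : Dec P) (e : Dec Q) → (P → Q) → [ d ] ≤ [ e ]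
 []-mono (no _) e h = 0≤[] e
 []-mono (yes p) e h = ≤-reflexive (sym ([]-yes e (h p)))

 Σ-mono : ∀ n {f g : ℕ → ℤ} → (∀ i → i ℕ.< n → f i ≤ g i) → Σ n f ≤ Σ n g
 Σ-mono zero h = ≤-refl
 Σ-mono (suc n) h = +-mono-≤ (Σ-mono n (λ i b → h i (ℕ.m≤n⇒m≤1+n b))) (h n ℕ.≤-refl)

 Σ-below : ∀ n m → m ℕ.≤ n → Σ n (λ b → [ b ℕ.<? m ]) ≡ ℤ.+ m
 Σ-below n m m≤n = trans (Σ-extend (λ b → [ b ℕ.<? m ]) m≤n (λ b m≤b → []-no (b ℕ.<? m) (ℕ.≤⇒≯ m≤b))) (trans (Σ-cong m (λ b b<m → []-yes (b ℕ.<? m) b<m)) (ones m))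
  where
  ones : ∀ m → Σ m (λ _ → 1ℤ) ≡ ℤ.+ m
  ones zero = refl
  ones (suc m) = trans (cong (_+ 1ℤ) (ones m)) (cong ℤ.+_ (ℕ.+-comm m 1))

 Σ-above : ∀ n m → Σ n (λ b → [ m ℕ.≤? b ]) ≡ ℤ.+ (n ℕ.∸ m)
 Σ-above zero m = cong ℤ.+_ (sym (ℕ.0∸n≡0 m))
 Σ-above (suc n) m with m ℕ.≤? n
 ... | yes m≤n = trans (cong (_+ 1ℤ) (Σ-above n m)) (cong ℤ.+_ (trans (ℕ.+-comm (n ℕ.∸ m) 1) (sym (ℕ.+-∸-assoc 1 m≤n))))
 ... | no m≰n = trans (+-identityʳ _) (trans (Σ-above n m) (cong ℤ.+_ (trans (ℕ.m≤n⇒m∸n≡0 (ℕ.<⇒≤ (ℕ.≰⇒> m≰n))) (sym (ℕ.m≤n⇒m∸n≡0 (ℕ.≰⇒> m≰n))))))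

 Σ-reindex : ∀ p (σ τ : ℕ → ℕ) (F : ℕ → ℤ) → (∀ i → σ i ℕ.< p) → (∀ b → τ b ℕ.< p) →
  (∀ i b → i ℕ.< p → b ℕ.< p → b ≡ σ i → i ≡ τ b) → (∀ i b → i ℕ.< p → b ℕ.< p → i ≡ τ b → b ≡ σ i) →
  Σ p (λ i → F (σ i)) ≡ Σ p F
 Σ-reindex p σ τ F σ< τ< to from = begin
  Σ p (λ i → F (σ i))
   ≡⟨ Σ-cong p (λ i _ → sym (Σ-pick p (σ i) F (σ< i))) ⟩
  Σ p (λ i → Σ p (λ b → F b * [ b ℕ.≟ σ i ]))
   ≡⟨ Σ-swap p p (λ i b → F b * [ b ℕ.≟ σ i ]) ⟩
  Σ p (λ b → Σ p (λ i → F b * [ b ℕ.≟ σ i ]))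
   ≡⟨ Σ-cong p (λ b b<p → trans (Σ-cong p (λ i i<p → cong (F b *_) ([]-cong (b ℕ.≟ σ i) (i ℕ.≟ τ b) (to i b i<p b<p) (from i b i<p b<p)))) (Σ-pick p (τ b) (λ _ → F b) (τ< b))) ⟩
  Σ p F ∎
  where open ≡-Reasoning

 ∣∣-bound : ∀ {a n} → a ≤ ℤ.+ n → - a ≤ ℤ.+ n → ∣ a ∣ ℕ.≤ n
 ∣∣-bound {ℤ.+ a} h _ = drop‿+≤+ h
 ∣∣-bound {ℤ.-[1+ a ]} _ h = drop‿+≤+ h

 chinese : ∀ {p q d} → Coprime p q → p ∣ d → q ∣ d → d ℕ.< p ℕ.* q → d ≡ 0
 chinese {p} {q} {zero} _ _ _ _ = refl
 chinese {p} {q} {suc d} co p∣d (divides k e) d<pq with coprime-divisor co (subst (p ∣_) (trans e (ℕ.*-comm k q)) p∣d)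
 ... | divides j refl = ⊥-elim (ℕ.<⇒≱ d<pq (∣⇒≤ (divides j (trans e (ℕ.*-assoc j p q)))))

 module Difference (N′ : ℕ) where

  open Residues N′
  open Additive N′

  ≈⇒∣ : ∀ {a b} → a ≈ b → N ∣ b ℕ.∸ a
  ≈⇒∣ {a} {b} h with ℕ.≤-total a b
  ... | inj₁ a≤b = m%n≡0⇒n∣m (b ℕ.∸ a) N (trans (remainder (≈-cancel-+ˡ a (≈-trans (≈-reflexive (ℕ.m+[n∸m]≡n a≤b)) (≈-trans (≈-sym h) (≈-reflexive (sym (ℕ.+-identityʳ a))))))) refl)
  ... | inj₂ b≤a = divides 0 (ℕ.m≤n⇒m∸n≡0 b≤a)

  coarsen : ∀ e M′ {a b} → suc M′ ≡ e ℕ.* N → Residues._≈_ M′ a b → a ≈ b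
  coarsen e M′ {a} {b} eq (Residues.≈-by h) = ≈-trans (reduce a) (≈-trans (≈-reflexive h) (≈-sym (reduce b)))
   where
   reduce : ∀ a → a ≈ a % suc M′
   reduce a = ≈-trans (≈-reflexive (trans (DM.m≡m%n+[m/n]*n a (suc M′)) (cong (a % suc M′ ℕ.+_) (trans (cong (a ℕ./ suc M′ ℕ.*_) eq) (sym (ℕ.*-assoc (a ℕ./ suc M′) e N)))))) (≈-kN (a % suc M′) (a ℕ./ suc M′ ℕ.* e))

 module Window (p′ q′ : ℕ) (pp : Prime (suc p′)) (qp : Prime (suc q′)) (p<q : p′ ℕ.< q′)
  (l : ℕ) (l<p : l ℕ.< suc p′) (1≤l : 1 ℕ.≤ l) (ql≈1 : Residues._≈_ p′ (suc q′ ℕ.* l) 1)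
  (r′ : ℕ) (rp : Prime (suc r′)) (q<r : q′ ℕ.< r′)
  (w : ℕ) (rw : Residues._≈_ (q′ ℕ.+ p′ ℕ.* suc q′) (suc r′ ℕ.* w) 1) where

  q r M M′ : ℕ
  q = suc q′
  r = suc r′
  M′ = q′ ℕ.+ p′ ℕ.* q
  M = suc M′

  open Coefficients p′ q l (s≤s z≤n) l<p 1≤l ql≈1 hiding (≈⇒∣; ∣⇒≈; ≈⇒≡) public
  open Additive p′ public

  -- `BinaryIndex` works with an inverse of q of its own. Cancelling the binomials shows that the
  -- series built from the given `l` is the same one.
  rc-pq : rc (cyclotomic (p ℕ.* q)) ≋ c
  rc-pq = ∗-cancel (E q) x c refl (∗-cancel (E p) (E q ∗ x) (E q ∗ c) refl (≋-trans (≋-trans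
   (∗-cong (≋-sym (E-box p)) (∗-congʳ {g = x} (≋-sym (E-box q))))
   (≋-trans (solve 4 (λ e a b x → (e ⊕ a) ⊕ ((e ⊕ b) ⊕ x) ⊜ e ⊕ (e ⊕ (a ⊕ (b ⊕ x)))) ≋-refl (E 1) (box p) (box q) x) (∗-congˡ {E 1} (BinaryIndex.product-pq p′ q′ pp qp p<q)))) (≋-sym E-E-c)))
   where
   x : Series
   x = rc (cyclotomic (p ℕ.* q))

  c-beyond-M : ∀ k → M ℕ.≤ k → c k ≡ 0ℤ
  c-beyond-M k h = c-beyond k (ℕ.≤-trans (s≤s (ℕ.≤-trans (ℕ.*-monoʳ-≤ p′ (ℕ.n≤1+n q′)) (ℕ.m≤n+m (p′ ℕ.* q) q′))) h)

  open TernaryIndex p′ q′ r′ pp qp rp p<q q<r c rc-pq E-E-c using (length-pqr; rc-pqr) public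

  M-split : l ℕ.* q ℕ.+ l′ ℕ.* q ≡ M
  M-split = trans (sym (ℕ.*-distribʳ-+ q l l′)) (cong (ℕ._* q) l+l′)

  module Coefficient (n : ℕ) where

   open KaplanSum p′ q′ r′ pp qp rp p<q q<r c rc-pq E-E-c c-beyond-M w rw n using (f; f<M; f-spec; f-unique; T; g; kaplan) public

   -- γ is the residue modulo p q that vanishes modulo p and agrees with k modulo q.
   Offset : ℕ → ℕ → Set
   Offset k γ = γ ℕ.< M × (k ≡ β k ℕ.* q ℕ.+ γ ⊎ k ℕ.+ M ≡ β k ℕ.* q ℕ.+ γ)

   -- In these four names the first letter says whether γ is low (at most l′ q) or high, the second
   -- whether β is low (below l) or high. Low γ gives the coefficients 1 and 0 for low and high β,
   -- high γ gives 0 and -1; the cutoff at T adds an indicator.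
   g-ll : ∀ {k γ} → Offset k γ → γ ℕ.≤ l′ ℕ.* q → β k ℕ.< l → g k ≡ [ β k ℕ.* q ℕ.+ γ ℕ.≤? T ]
   g-ll {k} {γ} (_ , inj₁ e) γ≤ b<l = trans (cong₂ _*_ ([]-cong (k ℕ.≤? T) (β k ℕ.* q ℕ.+ γ ℕ.≤? T) (subst (ℕ._≤ T) e) (subst (ℕ._≤ T) (sym e)))
    (trans (c-low k b<l) (cong₂ _*_ ([]-yes (β k ℕ.* q ℕ.≤? k) (ℕ.≤-trans (ℕ.m≤m+n _ γ) (ℕ.≤-reflexive (sym e))))
     ([]-yes (k ℕ.≤? (β k ℕ.+ l′) ℕ.* q) (ℕ.≤-trans (ℕ.≤-reflexive e) (ℕ.≤-trans (ℕ.+-monoʳ-≤ _ γ≤) (ℕ.≤-reflexive (sym (ℕ.*-distribʳ-+ q (β k) l′)))))))))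
    (*-identityʳ _)
   g-ll {k} {γ} (_ , inj₂ e) γ≤ b<l = ⊥-elim (ℕ.<⇒≱ (ℕ.*-monoˡ-< q (ℕ.+-monoˡ-< l′ b<l)) (begin
    (l ℕ.+ l′) ℕ.* q ≡⟨ cong (ℕ._* q) l+l′ ⟩
    M ≤⟨ ℕ.m≤n+m M k ⟩
    k ℕ.+ M ≡⟨ e ⟩
    β k ℕ.* q ℕ.+ γ ≤⟨ ℕ.+-monoʳ-≤ _ γ≤ ⟩
    β k ℕ.* q ℕ.+ l′ ℕ.* q ≡⟨ ℕ.*-distribʳ-+ q (β k) l′ ⟨
    (β k ℕ.+ l′) ℕ.* q ∎))
    where open ℕ.≤-Reasoning

   private
    high : ∀ k → l ℕ.≤ β k → (β k ℕ.∸ l) ℕ.* q ℕ.+ M ≡ β k ℕ.* q ℕ.+ l′ ℕ.* q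
    high k l≤b = trans (cong ((β k ℕ.∸ l) ℕ.* q ℕ.+_) (sym M-split)) (trans (sym (ℕ.+-assoc _ (l ℕ.* q) (l′ ℕ.* q)))
     (cong (ℕ._+ l′ ℕ.* q) (trans (sym (ℕ.*-distribʳ-+ q (β k ℕ.∸ l) l)) (cong (ℕ._* q) (ℕ.m∸n+n≡m l≤b)))))

    wrapped : ∀ {k γ} → γ ℕ.< M → k ℕ.+ M ≡ β k ℕ.* q ℕ.+ γ → k ℕ.< β k ℕ.* q
    wrapped {k} {γ} γ<M e = ℕ.+-cancelʳ-< M k (β k ℕ.* q) (ℕ.≤-<-trans (ℕ.≤-reflexive e) (ℕ.+-monoʳ-< (β k ℕ.* q) γ<M))

    vanish : ∀ k → c k ≡ 0ℤ → g k ≡ 0ℤ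
    vanish k h = trans (cong ([ k ℕ.≤? T ] *_) h) (*-zeroʳ [ k ℕ.≤? T ])

   g-lh : ∀ {k γ} → Offset k γ → γ ℕ.≤ l′ ℕ.* q → l ℕ.≤ β k → g k ≡ 0ℤ
   g-lh {k} {γ} (_ , inj₁ e) γ≤ l≤b = vanish k (trans (c-high k l≤b) (cong -_ (trans (cong ([ (β k ℕ.∸ l) ℕ.* q ℕ.<? k ] *_) ([]-no (k ℕ.<? β k ℕ.* q) (ℕ.≤⇒≯ (ℕ.≤-trans (ℕ.m≤m+n _ γ) (ℕ.≤-reflexive (sym e)))))) (*-zeroʳ [ (β k ℕ.∸ l) ℕ.* q ℕ.<? k ]))))
   g-lh {k} {γ} (_ , inj₂ e) γ≤ l≤b = vanish k (trans (c-high k l≤b) (cong -_ (cong (_* [ k ℕ.<? β k ℕ.* q ]) ([]-no ((β k ℕ.∸ l) ℕ.* q ℕ.<? k) (ℕ.≤⇒≯ (ℕ.+-cancelʳ-≤ M k _ (ℕ.≤-trans (ℕ.≤-reflexive e) (ℕ.≤-trans (ℕ.+-monoʳ-≤ _ γ≤) (ℕ.≤-reflexive (sym (high k l≤b)))))))))))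

   g-hl : ∀ {k γ} → Offset k γ → l′ ℕ.* q ℕ.< γ → β k ℕ.< l → g k ≡ 0ℤ
   g-hl {k} {γ} (_ , inj₁ e) <γ b<l = vanish k (trans (c-low k b<l) (trans (cong ([ β k ℕ.* q ℕ.≤? k ] *_) ([]-no (k ℕ.≤? (β k ℕ.+ l′) ℕ.* q) (ℕ.<⇒≱ (ℕ.≤-<-trans (ℕ.≤-reflexive (ℕ.*-distribʳ-+ q (β k) l′)) (ℕ.<-≤-trans (ℕ.+-monoʳ-< (β k ℕ.* q) <γ) (ℕ.≤-reflexive (sym e))))))) (*-zeroʳ [ β k ℕ.* q ℕ.≤? k ])))
   g-hl {k} {γ} (γ<M , inj₂ e) <γ b<l = vanish k (trans (c-low k b<l) (cong (_* [ k ℕ.≤? (β k ℕ.+ l′) ℕ.* q ]) ([]-no (β k ℕ.* q ℕ.≤? k) (ℕ.<⇒≱ (wrapped γ<M e)))))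

   g-hh : ∀ {k γ} → k ℕ.< M → Offset k γ → l′ ℕ.* q ℕ.< γ → l ℕ.≤ β k → g k ≡ - [ β k ℕ.* q ℕ.+ γ ℕ.≤? T ℕ.+ M ]
   g-hh {k} {γ} k<M (_ , inj₁ e) <γ l≤b = ⊥-elim (ℕ.<⇒≱ k<M (ℕ.≤-trans (ℕ.≤-reflexive (sym M-split)) (ℕ.≤-trans (ℕ.+-mono-≤ (ℕ.*-monoˡ-≤ q l≤b) (ℕ.<⇒≤ <γ)) (ℕ.≤-reflexive (sym e)))))
   g-hh {k} {γ} k<M (γ<M , inj₂ e) <γ l≤b = trans (cong₂ _*_
    ([]-cong (k ℕ.≤? T) (β k ℕ.* q ℕ.+ γ ℕ.≤? T ℕ.+ M) (λ h → subst (ℕ._≤ T ℕ.+ M) e (ℕ.+-monoˡ-≤ M h)) (λ h → ℕ.+-cancelʳ-≤ M k T (subst (ℕ._≤ T ℕ.+ M) (sym e) h)))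
    (trans (c-high k l≤b) (cong -_ (cong₂ _*_
     ([]-yes ((β k ℕ.∸ l) ℕ.* q ℕ.<? k) (ℕ.+-cancelʳ-< M _ k (ℕ.≤-<-trans (ℕ.≤-reflexive (high k l≤b)) (ℕ.<-≤-trans (ℕ.+-monoʳ-< (β k ℕ.* q) <γ) (ℕ.≤-reflexive (sym e))))))
     ([]-yes (k ℕ.<? β k ℕ.* q) (wrapped γ<M e))))))
    (lem [ β k ℕ.* q ℕ.+ γ ℕ.≤? T ℕ.+ M ])
    where
    lem : ∀ a → a * - (1ℤ * 1ℤ) ≡ - a
    lem = solve-∀

   offset : ∀ k → ∃ λ γ → k ℕ.< M → Offset k γ
   offset k with β k ℕ.* q ℕ.≤? k
   ... | yes h = k ℕ.∸ β k ℕ.* q , λ k<M → ℕ.≤-<-trans (ℕ.m∸n≤m k (β k ℕ.* q)) k<M , inj₁ (sym (ℕ.m+[n∸m]≡n h))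
   ... | no h = k ℕ.+ M ℕ.∸ β k ℕ.* q , λ k<M → ℕ.+-cancelˡ-< (β k ℕ.* q) _ M (ℕ.≤-<-trans (ℕ.≤-reflexive (eq k<M)) (ℕ.+-monoˡ-< M (ℕ.≰⇒> h))) , inj₂ (sym (eq k<M))
    where
    eq : k ℕ.< M → β k ℕ.* q ℕ.+ (k ℕ.+ M ℕ.∸ β k ℕ.* q) ≡ k ℕ.+ M
    eq k<M = ℕ.m+[n∸m]≡n (ℕ.≤-trans (ℕ.*-monoˡ-≤ q (ℕ.<⇒≤ (β<p k))) (ℕ.m≤n+m M k))

   private
    module ≈q = Residues q′
    module Addq = Additive q′
    module ≈M = Residues M′
    module AddM = Additive M′

   offset-unique : ∀ {k k₁ γ γ₁} → k ≈q.≈ k₁ → Offset k γ → Offset k₁ γ₁ → γ ≡ γ₁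
   offset-unique {k} {k₁} {γ} {γ₁} k≈k₁ o o₁ = ℕ.≤-antisym (half (≈q.≈-sym k≈k₁) o₁ o) (half k≈k₁ o o₁)
    where
    coprime-pq : Coprime p q
    coprime-pq = coprime-sym (prime⇒coprime qp (s≤s p<q))
    multiple : ∀ {k γ} → Offset k γ → γ ≈ 0
    multiple {k} {γ} (_ , e) = ≈-cancel-+ˡ (β k ℕ.* q) (≈-trans (go e) (≈-trans (≈-sym (β*q≈ k)) (≈-reflexive (sym (ℕ.+-identityʳ (β k ℕ.* q))))))
     where
     go : k ≡ β k ℕ.* q ℕ.+ γ ⊎ k ℕ.+ M ≡ β k ℕ.* q ℕ.+ γ → β k ℕ.* q ℕ.+ γ ≈ k
     go (inj₁ e) = ≈-reflexive (sym e)
     go (inj₂ e) = ≈-trans (≈-reflexive (trans (sym e) (cong (k ℕ.+_) (ℕ.*-comm p q)))) (≈-kN k q)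
    agrees : ∀ {k γ} → Offset k γ → γ ≈q.≈ k
    agrees {k} {γ} (_ , e) = ≈q.≈-trans (≈q.≈-sym (≈q.≈-kN γ (β k))) (≈q.≈-trans (≈q.≈-reflexive (ℕ.+-comm γ (β k ℕ.* q))) (go e))
     where
     go : k ≡ β k ℕ.* q ℕ.+ γ ⊎ k ℕ.+ M ≡ β k ℕ.* q ℕ.+ γ → β k ℕ.* q ℕ.+ γ ≈q.≈ k
     go (inj₁ e) = ≈q.≈-reflexive (sym e)
     go (inj₂ e) = ≈q.≈-trans (≈q.≈-reflexive (sym e)) (≈q.≈-kN k p)
    half : ∀ {k k₁ γ γ₁} → k ≈q.≈ k₁ → Offset k γ → Offset k₁ γ₁ → γ₁ ℕ.≤ γ
    half {γ = γ} {γ₁} h o o₁ = ℕ.m∸n≡0⇒m≤n (chinese coprime-pq (Difference.≈⇒∣ p′ (≈-trans (multiple o) (≈-sym (multiple o₁)))) (Difference.≈⇒∣ q′ (≈q.≈-trans (agrees o) (≈q.≈-trans h (≈q.≈-sym (agrees o₁)))))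
     (ℕ.≤-<-trans (ℕ.m∸n≤m γ₁ γ) (proj₁ o₁)))

   -- Marks the b = β k for which g k - g k₁ can be positive when β k ≡ β k₁ + t: either β has
   -- wrapped around, so b < t, and b is low, or it has not wrapped and β k₁ is already high, so b ≥
   -- l + t.
   excess : ℕ → ℕ → ℤ
   excess t b = [ b ℕ.<? l ] * [ b ℕ.<? t ] + [ l ℕ.+ t ℕ.≤? b ]

   private
    0≤excess : ∀ t b → 0ℤ ≤ excess t b
    0≤excess t b = +-mono-≤ (0≤[]*[] (b ℕ.<? l) (b ℕ.<? t)) (0≤[] (l ℕ.+ t ℕ.≤? b))

    1≤excess-low : ∀ t b → b ℕ.< l → b ℕ.< t → 1ℤ ≤ excess t b
    1≤excess-low t b h k = subst (1ℤ ≤_) (cong (_+ [ l ℕ.+ t ℕ.≤? b ]) (sym (cong₂ _*_ ([]-yes (b ℕ.<? l) h) ([]-yes (b ℕ.<? t) k)))) (+-monoʳ-≤ 1ℤ (0≤[] (l ℕ.+ t ℕ.≤? b)))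

    1≤excess-high : ∀ t b → l ℕ.+ t ℕ.≤ b → 1ℤ ≤ excess t b
    1≤excess-high t b h = subst (λ x → x ≤ excess t b) (+-identityˡ 1ℤ) (+-mono-≤ (0≤[]*[] (b ℕ.<? l) (b ℕ.<? t)) (≤-reflexive (sym ([]-yes (l ℕ.+ t ℕ.≤? b) h))))

    ≤0⇒ : ∀ {x y t b} → x ≤ y → x - y ≤ excess t b
    ≤0⇒ {x} {y} {t} {b} h = ≤-trans (i≤j⇒i-j≤0 h) (0≤excess t b)

    ≤1⇒ : ∀ {x y t b} → x ≤ 1ℤ → 0ℤ ≤ y → 1ℤ ≤ excess t b → x - y ≤ excess t b
    ≤1⇒ {x} {y} h k e = ≤-trans (+-mono-≤ h (neg-mono-≤ k)) e

   -- With γ in common, low γ makes `g` non-negative and, among low β, decreasing in β; high γ makes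
   -- it non-positive and, among high β, increasing. A positive difference therefore requires one of
   -- the two patterns of `excess`.
   difference : ∀ {k k₁ γ} t → t ℕ.≤ p → k ℕ.< M → k₁ ℕ.< M → Offset k γ → Offset k₁ γ → β k₁ ℕ.+ t ≡ β k ⊎ β k₁ ℕ.+ t ≡ β k ℕ.+ p → g k - g k₁ ≤ excess t (β k)
   difference {k} {k₁} {γ} t t≤p k<M k₁<M o o₁ rel = go (γ ℕ.≤? l′ ℕ.* q) (β k ℕ.<? l) (β k₁ ℕ.<? l) rel
    where
    wrap : β k₁ ℕ.+ t ≡ β k ℕ.+ p → β k ℕ.< t
    wrap e = ℕ.+-cancelʳ-< p (β k) t (ℕ.≤-<-trans (ℕ.≤-reflexive (sym e)) (ℕ.<-≤-trans (ℕ.+-monoˡ-< t (β<p k₁)) (ℕ.≤-reflexive (ℕ.+-comm p t))))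
    go : Dec (γ ℕ.≤ l′ ℕ.* q) → Dec (β k ℕ.< l) → Dec (β k₁ ℕ.< l) → β k₁ ℕ.+ t ≡ β k ⊎ β k₁ ℕ.+ t ≡ β k ℕ.+ p → g k - g k₁ ≤ excess t (β k)
    nonneg : γ ℕ.≤ l′ ℕ.* q → Dec (β k₁ ℕ.< l) → 0ℤ ≤ g k₁
    nonneg h (yes b) = subst (0ℤ ≤_) (sym (g-ll o₁ h b)) (0≤[] (β k₁ ℕ.* q ℕ.+ γ ℕ.≤? T))
    nonneg h (no b) = ≤-reflexive (sym (g-lh o₁ h (ℕ.≮⇒≥ b)))
    nonpos : l′ ℕ.* q ℕ.< γ → Dec (β k ℕ.< l) → g k ≤ 0ℤ
    nonpos h (yes b) = ≤-reflexive (g-hl o h b)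
    nonpos h (no b) = subst (_≤ 0ℤ) (sym (g-hh k<M o h (ℕ.≮⇒≥ b))) (neg-mono-≤ (0≤[] (β k ℕ.* q ℕ.+ γ ℕ.≤? T ℕ.+ M)))
    go (yes h) (no b) d _ = ≤0⇒ {t = t} (≤-trans (≤-reflexive (g-lh o h (ℕ.≮⇒≥ b))) (nonneg h d))
    go (yes h) (yes b) d (inj₂ e) = ≤1⇒ {t = t} (subst (_≤ 1ℤ) (sym (g-ll o h b)) ([]≤1 (β k ℕ.* q ℕ.+ γ ℕ.≤? T))) (nonneg h d) (1≤excess-low t (β k) b (wrap e))
    go (yes h) (yes b) d (inj₁ e) = ≤0⇒ {t = t} (subst₂ _≤_ (sym (g-ll o h b)) (sym (g-ll o₁ h (ℕ.≤-<-trans b₁≤b b))) ([]-mono (β k ℕ.* q ℕ.+ γ ℕ.≤? T) (β k₁ ℕ.* q ℕ.+ γ ℕ.≤? T) (ℕ.≤-trans (ℕ.+-monoˡ-≤ γ (ℕ.*-monoˡ-≤ q b₁≤b)))))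
     where
     b₁≤b = ℕ.≤-trans (ℕ.m≤m+n (β k₁) t) (ℕ.≤-reflexive e)
    go (no h) d (yes b₁) _ = ≤0⇒ {t = t} (≤-trans (nonpos (ℕ.≰⇒> h) d) (≤-reflexive (sym (g-hl o₁ (ℕ.≰⇒> h) b₁))))
    go (no h) d (no b₁) (inj₁ e) = subst (λ x → g k - x ≤ excess t (β k)) (sym (g-hh k₁<M o₁ (ℕ.≰⇒> h) (ℕ.≮⇒≥ b₁))) (≤-trans (+-mono-≤ (nonpos (ℕ.≰⇒> h) d) (≤-trans (≤-reflexive (neg-involutive [ s ])) ([]≤1 s))) (1≤excess-high t (β k) (ℕ.≤-trans (ℕ.+-monoˡ-≤ t (ℕ.≮⇒≥ b₁)) (ℕ.≤-reflexive e))))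
     where
     s = β k₁ ℕ.* q ℕ.+ γ ℕ.≤? T ℕ.+ M
    go (no h) (yes b) (no b₁) (inj₂ e) = subst (λ x → g k - x ≤ excess t (β k)) (sym (g-hh k₁<M o₁ (ℕ.≰⇒> h) (ℕ.≮⇒≥ b₁))) (≤-trans (+-mono-≤ (nonpos (ℕ.≰⇒> h) (yes b)) (≤-trans (≤-reflexive (neg-involutive [ s ])) ([]≤1 s))) (1≤excess-low t (β k) b (wrap e)))
     where
     s = β k₁ ℕ.* q ℕ.+ γ ℕ.≤? T ℕ.+ M
    go (no h) (no b) (no b₁) (inj₂ e) = ≤0⇒ {t = t} (subst₂ _≤_ (sym (g-hh k<M o (ℕ.≰⇒> h) (ℕ.≮⇒≥ b))) (sym (g-hh k₁<M o₁ (ℕ.≰⇒> h) (ℕ.≮⇒≥ b₁))) (neg-mono-≤ ([]-mono (β k₁ ℕ.* q ℕ.+ γ ℕ.≤? T ℕ.+ M) (β k ℕ.* q ℕ.+ γ ℕ.≤? T ℕ.+ M) (ℕ.≤-trans (ℕ.+-monoˡ-≤ γ (ℕ.*-monoˡ-≤ q b≤b₁))))))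
     where
     b≤b₁ = ℕ.+-cancelʳ-≤ p (β k) (β k₁) (ℕ.≤-trans (ℕ.≤-reflexive (sym e)) (ℕ.+-monoʳ-≤ (β k₁) t≤p))

   -- The count is at most min(l, t) + max(p - l - t, 0), which is at most l because p ≤ 2 l.
   Σ-excess : ∀ t → l′ ℕ.≤ l → Σ p (excess t) ≤ ℤ.+ l
   Σ-excess t l′≤l = ≤-trans (Σ-mono p {excess t} {λ b → [ b ℕ.<? l ⊓ t ] + [ l ℕ.+ t ℕ.≤? b ]} (λ b _ → +-monoˡ-≤ [ l ℕ.+ t ℕ.≤? b ] (meet b (b ℕ.<? l) (b ℕ.<? t))))
    (≤-trans (≤-reflexive (trans (Σ-+ p _ _) (cong₂ _+_ (Σ-below p (l ⊓ t) (ℕ.≤-trans (ℕ.m⊓n≤m l t) (ℕ.<⇒≤ l<p))) (Σ-above p (l ℕ.+ t))))) (+≤+ count))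
    where
    meet : ∀ b (d : Dec (b ℕ.< l)) (e : Dec (b ℕ.< t)) → [ d ] * [ e ] ≤ [ b ℕ.<? l ⊓ t ]
    meet b (yes h) (yes k) = ≤-reflexive (sym ([]-yes (b ℕ.<? l ⊓ t) (ℕ.⊓-glb h k)))
    meet b (yes h) (no k) = 0≤[] (b ℕ.<? l ⊓ t)
    meet b (no h) e = 0≤[] (b ℕ.<? l ⊓ t)
    p≤2l : p ℕ.≤ l ℕ.+ l
    p≤2l = ℕ.≤-trans (ℕ.≤-reflexive (sym l+l′)) (ℕ.+-monoʳ-≤ l l′≤l)
    count : l ⊓ t ℕ.+ (p ℕ.∸ (l ℕ.+ t)) ℕ.≤ l
    count with ℕ.≤-total t l | ℕ.≤-total p (l ℕ.+ t)
    ... | _ | inj₁ p≤ = ℕ.≤-trans (ℕ.≤-reflexive (trans (cong (l ⊓ t ℕ.+_) (ℕ.m≤n⇒m∸n≡0 p≤)) (ℕ.+-identityʳ (l ⊓ t)))) (ℕ.m⊓n≤m l t)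
    ... | inj₂ l≤t | inj₂ _ = ℕ.≤-trans (ℕ.≤-reflexive (trans (cong (l ⊓ t ℕ.+_) (ℕ.m≤n⇒m∸n≡0 (ℕ.≤-trans p≤2l (ℕ.+-monoʳ-≤ l l≤t)))) (ℕ.+-identityʳ (l ⊓ t)))) (ℕ.m⊓n≤m l t)
    ... | inj₁ t≤l | inj₂ ≤p = ℕ.+-cancelˡ-≤ l _ l (ℕ.≤-trans (ℕ.≤-trans (ℕ.+-monoʳ-≤ l (ℕ.+-monoˡ-≤ _ (ℕ.m⊓n≤n l t))) (ℕ.≤-reflexive (trans (sym (ℕ.+-assoc l t _)) (ℕ.m+[n∸m]≡n ≤p)))) p≤2l)

   -- r β q ≡ n - x - i modulo p, so β runs through all residues as i does. `τ` solves this for i,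
   -- with p′ in the role of -1.
   Σ-β : ∀ x (F : ℕ → ℤ) → Σ p (λ i → F (β (f (x ℕ.+ i)))) ≡ Σ p F
   Σ-β x F = Σ-reindex p (λ i → β (f (x ℕ.+ i))) τ F (λ i → β<p (f (x ℕ.+ i))) (λ b → DM.m%n<n (n ℕ.+ p′ ℕ.* y b) p) to from
    where
    y τ : ℕ → ℕ
    y b = r ℕ.* (b ℕ.* q) ℕ.+ x
    τ b = (n ℕ.+ p′ ℕ.* y b) % p
    p-coarsen : ∀ {a b} → a ≈M.≈ b → a ≈ b
    p-coarsen = Difference.coarsen p′ q M′ (ℕ.*-comm p q)
    spec : ∀ i → r ℕ.* f (x ℕ.+ i) ℕ.+ (x ℕ.+ i) ≈ n
    spec i = p-coarsen (f-spec (x ℕ.+ i))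
    lem : ∀ n m y → n ℕ.+ m ℕ.* y ℕ.+ y ≡ n ℕ.+ y ℕ.* suc m
    lem = ℕ-solve
    lem₂ : ∀ y i → y ℕ.+ i ≡ i ℕ.+ y
    lem₂ = ℕ-solve
    to : ∀ i b → i ℕ.< p → b ℕ.< p → b ≡ β (f (x ℕ.+ i)) → i ≡ τ b
    to i b i<p _ refl = ≈⇒≡ i<p (DM.m%n<n (n ℕ.+ p′ ℕ.* y b) p) (≈-cancel-+ʳ (y b) (≈-trans (≈-trans (≈-reflexive (trans (lem₂ i (y b)) (ℕ.+-assoc (r ℕ.* (b ℕ.* q)) x i)))
     (≈-trans (≈-+ʳ (x ℕ.+ i) (≈-*ˡ r (β*q≈ (f (x ℕ.+ i))))) (spec i))) (≈-trans (≈-sym (≈-kN n (y b))) (≈-trans (≈-reflexive (sym (lem n p′ (y b)))) (≈-+ʳ (y b) (≈-sym (≈-% (n ℕ.+ p′ ℕ.* y b))))))))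
    from : ∀ i b → i ℕ.< p → b ℕ.< p → i ≡ τ b → b ≡ β (f (x ℕ.+ i))
    from i b _ b<p i≡ = β-unique (f (x ℕ.+ i)) b b<p (Residues.cancelˡ p′ {r} (Residues.Unit-inv p′ {r} {w} (p-coarsen rw)) (≈-cancel-+ʳ (x ℕ.+ i) (≈-trans
     (≈-trans (≈-reflexive (trans (sym (ℕ.+-assoc (r ℕ.* (b ℕ.* q)) x i)) (lem₂ (y b) i))) (≈-trans (≈-+ʳ (y b) (≈-trans (≈-reflexive i≡) (≈-% (n ℕ.+ p′ ℕ.* y b)))) (≈-trans (≈-reflexive (lem n p′ (y b))) (≈-kN n (y b))))) (≈-sym (spec i)))))

   blocks : ∀ i → f (q ℕ.+ i) ℕ.+ w ℕ.* q ≈M.≈ f i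
   blocks i = ≈M.cancelˡ {r} (≈M.Unit-inv {r} {w} rw) (AddM.≈-cancel-+ʳ i (≈M.≈-trans (≈M.≈-reflexive (lem r (f (q ℕ.+ i)) w q i))
    (≈M.≈-trans (AddM.≈-+ʳ i (AddM.≈-+ˡ (r ℕ.* f (q ℕ.+ i)) (≈M.≈-*ʳ q rw))) (≈M.≈-trans (≈M.≈-reflexive (lem₂ (r ℕ.* f (q ℕ.+ i)) q i)) (≈M.≈-trans (f-spec (q ℕ.+ i)) (≈M.≈-sym (f-spec i)))))))
    where
    lem : ∀ r f w q i → r ℕ.* (f ℕ.+ w ℕ.* q) ℕ.+ i ≡ r ℕ.* f ℕ.+ r ℕ.* w ℕ.* q ℕ.+ i
    lem = ℕ-solve
    lem₂ : ∀ a q i → a ℕ.+ 1 ℕ.* q ℕ.+ i ≡ a ℕ.+ (q ℕ.+ i)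
    lem₂ = ℕ-solve

   private
    t : ℕ
    t = w % p

    t≤p : t ℕ.≤ p
    t≤p = ℕ.<⇒≤ (DM.m%n<n w p)

    β-shift : ∀ i → β (f (q ℕ.+ i)) ℕ.+ t ≈ β (f i)
    β-shift i = ≈-trans (≈-trans (≈-+ʳ t (β≈ (f (q ℕ.+ i)))) (≈-+ˡ (f (q ℕ.+ i) ℕ.* l) (≈-trans (≈-% w) (≈-trans (≈-reflexive (sym (ℕ.*-identityʳ w))) (≈-trans (≈-*ˡ w (≈-sym ql≈1)) (≈-reflexive (sym (ℕ.*-assoc w q l))))))))
     (≈-trans (≈-reflexive (sym (ℕ.*-distribʳ-+ l (f (q ℕ.+ i)) (w ℕ.* q)))) (≈-trans (≈-*ʳ l (Difference.coarsen p′ q M′ (ℕ.*-comm p q) (blocks i))) (≈-sym (β≈ (f i)))))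

    β-cases : ∀ i → β (f (q ℕ.+ i)) ℕ.+ t ≡ β (f i) ⊎ β (f (q ℕ.+ i)) ℕ.+ t ≡ β (f i) ℕ.+ p
    β-cases i with β (f (q ℕ.+ i)) ℕ.+ t ℕ.<? p
    ... | yes h = inj₁ (≈⇒≡ h (β<p (f i)) (β-shift i))
    ... | no h = inj₂ (trans (sym (ℕ.m∸n+n≡m (ℕ.≮⇒≥ h))) (cong (ℕ._+ p) (≈⇒≡ small (β<p (f i)) (≈-trans (≈-trans (≈-sym (Residues.≈-+N p′ _)) (≈-reflexive (ℕ.m∸n+n≡m (ℕ.≮⇒≥ h)))) (β-shift i)))))
     where
     small : β (f (q ℕ.+ i)) ℕ.+ t ℕ.∸ p ℕ.< p
     small = ℕ.+-cancelʳ-< p _ p (ℕ.≤-<-trans (ℕ.≤-reflexive (ℕ.m∸n+n≡m (ℕ.≮⇒≥ h))) (ℕ.+-mono-< (β<p (f (q ℕ.+ i))) (DM.m%n<n w p)))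

    β-cases⁻ : ∀ i → β (f i) ℕ.+ (p ℕ.∸ t) ≡ β (f (q ℕ.+ i)) ⊎ β (f i) ℕ.+ (p ℕ.∸ t) ≡ β (f (q ℕ.+ i)) ℕ.+ p
    β-cases⁻ i with β-cases i
    ... | inj₁ e = inj₂ (trans (cong (ℕ._+ (p ℕ.∸ t)) (sym e)) (trans (ℕ.+-assoc _ t (p ℕ.∸ t)) (cong (β (f (q ℕ.+ i)) ℕ.+_) (ℕ.m+[n∸m]≡n t≤p))))
    ... | inj₂ e = inj₁ (ℕ.+-cancelʳ-≡ t _ _ (trans (ℕ.+-assoc (β (f i)) (p ℕ.∸ t) t) (trans (cong (β (f i) ℕ.+_) (ℕ.m∸n+n≡m t≤p)) (sym e))))

    γ : ℕ → ℕ
    γ i = proj₁ (offset (f i))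

    o : ∀ i → Offset (f i) (γ i)
    o i = proj₂ (offset (f i)) (f<M i)

    o₁ : ∀ i → Offset (f (q ℕ.+ i)) (γ i)
    o₁ i = subst (Offset (f (q ℕ.+ i))) (offset-unique (≈q.≈-trans (≈q.≈-sym (≈q.≈-kN (f (q ℕ.+ i)) w)) (Difference.coarsen q′ p M′ refl (blocks i))) (o (q ℕ.+ i)) (o i)) (o (q ℕ.+ i))

   -- The opposite sign is obtained by exchanging the two blocks, which replaces the shift t by p -
   -- t.
   upper : l′ ℕ.≤ l → ∣ Σ p (λ i → g (f i) - g (f (q ℕ.+ i))) ∣ ℕ.≤ l
   upper l′≤l = ∣∣-bound
    (≤-trans (Σ-mono p (λ i _ → difference t t≤p (f<M i) (f<M (q ℕ.+ i)) (o i) (o₁ i) (β-cases i))) (≤-trans (≤-reflexive (Σ-β 0 (excess t))) (Σ-excess t l′≤l)))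
    (≤-trans (≤-reflexive negate) (≤-trans (Σ-mono p (λ i _ → difference (p ℕ.∸ t) (ℕ.m∸n≤m p t) (f<M (q ℕ.+ i)) (f<M i) (o₁ i) (o i) (β-cases⁻ i)))
     (≤-trans (≤-reflexive (Σ-β q (excess (p ℕ.∸ t)))) (Σ-excess (p ℕ.∸ t) l′≤l))))
    where
    negate : - Σ p (λ i → g (f i) - g (f (q ℕ.+ i))) ≡ Σ p (λ i → g (f (q ℕ.+ i)) - g (f i))
    negate = trans (cong -_ (Σ-- p (λ i → g (f i)) (λ i → g (f (q ℕ.+ i))))) (trans (lem (Σ p (λ i → g (f i))) (Σ p (λ i → g (f (q ℕ.+ i))))) (sym (Σ-- p (λ i → g (f (q ℕ.+ i))) (λ i → g (f i)))))
     where
     lem : ∀ a b → - (a - b) ≡ b - a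
     lem = solve-∀

   -- The first alternative describes the members up to the boundary l₁ q, the second those beyond
   -- it; multiples of v are added on whichever side avoids subtraction.
   Position : ℕ → ℕ → ℕ → Set
   Position l₁ v i = (∃ λ m → m ℕ.≤ l₁ × f (q ℕ.+ i) ℕ.+ m ℕ.* v ≡ l₁ ℕ.* q) ⊎ (∃ λ j → 1 ℕ.≤ j × j ℕ.≤ l′ × f (q ℕ.+ i) ≡ l₁ ℕ.* q ℕ.+ j ℕ.* v)

   -- The second block is spread by steps of v around the window boundary T, so that exactly its
   -- l low members count; the first block, t q further on, contributes nothing.
   module Extremal (l₁ s v : ℕ) (l≡ : l ≡ suc l₁) (1≤s : 1 ℕ.≤ s) (1≤v : 1 ℕ.≤ v) (q≡ : q ≡ v ℕ.+ s ℕ.* p) (l′≤l : l′ ℕ.≤ l)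
    (steps : l₁ ℕ.* (s ℕ.* p) ℕ.≤ l′ ℕ.* q) (l+t≤p : l ℕ.+ w % p ℕ.≤ p) (jump : l₁ ℕ.* v ℕ.< w % p ℕ.* q)
    (T≡ : T ≡ l₁ ℕ.* q) (position : ∀ i → i ℕ.< p → Position l₁ v i) where

    private
     l₁<l : l₁ ℕ.< l
     l₁<l = ℕ.≤-reflexive (sym l≡)

     g-beyond : ∀ k → l₁ ℕ.* q ℕ.< k → g k ≡ 0ℤ
     g-beyond k h = cong (_* c k) ([]-no (k ℕ.≤? T) (ℕ.<⇒≱ (subst (ℕ._< k) (sym T≡) h)))

     first-≈ : ∀ i → f (q ℕ.+ i) ℕ.+ t ℕ.* q ≈M.≈ f i
     first-≈ i = ≈M.≈-trans (AddM.≈-+ˡ (f (q ℕ.+ i)) (≈M.≈-trans (≈M.≈-sym (≈M.≈-kN (t ℕ.* q) (w ℕ./ p)))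
      (≈M.≈-reflexive (trans (lem t q (w ℕ./ p) p) (cong (ℕ._* q) (sym (DM.m≡m%n+[m/n]*n w p))))))) (blocks i)
      where
      lem : ∀ t q k p → t ℕ.* q ℕ.+ k ℕ.* (p ℕ.* q) ≡ (t ℕ.+ k ℕ.* p) ℕ.* q
      lem = ℕ-solve

     first-< : ∀ i → f (q ℕ.+ i) ℕ.+ t ℕ.* q ℕ.< M → f i ≡ f (q ℕ.+ i) ℕ.+ t ℕ.* q
     first-< i h = sym (AddM.≈⇒≡ h (f<M i) (first-≈ i))

     first-≥ : ∀ i → M ℕ.≤ f (q ℕ.+ i) ℕ.+ t ℕ.* q → f i ℕ.+ M ≡ f (q ℕ.+ i) ℕ.+ t ℕ.* q
     first-≥ i h = trans (cong (ℕ._+ M) (sym (AddM.≈⇒≡ small (f<M i) (≈M.≈-trans (≈M.≈-sym (≈M.≈-+N _)) (≈M.≈-trans (≈M.≈-reflexive (ℕ.m∸n+n≡m h)) (first-≈ i)))))) (ℕ.m∸n+n≡m h)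
      where
      small : f (q ℕ.+ i) ℕ.+ t ℕ.* q ℕ.∸ M ℕ.< M
      small = ℕ.+-cancelʳ-< M _ M (ℕ.≤-<-trans (ℕ.≤-reflexive (ℕ.m∸n+n≡m h)) (ℕ.+-mono-< (f<M (q ℕ.+ i)) (ℕ.*-monoˡ-< q (DM.m%n<n w p))))

    -- In the first alternative k = (l₁ - m) q + m s p, so β k = l₁ - m is low and the offset m s p
    -- is at most l′ q: g k = 1, while the partner t q further on is past T. In the second, k is
    -- past T with β k = l₁ + j high. Its partner is past T as well, or after reduction modulo M
    -- lies below β q with low β, where the coefficient is 0.
    pointwise : ∀ i → Position l₁ v i → g (f i) - g (f (q ℕ.+ i)) ≤ - [ β (f (q ℕ.+ i)) ℕ.<? l ]
    pointwise i (inj₁ (m , m≤l₁ , e)) = subst₂ (λ x y → x - y ≤ - [ β k ℕ.<? l ]) (sym first) (sym second) (neg-mono-≤ ([]≤1 (β k ℕ.<? l)))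
     where
     k b : ℕ
     k = f (q ℕ.+ i)
     b = l₁ ℕ.∸ m
     b+m : b ℕ.+ m ≡ l₁
     b+m = ℕ.m∸n+n≡m m≤l₁
     b≤l₁ : b ℕ.≤ l₁
     b≤l₁ = ℕ.m∸n≤m l₁ m
     k≡ : k ≡ b ℕ.* q ℕ.+ m ℕ.* (s ℕ.* p)
     k≡ = ℕ.+-cancelʳ-≡ (m ℕ.* v) k _ (trans e (trans (cong (ℕ._* q) (sym b+m)) (trans (ℕ.*-distribʳ-+ q b m) (trans (cong (λ x → b ℕ.* q ℕ.+ m ℕ.* x) q≡) (lem (b ℕ.* q) m v (s ℕ.* p))))))
      where
      lem : ∀ a m v x → a ℕ.+ m ℕ.* (v ℕ.+ x) ≡ a ℕ.+ m ℕ.* x ℕ.+ m ℕ.* v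
      lem = ℕ-solve
     βk : b ≡ β k
     βk = β-unique k b (ℕ.≤-<-trans b≤l₁ (ℕ.<-trans l₁<l l<p)) (≈-trans (≈-sym (≈-kN (b ℕ.* q) (m ℕ.* s))) (≈-reflexive (trans (cong (b ℕ.* q ℕ.+_) (ℕ.*-assoc m s p)) (sym k≡))))
     k≤T : k ℕ.≤ l₁ ℕ.* q
     k≤T = ℕ.≤-trans (ℕ.m≤m+n k (m ℕ.* v)) (ℕ.≤-reflexive e)
     second : g k ≡ 1ℤ
     second = cong₂ _*_ ([]-yes (k ℕ.≤? T) (subst (k ℕ.≤_) (sym T≡) k≤T)) (trans (c-low k (subst (ℕ._< l) βk (ℕ.≤-<-trans b≤l₁ l₁<l)))
      (cong₂ _*_ ([]-yes (β k ℕ.* q ℕ.≤? k) (subst (λ x → x ℕ.* q ℕ.≤ k) βk (ℕ.≤-trans (ℕ.m≤m+n (b ℕ.* q) _) (ℕ.≤-reflexive (sym k≡)))))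
       ([]-yes (k ℕ.≤? (β k ℕ.+ l′) ℕ.* q) (subst (λ x → k ℕ.≤ (x ℕ.+ l′) ℕ.* q) βk (ℕ.≤-trans (ℕ.≤-reflexive k≡) (ℕ.≤-trans (ℕ.+-monoʳ-≤ (b ℕ.* q) (ℕ.≤-trans (ℕ.*-monoˡ-≤ (s ℕ.* p) m≤l₁) steps)) (ℕ.≤-reflexive (sym (ℕ.*-distribʳ-+ q b l′)))))))))
     first : g (f i) ≡ 0ℤ
     first = g-beyond (f i) (ℕ.<-≤-trans (ℕ.≤-<-trans (ℕ.≤-reflexive (sym e)) (ℕ.+-monoʳ-< k (ℕ.≤-<-trans (ℕ.*-monoˡ-≤ v m≤l₁) jump))) (ℕ.≤-reflexive (sym (first-< i
      (ℕ.≤-<-trans (ℕ.+-monoˡ-≤ (t ℕ.* q) k≤T) (ℕ.≤-<-trans (ℕ.≤-reflexive (sym (ℕ.*-distribʳ-+ q l₁ t))) (ℕ.*-monoˡ-< q (ℕ.<-≤-trans (ℕ.+-monoˡ-< t l₁<l) l+t≤p))))))))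
    pointwise i (inj₂ (j , 1≤j , j≤l′ , e)) = subst₂ (λ x y → g (f i) - x ≤ - y) (sym second) (sym ([]-no (β k ℕ.<? l) (ℕ.≤⇒≯ (subst (l ℕ.≤_) βk l≤b)))) (≤-trans (≤-reflexive (+-identityʳ (g (f i)))) (≤-reflexive (first (f (q ℕ.+ i) ℕ.+ t ℕ.* q ℕ.<? M))))
     where
     k b : ℕ
     k = f (q ℕ.+ i)
     b = l₁ ℕ.+ j
     l≤b : l ℕ.≤ b
     l≤b = ℕ.≤-trans (ℕ.≤-reflexive (trans l≡ (ℕ.+-comm 1 l₁))) (ℕ.+-monoʳ-≤ l₁ 1≤j)
     b<p : b ℕ.< p
     b<p = ℕ.<-≤-trans (ℕ.+-mono-<-≤ l₁<l j≤l′) (ℕ.≤-reflexive l+l′)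
     k≡ : k ℕ.+ j ℕ.* s ℕ.* p ≡ b ℕ.* q
     k≡ = trans (cong (ℕ._+ j ℕ.* s ℕ.* p) e) (trans (lem (l₁ ℕ.* q) j v s p) (trans (cong (λ x → l₁ ℕ.* q ℕ.+ j ℕ.* x) (sym q≡)) (sym (ℕ.*-distribʳ-+ q l₁ j))))
      where
      lem : ∀ a j v s p → a ℕ.+ j ℕ.* v ℕ.+ j ℕ.* s ℕ.* p ≡ a ℕ.+ j ℕ.* (v ℕ.+ s ℕ.* p)
      lem = ℕ-solve
     βk : b ≡ β k
     βk = β-unique k b b<p (≈-trans (≈-reflexive (sym k≡)) (≈-kN k (j ℕ.* s)))
     T<k : l₁ ℕ.* q ℕ.< k
     T<k = ℕ.<-≤-trans (ℕ.m<m+n (l₁ ℕ.* q) (ℕ.*-mono-≤ 1≤j 1≤v)) (ℕ.≤-reflexive (sym e))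
     second : g k ≡ 0ℤ
     second = g-beyond k T<k
     first : Dec (k ℕ.+ t ℕ.* q ℕ.< M) → g (f i) ≡ 0ℤ
     first (yes h) = g-beyond (f i) (ℕ.<-≤-trans T<k (ℕ.≤-trans (ℕ.m≤m+n k (t ℕ.* q)) (ℕ.≤-reflexive (sym (first-< i h)))))
     first (no h) = trans (cong ([ f i ℕ.≤? T ] *_) c≡0) (*-zeroʳ [ f i ℕ.≤? T ])
      where
      a : ℕ
      a = b ℕ.+ t ℕ.∸ p
      sum : f i ℕ.+ j ℕ.* s ℕ.* p ℕ.+ M ≡ (b ℕ.+ t) ℕ.* q
      sum = trans (lem (f i) (j ℕ.* s ℕ.* p) M) (trans (cong (ℕ._+ j ℕ.* s ℕ.* p) (first-≥ i (ℕ.≮⇒≥ h))) (trans (lem k (t ℕ.* q) (j ℕ.* s ℕ.* p)) (trans (cong (ℕ._+ t ℕ.* q) k≡) (sym (ℕ.*-distribʳ-+ q b t)))))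
       where
       lem : ∀ a b c → a ℕ.+ b ℕ.+ c ≡ a ℕ.+ c ℕ.+ b
       lem = ℕ-solve
      p≤b+t : p ℕ.≤ b ℕ.+ t
      p≤b+t = ℕ.*-cancelʳ-≤ p (b ℕ.+ t) q (ℕ.≤-trans (ℕ.m≤n+m M _) (ℕ.≤-reflexive sum))
      a+p : a ℕ.+ p ≡ b ℕ.+ t
      a+p = ℕ.m∸n+n≡m p≤b+t
      a≡ : f i ℕ.+ j ℕ.* s ℕ.* p ≡ a ℕ.* q
      a≡ = ℕ.+-cancelʳ-≡ M _ _ (trans sum (trans (cong (ℕ._* q) (sym a+p)) (ℕ.*-distribʳ-+ q a p)))
      a<t : a ℕ.< t
      a<t = ℕ.+-cancelʳ-< p a t (ℕ.≤-<-trans (ℕ.≤-reflexive a+p) (ℕ.<-≤-trans (ℕ.+-monoˡ-< t b<p) (ℕ.≤-reflexive (ℕ.+-comm p t))))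
      a<l : a ℕ.< l
      a<l = ℕ.<-≤-trans a<t (ℕ.≤-trans (ℕ.+-cancelˡ-≤ l t l′ (ℕ.≤-trans l+t≤p (ℕ.≤-reflexive (sym l+l′)))) l′≤l)
      βf : a ≡ β (f i)
      βf = β-unique (f i) a (ℕ.<-trans a<l l<p) (≈-trans (≈-reflexive (sym a≡)) (≈-kN (f i) (j ℕ.* s)))
      f<aq : f i ℕ.< a ℕ.* q
      f<aq = ℕ.<-≤-trans (ℕ.m<m+n (f i) (ℕ.*-mono-≤ (ℕ.*-mono-≤ 1≤j 1≤s) (s≤s z≤n))) (ℕ.≤-reflexive a≡)
      c≡0 : c (f i) ≡ 0ℤ
      c≡0 = trans (c-low (f i) (subst (ℕ._< l) βf a<l)) (cong (_* [ f i ℕ.≤? (β (f i) ℕ.+ l′) ℕ.* q ])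
       ([]-no (β (f i) ℕ.* q ℕ.≤? f i) (ℕ.<⇒≱ (subst (λ x → f i ℕ.< x ℕ.* q) βf f<aq))))

    extremal : l ℕ.≤ ∣ Σ p (λ i → g (f i) - g (f (q ℕ.+ i))) ∣
    extremal = ≤-∣∣ (≤-trans (Σ-mono p (λ i i<p → pointwise i (position i i<p))) (≤-reflexive (trans negate (cong -_ (trans (Σ-β q (λ b → [ b ℕ.<? l ])) (Σ-below p l (ℕ.<⇒≤ l<p)))))))
     where
     negate : Σ p (λ i → - [ β (f (q ℕ.+ i)) ℕ.<? l ]) ≡ - Σ p (λ i → [ β (f (q ℕ.+ i)) ℕ.<? l ])
     negate = trans (Σ-cong p (λ i _ → sym (-1*i≡-i [ β (f (q ℕ.+ i)) ℕ.<? l ]))) (trans (Σ-*ˡ p (- 1ℤ) _) (-1*i≡-i _))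
     ≤-∣∣ : ∀ {a n} → a ≤ - (ℤ.+ n) → n ℕ.≤ ∣ a ∣
     ≤-∣∣ {a} {n} h = subst (n ℕ.≤_) (∣-i∣≡∣i∣ a) (go (- a) (subst (_≤ - a) (neg-involutive (ℤ.+ n)) (neg-mono-≤ h)))
      where
      go : ∀ x → ℤ.+ n ≤ x → n ℕ.≤ ∣ x ∣
      go (ℤ.+ x) h = drop‿+≤+ h

  A-upper : l′ ℕ.≤ l → A (p ℕ.* q ℕ.* r) ℕ.≤ l
  A-upper l′≤l = height-≤ (cyclotomic (p ℕ.* q ℕ.* r)) l (λ i i< → subst (λ x → ∣ x ∣ ℕ.≤ l) (sym (trans (rc-pqr i i<) (Coefficient.kaplan i))) (Coefficient.upper i l′≤l))

  A-lower : ∀ n → n ℕ.≤ p′ ℕ.* q′ ℕ.* r′ → l ℕ.≤ ∣ Σ p (λ i → Coefficient.g n (Coefficient.f n i) - Coefficient.g n (Coefficient.f n (q ℕ.+ i))) ∣ → l ℕ.≤ A (p ℕ.* q ℕ.* r)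
  A-lower n n≤ h = ℕ.≤-trans (subst (λ x → l ℕ.≤ ∣ x ∣) (sym (trans (rc-pqr n n<) (Coefficient.kaplan n))) h) (≤-height (cyclotomic (p ℕ.* q ℕ.* r)) n n<)
   where
   n< = subst (n ℕ.<_) (sym length-pqr) (s≤s n≤)

-- Choice of r, and the theorem.

module Final where

 open import Defs
 open Kaplan using (module Additive)
 open Upper
 open Dirichlet using (dirichlet)
 open Periodic using (module Residues)
 open NatLog using (prime≥2)
 open import Data.Nat using (_+_; _*_; _∸_; _≤_; _<_; _%_; _/_)
 open import Data.Nat.Properties
 open import Data.Nat.Divisibility using (_∣_; divides; ∣-trans; ∣⇒≤; ∣m∣n⇒∣m+n; ∣m+n∣m⇒∣n; ∣n⇒∣m*n; m%n≡0⇒n∣m)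
 open import Data.Nat.Coprimality using (Coprime; coprime-divisor; prime⇒coprime) renaming (sym to coprime-sym)
 open import Data.Nat.Primality using (Prime; prime⇒irreducible)
 open import Data.Nat.Tactic.RingSolver using (solve-∀)
 import Data.Integer as ℤ
 open import Data.Integer.Properties using (m-n≡m⊖n; ⊖-≥)
 open import Data.Integer.Divisibility using () renaming (_∣_ to _∣ℤ_)

 module Attained (p′ q′ : ℕ) (pp : Prime (suc p′)) (qp : Prime (suc q′)) (p<q : p′ < q′)
  (l₁ g : ℕ) (p≡ : suc p′ ≡ suc l₁ + g) (1≤g : 1 ≤ g) (g≤l : g ≤ suc l₁)
  (ql≈1 : Residues._≈_ p′ (suc q′ * suc l₁) 1)
  (s v : ℕ) (1≤s : 1 ≤ s) (1≤v : 1 ≤ v) (q≡ : suc q′ ≡ v + s * suc p′) (steps : l₁ * (s * suc p′) ≤ g * suc q′) where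

  p q l M′ M : ℕ
  p = suc p′
  q = suc q′
  l = suc l₁
  M′ = q′ + p′ * q
  M = suc M′

  open Residues M′
  open Additive M′

  l<p : l < p
  l<p = ≤-trans (m<m+n l 1≤g) (≤-reflexive (sym p≡))

  l′≡g : p ∸ l ≡ g
  l′≡g = trans (cong (_∸ l) p≡) (m+n∸m≡n l g)

  -- The congruence for i that makes f (q + i) satisfy `Position`. It comes from r f + (q + i) ≡ n
  -- with n = r l₁ q + q + x.
  Shift : ℕ → ℕ → ℕ → Set
  Shift r x i = (∃ λ m → m ≤ l₁ × i ≈ r * (m * v) + x) ⊎ (∃ λ j → 1 ≤ j × j ≤ g × r * (j * v) + i ≈ x)

  attain : ∀ w x → Unit w → l + w % p ≤ p → l₁ * v < w % p * q → x ≤ p → (∀ r → r * w ≈ 1 → ∀ i → i < p → Shift r x i) →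
   ∃[ r ] (Prime r × q < r × A (p * q * r) ≡ l)
  attain w x uw l+t≤p jump x≤p shift = choose (inverse w uw)
   where
   R T₀ y : ℕ
   -- r > q + x makes n / r equal to l₁ q, and r > p′ q′ helps to keep n within the degree p′ q′ r′.
   R = p′ * q′ + (q + x)
   T₀ = l₁ * q
   y = q + x

   choose : (∃ λ a → w * a ≈ 1) → ∃[ r ] (Prime r × q < r × A (p * q * r) ≡ l)
   choose (a , wa) = build (dirichlet M′ a (Unit-inv {a} {w} (≈-trans (≈-reflexive (*-comm a w)) wa)) R)
    where
    build : (∃ λ r → Prime r × R < r × r ≈ a) → ∃[ r ] (Prime r × q < r × A (p * q * r) ≡ l)
    build (suc r′ , rp , R<r , r≈a) = suc r′ , rp , q<r , ≤-antisym (A-upper l′≤l) (A-lower n n≤ (Coefficient.Extremal.extremal n l₁ s v refl 1≤s 1≤v q≡ l′≤l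
      (subst (λ e → l₁ * (s * p) ≤ e * q) (sym l′≡g) steps) l+t≤p jump T≡ positions))
     where
     r : ℕ
     r = suc r′
     rw : r * w ≈ 1
     rw = ≈-trans (≈-*ʳ w r≈a) (≈-trans (≈-reflexive (*-comm a w)) wa)
     y<r : y < r
     y<r = ≤-<-trans (m≤n+m y (p′ * q′)) R<r
     q<r : q < r
     q<r = ≤-<-trans (m≤m+n q x) y<r
     open Window p′ q′ pp qp p<q l l<p (s≤s z≤n) ql≈1 r′ rp (≤-pred q<r) w rw using (A-upper; A-lower; module Coefficient)
     l′≤l : p ∸ l ≤ l
     l′≤l = ≤-trans (≤-reflexive l′≡g) g≤l
     n : ℕ
     n = r * T₀ + y
     open Coefficient n using (Position; f-unique)
     T≡ : n / r ≡ T₀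
     T≡ = trans (DM.+-distrib-/-∣ˡ y (divides T₀ (*-comm r T₀))) (trans (cong₂ _+_ (trans (cong (_/ r) (*-comm r T₀)) (DM.m*n/n≡m T₀ r)) (DM.m<n⇒m/n≡0 y<r)) (+-identityʳ T₀))
     p′≡ : p′ ≡ l₁ + g
     p′≡ = suc-injective p≡
     room : T₀ + 2 ≤ p′ * q′
     room = +-cancelˡ-≤ p′ _ _ (begin
      p′ + (T₀ + 2) ≡⟨ lem p′ T₀ ⟩
      T₀ + suc (suc p′) ≤⟨ +-monoʳ-≤ T₀ (s≤s p<q) ⟩
      T₀ + q ≤⟨ +-monoʳ-≤ T₀ (m≤n*m q g {{ℕ.>-nonZero 1≤g}}) ⟩
      T₀ + g * q ≡⟨ *-distribʳ-+ q l₁ g ⟨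
      (l₁ + g) * q ≡⟨ cong (_* q) p′≡ ⟨
      p′ * q ≡⟨ *-suc p′ q′ ⟩
      p′ + p′ * q′ ∎)
      where
      open ≤-Reasoning
      lem : ∀ a b → a + (b + 2) ≡ b + suc (suc a)
      lem = solve-∀
     n≤ : n ≤ p′ * q′ * r′
     n≤ = +-cancelˡ-≤ (p′ * q′) _ _ (begin
      p′ * q′ + (r * T₀ + y) ≤⟨ +-mono-≤ (≤-trans (m≤m+n (p′ * q′) y) (<⇒≤ R<r)) (+-monoʳ-≤ (r * T₀) (<⇒≤ y<r)) ⟩
      r + (r * T₀ + r) ≡⟨ lem r T₀ ⟩
      (T₀ + 2) * r ≤⟨ *-monoˡ-≤ r room ⟩
      p′ * q′ * r ≡⟨ *-suc (p′ * q′) r′ ⟩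
      p′ * q′ + p′ * q′ * r′ ∎)
      where
      open ≤-Reasoning
      lem : ∀ r a → r + (r * a + r) ≡ (a + 2) * r
      lem = solve-∀
     v≤q : v ≤ q
     v≤q = ≤-trans (m≤m+n v (s * p)) (≤-reflexive (sym q≡))
     place : ∀ i → Shift r x i → Position l₁ v i
     place i (inj₁ (m , m≤l₁ , h)) = inj₁ (m , m≤l₁ , trans (cong (_+ m * v) (sym (f-unique (q + i) k k<M (≈-trans (≈-+ˡ (r * k) (≈-+ˡ q h))
       (≈-reflexive (trans (lem r k (m * v) q x) (cong (λ e → r * e + y) k+))))))) k+)
      where
      k : ℕ
      k = T₀ ∸ m * v
      k+ : k + m * v ≡ T₀
      k+ = m∸n+n≡m (*-mono-≤ m≤l₁ v≤q)
      k<M : k < M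
      k<M = ≤-<-trans (m∸n≤m T₀ (m * v)) (*-monoˡ-< q (<-trans (n<1+n l₁) l<p))
      lem : ∀ r k e q x → r * k + (q + (r * e + x)) ≡ r * (k + e) + (q + x)
      lem = solve-∀
     place i (inj₂ (j , 1≤j , j≤g , h)) = inj₂ (j , 1≤j , ≤-trans j≤g (≤-reflexive (sym l′≡g)) , sym (f-unique (q + i) k k<M (≈-trans (≈-reflexive (lem r T₀ (j * v) q i)) (≈-+ˡ (r * T₀) (≈-+ˡ q h)))))
      where
      k : ℕ
      k = T₀ + j * v
      k<M : k < M
      k<M = ≤-<-trans (+-monoʳ-≤ T₀ (*-mono-≤ j≤g v≤q)) (≤-<-trans (≤-reflexive (sym (*-distribʳ-+ q l₁ g))) (*-monoˡ-< q (≤-reflexive (sym p≡))))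
      lem : ∀ r a b q i → r * (a + b) + (q + i) ≡ r * a + (q + (r * b + i))
      lem = solve-∀
     positions : ∀ i → i < p → Position l₁ v i
     positions i i<p = place i (shift r rw i i<p)

  private
   scale : ∀ r m → r * (m * v) ≡ m * (r * v)
   scale r m = lem r m v
    where
    lem : ∀ r m v → r * (m * v) ≡ m * (r * v)
    lem = solve-∀

  -- For 1/r ≡ v the second block satisfies T - f (q + i) ≡ (i - g) v, and i - g runs from -g to l₁:
  -- exactly l members lie at or before the boundary.
  attain-plus : Unit v → l + q % p ≤ p → l₁ * v < q % p * q → ∃[ r ] (Prime r × q < r × A (p * q * r) ≡ l)
  attain-plus uv l+t≤p jump = attain v g uv (subst (λ t → l + t ≤ p) (sym v%p) l+t≤p) (subst (λ t → l₁ * v < t * q) (sym v%p) jump) (≤-trans g≤l (<⇒≤ l<p)) shift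
   where
   v%p : v % p ≡ q % p
   v%p = trans (sym (DM.[m+kn]%n≡m%n v s p)) (cong (_% p) (sym q≡))
   shift : ∀ r → r * v ≈ 1 → ∀ i → i < p → Shift r g i
   shift r rv i i<p with ≤-total g i
   ... | inj₁ g≤i = inj₁ (i ∸ g , +-cancelʳ-≤ g _ l₁ (≤-trans (≤-reflexive (m∸n+n≡m g≤i)) (≤-trans (≤-pred i<p) (≤-reflexive (suc-injective p≡)))) ,
       ≈-sym (≈-trans (≈-+ʳ g (≈-trans (≈-reflexive (scale r (i ∸ g))) (≈-*ˡ (i ∸ g) rv))) (≈-reflexive (trans (cong (_+ g) (*-identityʳ (i ∸ g))) (m∸n+n≡m g≤i)))))
   ... | inj₂ i≤g with g ≤? i
   ... | yes g≤i = inj₁ (0 , z≤n , ≈-reflexive (trans (≤-antisym i≤g g≤i) (cong (_+ g) (sym (*-zeroʳ r)))))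
   ... | no g≰i = inj₂ (g ∸ i , m<n⇒0<n∸m (≰⇒> g≰i) , m∸n≤m g i ,
       ≈-trans (≈-+ʳ i (≈-trans (≈-reflexive (scale r (g ∸ i))) (≈-*ˡ (g ∸ i) rv))) (≈-reflexive (trans (cong (_+ i) (*-identityʳ (g ∸ i))) (m∸n+n≡m i≤g))))

  -- For 1/r ≡ -v the block is traversed backwards: T - f (q + i) ≡ (l₁ - i) v, so the offset x is
  -- l₁ and l₁ - i runs from l₁ down to -g.
  attain-minus : Unit v → 1 ≤ q % p → l + (p ∸ q % p) ≤ p → l₁ * v < (p ∸ q % p) * q → ∃[ r ] (Prime r × q < r × A (p * q * r) ≡ l)
  attain-minus uv 1≤ρ l+t≤p jump = attain w l₁ uw (subst (λ t → l + t ≤ p) (sym w%p) l+t≤p) (subst (λ t → l₁ * v < t * q) (sym w%p) jump) (≤-trans (n≤1+n l₁) (<⇒≤ l<p)) shift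
   where
   w : ℕ
   w = M ∸ v
   v≤M : v ≤ M
   v≤M = ≤-trans (≤-trans (m≤m+n v (s * p)) (≤-reflexive (sym q≡))) (m≤m+n q (p′ * q))
   w+v : w + v ≡ M
   w+v = m∸n+n≡m v≤M
   uw : Unit w
   uw {i} (i∣w , i∣M) = uv (∣m+n∣m⇒∣n (subst (i ∣_) (sym w+v) i∣M) i∣w , i∣M)
   module P = Residues p′
   module Addp = Additive p′
   w%p : w % p ≡ p ∸ q % p
   w%p = trans (P.remainder (Addp.≈-cancel-+ʳ q (P.≈-trans w+q≈0 (P.≈-sym t+q≈0)))) (DM.m<n⇒m%n≡m (∸-monoʳ-< 1≤ρ (<⇒≤ (DM.m%n<n q p))))
    where
    w+q≈0 : w + q P.≈ 0
    w+q≈0 = P.≈-trans (P.≈-reflexive (trans (cong (w +_) q≡) (trans (sym (+-assoc w v (s * p))) (trans (cong (_+ s * p) w+v) (lem p q s))))) (P.≈-kN 0 (q + s))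
     where
     lem : ∀ p q s → p * q + s * p ≡ 0 + (q + s) * p
     lem = solve-∀
    t+q≈0 : p ∸ q % p + q P.≈ 0
    t+q≈0 = P.≈-trans (Addp.≈-+ˡ (p ∸ q % p) (P.≈-sym (Addp.≈-% q))) (P.≈-trans (P.≈-reflexive (trans (m∸n+n≡m (<⇒≤ (DM.m%n<n q p))) (sym (*-identityˡ p)))) (P.≈-kN 0 1))
   shift : ∀ r → r * w ≈ 1 → ∀ i → i < p → Shift r l₁ i
   shift r rw i i<p = cases (i ≤? l₁)
    where
    cancel : ∀ m → r * (m * v) + m ≈ 0
    cancel m = ≈-trans (≈-reflexive (lem r m v)) (≈-trans (≈-*ˡ m (≈-trans (≈-+ˡ (r * v) (≈-sym rw)) (≈-trans (≈-reflexive (trans (lem′ r v w) (trans (cong (r *_) w+v) refl))) (≈-kN 0 r)))) (≈-reflexive (*-zeroʳ m)))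
     where
     lem : ∀ r m v → r * (m * v) + m ≡ m * (r * v + 1)
     lem = solve-∀
     lem′ : ∀ r v w → r * v + r * w ≡ r * (w + v)
     lem′ = solve-∀
    cases : Dec (i ≤ l₁) → Shift r l₁ i
    cases (yes i≤l₁) = inj₁ (l₁ ∸ i , m∸n≤m l₁ i , ≈-sym (≈-trans (≈-reflexive (trans (cong (r * ((l₁ ∸ i) * v) +_) (sym (m∸n+n≡m i≤l₁))) (sym (+-assoc _ (l₁ ∸ i) i)))) (≈-+ʳ i (cancel (l₁ ∸ i)))))
    cases (no i≰l₁) = inj₂ (i ∸ l₁ , m<n⇒0<n∸m (≰⇒> i≰l₁) , +-cancelˡ-≤ l₁ _ g (≤-trans (≤-reflexive (m+[n∸m]≡n l₁≤i)) (≤-trans (≤-pred i<p) (≤-reflexive (suc-injective p≡)))) ,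
      ≈-trans (≈-reflexive (trans (cong (r * ((i ∸ l₁) * v) +_) (sym (m∸n+n≡m l₁≤i))) (sym (+-assoc _ (i ∸ l₁) l₁)))) (≈-+ʳ l₁ (cancel (i ∸ l₁))))
     where
     l₁≤i = <⇒≤ (≰⇒> i≰l₁)

 -- For the odd number L of the theorem, m = L + 2 is written 3 + 2 h and p = m + 2 g. Then `l` is λ
 -- = m + g, its complement p - λ is g, and no halves remain.
 module Core (p′ q′ : ℕ) (pp : Prime (suc p′)) (qp : Prime (suc q′)) (p<q : p′ < q′) (h g : ℕ)
  (p≡ : suc p′ ≡ (3 + (2 * h + g)) + g) (1≤g : 1 ≤ g) (large : (3 + 2 * h) * (2 + 2 * h) + 3 ≤ suc p′)
  (q-large : (2 + (2 * h + g)) * suc p′ ≤ suc q′) (mq≈2 : Residues._≈_ p′ ((3 + 2 * h) * suc q′) 2) where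

  p q m l₁ l : ℕ
  p = suc p′
  q = suc q′
  m = 3 + 2 * h
  l₁ = 2 + (2 * h + g)
  l = suc l₁

  open Residues p′
  open Additive p′

  private
   below-p : ∀ {a} → a ≤ m * (2 + 2 * h) + 2 → a < p
   below-p h′ = ≤-<-trans h′ (≤-trans (≤-reflexive (sym (+-suc (m * (2 + 2 * h)) 2))) large)

   m+g : m + g ≡ l
   m+g = lem h g
    where
    lem : ∀ h g → 3 + 2 * h + g ≡ 3 + (2 * h + g)
    lem = solve-∀

   coprime-pq : Coprime p q
   coprime-pq = coprime-sym (prime⇒coprime qp (s≤s p<q))

  -- 2 q l = q (m + p) ≡ m q ≡ 2, and 2 is invertible modulo the odd prime p.
  ql≈1 : q * l ≈ 1
  ql≈1 = cancelˡ {2} (coprime-sym (prime⇒coprime pp 2<p)) (≈-trans (≈-reflexive (trans (lem q h g) (cong (λ t → m * q + q * t) (sym p≡)))) (≈-trans (≈-kN (m * q) q) mq≈2))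
   where
   2<p : 2 < p
   2<p = below-p (m≤n+m 2 (m * (2 + 2 * h)))
   lem : ∀ q h g → 2 * (q * (3 + (2 * h + g))) ≡ (3 + 2 * h) * q + q * (3 + (2 * h + g) + g)
   lem = solve-∀

  g<l₁ : g < l₁
  g<l₁ = s≤s (≤-trans (m≤n+m g (2 * h)) (n≤1+n (2 * h + g)))

  g≤l : g ≤ l
  g≤l = ≤-trans (<⇒≤ g<l₁) (n≤1+n l₁)

  upper : ∀ r → Prime r → q < r → A (p * q * r) ≤ l
  upper zero _ ()
  upper (suc r′) rp (s≤s q<r) = bound (Residues.inverse (q′ + p′ * q) (suc r′) ur)
   where
   module RM = Residues (q′ + p′ * q)
   ur : RM.Unit (suc r′)
   ur {i} (i∣r , i∣M) with prime⇒irreducible rp i∣r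
   ... | inj₁ e = e
   ... | inj₂ refl = ⊥-elim (over (prime-∤-* i∣M))
    where
    over : suc r′ ∣ q → ⊥
    over d = <⇒≱ (s≤s q<r) (∣⇒≤ d)
    prime-∤-* : suc r′ ∣ p * q → suc r′ ∣ q
    prime-∤-* = coprime-divisor (prime⇒coprime rp (<-trans (s≤s p<q) (s≤s q<r)))
   bound : (∃ λ w → suc r′ * w RM.≈ 1) → A (p * q * suc r′) ≤ l
   bound (w , rw) = Window.A-upper p′ q′ pp qp p<q l (≤-trans (m<m+n l 1≤g) (≤-reflexive (sym p≡))) (s≤s z≤n) ql≈1 r′ rp q<r w rw
    (≤-trans (≤-reflexive (trans (cong (_∸ l) p≡) (m+n∸m≡n l g))) g≤l)

  private
   ρ d s v : ℕ
   ρ = q % p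
   d = l₁ * p
   -- The largest s with l₁ s p ≤ g q, as `steps` demands; it makes v = q - s p as small as
   -- possible.
   s = (q * g) / d
   v = q ∸ s * p

   mρ≈2 : m * ρ ≈ 2
   mρ≈2 = ≈-trans (≈-*ˡ m (≈-% q)) mq≈2

   1≤s : 1 ≤ s
   1≤s = DM.m≥n⇒m/n>0 (≤-trans q-large (m≤m*n q g {{ℕ.>-nonZero 1≤g}}))

   sd≤qg : s * d ≤ q * g
   sd≤qg = DM.m/n*n≤m (q * g) d

   qg< : q * g < d + s * d
   qg< = ≤-<-trans (≤-reflexive (DM.m≡m%n+[m/n]*n (q * g) d)) (+-monoˡ-< (s * d) (DM.m%n<n (q * g) d))

   lsp : l₁ * (s * p) ≡ s * d
   lsp = lem l₁ s p
    where
    lem : ∀ a b c → a * (b * c) ≡ b * (a * c)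
    lem = solve-∀

   sp<q : s * p < q
   sp<q = *-cancelˡ-< l₁ (s * p) q (≤-<-trans (≤-reflexive lsp) (≤-<-trans sd≤qg (<-≤-trans (*-monoʳ-< q g<l₁) (≤-reflexive (*-comm q l₁)))))

   q≡ : q ≡ v + s * p
   q≡ = sym (m∸n+n≡m (<⇒≤ sp<q))

   1≤v : 1 ≤ v
   1≤v = m<n⇒0<n∸m sp<q

   steps : l₁ * (s * p) ≤ g * q
   steps = ≤-trans (≤-reflexive lsp) (≤-trans sd≤qg (≤-reflexive (*-comm q g)))

   -- Maximality of s gives l₁ v < (m - 1) q + l₁ p, and q ≥ l₁ p absorbs the loss from rounding.
   -- Any residue t ≥ m of 1/r is therefore large enough.
   jump : l₁ * v < m * q
   jump = +-cancelʳ-< (s * d) _ _ (begin-strict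
    l₁ * v + s * d ≡⟨ cong (l₁ * v +_) lsp ⟨
    l₁ * v + l₁ * (s * p) ≡⟨ *-distribˡ-+ l₁ v (s * p) ⟨
    l₁ * (v + s * p) ≡⟨ cong (l₁ *_) q≡ ⟨
    l₁ * q ≡⟨ lem h g q ⟩
    (2 + 2 * h) * q + q * g <⟨ +-monoʳ-< ((2 + 2 * h) * q) qg< ⟩
    (2 + 2 * h) * q + (d + s * d) ≤⟨ +-monoʳ-≤ ((2 + 2 * h) * q) (+-monoˡ-≤ (s * d) q-large) ⟩
    (2 + 2 * h) * q + (q + s * d) ≡⟨ lem′ h q (s * d) ⟩
    m * q + s * d ∎)
    where
    open ≤-Reasoning
    lem : ∀ h g q → (2 + (2 * h + g)) * q ≡ (2 + 2 * h) * q + q * g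
    lem = solve-∀
    lem′ : ∀ h q e → (2 + 2 * h) * q + (q + e) ≡ (3 + 2 * h) * q + e
    lem′ = solve-∀

   unit-v : Residues.Unit (q′ + p′ * q) v
   unit-v {i} (i∣v , i∣M) = prime⇒coprime-q (i∣v , coprime-divisor i-p i∣M)
    where
    i-p : Coprime i p
    i-p {j} (j∣i , j∣p) = coprime-pq (j∣p , subst (j ∣_) (sym q≡) (∣m∣n⇒∣m+n (∣-trans j∣i i∣v) (∣n⇒∣m*n s j∣p)))
    prime⇒coprime-q : Coprime v q
    prime⇒coprime-q = coprime-sym (prime⇒coprime qp {{ℕ.>-nonZero 1≤v}} (≤-trans (m<m+n v (*-mono-≤ 1≤s (s≤s z≤n))) (≤-reflexive (sym q≡))))

   open Attained p′ q′ pp qp p<q l₁ g p≡ 1≤g g≤l ql≈1 s v 1≤s 1≤v q≡ steps using (attain-plus; attain-minus)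

   l+t≤p : ∀ {t} → t ≤ g → l + t ≤ p
   l+t≤p t≤g = ≤-trans (+-monoʳ-≤ l t≤g) (≤-reflexive (sym p≡))

   m-small : ∀ {t} → ¬ m ≤ t → m * t ≤ m * (2 + 2 * h)
   m-small t<m = *-monoʳ-≤ m (≤-pred (≰⇒> t<m))

   m*≢2 : ∀ t → m * t ≢ 2
   m*≢2 zero e = 0≢1+n (trans (sym (*-zeroʳ m)) e)
   m*≢2 (suc t) e = <⇒≱ (s≤s (s≤s (s≤s z≤n))) (≤-trans (m≤m*n m (suc t)) (≤-reflexive e))

   m*≢4 : ∀ t → m * t ≢ 4
   m*≢4 zero e = 0≢1+n (trans (sym (*-zeroʳ m)) e)
   m*≢4 (suc zero) e = odd h (suc-injective (suc-injective (suc-injective (trans (sym (*-identityʳ m)) e))))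
    where
    odd : ∀ h → 2 * h ≢ 1
    odd (suc h) e = 0≢1+n (sym (suc-injective (trans (sym (+-suc (suc h) (h + 0))) e)))
   m*≢4 (suc (suc t)) e = <⇒≱ (s≤s (s≤s (s≤s (s≤s (s≤s z≤n))))) (≤-trans (≤-trans (≤-reflexive refl) (*-mono-≤ (m≤m+n 3 (2 * h)) (s≤s (s≤s (z≤n {t}))))) (≤-reflexive e))

   2<p : 2 < p
   2<p = below-p (m≤n+m 2 (m * (2 + 2 * h)))

   bound-4 : ∀ {t} → t ≤ 1 + 2 * h → 4 + m * t < p
   bound-4 {t} t≤ = below-p (≤-trans (+-monoʳ-≤ 4 (*-monoʳ-≤ m t≤)) (≤-trans (m≤m+n _ (1 + 2 * h)) (≤-reflexive (lem h))))
    where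
    lem : ∀ h → 4 + (3 + 2 * h) * (1 + 2 * h) + (1 + 2 * h) ≡ (3 + 2 * h) * (2 + 2 * h) + 2
    lem = solve-∀

   -- A residue of q strictly between g and p - g is impossible: modulo p, 2 m ρ = 4 would be m
   -- times an odd number smaller than m.
   middle : g < ρ → ρ + g < p → ⊥
   middle g<ρ ρ+g<p = cases (m ≤? 2 * u)
    where
    u : ℕ
    u = ρ ∸ g
    ρ≡ : u + g ≡ ρ
    ρ≡ = m∸n+n≡m (<⇒≤ g<ρ)
    1≤u : 1 ≤ u
    1≤u = m<n⇒0<n∸m g<ρ
    u<m : u < m
    u<m = +-cancelʳ-< (g + g) u m (begin-strict
     u + (g + g) ≡⟨ trans (sym (+-assoc u g g)) (cong (_+ g) ρ≡) ⟩
     ρ + g <⟨ ρ+g<p ⟩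
     p ≡⟨ p≡ ⟩
     l + g ≡⟨ trans (cong (_+ g) (sym m+g)) (+-assoc m g g) ⟩
     m + (g + g) ∎)
     where open ≤-Reasoning
    key : 4 + m * m ≈ m * (2 * u)
    key = ≈-trans (≈-+ʳ (m * m) (≈-sym (≈-*ˡ 2 mρ≈2))) (≈-trans (≈-reflexive (trans (cong (λ t → 2 * (m * t) + m * m) (sym ρ≡)) (trans (lem h g u) (cong (λ t → m * (2 * u) + m * t) (sym p≡))))) (≈-kN (m * (2 * u)) m))
     where
     lem : ∀ h g u → 2 * ((3 + 2 * h) * (u + g)) + (3 + 2 * h) * (3 + 2 * h) ≡ (3 + 2 * h) * (2 * u) + (3 + 2 * h) * (3 + (2 * h + g) + g)
     lem = solve-∀
    cases : Dec (m ≤ 2 * u) → ⊥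
    cases (yes m≤2u) = m*≢4 t (sym (≈⇒≡ (≤-<-trans (m≤m+n 4 (m * t)) (bound-4 t≤)) (≤-<-trans (m≤n+m (m * t) 4) (bound-4 t≤)) (≈-cancel-+ʳ (m * m) (≈-trans key (≈-reflexive (trans (cong (m *_) (sym t+m)) (*-distribˡ-+ m t m)))))))
     where
     t : ℕ
     t = 2 * u ∸ m
     t+m : t + m ≡ 2 * u
     t+m = m∸n+n≡m m≤2u
     t≤ : t ≤ 1 + 2 * h
     t≤ = +-cancelʳ-≤ m t _ (≤-trans (≤-reflexive t+m) (≤-trans (*-monoʳ-≤ 2 (≤-pred u<m)) (≤-reflexive (lem h))))
      where
      lem : ∀ h → 2 * (2 + 2 * h) ≡ 1 + 2 * h + (3 + 2 * h)
      lem = solve-∀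
    cases (no m≰2u) = 0≢1+n (sym (≈⇒≡ (bound-4 t≤) (s≤s z≤n) (≈-cancel-+ʳ (m * (2 * u)) (≈-trans (≈-reflexive (trans (+-assoc 4 (m * t) (m * (2 * u))) (cong (4 +_) (trans (sym (*-distribˡ-+ m t (2 * u))) (cong (m *_) t+2u))))) key))))
     where
     t : ℕ
     t = m ∸ 2 * u
     t+2u : t + 2 * u ≡ m
     t+2u = m∸n+n≡m (<⇒≤ (≰⇒> m≰2u))
     t≤ : t ≤ 1 + 2 * h
     t≤ = ∸-monoʳ-≤ m (*-monoʳ-≤ 2 1≤u)

  -- The residue t of 1/r is ρ or p - ρ and has to satisfy m ≤ t ≤ g. By `middle` one of the two is
  -- at most g. Were it below m, then m t + 2 < p, and the congruence would become m ρ = 2 or m t +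
  -- 2 = 0 as integers.
  attained : ∃[ r ] (Prime r × q < r × A (p * q * r) ≡ l)
  attained = cases (ρ ≤? g) (p ≤? ρ + g)
   where
   cases : Dec (ρ ≤ g) → Dec (p ≤ ρ + g) → ∃[ r ] (Prime r × q < r × A (p * q * r) ≡ l)
   cases (yes ρ≤g) _ = attain-plus unit-v (l+t≤p ρ≤g) (<-≤-trans jump (*-monoˡ-≤ q (m≤ρ (m ≤? ρ))))
    where
    m≤ρ : Dec (m ≤ ρ) → m ≤ ρ
    m≤ρ (yes h′) = h′
    m≤ρ (no h′) = ⊥-elim (m*≢2 ρ (≈⇒≡ (below-p (≤-trans (m-small h′) (m≤m+n _ 2))) 2<p mρ≈2))
   cases (no _) (yes p≤) = attain-minus unit-v 1≤ρ (l+t≤p t≤g) (<-≤-trans jump (*-monoˡ-≤ q (m≤t (m ≤? t))))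
    where
    t : ℕ
    t = p ∸ ρ
    t+ρ : t + ρ ≡ p
    t+ρ = m∸n+n≡m (<⇒≤ (DM.m%n<n q p))
    t≤g : t ≤ g
    t≤g = ≤-trans (∸-monoˡ-≤ ρ p≤) (≤-reflexive (m+n∸m≡n ρ g))
    1≤ρ : 1 ≤ ρ
    1≤ρ = n≢0⇒n>0 (λ ρ≡0 → 0≢1+n (≈⇒≡ (s≤s z≤n) 2<p (≈-trans (≈-reflexive (sym (trans (cong (m *_) ρ≡0) (*-zeroʳ m)))) mρ≈2)))
    m≤t : Dec (m ≤ t) → m ≤ t
    m≤t (yes h′) = h′
    m≤t (no h′) = ⊥-elim (0≢1+n (sym (≈⇒≡ {suc (suc (m * t))} {0} (below-p (≤-trans (≤-reflexive (+-comm 2 (m * t))) (+-monoˡ-≤ 2 (m-small h′)))) (s≤s z≤n)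
     (≈-trans (≈-reflexive (+-comm 2 (m * t))) (≈-trans (≈-+ˡ (m * t) (≈-sym mρ≈2)) (≈-trans (≈-reflexive (trans (sym (*-distribˡ-+ m t ρ)) (cong (m *_) t+ρ))) (≈-kN 0 m)))))))
   cases (no ρ≰g) (no p≰) = ⊥-elim (middle (≰⇒> ρ≰g) (≰⇒> p≰))

 odd-form : ∀ n → n % 2 ≡ 1 → n ≡ 1 + 2 * (n / 2)
 odd-form n e = trans (DM.m≡m%n+[m/n]*n n 2) (cong₂ _+_ e (*-comm (n / 2) 2))

 prime-odd : ∀ {p} → Prime p → 2 < p → p % 2 ≡ 1
 prime-odd {p} pp 2<p = cases (p % 2) (DM.m%n<n p 2) refl
  where
  cases : ∀ k → k < 2 → p % 2 ≡ k → k ≡ 1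
  cases 1 _ _ = refl
  cases (suc (suc k)) (s≤s (s≤s ())) _
  cases 0 _ e with prime⇒irreducible pp (m%n≡0⇒n∣m p 2 e)
  ... | inj₂ e′ = ⊥-elim (<-irrefl e′ 2<p)

 congruent-2 : ∀ p′ x → 2 ≤ x → (ℤ.+ suc p′) ∣ℤ (ℤ.+ x ℤ.- ℤ.+ 2) → Residues._≈_ p′ x 2
 congruent-2 p′ x 2≤x d = ≈-trans (≈-reflexive (sym (m∸n+n≡m 2≤x))) (≈-+ʳ 2 (multiple (subst (λ z → (ℤ.+ suc p′) ∣ℤ z) (trans (m-n≡m⊖n x 2) (⊖-≥ 2≤x)) d)))
  where
  open Residues p′
  open Additive p′
  multiple : suc p′ ∣ x ∸ 2 → x ∸ 2 ≈ 0
  multiple (divides k e) = ≈-trans (≈-reflexive e) (≈-kN 0 k)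

 theorem3 : (l p q : ℕ) → 1 ≤ l → l % 2 ≡ 1 → Prime p → l * l + 3 * l + 5 ≤ p →
   Prime q → p < q → (p + l) * p ≤ 2 * q → (ℤ.+ p) ∣ℤ (ℤ.+ ((l + 2) * q) ℤ.- ℤ.+ 2) →
   ((r : ℕ) → Prime r → q < r → A (p * q * r) ≤ (p + l + 2) / 2)
   × (∃[ r ] (Prime r × q < r × A (p * q * r) ≡ (p + l + 2) / 2))
 theorem3 l zero q _ _ pp = ⊥-elim (n≮0 (prime≥2 pp))
 theorem3 l (suc p′) zero _ _ _ _ _ ()
 theorem3 l (suc p′) (suc q′) 1≤l l-odd pp p-large qp (s≤s p<q) q-large d = subst (λ t → ((r : ℕ) → Prime r → q < r → A (p * q * r) ≤ t) × (∃[ r ] (Prime r × q < r × A (p * q * r) ≡ t))) half (upper , attained)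
  where
  p q h a g : ℕ
  p = suc p′
  q = suc q′
  h = l / 2
  a = p / 2
  l≡ : l ≡ 1 + 2 * h
  l≡ = odd-form l l-odd
  large₀ : (1 + 2 * h) * (1 + 2 * h) + 3 * (1 + 2 * h) + 5 ≤ p
  large₀ = subst (λ t → t * t + 3 * t + 5 ≤ p) l≡ p-large
  large : (3 + 2 * h) * (2 + 2 * h) + 3 ≤ p
  large = ≤-trans (≤-reflexive (lem h)) large₀
   where
   lem : ∀ h → (3 + 2 * h) * (2 + 2 * h) + 3 ≡ (1 + 2 * h) * (1 + 2 * h) + 3 * (1 + 2 * h) + 5
   lem = solve-∀
  p≡₀ : p ≡ 1 + 2 * a
  p≡₀ = odd-form p (prime-odd pp (≤-trans (m≤n+m 3 ((3 + 2 * h) * (2 + 2 * h))) large))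
  2+h≤a : 2 + h ≤ a
  2+h≤a = *-cancelˡ-≤ 2 (+-cancelˡ-≤ 1 _ _ (≤-trans (≤-trans (m≤m+n (1 + 2 * (2 + h)) _) (≤-reflexive (lem h))) (≤-trans large (≤-reflexive p≡₀))))
   where
   lem : ∀ h → 1 + 2 * (2 + h) + (4 + 8 * h + 4 * (h * h)) ≡ (3 + 2 * h) * (2 + 2 * h) + 3
   lem = solve-∀
  g = a ∸ (1 + h)
  a≡ : a ≡ g + (1 + h)
  a≡ = sym (m∸n+n≡m (≤-trans (n≤1+n (1 + h)) 2+h≤a))
  p≡ : p ≡ (3 + (2 * h + g)) + g
  p≡ = trans p≡₀ (trans (cong (λ t → 1 + 2 * t) a≡) (lem g h))
   where
   lem : ∀ g h → 1 + 2 * (g + (1 + h)) ≡ (3 + (2 * h + g)) + g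
   lem = solve-∀
  1≤g : 1 ≤ g
  1≤g = m<n⇒0<n∸m 2+h≤a
  bound : (2 + (2 * h + g)) * p ≤ q
  bound = *-cancelˡ-≤ 2 (≤-trans (≤-reflexive (trans (sym (*-assoc 2 (2 + (2 * h + g)) p)) (cong (_* p) (trans (lem h g) (cong₂ _+_ (sym p≡) (sym l≡)))))) q-large)
   where
   lem : ∀ h g → 2 * (2 + (2 * h + g)) ≡ (3 + (2 * h + g)) + g + (1 + 2 * h)
   lem = solve-∀
  half : 3 + (2 * h + g) ≡ (p + l + 2) / 2
  half = sym (trans (cong (_/ 2) (trans (cong₂ (λ x y → x + y + 2) p≡ l≡) (lem h g))) (DM.m*n/n≡m (3 + (2 * h + g)) 2))
   where
   lem : ∀ h g → (3 + (2 * h + g)) + g + (1 + 2 * h) + 2 ≡ (3 + (2 * h + g)) * 2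
   lem = solve-∀
  mq≈2 : Residues._≈_ p′ ((3 + 2 * h) * q) 2
  mq≈2 = subst (λ t → Residues._≈_ p′ (t * q) 2) (trans (cong (_+ 2) l≡) (+-comm (1 + 2 * h) 2)) (congruent-2 p′ ((l + 2) * q) (≤-trans (m≤n+m 2 l) (m≤m*n (l + 2) q)) d)
  open Core p′ q′ pp qp p<q h g p≡ 1≤g large bound mq≈2 using (upper; attained)

open import Defs
open import Data.Nat using (ℕ; _+_; _*_; _≤_; _<_; _%_; _/_)
open import Data.Nat.Primality using (Prime)
open import Data.Integer using (+_; _-_)
open import Data.Integer.Divisibility using () renaming (_∣_ to _∣ℤ_)
open import Data.Product using (_×_; ∃-syntax)
open import Relation.Binary.PropositionalEquality using (_≡_)

theorem3 : (l p q : ℕ) → 1 ≤ l → l % 2 ≡ 1 → Prime p → l * l + 3 * l + 5 ≤ p →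
    Prime q → p < q → (p + l) * p ≤ 2 * q → (+ p) ∣ℤ (+ ((l + 2) * q) - + 2) →
    ((r : ℕ) → Prime r → q < r → A (p * q * r) ≤ (p + l + 2) / 2)
    × (∃[ r ] (Prime r × q < r × A (p * q * r) ≡ (p + l + 2) / 2))
theorem3 = Final.theorem3
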